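{- Let $\mathcal{B}$ be a finite structure. Then: (1) If there is no $\phi$ that breaks $\wedge$ on $\mathcal{B}$ and no $\psi$ that breaks $\vee$ on $\mathcal{B}$, then $\mathrm{MC}(\mathcal{B})$ is in Logspace. (2) If there exists $\phi$ that breaks $\wedge$ on $\mathcal{B}$ and there is no $\psi$ that breaks $\vee$ on $\mathcal{B}$, then $\mathrm{MC}(\mathcal{B})$ is NP-complete. (3) If there is no $\phi$ that breaks $\wedge$ on $\mathcal{B}$ and there exists $\psi$ that breaks $\vee$ on $\mathcal{B}$, then $\mathrm{MC}(\mathcal{B})$ is co-NP-complete. (4) If there exist $\phi$ that breaks $\wedge$ on $\mathcal{B}$ and $\psi$ that breaks $\vee$ on $\mathcal{B}$, then $\mathrm{MC}(\mathcal{B})$ is Pspace-complete.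
   Context: All structures have a finite relational signature; $B$ denotes the domain of $\mathcal{B}$ (nonempty). A positive equality-free formula is a first-order formula built from relational atoms of the signature (the equality symbol is not available unless it is one of the relations) using only $\forall,\exists,\wedge,\vee$. For a fixed structure $\mathcal{B}$, $\mathrm{MC}(\mathcal{B})$ is the decision problem: given as input a positive equality-free sentence $\theta$ over the signature of $\mathcal{B}$, decide whether $\mathcal{B}\models\theta$. A positive equality-free sentence $\phi = Q_1v_1\ldots Q_kv_k\,(\phi_1\wedge\phi_2)$, with $Q_i\in\{\forall,\exists\}$ and $\phi_1,\phi_2$ positive equality-free formulas (not necessarily quantifier-free), breaks $\wedge$ on $\mathcal{B}$ if $\mathcal{B}\not\models\phi$ but $\mathcal{B}\models Q_1v_1\ldots Q_kv_k\,\phi_1$ and $\mathcal{B}\models Q_1v_1\ldots Q_kv_k\,\phi_2$. A positive equality-free sentence $\psi = Q'_1w_1\ldots Q'_\ell w_\ell\,(\psi_1\vee\psi_2)$ breaks $\vee$ on $\mathcal{B}$ if $\mathcal{B}\models\psi$ but $\mathcal{B}\not\models Q'_1w_1\ldots Q'_\ell w_\ell\,\psi_1$ and $\mathcal{B}\not\models Q'_1w_1\ldots Q'_\ell w_\ell\,\psi_2$. Hardness and completeness are with respect to polynomial-time many-one reductions. -}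

module Defs where

open import Level using (Level; 0ℓ; _⊔_) renaming (suc to lsuc)
open import Data.Bool using (Bool; T)
open import Data.Fin using (Fin; zero; suc; toℕ; _↑ʳ_)
open import Data.List using (List; []; _∷_; _++_; map; length; replicate; fromMaybe)
open import Data.List.Membership.Propositional using (_∈_)
open import Data.Maybe using (Maybe)
open import Data.Nat using (ℕ; zero; suc; pred; _+_; _*_; _≤_; _⊓_; NonZero)
open import Data.Nat.Logarithm using (⌊log₂_⌋)
open import Data.Product using (Σ-syntax; ∃-syntax; _×_; _,_)
open import Data.Sum using (_⊎_)
open import Data.Vec using (Vec; []; _∷_)
import Data.Vec as Vec
open import Function.Bundles using (_⇔_)
open import Relation.Binary.PropositionalEquality using (_≡_)
open import Relation.Nullary using (¬_)
open import Relation.Unary using (Pred; Decidable; _≐_; ∁)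

record Signature : Set where
  field
    #rel  : ℕ
    arity : Fin #rel → ℕ

open Signature public

record Structure (σ : Signature) : Set₁ where
  field
    size              : ℕ
    .{{size-nonZero}} : NonZero size

  Dom : Set
  Dom = Fin size

  field
    Rel  : (r : Fin (#rel σ)) → Pred (Vec Dom (arity σ r)) 0ℓ
    rel? : (r : Fin (#rel σ)) → Decidable (Rel r)

open Structure public using (Dom; Rel)

data Quantifier : Set where
  forAll exists : Quantifier

-- `Formula σ n` has its free variables among n de Bruijn indices;
-- index 0 is the most recently bound variable.
data Formula (σ : Signature) (n : ℕ) : Set where
  atom    : (r : Fin (#rel σ)) → Vec (Fin n) (arity σ r) → Formula σ n
  _∧_ _∨_ : Formula σ n → Formula σ n → Formula σ n
  quant   : Quantifier → Formula σ (suc n) → Formula σ n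

infixr 6 _∧_
infixr 5 _∨_

Sentence : Signature → Set
Sentence σ = Formula σ 0

module _ {σ : Signature} (B : Structure σ) where

  Sat : ∀ {n} → Vec (Dom B) n → Formula σ n → Set
  Sat ρ (atom r xs)      = Rel B r (Vec.map (Vec.lookup ρ) xs)
  Sat ρ (φ ∧ ψ)          = Sat ρ φ × Sat ρ ψ
  Sat ρ (φ ∨ ψ)          = Sat ρ φ ⊎ Sat ρ ψ
  Sat ρ (quant forAll φ) = ∀ b → Sat (b ∷ ρ) φ
  Sat ρ (quant exists φ) = ∃[ b ] Sat (b ∷ ρ) φ

infix 4 _⊨_ _⊭_

_⊨_ _⊭_ : ∀ {σ} → Structure σ → Sentence σ → Set
B ⊨ φ = Sat B [] φ
B ⊭ φ = ¬ B ⊨ φ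

-- The prefix Q₁ … Qₖ is stored innermost quantifier first, as the vector
-- Qₖ ∷ … ∷ Q₁ ∷ [].
close : ∀ {σ k} → Vec Quantifier k → Formula σ k → Sentence σ
close []       φ = φ
close (Q ∷ Qs) φ = close Qs (quant Q φ)

module _ {σ : Signature} (B : Structure σ) where

  Breaks∧ : Sentence σ → Set
  Breaks∧ φ =
    ∃[ k ] Σ[ Qs ∈ Vec Quantifier k ] ∃[ φ₁ ] ∃[ φ₂ ]
      φ ≡ close Qs (φ₁ ∧ φ₂)
      × B ⊭ φ × B ⊨ close Qs φ₁ × B ⊨ close Qs φ₂

  Breaks∨ : Sentence σ → Set
  Breaks∨ ψ =
    ∃[ k ] Σ[ Qs ∈ Vec Quantifier k ] ∃[ ψ₁ ] ∃[ ψ₂ ]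
      ψ ≡ close Qs (ψ₁ ∨ ψ₂)
      × B ⊨ ψ × B ⊭ close Qs ψ₁ × B ⊭ close Qs ψ₂

Word : ℕ → Set
Word k = List (Fin k)

Language : ℕ → Set₁
Language k = Pred (Word k) 0ℓ

data Move : Set where
  left stay right : Move

data InputSymbol (k : ℕ) : Set where
  ⊢ ⊣ : InputSymbol k
  sym : Fin k → InputSymbol k

-- The input w occupies cells 1 … length w, between the end markers ⊢ in
-- cell 0 and ⊣ in cell suc (length w).
readInput : ∀ {k} → Word k → ℕ → InputSymbol k
readInput w       zero          = ⊢
readInput []      (suc i)       = ⊣
readInput (a ∷ w) (suc zero)    = sym a
readInput (a ∷ w) (suc (suc i)) = readInput w (suc i)

-- The input head never leaves the marked input; otherwise its position
-- would be an unbounded counter that the space measure does not see.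
moveInput : ∀ {k} → Word k → Move → ℕ → ℕ
moveInput w left  i = pred i
moveInput w stay  i = i
moveInput w right i = suc i ⊓ suc (length w)

-- A two-way infinite tape over Fin (suc g), with blank symbol zero.  Only
-- the cells visited so far are stored; those on the left are listed from
-- the head outwards, as are those on the right.
record Tape (g : ℕ) : Set where
  constructor tape
  field
    before  : List (Fin (suc g))
    current : Fin (suc g)
    after   : List (Fin (suc g))

blankTape : ∀ {g} → Tape g
blankTape = tape [] zero []

tapeSpace : ∀ {g} → Tape g → ℕ
tapeSpace (tape ls _ rs) = length ls + suc (length rs)

write : ∀ {g} → Fin (suc g) → Tape g → Tape g
write a (tape ls _ rs) = tape ls a rs

moveTape : ∀ {g} → Move → Tape g → Tape g
moveTape left  (tape []       a rs)       = tape [] zero (a ∷ rs)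
moveTape left  (tape (l ∷ ls) a rs)       = tape ls l (a ∷ rs)
moveTape stay  t                          = t
moveTape right (tape ls       a [])       = tape (a ∷ ls) zero []
moveTape right (tape ls       a (r ∷ rs)) = tape (a ∷ ls) r rs

record Action (k b q t g : ℕ) : Set where
  field
    nextState : Fin q
    inputMove : Move
    workMoves : Vec (Fin (suc g) × Move) t
    emit      : Maybe (Fin b)

-- A nondeterministic machine with a read-only two-way input tape over
-- Fin k, finitely many work tapes, and a write-only output tape over Fin b.
-- It halts when no action is available; `accepting` is consulted only then.
record Machine (k b : ℕ) : Set where
  field
    #states #tapes #symbols : ℕ
    initial   : Fin #states
    accepting : Fin #states → Bool
    δ         : Fin #states → InputSymbol k → Vec (Fin (suc #symbols)) #tapes →
                List (Action k b #states #tapes #symbols)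

  Deterministic : Set
  Deterministic = ∀ s a γ → length (δ s a γ) ≤ 1

  record Config : Set where
    field
      state    : Fin #states
      position : ℕ
      works    : Vec (Tape #symbols) #tapes
      output   : Word b

  open Config public

  initialConfig : Config
  initialConfig = record
    { state    = initial
    ; position = 0
    ; works    = Vec.replicate #tapes blankTape
    ; output   = []
    }

  perform : Word k → Config → Action k b #states #tapes #symbols → Config
  perform w c a = record
    { state    = nextState
    ; position = moveInput w inputMove (position c)
    ; works    = Vec.zipWith (λ (x , m) t → moveTape m (write x t)) workMoves (works c)
    ; output   = output c ++ fromMaybe emit
    }
    where open Action a

  successors : Word k → Config → List Config
  successors w c =
    map (perform w c)
        (δ (state c) (readInput w (position c)) (Vec.map Tape.current (works c)))

  data Reaches (w : Word k) : ℕ → Config → Set where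
    start : Reaches w 0 initialConfig
    step  : ∀ {n c c′} → Reaches w n c → c′ ∈ successors w c → Reaches w (suc n) c′

  Halted : Word k → Config → Set
  Halted w c = successors w c ≡ []

  Accepting : Config → Set
  Accepting c = T (accepting (state c))

  space : Config → ℕ
  space c = Vec.sum (Vec.map tapeSpace (works c))

  RunsInTime : (ℕ → ℕ) → Set
  RunsInTime f = ∀ w n c → Reaches w n c → n ≤ f (length w)

  RunsInSpace : (ℕ → ℕ) → Set
  RunsInSpace f = ∀ w n c → Reaches w n c → space c ≤ f (length w)

  Accepts : Language k
  Accepts w = ∃[ n ] ∃[ c ] Reaches w n c × Halted w c × Accepting c

  HaltsOn : Word k → Set
  HaltsOn w = ∃[ n ] ∃[ c ] Reaches w n c × Halted w c

  Computes : (Word k → Word b) → Set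
  Computes f = ∀ w → ∃[ n ] ∃[ c ] Reaches w n c × Halted w c × output c ≡ f w

-- Coefficients of a polynomial, constant term first.
Polynomial : Set
Polynomial = List ℕ

eval : Polynomial → ℕ → ℕ
eval []      n = 0
eval (a ∷ p) n = a + n * eval p n

-- A machine with empty output alphabet cannot emit anything.
Acceptor : ℕ → Set
Acceptor k = Machine k 0

open Machine

DecidesInSpace : ∀ {k} → Acceptor k → (ℕ → ℕ) → Language k → Set
DecidesInSpace M f L =
  Deterministic M × (∀ w → HaltsOn M w) × RunsInSpace M f × L ≐ Accepts M

Class : (ℓ : Level) → Set (lsuc ℓ)
Class ℓ = ∀ {k} → Language k → Set ℓ

Logspace : Class 0ℓ
Logspace {k} L =
  Σ[ M ∈ Acceptor k ] ∃[ c ] DecidesInSpace M (λ n → c * suc ⌊log₂ n ⌋) L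

Pspace : Class 0ℓ
Pspace {k} L = Σ[ M ∈ Acceptor k ] Σ[ p ∈ Polynomial ] DecidesInSpace M (eval p) L

NP : Class 0ℓ
NP {k} L =
  Σ[ M ∈ Acceptor k ] Σ[ p ∈ Polynomial ] RunsInTime M (eval p) × L ≐ Accepts M

PolyTimeComputable : ∀ {k b} → (Word k → Word b) → Set
PolyTimeComputable {k} {b} f =
  Σ[ M ∈ Machine k b ] Σ[ p ∈ Polynomial ]
    Deterministic M × RunsInTime M (eval p) × Computes M f

infix 4 _≤ₚ_

_≤ₚ_ : ∀ {k b} → Language k → Language b → Set
_≤ₚ_ {k} {b} L L′ =
  Σ[ f ∈ (Word k → Word b) ] PolyTimeComputable f × (∀ w → L w ⇔ L′ (f w))

-- Quantifying over the complemented NP language, rather than asking for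
-- NP (∁ L), makes every co-NP language ¬¬-stable, as classically it is.
coNP : Class (lsuc 0ℓ)
coNP {k} L = Σ[ L′ ∈ Language k ] NP L′ × L ≐ ∁ L′

Hard : ∀ {ℓ k} → Class ℓ → Language k → Set (lsuc 0ℓ ⊔ ℓ)
Hard C L = ∀ {j} (L′ : Language j) → C L′ → L′ ≤ₚ L

Complete : ∀ {ℓ k} → Class ℓ → Language k → Set (lsuc 0ℓ ⊔ ℓ)
Complete C L = C L × Hard C L

-- Sentences are written in Polish notation over a finite alphabet: two
-- quantifiers, two connectives, a tick and a stop for variables, and one
-- letter per relation symbol.  The variable with index i is i ticks and a
-- stop.
module _ (σ : Signature) where

  #letters : ℕ
  #letters = 6 + #rel σ

  Letter : Set
  Letter = Fin #letters

  pattern forAll-letter = zero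
  pattern exists-letter = suc zero
  pattern and-letter    = suc (suc zero)
  pattern or-letter     = suc (suc (suc zero))
  pattern tick-letter   = suc (suc (suc (suc zero)))
  pattern stop-letter   = suc (suc (suc (suc (suc zero))))

  rel-letter : Fin (#rel σ) → Letter
  rel-letter r = 6 ↑ʳ r

  quantifier-letter : Quantifier → Letter
  quantifier-letter forAll = forAll-letter
  quantifier-letter exists = exists-letter

  encodeVars : ∀ {n m} → Vec (Fin n) m → List Letter
  encodeVars []       = []
  encodeVars (x ∷ xs) = replicate (toℕ x) tick-letter ++ stop-letter ∷ encodeVars xs

  encode : ∀ {n} → Formula σ n → List Letter
  encode (atom r xs) = rel-letter r ∷ encodeVars xs
  encode (φ ∧ ψ)     = and-letter ∷ encode φ ++ encode ψ
  encode (φ ∨ ψ)     = or-letter ∷ encode φ ++ encode ψ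
  encode (quant Q φ) = quantifier-letter Q ∷ encode φ

MC : ∀ {σ} → Structure σ → Language (#letters σ)
MC {σ} B w = Σ[ θ ∈ Sentence σ ] encode σ θ ≡ w × B ⊨ θ

{-# OPTIONS --safe #-}
-- A sentence that breaks ∧ (∨) shows two ways of playing an existential
-- (universal) variable that exclude each other: existential (universal) bits.
-- Tableaux of computations, written with such bits, give hardness.  If nothing
-- breaks ∧ (∨), one witness serves all instances, so that ∃ (∀) may be played by
-- a constant; the remaining game is evaluated by a machine that keeps the values
-- of the variables next to the quantifiers and a few logarithmic counters.
module Submission where

open import Defs
open import Data.Product using (∃; _×_)
open import Relation.Nullary using (¬_)
open import Data.Bool using (Bool; true; false; T; not; if_then_else_) renaming (_∧_ to _∧ᵇ_; _∨_ to _∨ᵇ_; _≟_ to _≟ᵇ_)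
import Data.Bool as Bool
open import Data.Bool.Properties using (T-≡; T-∧; T-∨; ∧-zeroʳ; ∨-zeroʳ; ∧-identityʳ; ∨-identityʳ)
open import Data.Empty using (⊥; ⊥-elim)
open import Data.Fin using (Fin; zero; suc; toℕ; fromℕ<; _↑ˡ_; _↑ʳ_; splitAt; combine; remQuot; funToFin; finToFun)
import Data.Fin as Fin
open import Data.Fin.Properties using (all?; any?; ¬∀⟶∃¬; pigeonhole; toℕ<n; toℕ-injective; toℕ-fromℕ<; toℕ-↑ˡ; toℕ-↑ʳ; splitAt-↑ˡ; splitAt-↑ʳ; ↑ˡ-injective; ↑ʳ-injective; remQuot-combine; combine-remQuot; finToFun-funToFin)
import Data.Fin.Properties as FinP
open import Data.List using (List; []; _∷_; _++_; _ʳ++_; map; length; replicate; fromMaybe; concat; applyUpTo; allFin; cartesianProductWith)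
import Data.List as List
open import Data.List.Membership.Propositional using (_∈_)
open import Data.List.Membership.Propositional.Properties using (∈-++⁺ˡ; ∈-++⁺ʳ; ∈-++⁻; ∈-concat⁺′; ∈-concat⁻′; ∈-tabulate⁺; ∈-tabulate⁻; ∈-map⁻; ∈-map⁺; ∈-cartesianProductWith⁺; ∈-allFin)
open import Data.List.Properties using (++-assoc; ++-identityʳ; length-++; length-applyUpTo; length-map; length-replicate; length-ʳ++; map-++; ∷-injectiveʳ; ∷-injectiveˡ)
open import Data.List.Relation.Binary.Pointwise using (Pointwise; []; _∷_)
open import Data.List.Relation.Unary.All using (All; []; _∷_)
open import Data.List.Relation.Unary.Any as Any using (here; there)
import Data.List.Relation.Unary.Any.Properties as AnyP
open import Data.Maybe using (Maybe; just; nothing)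
open import Data.Maybe.Properties using (just-injective)
open import Data.Nat
open import Data.Nat.DivMod using (_mod_; m<n⇒m%n≡m; m%n<n)
open import Data.Nat.Logarithm using (⌊log₂_⌋; ⌊log₂⌋-mono-≤; ⌊log₂[2^n]⌋≡n; ⌊log₂[2*b]⌋≡1+⌊log₂b⌋)
open import Data.Nat.Properties renaming (≤-reflexive to ≡⇒≤)
open import Data.Nat.Solver using (module +-*-Solver)
open import Data.Product using (Σ; Σ-syntax; ∃-syntax; _,_; proj₁; proj₂)
open import Data.Product.Function.NonDependent.Propositional using (_×-⇔_)
open import Data.Sum using (_⊎_; inj₁; inj₂; [_,_]′)
import Data.Sum as Sum
open import Data.Sum.Function.Propositional using (_⊎-⇔_)
open import Data.Unit using (⊤; tt)
open import Data.Vec using (Vec; []; _∷_; _[_]≔_; lookup)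
import Data.Vec as Vec
open import Data.Vec.Properties using ([]≔-commutes; []≔-idempotent; []≔-lookup; lookup-++ʳ; lookup-++ˡ; lookup-allFin; lookup-map; lookup-replicate; lookup-zipWith; lookup∘tabulate; lookup∘update; lookup∘updateAt; lookup∘update′; map-cong; map-∘; tabulate-cong; tabulate∘lookup)
open import Function.Base using (_∘_; id)
open import Function.Bundles using (_⇔_; mk⇔; Equivalence)
import Function.Properties.Equivalence as ⇔P
open import Relation.Binary.PropositionalEquality renaming (sym to symm) hiding ([_])
open import Relation.Nullary using (Dec; yes; no; ¬?; _×-dec_; _⊎-dec_)
open import Relation.Nullary.Decidable using (does; isYes; toWitness; fromWitness; map′; decidable-stable; dec-true; dec-false) renaming (map to map-⇔)

≡⇒≥ : ∀ {m n} → n ≡ m → m ≤ n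
≡⇒≥ e = ≡⇒≤ (symm e)

PolyBound : (ℕ → ℕ) → Set
PolyBound f = Σ[ p ∈ Polynomial ] (∀ n → f n ≤ eval p n)

infixl 6 _⊞_
_⊞_ : Polynomial → Polynomial → Polynomial
[] ⊞ q = q
(a ∷ p) ⊞ [] = a ∷ p
(a ∷ p) ⊞ (b ∷ q) = a + b ∷ p ⊞ q

eval-⊞ : ∀ p q n → eval (p ⊞ q) n ≡ eval p n + eval q n
eval-⊞ [] q n = refl
eval-⊞ (a ∷ p) [] n = symm (+-identityʳ _)
eval-⊞ (a ∷ p) (b ∷ q) n rewrite eval-⊞ p q n =
 solve 5 (λ a b n x y → (a :+ b) :+ n :* (x :+ y) := (a :+ n :* x) :+ (b :+ n :* y))
   refl a b n (eval p n) (eval q n)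
 where open +-*-Solver

scale : ℕ → Polynomial → Polynomial
scale c = map (c *_)

eval-scale : ∀ c p n → eval (scale c p) n ≡ c * eval p n
eval-scale c [] n = symm (*-zeroʳ c)
eval-scale c (a ∷ p) n rewrite eval-scale c p n =
 solve 4 (λ c a n x → c :* a :+ n :* (c :* x) := c :* (a :+ n :* x)) refl c a n (eval p n)
 where open +-*-Solver

infixl 7 _⊠_
_⊠_ : Polynomial → Polynomial → Polynomial
[] ⊠ q = []
(a ∷ p) ⊠ q = scale a q ⊞ (0 ∷ p ⊠ q)

eval-⊠ : ∀ p q n → eval (p ⊠ q) n ≡ eval p n * eval q n
eval-⊠ [] q n = refl
eval-⊠ (a ∷ p) q n
 rewrite eval-⊞ (scale a q) (0 ∷ p ⊠ q) n | eval-scale a q n | eval-⊠ p q n =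
 solve 4 (λ a n x y → a :* y :+ n :* (x :* y) := (a :+ n :* x) :* y) refl a n (eval p n) (eval q n)
 where open +-*-Solver

pb-const : ∀ c → PolyBound (λ _ → c)
pb-const c = c ∷ [] , λ n → ≡⇒≥ (trans (cong (c +_) (*-zeroʳ n)) (+-identityʳ c))

pb-id : PolyBound (λ n → n)
pb-id = 0 ∷ 1 ∷ [] , λ n →
 ≡⇒≥ (trans (cong (λ z → n * (1 + z)) (*-zeroʳ n)) (*-identityʳ n))

pb-+ : ∀ {f g} → PolyBound f → PolyBound g → PolyBound (λ n → f n + g n)
pb-+ (p , P) (q , Q) = p ⊞ q , λ n →
 ≤-trans (+-mono-≤ (P n) (Q n)) (≡⇒≥ (eval-⊞ p q n))

pb-* : ∀ {f g} → PolyBound f → PolyBound g → PolyBound (λ n → f n * g n)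
pb-* (p , P) (q , Q) = p ⊠ q , λ n →
 ≤-trans (*-mono-≤ (P n) (Q n)) (≡⇒≥ (eval-⊠ p q n))

pb-≤ : ∀ {f g} → (∀ n → f n ≤ g n) → PolyBound g → PolyBound f
pb-≤ f≤g (p , P) = p , λ n → ≤-trans (f≤g n) (P n)

open Any using (here; there)

digitsValue : List Bool → ℕ
digitsValue [] = 0
digitsValue (false ∷ ds) = 1 + 2 * digitsValue ds
digitsValue (true ∷ ds) = 2 + 2 * digitsValue ds

2^digits≤ : ∀ ds → 2 ^ length ds ≤ suc (digitsValue ds)
2^digits≤ [] = ≤-refl
2^digits≤ (false ∷ ds) = ≤-trans (*-monoʳ-≤ 2 (2^digits≤ ds)) (≡⇒≤ (*-suc 2 (digitsValue ds)))
2^digits≤ (true ∷ ds) = m≤n⇒m≤1+n (≤-trans (*-monoʳ-≤ 2 (2^digits≤ ds)) (≡⇒≤ (*-suc 2 (digitsValue ds))))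

digits-bound : ∀ {M} ds → digitsValue ds ≤ M → length ds < suc ⌊log₂ suc M ⌋
digits-bound {M} ds le = s≤s (subst (_≤ ⌊log₂ suc M ⌋) (⌊log₂[2^n]⌋≡n (length ds))
 (⌊log₂⌋-mono-≤ (≤-trans (2^digits≤ ds) (s≤s le))))

ends : ∀ {k} → Word k → List (InputSymbol k)
ends w = ⊢ ∷ map sym w ++ ⊣ ∷ []

at : ∀ {A : Set} → List A → A → ℕ → A
at [] d i = d
at (x ∷ xs) d zero = x
at (x ∷ xs) d (suc i) = at xs d i

readInput-at : ∀ {k} (w : Word k) i → readInput w i ≡ at (ends w) ⊣ i
readInput-at w zero = refl
readInput-at w (suc i) = go w i where
 go : ∀ w i → readInput w (suc i) ≡ at (map sym w ++ ⊣ ∷ []) ⊣ i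
 go [] zero = refl
 go [] (suc zero) = refl
 go [] (suc (suc i)) = refl
 go (a ∷ w) zero = refl
 go (a ∷ w) (suc i) = go w i

at-ʳ++ : ∀ {A : Set} (L : List A) {h R d} → at (L ʳ++ (h ∷ R)) d (length L) ≡ h
at-ʳ++ L {h} {R} {d} = trans (cong (at (L ʳ++ (h ∷ R)) d) (symm (+-identityʳ (length L)))) (go L (h ∷ R) 0)
 where
 go : ∀ (L : List _) X i → at (L ʳ++ X) d (length L + i) ≡ at X d i
 go [] X i = refl
 go (l ∷ L) X i = trans (cong (at (L ʳ++ (l ∷ X)) d) (symm (+-suc (length L) i))) (go L (l ∷ X) (suc i))

length-ends : ∀ {k} (w : Word k) → length (ends w) ≡ 2 + length w
length-ends w = cong suc (trans (length-++ (map sym w)) (trans (cong (_+ 1) (length-map sym w)) (+-comm (length w) 1)))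

isStart isEnd : ∀ {k} → InputSymbol k → Bool
isStart ⊢ = true
isStart _ = false
isEnd ⊣ = true
isEnd _ = false

symCode : ∀ {k} → InputSymbol k → Fin (2 + k)
symCode ⊢ = zero
symCode ⊣ = suc zero
symCode (sym a) = suc (suc a)

symDecode : ∀ {k} → Fin (2 + k) → InputSymbol k
symDecode zero = ⊢
symDecode (suc zero) = ⊣
symDecode (suc (suc a)) = sym a

symDecode-symCode : ∀ {k} (a : InputSymbol k) → symDecode (symCode a) ≡ a
symDecode-symCode ⊢ = refl
symDecode-symCode ⊣ = refl
symDecode-symCode (sym a) = refl

module Programs (k b g nc : ℕ) (tr nd : Bool) where

 Sym : Set
 Sym = Fin (3 + g)

 pattern blank = zero
 pattern one = suc zero
 pattern two = suc (suc zero)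

 data CounterOp : Set where
  inc dec erase return : CounterOp

 data Test : Set where
  local : (InputSymbol k → Sym → Sym → Bool) → Test
  isZero : Fin nc → Test
  both : Test → Test → Test
  neg : Test → Test

 data Prog : Set where
  goL goR : Prog
  setAnn : T tr → (InputSymbol k → Sym → Sym → Sym) → Prog
  setReg : (InputSymbol k → Sym → Sym → Sym) → Prog
  emit : Fin b → Prog
  counter : CounterOp → Fin nc → Prog
  _⨾_ : Prog → Prog → Prog
  ifThen : Test → Prog → Prog → Prog
  while : Test → Prog → Prog
  switch : ∀ {n} → (InputSymbol k → Sym → Sym → Fin n) → (Fin n → Prog) → Prog
  choose : T nd → Prog → Prog → Prog
  halt : Bool → Prog

 infixr 6 _⨾_

 skip : Prog
 skip = setReg (λ _ _ u → u)

 times : ℕ → Prog → Prog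
 times zero p = skip
 times (suc n) p = p ⨾ times n p

 positive? : Fin nc → Test
 positive? i = neg (isZero i)

 Cont : Set
 Cont = List Prog

 evalTest : (Fin nc → Bool) → InputSymbol k → Sym → Sym → Test → Bool
 evalTest z a u v (local f) = f a u v
 evalTest z a u v (isZero i) = z i
 evalTest z a u v (both s t) = evalTest z a u v s ∧ᵇ evalTest z a u v t
 evalTest z a u v (neg t) = not (evalTest z a u v t)

 evalTest-cong : ∀ {z z′} a u v → (∀ i → z i ≡ z′ i) → ∀ t → evalTest z a u v t ≡ evalTest z′ a u v t
 evalTest-cong a u v e (local f) = refl
 evalTest-cong a u v e (isZero i) = e i
 evalTest-cong a u v e (both s t) = cong₂ _∧ᵇ_ (evalTest-cong a u v e s) (evalTest-cong a u v e t)
 evalTest-cong a u v e (neg t) = cong not (evalTest-cong a u v e t)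

 isBlank : Sym → Bool
 isBlank blank = true
 isBlank (suc _) = false

 -- A counter is kept in bijective binary, least significant digit first, with
 -- the head resting on that digit: the counter is zero exactly when the head
 -- scans a blank.  `return` walks back to the blank left of the number.
 counterδ : CounterOp → Sym → Sym × Move × Maybe CounterOp
 counterδ inc two = one , right , just inc
 counterδ inc one = two , left , just return
 counterδ inc _ = one , left , just return
 counterδ dec one = two , right , just dec
 counterδ dec two = one , left , just return
 counterδ dec _ = blank , left , just erase
 counterδ erase _ = blank , left , just return
 counterδ return blank = blank , right , nothing
 counterδ return (suc s) = suc s , left , just return

 afterOp : Maybe CounterOp → Fin nc → Cont → Cont
 afterOp (just o) i K = counter o i ∷ K
 afterOp nothing i K = K

 Raw : Set
 Raw = Move × Vec (Sym × Move) (2 + nc) × Maybe (Fin b)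

 idle : ∀ {n} → Vec Sym n → Vec (Sym × Move) n
 idle = Vec.map (_, stay)

 trackMove : Move → Move
 trackMove m = if tr then m else stay

 next : Cont → InputSymbol k → Vec Sym (2 + nc) → List (Raw × Cont)
 next [] a γ = []
 next (goL ∷ K) a (u ∷ v ∷ γ) = ((left , (u , trackMove left) ∷ (v , stay) ∷ idle γ , nothing) , K) ∷ []
 next (goR ∷ K) a (u ∷ v ∷ γ) = ((right , (u , trackMove right) ∷ (v , stay) ∷ idle γ , nothing) , K) ∷ []
 next (setAnn _ f ∷ K) a (u ∷ v ∷ γ) = ((stay , (f a u v , stay) ∷ (v , stay) ∷ idle γ , nothing) , K) ∷ []
 next (setReg f ∷ K) a (u ∷ v ∷ γ) = ((stay , (u , stay) ∷ (f a u v , stay) ∷ idle γ , nothing) , K) ∷ []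
 next (emit x ∷ K) a γ = ((stay , idle γ , just x) , K) ∷ []
 next (counter o i ∷ K) a (u ∷ v ∷ γ) with counterδ o (Vec.lookup γ i)
 ... | x , m , o′ = ((stay , (u , stay) ∷ (v , stay) ∷ idle γ [ i ]≔ (x , m) , nothing) , afterOp o′ i K) ∷ []
 next (p ⨾ q ∷ K) a γ = ((stay , idle γ , nothing) , p ∷ q ∷ K) ∷ []
 next (ifThen t p q ∷ K) a (u ∷ v ∷ γ) =
  ((stay , idle (u ∷ v ∷ γ) , nothing) ,
   (if evalTest (λ i → isBlank (Vec.lookup γ i)) a u v t then p else q) ∷ K) ∷ []
 next (while t p ∷ K) a (u ∷ v ∷ γ) =
  ((stay , idle (u ∷ v ∷ γ) , nothing) ,
   (if evalTest (λ i → isBlank (Vec.lookup γ i)) a u v t then p ∷ while t p ∷ K else K)) ∷ []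
 next (switch f p ∷ K) a (u ∷ v ∷ γ) = ((stay , idle (u ∷ v ∷ γ) , nothing) , p (f a u v) ∷ K) ∷ []
 next (choose _ p q ∷ K) a γ = ((stay , idle γ , nothing) , p ∷ K) ∷ ((stay , idle γ , nothing) , q ∷ K) ∷ []
 next (halt _ ∷ K) a γ = []

 conts : Prog → Cont → List Cont
 conts (counter o i) K = (counter inc i ∷ K) ∷ (counter dec i ∷ K) ∷ (counter erase i ∷ K) ∷ (counter return i ∷ K) ∷ []
 conts (p ⨾ q) K = (p ⨾ q ∷ K) ∷ conts p (q ∷ K) ++ conts q K
 conts (ifThen t p q) K = (ifThen t p q ∷ K) ∷ conts p K ++ conts q K
 conts (while t p) K = (while t p ∷ K) ∷ conts p (while t p ∷ K)
 conts (switch f p) K = (switch f p ∷ K) ∷ concat (List.tabulate (λ i → conts (p i) K))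
 conts (choose d p q) K = (choose d p q ∷ K) ∷ conts p K ++ conts q K
 conts p K = (p ∷ K) ∷ []

 conts-entry : ∀ p K → p ∷ K ∈ conts p K
 conts-entry goL K = here refl
 conts-entry goR K = here refl
 conts-entry (setAnn _ x) K = here refl
 conts-entry (setReg x) K = here refl
 conts-entry (emit x) K = here refl
 conts-entry (counter inc i) K = here refl
 conts-entry (counter dec i) K = there (here refl)
 conts-entry (counter erase i) K = there (there (here refl))
 conts-entry (counter return i) K = there (there (there (here refl)))
 conts-entry (p ⨾ p₁) K = here refl
 conts-entry (ifThen x p p₁) K = here refl
 conts-entry (while x p) K = here refl
 conts-entry (switch f p) K = here refl
 conts-entry (choose x p p₁) K = here refl
 conts-entry (halt x) K = here refl

 Closed : List Cont → Cont → Set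
 Closed Ks K = ∀ a γ → All (λ r → proj₂ r ∈ Ks) (next K a γ)

 -- Membership is asked of any larger set, so that the induction goes through.
 conts-closed : ∀ Ks p K → (∀ {K′} → K′ ∈ conts p K → K′ ∈ Ks) → K ∈ Ks →
   ∀ {K′} → K′ ∈ conts p K → Closed Ks K′
 conts-closed Ks goL K sub k∈ (here refl) a (u ∷ v ∷ γ) = k∈ ∷ []
 conts-closed Ks goR K sub k∈ (here refl) a (u ∷ v ∷ γ) = k∈ ∷ []
 conts-closed Ks (setAnn _ x) K sub k∈ (here refl) a (u ∷ v ∷ γ) = k∈ ∷ []
 conts-closed Ks (setReg x) K sub k∈ (here refl) a (u ∷ v ∷ γ) = k∈ ∷ []
 conts-closed Ks (emit x) K sub k∈ (here refl) a γ = k∈ ∷ []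
 conts-closed Ks (counter o i) K sub k∈ {K′} m a (u ∷ v ∷ γ) = go m where
  op∈ : ∀ o → counter o i ∷ K ∈ Ks
  op∈ inc = sub (here refl)
  op∈ dec = sub (there (here refl))
  op∈ erase = sub (there (there (here refl)))
  op∈ return = sub (there (there (there (here refl))))
  after∈ : ∀ o′ → afterOp o′ i K ∈ Ks
  after∈ (just o′) = op∈ o′
  after∈ nothing = k∈
  go : K′ ∈ conts (counter o i) K → All (λ r → proj₂ r ∈ Ks) (next K′ a (u ∷ v ∷ γ))
  go (here refl) = after∈ _ ∷ []
  go (there (here refl)) = after∈ _ ∷ []
  go (there (there (here refl))) = after∈ _ ∷ []
  go (there (there (there (here refl)))) = after∈ _ ∷ []
 conts-closed Ks (p ⨾ q) K sub k∈ (here refl) a γ = sub (there (∈-++⁺ˡ (conts-entry p (q ∷ K)))) ∷ []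
 conts-closed Ks (p ⨾ q) K sub k∈ (there m) with ∈-++⁻ (conts p (q ∷ K)) m
 ... | inj₁ m′ = conts-closed Ks p (q ∷ K) (λ x → sub (there (∈-++⁺ˡ x))) (sub (there (∈-++⁺ʳ _ (conts-entry q K)))) m′
 ... | inj₂ m′ = conts-closed Ks q K (λ x → sub (there (∈-++⁺ʳ (conts p (q ∷ K)) x))) k∈ m′
 conts-closed Ks (ifThen t p q) K sub k∈ (here refl) a (u ∷ v ∷ γ) = go (evalTest _ a u v t) ∷ []
  where
  go : ∀ x → (if x then p else q) ∷ K ∈ Ks
  go true = sub (there (∈-++⁺ˡ (conts-entry p K)))
  go false = sub (there (∈-++⁺ʳ _ (conts-entry q K)))
 conts-closed Ks (ifThen t p q) K sub k∈ (there m) with ∈-++⁻ (conts p K) m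
 ... | inj₁ m′ = conts-closed Ks p K (λ x → sub (there (∈-++⁺ˡ x))) k∈ m′
 ... | inj₂ m′ = conts-closed Ks q K (λ x → sub (there (∈-++⁺ʳ (conts p K) x))) k∈ m′
 conts-closed Ks (while t p) K sub k∈ (here refl) a (u ∷ v ∷ γ) = go (evalTest _ a u v t) ∷ [] where
  go : ∀ x → (if x then p ∷ while t p ∷ K else K) ∈ Ks
  go true = sub (there (conts-entry p _))
  go false = k∈
 conts-closed Ks (while t p) K sub k∈ (there m) =
  conts-closed Ks p (while t p ∷ K) (λ x → sub (there x)) (sub (here refl)) m
 conts-closed Ks (switch f p) K sub k∈ (here refl) a (u ∷ v ∷ γ) =
  sub (there (∈-concat⁺′ (conts-entry (p (f a u v)) K) (∈-tabulate⁺ {f = λ i → conts (p i) K} (f a u v)))) ∷ []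
 conts-closed Ks (switch f p) K sub k∈ (there m) with ∈-concat⁻′ _ m
 ... | _ , m′ , t∈ with ∈-tabulate⁻ {f = λ i → conts (p i) K} t∈
 ... | i , refl = conts-closed Ks (p i) K (λ x → sub (there (∈-concat⁺′ x (∈-tabulate⁺ {f = λ i → conts (p i) K} i)))) k∈ m′
 conts-closed Ks (choose d p q) K sub k∈ (here refl) a γ =
  sub (there (∈-++⁺ˡ (conts-entry p K))) ∷ sub (there (∈-++⁺ʳ _ (conts-entry q K))) ∷ []
 conts-closed Ks (choose d p q) K sub k∈ (there m) with ∈-++⁻ (conts p K) m
 ... | inj₁ m′ = conts-closed Ks p K (λ x → sub (there (∈-++⁺ˡ x))) k∈ m′
 ... | inj₂ m′ = conts-closed Ks q K (λ x → sub (there (∈-++⁺ʳ (conts p K) x))) k∈ m′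
 conts-closed Ks (halt x) K sub k∈ (here refl) a γ = []

 next-det : nd ≡ false → ∀ K a γ → length (next K a γ) ≤ 1
 next-det e [] a γ = z≤n
 next-det e (goL ∷ K) a (u ∷ v ∷ γ) = ≤-refl
 next-det e (goR ∷ K) a (u ∷ v ∷ γ) = ≤-refl
 next-det e (setAnn _ x ∷ K) a (u ∷ v ∷ γ) = ≤-refl
 next-det e (setReg x ∷ K) a (u ∷ v ∷ γ) = ≤-refl
 next-det e (emit x ∷ K) a (u ∷ v ∷ γ) = ≤-refl
 next-det e (counter x x₁ ∷ K) a (u ∷ v ∷ γ) = ≤-refl
 next-det e (x ⨾ x₁ ∷ K) a (u ∷ v ∷ γ) = ≤-refl
 next-det e (ifThen x x₁ x₂ ∷ K) a (u ∷ v ∷ γ) = ≤-refl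
 next-det e (while x x₁ ∷ K) a (u ∷ v ∷ γ) = ≤-refl
 next-det e (switch f p ∷ K) a (u ∷ v ∷ γ) = ≤-refl
 next-det e (choose d x₁ x₂ ∷ K) a (u ∷ v ∷ γ) = ⊥-elim (subst T e d)
 next-det e (halt x ∷ K) a (u ∷ v ∷ γ) = z≤n

 accepts : Cont → Bool
 accepts (halt v ∷ K) = v
 accepts _ = false

 data HaltedCont : Cont → Set where
  ended : HaltedCont []
  halted : ∀ {v K} → HaltedCont (halt v ∷ K)

 LConf : Set
 LConf = Cont × ℕ × Vec (Tape (2 + g)) (2 + nc) × Word b

 actTape : Sym × Move → Tape (2 + g) → Tape (2 + g)
 actTape (x , m) t = moveTape m (write x t)

 applyRaw : Word k → LConf → Raw × Cont → LConf
 applyRaw w (_ , p , ws , o) ((m , ms , e) , K) =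
  K , moveInput w m p , Vec.zipWith actTape ms ws , o ++ fromMaybe e

 lnext : Word k → LConf → List LConf
 lnext w (K , p , ws , o) = map (applyRaw w (K , p , ws , o)) (next K (readInput w p) (Vec.map Tape.current ws))

 lspace : LConf → ℕ
 lspace (K , p , ws , o) = Vec.sum (Vec.map tapeSpace ws)

 -- Every run from the configuration halts within the given number of steps;
 -- the index A is the disjunction, over all runs, of the statements at the leaves.
 data LTree (w : Word k) (S : ℕ) (P : Cont → Word b → Set → Set) : ℕ → LConf → Set → Set₁ where
  leaf : ∀ {t K p ws o A} → HaltedCont K → lspace (K , p , ws , o) ≤ S → P K o A → LTree w S P t (K , p , ws , o) A
  step : ∀ {t lc lc′ A} → lspace lc ≤ S → lnext w lc ≡ lc′ ∷ [] → LTree w S P t lc′ A → LTree w S P (suc t) lc A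
  fork : ∀ {t lc l₁ l₂ A B} → lspace lc ≤ S → lnext w lc ≡ l₁ ∷ l₂ ∷ [] →
    LTree w S P t l₁ A → LTree w S P t l₂ B → LTree w S P (suc t) lc (A ⊎ B)

 weakenTree : ∀ {w S P t t′ lc A} → t ≤ t′ → LTree w S P t lc A → LTree w S P t′ lc A
 weakenTree le (leaf h s p) = leaf h s p
 weakenTree (s≤s le) (step s e x) = step s e (weakenTree le x)
 weakenTree (s≤s le) (fork s e x y) = fork s e (weakenTree le x) (weakenTree le y)

 module Compiled (p₀ : Prog) where

  states : List Cont
  states = [] ∷ conts p₀ []

  closed : ∀ {K} → K ∈ states → Closed states K
  closed (here refl) = λ a γ → []
  closed (there m) = conts-closed states p₀ [] there (here refl) m

  lookup∈ : ∀ (Ks : List Cont) i → List.lookup Ks i ∈ Ks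
  lookup∈ (K ∷ Ks) zero = here refl
  lookup∈ (K ∷ Ks) (suc i) = there (lookup∈ Ks i)

  actions : ∀ {rs : List (Raw × Cont)} → All (λ r → proj₂ r ∈ states) rs → List (Action k b (length states) (2 + nc) (2 + g))
  actions [] = []
  actions {((m , ms , e) , K) ∷ rs} (K∈ ∷ ks) =
   record { nextState = Any.index K∈ ; inputMove = m ; workMoves = ms ; emit = e } ∷ actions ks

  machine : Machine k b
  machine = record
   { #states = length states
   ; #tapes = 2 + nc
   ; #symbols = 2 + g
   ; initial = Any.index {xs = states} (there (conts-entry p₀ []))
   ; accepting = λ s → accepts (List.lookup states s)
   ; δ = λ s a γ → actions (closed (lookup∈ states s) a γ)
   }

  open Machine machine using (Config; Reaches; successors; initialConfig; Deterministic; RunsInTime; RunsInSpace; HaltsOn; Accepts; Computes; perform; Halted; Accepting; start; step)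
  open Config

  low : Config → LConf
  low c = List.lookup states (state c) , position c , works c , output c

  low-successors : ∀ w c → map low (successors w c) ≡ lnext w (low c)
  low-successors w c = go _ (closed (lookup∈ states (state c)) (readInput w (position c)) (Vec.map Tape.current (works c)))
   where
   lookup-index : ∀ {K} {Ks : List Cont} (m : K ∈ Ks) → List.lookup Ks (Any.index m) ≡ K
   lookup-index (here refl) = refl
   lookup-index (there m) = lookup-index m
   go : ∀ rs (ms : All (λ r → proj₂ r ∈ states) rs) →
     map low (map (perform w c) (actions ms)) ≡ map (applyRaw w (low c)) rs
   go [] [] = refl
   go (r ∷ rs) (m ∷ ms) = cong₂ _∷_ (cong (λ K → K , proj₂ (applyRaw w (low c) r)) (lookup-index m)) (go rs ms)

  low-initial : low initialConfig ≡ (p₀ ∷ [] , 0 , Vec.replicate (2 + nc) blankTape , [])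
  low-initial = cong (λ K → K , 0 , Vec.replicate (2 + nc) blankTape , []) (go (conts-entry p₀ []))
   where
   go : ∀ {K} {Ks : List Cont} (m : K ∈ Ks) → List.lookup Ks (Any.index m) ≡ K
   go (here refl) = refl
   go (there m) = go m

  deterministic : nd ≡ false → Deterministic
  deterministic e s a γ = subst (_≤ 1) (symm (go (closed (lookup∈ states s) a γ)))
    (next-det e (List.lookup states s) a γ) where
   go : ∀ {rs} (ms : All (λ r → proj₂ r ∈ states) rs) → length (actions ms) ≡ length rs
   go [] = refl
   go (m ∷ ms) = cong suc (go ms)

  map-singleton : ∀ {A B : Set} (f : A → B) xs {y ys} → map f xs ≡ y ∷ ys → ∃[ x ] x ∈ xs × f x ≡ y
  map-singleton f (x ∷ xs) refl = x , here refl , refl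

  module _ (w : Word k) (S : ℕ) (P : Cont → Word b → Set → Set) where

   private
    member : ∀ {c c′} → c′ ∈ successors w c → low c′ ∈ lnext w (low c)
    member {c} {c′} m = subst (low c′ ∈_) (low-successors w c) (∈-map⁺ low m)
    next≡[] : ∀ {lc} → HaltedCont (proj₁ lc) → lnext w lc ≡ []
    next≡[] ended = refl
    next≡[] halted = refl
    map-[] : ∀ {A B : Set} {f : A → B} xs → map f xs ≡ [] → xs ≡ []
    map-[] [] e = refl
   tree-reach : ∀ {T A} → LTree w S P T (low initialConfig) A → ∀ {n c} → Reaches w n c →
     ∃[ t ] ∃[ B ] n + t ≤ T × LTree w S P t (low c) B × (B → A)
   tree-reach tree start = _ , _ , ≤-refl , tree , λ x → x
   tree-reach {T} tree (step {n} {c} {c′} r m) with tree-reach tree r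
   ... | t , B , le , leaf h _ _ , f with subst (low c′ ∈_) (next≡[] h) (member {c} m)
   ... | ()
   tree-reach {T} tree (step {n} {c} {c′} r m) | suc t , B , le , step _ e tree′ , f
    with subst (low c′ ∈_) e (member {c} m)
   ... | here e′ = t , B , subst (_≤ T) (+-suc n t) le , subst (λ l → LTree w S P t l B) (symm e′) tree′ , f
   tree-reach {T} tree (step {n} {c} {c′} r m) | suc t , _ , le , fork {A = B₁} {B = B₂} _ e tree₁ tree₂ , f
    with subst (low c′ ∈_) e (member {c} m)
   ... | here e′ = t , B₁ , subst (_≤ T) (+-suc n t) le , subst (λ l → LTree w S P t l B₁) (symm e′) tree₁ , λ x → f (inj₁ x)
   ... | there (here e′) = t , B₂ , subst (_≤ T) (+-suc n t) le , subst (λ l → LTree w S P t l B₂) (symm e′) tree₂ , λ x → f (inj₂ x)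
   private
    descend : ∀ {lc′ ls c} → lnext w (low c) ≡ lc′ ∷ ls → ∃[ c′ ] c′ ∈ successors w c × low c′ ≡ lc′
    descend {c = c} e = map-singleton low (successors w c) (trans (low-successors w c) e)
    second : ∀ {l₁ l₂ ls c} → lnext w (low c) ≡ l₁ ∷ l₂ ∷ ls → ∃[ c′ ] c′ ∈ successors w c × low c′ ≡ l₂
    second {c = c} e with successors w c | trans (low-successors w c) e
    ... | x ∷ y ∷ xs | refl = y , there (here refl) , refl
   tree-halts : ∀ {t A n} c → LTree w S P t (low c) A → Reaches w n c →
     ∃[ n′ ] ∃[ c′ ] ∃[ B ] Reaches w n′ c′ × Halted w c′ × P (proj₁ (low c′)) (output c′) B
   tree-halts c (leaf h _ p) r = _ , c , _ , r , map-[] _ (trans (low-successors w c) (next≡[] {low c} h)) , p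
   tree-halts c (step _ e tree) r with descend {c = c} e
   ... | c′ , m , refl = tree-halts c′ tree (step r m)
   tree-halts c (fork _ e tree _) r with descend {c = c} e
   ... | c′ , m , refl = tree-halts c′ tree (step r m)
   tree-accepts : (∀ {K o B} → P K o B → B → T (accepts K)) → ∀ {t A n} c → LTree w S P t (low c) A →
     Reaches w n c → A → Accepts w
   tree-accepts f c (leaf h _ p) r a = _ , c , r , map-[] _ (trans (low-successors w c) (next≡[] {low c} h)) , f p a
   tree-accepts f c (step _ e tree) r a with descend {c = c} e
   ... | c′ , m , refl = tree-accepts f c′ tree (step r m) a
   tree-accepts f c (fork _ e tree _) r (inj₁ a) with descend {c = c} e
   ... | c′ , m , refl = tree-accepts f c′ tree (step r m) a
   tree-accepts f c (fork _ e _ tree) r (inj₂ a) with second {c = c} e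
   ... | c′ , m , refl = tree-accepts f c′ tree (step r m) a
   tree-rejects : (∀ {K o B} → P K o B → T (accepts K) → B) → ∀ {T A} →
     LTree w S P T (low initialConfig) A → Accepts w → A
   tree-rejects f tree (n , c , r , h , acc) with tree-reach tree r
   ... | t , B , _ , leaf _ _ p , g = g (f p acc)
   ... | _ , _ , _ , step _ e _ , _ with trans (symm e) (trans (symm (low-successors w c)) (cong (map low) h))
   ... | ()
   tree-rejects f tree (n , c , r , h , acc) | _ , _ , _ , fork _ e _ _ , _
    with trans (symm e) (trans (symm (low-successors w c)) (cong (map low) h))
   ... | ()
   tree-space : ∀ {t c A} → LTree w S P t (low c) A → Machine.space machine c ≤ S
   tree-space (leaf _ le _) = le
   tree-space (step le _ _) = le
   tree-space (fork le _ _ _) = le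

 WorkTape : Set
 WorkTape = Tape (2 + g)

 digit : Bool → Sym
 digit false = one
 digit true = two

 cells : List Bool → ℕ → List Sym
 cells ds m = map digit ds ++ replicate m blank

 mk : List Sym → List Sym → WorkTape
 mk ls [] = tape ls blank []
 mk ls (x ∷ xs) = tape ls x xs

 move-right : ∀ ls a xs → moveTape right (tape ls a xs) ≡ mk (a ∷ ls) xs
 move-right ls a [] = refl
 move-right ls a (x ∷ xs) = refl

 mk-space : ∀ ls xs {r} → length xs ≤ r → 1 ≤ r → tapeSpace (mk ls xs) ≤ length ls + r
 mk-space ls [] le 1≤r = +-monoʳ-≤ (length ls) 1≤r
 mk-space ls (x ∷ xs) le 1≤r = +-monoʳ-≤ (length ls) le

 data TPath (S : ℕ) : Maybe CounterOp → WorkTape → ℕ → Maybe CounterOp → WorkTape → Set where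
  done : ∀ {O t} → TPath S O t 0 O t
  step : ∀ {o t x m O′ n O″ t″} → tapeSpace t ≤ S → counterδ o (Tape.current t) ≡ (x , m , O′) →
    TPath S O′ (actTape (x , m) t) n O″ t″ → TPath S (just o) t (suc n) O″ t″

 _▷_ : ∀ {S O t n O′ t′ n′ O″ t″} → TPath S O t n O′ t′ → TPath S O′ t′ n′ O″ t″ → TPath S O t (n + n′) O″ t″
 done ▷ q = q
 step s e p ▷ q = step s e (p ▷ q)

 record Ran (S : ℕ) (o : CounterOp) (t : WorkTape) (ls : List Sym) (r v len : ℕ) : Set where
  constructor ran
  field
   ds′ : List Bool
   m′ : ℕ
   c : Sym
   cs : List Sym
   n : ℕ
   path : TPath S (just o) t n (just return) (moveTape left (tape ls c cs))
   shape : cells ds′ m′ ≡ c ∷ cs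
   value : digitsValue ds′ ≡ v
   fits : length (c ∷ cs) ≤ r
   time : n ≤ 2 + 2 * len

 inc-run : ∀ {S} ds m ls r → length (cells ds m) ≤ r → length ds < r → length ls + r ≤ S →
   Ran S inc (mk ls (cells ds m)) ls r (suc (digitsValue ds)) (length ds)
 inc-run [] zero ls r le lt room =
  ran (false ∷ []) 0 one [] 1 (step (≤-trans (mk-space ls [] z≤n lt) room) refl done) refl refl lt z<s
 inc-run [] (suc m) ls r le lt room =
  ran (false ∷ []) m one _ 1 (step (≤-trans (mk-space ls (replicate (suc m) blank) le lt) room) refl done) refl refl le z<s
 inc-run (false ∷ ds) m ls r le lt room =
  ran (true ∷ ds) m two _ 1 (step (≤-trans (mk-space ls (cells (false ∷ ds) m) le (≤-trans z<s lt)) room) refl done) refl refl le z<s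
 inc-run {S} (true ∷ ds) m ls (suc r) (s≤s le) (s≤s lt) room
  with inc-run {S} ds m (one ∷ ls) r le lt (subst (_≤ S) (+-suc (length ls) r) room)
 ... | ran ds′ m′ c cs n path shape value fits time =
  ran (false ∷ ds′) m′ one (c ∷ cs) (suc (n + 1))
   (step (≤-trans (mk-space ls (two ∷ cells ds m) (s≤s le) z<s) room) refl
    (subst (λ t → TPath S (just inc) t (n + 1) _ _) (symm (move-right ls one (cells ds m)))
     (path ▷ step (≤-trans (mk-space ls (one ∷ c ∷ cs) (s≤s fits) z<s) room) refl done)))
   (cong (one ∷_) shape)
   (cong suc (trans (cong (2 *_) value) (*-suc 2 (digitsValue ds))))
   (s≤s fits)
   (s≤s (≤-trans (≡⇒≤ (+-comm n 1)) (s≤s (≤-trans time (≡⇒≥ (*-suc 2 (length ds)))))))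

 dec-run : ∀ {S} d ds m ls r → length (cells (d ∷ ds) m) ≤ r → length (d ∷ ds) < r → length ls + r ≤ S →
   Ran S dec (mk ls (cells (d ∷ ds) m)) ls r (pred (digitsValue (d ∷ ds))) (length (d ∷ ds))
 dec-run true ds m ls r le lt room =
  ran (false ∷ ds) m one _ 1 (step (≤-trans (mk-space ls (cells (true ∷ ds) m) le (≤-trans z<s lt)) room) refl done) refl refl le z<s
 dec-run false [] zero ls r le lt room =
  ran [] 2 blank (blank ∷ []) 3
   (step (≤-trans (mk-space ls (one ∷ []) le (≤-trans z<s lt)) room) refl
    (step (≤-trans (mk-space (two ∷ ls) [] z≤n z<s) (≤-trans (≡⇒≥ (+-suc (length ls) 1)) (≤-trans (+-monoʳ-≤ (length ls) lt) room))) refl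
     (step (≤-trans (+-monoʳ-≤ (length ls) lt) room) refl done)))
   refl refl lt (s≤s (s≤s z<s))
 dec-run false [] (suc m) ls r le lt room =
  ran [] (suc (suc m)) blank _ 3
   (step (≤-trans (mk-space ls (cells (false ∷ []) (suc m)) le (≤-trans z<s lt)) room) refl
    (step (≤-trans (≡⇒≥ (+-suc (length ls) _)) (≤-trans (+-monoʳ-≤ (length ls) le) room)) refl
     (step (≤-trans (+-monoʳ-≤ (length ls) le) room) refl done)))
   refl refl le (s≤s (s≤s z<s))
 dec-run {S} false (d ∷ ds) m ls (suc r) (s≤s le) (s≤s lt) room
  with dec-run {S} d ds m (two ∷ ls) r le lt (subst (_≤ S) (+-suc (length ls) r) room)
 ... | ran ds′ m′ c cs n path shape value fits time =
  ran (true ∷ ds′) m′ two (c ∷ cs) (suc (n + 1))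
   (step (≤-trans (mk-space ls (one ∷ cells (d ∷ ds) m) (s≤s le) z<s) room) refl
     (path ▷ step (≤-trans (mk-space ls (two ∷ c ∷ cs) (s≤s fits) z<s) room) refl done))
   (cong (two ∷_) shape)
   (trans (cong (λ v → 2 + 2 * v) value) (doubled d))
   (s≤s fits)
   (s≤s (≤-trans (≡⇒≤ (+-comm n 1)) (s≤s (≤-trans time (≡⇒≥ (*-suc 2 (suc (length ds)))))))) where
  doubled : ∀ d → 2 + 2 * pred (digitsValue (d ∷ ds)) ≡ 2 * digitsValue (d ∷ ds)
  doubled false = symm (*-suc 2 (2 * digitsValue ds))
  doubled true = symm (*-suc 2 (1 + 2 * digitsValue ds))

 -- Both constructors of `home` are needed: the cell left of the number is
 -- visited for the first time by the first operation.
 data Home : List Sym → Set where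
  fresh : Home []
  used : Home (blank ∷ [])

 record Counter (r M v : ℕ) (t : WorkTape) : Set where
  constructor counter!
  field
   {ls} : List Sym
   ds : List Bool
   m : ℕ
   shape : t ≡ mk ls (cells ds m)
   home : Home ls
   value : digitsValue ds ≡ v
   fits : length (cells ds m) ≤ r
   bound : v ≤ M

 Cell : Set
 Cell = InputSymbol k × Sym

 record Store : Set where
  constructor store
  field
   lefts : List Cell
   focus : Cell
   rights : List Cell
   reg : Sym
   cnt : Vec ℕ nc
   out : Word b

 open Store

 zero? : ℕ → Bool
 zero? zero = true
 zero? (suc _) = false

 test : Store → Test → Bool
 test σ = evalTest (λ i → zero? (Vec.lookup (cnt σ) i)) (proj₁ (focus σ)) (proj₂ (focus σ)) (reg σ)

 data Step (M : ℕ) : Cont × Store → Cont × Store → Set where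
  goL : ∀ {K l L h R u vs o} → Step M (goL ∷ K , store (l ∷ L) h R u vs o) (K , store L l (h ∷ R) u vs o)
  goR : ∀ {K L h r R u vs o} → Step M (goR ∷ K , store L h (r ∷ R) u vs o) (K , store (h ∷ L) r R u vs o)
  setAnn : ∀ {K on f L a x R u vs o} →
    Step M (setAnn on f ∷ K , store L (a , x) R u vs o) (K , store L (a , f a x u) R u vs o)
  setReg : ∀ {K f L a x R u vs o} →
    Step M (setReg f ∷ K , store L (a , x) R u vs o) (K , store L (a , x) R (f a x u) vs o)
  emit : ∀ {K e L h R u vs o} → Step M (emit e ∷ K , store L h R u vs o) (K , store L h R u vs (o ++ e ∷ []))
  inc : ∀ {K i L h R u vs o} → Vec.lookup vs i < M →
    Step M (counter inc i ∷ K , store L h R u vs o) (K , store L h R u (vs [ i ]≔ suc (Vec.lookup vs i)) o)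
  dec : ∀ {K i L h R u vs o} → 0 < Vec.lookup vs i →
    Step M (counter dec i ∷ K , store L h R u vs o) (K , store L h R u (vs [ i ]≔ pred (Vec.lookup vs i)) o)
  seq : ∀ {K p q σ} → Step M (p ⨾ q ∷ K , σ) (p ∷ q ∷ K , σ)
  ifThen : ∀ {K t p q σ c} → test σ t ≡ c → Step M (ifThen t p q ∷ K , σ) ((if c then p else q) ∷ K , σ)
  while : ∀ {K t p σ c} → test σ t ≡ c → Step M (while t p ∷ K , σ) ((if c then p ∷ while t p ∷ K else K) , σ)
  switch : ∀ {K n f p σ i} → f (proj₁ (focus σ)) (proj₂ (focus σ)) (reg σ) ≡ i →
    Step M (switch {n} f p ∷ K , σ) (p i ∷ K , σ)

 data ATree (M : ℕ) (P : Cont → Word b → Set → Set) : ℕ → Cont × Store → Set → Set₁ where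
  leaf : ∀ {t K σ A} → HaltedCont K → P K (out σ) A → ATree M P t (K , σ) A
  step : ∀ {t c c′ A} → Step M c c′ → ATree M P t c′ A → ATree M P (suc t) c A
  fork : ∀ {t K d p q σ A B} → ATree M P t (p ∷ K , σ) A → ATree M P t (q ∷ K , σ) B →
    ATree M P (suc t) (choose d p q ∷ K , σ) (A ⊎ B)

 module Refinement (w : Word k) (M r : ℕ) (room : ∀ ds → digitsValue ds ≤ M → length ds < r) where

  Z S τ : ℕ
  Z = if tr then 2 + length w else 1
  S = Z + (1 + nc * (2 + r))
  τ = 4 + 2 * r

  data Track : List Sym → Sym → List Sym → WorkTape → Set where
   synced : ∀ {L h R xs} m → tr ≡ true → R ≡ xs ++ replicate m blank → Track L h R (tape L h xs)
   absent : ∀ {L R} → tr ≡ false → All (_≡ blank) L → All (_≡ blank) R → Track L blank R blankTape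

  record Sim (σ : Store) (p : ℕ) (ws : Vec WorkTape (2 + nc)) (o : Word b) : Set where
   constructor sim
   field
    {u} : WorkTape
    {cs} : Vec WorkTape nc
    pos : p ≡ length (lefts σ)
    input : map proj₁ (lefts σ) ʳ++ (proj₁ (focus σ) ∷ map proj₁ (rights σ)) ≡ ends w
    works : ws ≡ u ∷ tape [] (reg σ) [] ∷ cs
    track : Track (map proj₂ (lefts σ)) (proj₂ (focus σ)) (map proj₂ (rights σ)) u
    counts : ∀ i → Counter r M (Vec.lookup (cnt σ) i) (Vec.lookup cs i)
    outs : o ≡ out σ

  open Sim

  cells-length : ∀ σ → map proj₁ (lefts σ) ʳ++ (proj₁ (focus σ) ∷ map proj₁ (rights σ)) ≡ ends w →
    length (lefts σ) + suc (length (rights σ)) ≡ 2 + length w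
  cells-length σ e = trans (cong₂ (λ x y → x + suc y) (symm (length-map proj₁ (lefts σ))) (symm (length-map proj₁ (rights σ))))
   (trans (symm (length-ʳ++ (map proj₁ (lefts σ)))) (trans (cong length e) (length-ends w)))

  sim-input : ∀ {σ p ws o} → Sim σ p ws o → readInput w p ≡ proj₁ (focus σ)
  sim-input {σ} (sim refl inp _ _ _ _) = trans (readInput-at w (length (lefts σ)))
   (trans (cong₂ (λ e i → at e ⊣ i) (symm inp) (symm (length-map proj₁ (lefts σ))))
    (at-ʳ++ (map proj₁ (lefts σ)) {d = ⊣}))

  track-current : ∀ {L h R u} → Track L h R u → Tape.current u ≡ h
  track-current (synced _ _ _) = refl
  track-current (absent _ _ _) = refl

  track-space : ∀ {L h R u} → Track L h R u → length L + suc (length R) ≡ 2 + length w → tapeSpace u ≤ Z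
  track-space {L} (synced {xs = xs} m e refl) len rewrite e = ≤-trans
   (+-monoʳ-≤ (length L) (s≤s (≤-trans (m≤m+n (length xs) _) (≡⇒≥ (length-++ xs))))) (≡⇒≤ len)
  track-space (absent e _ _) len rewrite e = ≤-refl

  track-left : ∀ {L l h R u} → Track (l ∷ L) h R u → Track L l (h ∷ R) (moveTape (trackMove left) u)
  track-left (synced m e f) rewrite e = synced m refl (cong (_ ∷_) f)
  track-left (absent e (refl ∷ a) c) rewrite e = absent refl a (refl ∷ c)

  track-right : ∀ {L r h R u} → Track L h (r ∷ R) u → Track (h ∷ L) r R (moveTape (trackMove right) u)
  track-right (synced {xs = []} (suc m) e refl) rewrite e = synced m refl refl
  track-right (synced {xs = x ∷ xs} m e refl) rewrite e = synced m refl refl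
  track-right (absent e a (refl ∷ c)) rewrite e = absent refl (refl ∷ a) c

  track-write : ∀ {L h R u} x → T tr → Track L h R u → Track L x R (actTape (x , stay) u)
  track-write x on (synced m e f) = synced m e f
  track-write x on (absent e _ _) = ⊥-elim (subst T e on)

  counter-current : ∀ {v t} → Counter r M v t → isBlank (Tape.current t) ≡ zero? v
  counter-current (counter! [] zero refl _ refl _ _) = refl
  counter-current (counter! [] (suc m) refl _ refl _ _) = refl
  counter-current (counter! (false ∷ ds) m refl _ refl _ _) = refl
  counter-current (counter! (true ∷ ds) m refl _ refl _ _) = refl

  1≤r : 1 ≤ r
  1≤r = room [] z≤n

  home-length : ∀ {ls} → Home ls → length ls ≤ 1
  home-length fresh = z≤n
  home-length used = ≤-refl

  counter-space : ∀ {v t} → Counter r M v t → tapeSpace t ≤ 2 + r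
  counter-space (counter! {ls} ds m refl h _ f _) =
   ≤-trans (mk-space ls (cells ds m) f 1≤r) (≤-trans (+-monoˡ-≤ r (home-length h)) (n≤1+n _))

  sum-space : ∀ {n B} (ts : Vec WorkTape n) → (∀ i → tapeSpace (Vec.lookup ts i) ≤ B) → Vec.sum (Vec.map tapeSpace ts) ≤ n * B
  sum-space [] f = z≤n
  sum-space (t ∷ ts) f = +-mono-≤ (f zero) (sum-space ts (f ∘ suc))

  space-bound : ∀ K p u v cs o → tapeSpace u ≤ Z → (∀ i → tapeSpace (Vec.lookup cs i) ≤ 2 + r) →
    lspace (K , p , u ∷ tape [] v [] ∷ cs , o) ≤ S
  space-bound K p u v cs o f h = +-mono-≤ f (+-monoʳ-≤ 1 (sum-space cs h))

  sim-track-space : ∀ {σ p ws o} (s : Sim σ p ws o) → tapeSpace (u s) ≤ Z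
  sim-track-space {σ} (sim pos inp refl tk cn _) = track-space tk
   (trans (cong₂ (λ x y → x + suc y) (length-map proj₂ (lefts σ)) (length-map proj₂ (rights σ))) (cells-length σ inp))

  sim-space : ∀ {K σ p ws o} → Sim σ p ws o → lspace (K , p , ws , o) ≤ S
  sim-space {K} {σ} {p} {o = o} s@(sim {u} {cs} pos inp refl tk cn e) = space-bound K p u (reg σ) cs o (sim-track-space s) (λ i → counter-space (cn i))

  idle-id : ∀ {n} (ts : Vec WorkTape n) → Vec.zipWith actTape (idle (Vec.map Tape.current ts)) ts ≡ ts
  idle-id [] = refl
  idle-id (t ∷ ts) = cong (t ∷_) (idle-id ts)

  settle : ∀ {K p u v cs o} → _≡_ {A = List LConf}
    ((K , p , u ∷ v ∷ Vec.zipWith actTape (idle (Vec.map Tape.current cs)) cs , o ++ []) ∷ []) ((K , p , u ∷ v ∷ cs , o) ∷ [])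
  settle {cs = cs} {o} = cong₂ (λ cs o → (_ , _ , _ ∷ _ ∷ cs , o) ∷ []) (idle-id cs) (++-identityʳ o)

  act-one : ∀ {n} (ts : Vec WorkTape n) i a →
    Vec.zipWith actTape (idle (Vec.map Tape.current ts) [ i ]≔ a) ts ≡ ts [ i ]≔ actTape a (Vec.lookup ts i)
  act-one (t ∷ ts) zero a = cong (_ ∷_) (idle-id ts)
  act-one (t ∷ ts) (suc i) a = cong (t ∷_) (act-one ts i a)

  sim-test : ∀ {σ p u v cs o} → Sim σ p (u ∷ v ∷ cs) o → ∀ t →
    evalTest (λ i → isBlank (Vec.lookup (Vec.map Tape.current cs) i)) (readInput w p) (Tape.current u) (reg σ) t ≡ test σ t
  sim-test {cs = cs} s@(sim refl _ refl tk cn refl) t rewrite sim-input s | track-current tk =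
   evalTest-cong _ _ _ (λ i → trans (cong isBlank (lookup-map i Tape.current cs)) (counter-current (cn i))) t

  module _ {P : Cont → Word b → Set → Set} where

   private
    one-step : ∀ {t lc lc′ A} → lspace lc ≤ S → lnext w lc ≡ lc′ ∷ [] → LTree w S P t lc′ A → LTree w S P (τ + t) lc A
    one-step {t} s e x = weakenTree (s≤s (m≤n+m t (3 + 2 * r))) (step s e x)
   run-counter : ∀ {K p u v cs o i O t n O′ t′ s A} → tapeSpace u ≤ Z → (∀ j → tapeSpace (Vec.lookup cs j) ≤ 2 + r) →
    TPath (2 + r) O t n O′ t′ → LTree w S P s (afterOp O′ i K , p , u ∷ tape [] v [] ∷ cs [ i ]≔ t′ , o) A →
    LTree w S P (n + s) (afterOp O i K , p , u ∷ tape [] v [] ∷ cs [ i ]≔ t , o) A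
   run-counter us css done x = x
   run-counter {K} {p} {u} {v} {cs} {o} {i} us css (step {o₀} {t} {y} {m} {O′} sp e path) x =
    step (space-bound (counter o₀ i ∷ K) p u v (cs [ i ]≔ t) o us small) next≡ (run-counter us css path x)
    where
    small : ∀ j → tapeSpace (Vec.lookup (cs [ i ]≔ t) j) ≤ 2 + r
    small j with i Data.Fin.≟ j
    ... | yes refl = subst (λ z → tapeSpace z ≤ 2 + r) (symm (lookup∘updateAt i cs)) sp
    ... | no i≢j = subst (λ z → tapeSpace z ≤ 2 + r) (symm (lookup∘update′ (i≢j ∘ symm) cs t)) (css j)
    next≡ : lnext w (counter o₀ i ∷ K , p , u ∷ tape [] v [] ∷ cs [ i ]≔ t , o) ≡
      (afterOp O′ i K , p , u ∷ tape [] v [] ∷ cs [ i ]≔ actTape (y , m) t , o) ∷ []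
    next≡ rewrite lookup-map i Tape.current (cs [ i ]≔ t) | lookup∘update i cs t | e | ++-identityʳ o
     | act-one (cs [ i ]≔ t) i (y , m) | lookup∘update i cs t | []≔-idempotent {x = t} {y = actTape (y , m) t} cs i = refl
   counter-op : ∀ {K p u v cs vs o i op x s A} → tapeSpace u ≤ Z → (cn : ∀ j → Counter r M (Vec.lookup vs j) (Vec.lookup cs j)) →
    (∀ {ls ds m} → Home ls → digitsValue ds ≡ Vec.lookup vs i → length (cells ds m) ≤ r → length ds < r →
      Ran (2 + r) op (mk ls (cells ds m)) ls r x (length ds)) → x ≤ M →
    (∀ {cs′} → (∀ j → Counter r M (Vec.lookup (vs [ i ]≔ x) j) (Vec.lookup cs′ j)) →
      LTree w S P s (K , p , u ∷ tape [] v [] ∷ cs′ , o) A) →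
    LTree w S P (τ + s) (counter op i ∷ K , p , u ∷ tape [] v [] ∷ cs , o) A
   counter-op {K} {p} {u} {v} {cs} {vs} {o} {i} {op} {x} {s} {A} us cn run x≤M κ with cn i in eqc
   ... | counter! {ls} ds m sh h val f bd with run {ls} {ds} {m} h val f (room ds (subst (_≤ M) (symm val) bd))
   ... | ran ds′ m′ c ts n path shape value fits time =
    weakenTree n≤ (subst (λ z → LTree w S P (n + 1 + s) (counter op i ∷ K , p , u ∷ tape [] v [] ∷ z , o) A)
     (trans (cong (cs [ i ]≔_) (symm sh)) ([]≔-lookup cs i))
     (run-counter {cs = cs} {i = i} us (λ j → counter-space (cn j)) (path ▷ final h) (κ {cs [ i ]≔ tape (blank ∷ []) c ts} new)))
    where
    n≤ : n + 1 + s ≤ τ + s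
    n≤ = +-monoˡ-≤ s (≤-trans (≡⇒≤ (+-comm n 1)) (s≤s (≤-trans time
      (≤-trans (+-monoʳ-≤ 2 (*-monoʳ-≤ 2 (<⇒≤ (room ds (subst (_≤ M) (symm val) bd))))) (n≤1+n _)))))
    final : Home ls → TPath (2 + r) (just return) (moveTape left (tape ls c ts)) 1 nothing (tape (blank ∷ []) c ts)
    final fresh = step (s≤s (s≤s (≤-trans (n≤1+n _) fits))) refl done
    final used = step (s≤s (≤-trans fits (n≤1+n r))) refl done
    new : ∀ j → Counter r M (Vec.lookup (vs [ i ]≔ x) j) (Vec.lookup (cs [ i ]≔ tape (blank ∷ []) c ts) j)
    new j with i Data.Fin.≟ j
    ... | yes refl rewrite lookup∘update i vs x | lookup∘update i cs (tape (blank ∷ []) c ts) =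
      counter! ds′ m′ (cong (mk (blank ∷ [])) (symm shape)) used value (subst (λ z → length z ≤ r) (symm shape) fits) x≤M
    ... | no i≢j rewrite lookup∘update′ (i≢j ∘ symm) vs x | lookup∘update′ (i≢j ∘ symm) cs (tape (blank ∷ []) c ts) = cn j
   conf : Store → Cont → WorkTape → Vec WorkTape nc → LConf
   conf σ K u cs = K , length (lefts σ) , u ∷ tape [] (reg σ) [] ∷ cs , Store.out σ
   lift-step : ∀ {K σ K′ σ′ p ws o s A} → Step M (K , σ) (K′ , σ′) → Sim σ p ws o →
     (∀ {p′ ws′ o′} → Sim σ′ p′ ws′ o′ → LTree w S P s (K′ , p′ , ws′ , o′) A) →
     LTree w S P (τ + s) (K , p , ws , o) A
   lift-step (goL {K}) s@(sim refl inp refl tk cn refl) κ =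
    one-step (sim-space {goL ∷ K} s) settle (κ (sim refl inp refl (track-left tk) cn refl))
   lift-step {σ = σ} (goR {K} {L} {h} {x} {R}) s@(sim {u} {cs} refl inp refl tk cn refl) κ =
    one-step (sim-space {goR ∷ K} s) eq (κ (sim refl inp refl (track-right tk) cn refl)) where
    pos≤ : length L ≤ length w
    pos≤ = (≤-trans (m≤m+n (length L) (length R)) (≡⇒≤ (suc-injective (suc-injective
     (trans (cong suc (symm (+-suc (length L) (length R)))) (trans (symm (+-suc (length L) (suc (length R)))) (cells-length σ inp)))))))
    eq : lnext w (goR ∷ K , length L , u ∷ tape [] (reg σ) [] ∷ cs , Store.out σ) ≡ (K , suc (length L) , moveTape (trackMove right) u ∷ tape [] (reg σ) [] ∷ cs , Store.out σ) ∷ []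
    eq rewrite idle-id cs | ++-identityʳ (Store.out σ) | m≤n⇒m⊓n≡m pos≤ = refl
   lift-step {σ = σ} (setAnn {K} {on} {f} {a = a} {x}) s@(sim {u} {cs} refl inp refl tk cn refl) κ =
    one-step (sim-space {setAnn on f ∷ K} s) eq (κ (sim refl inp refl (track-write _ on tk) cn refl))
    where
    eq : lnext w (conf σ (setAnn on f ∷ K) u cs) ≡ (K , length (lefts σ) , actTape (f a x (reg σ) , stay) u ∷ tape [] (reg σ) [] ∷ cs , Store.out σ) ∷ []
    eq rewrite idle-id cs | ++-identityʳ (Store.out σ) | sim-input s | track-current tk = refl
   lift-step {σ = σ} (setReg {K} {f} {a = a} {x}) s@(sim {u} {cs} refl inp refl tk cn refl) κ =
    one-step (sim-space {setReg f ∷ K} s) eq (κ (sim refl inp refl tk cn refl)) where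
    eq : lnext w (conf σ (setReg f ∷ K) u cs) ≡ (K , length (lefts σ) , u ∷ tape [] (f a x (reg σ)) [] ∷ cs , Store.out σ) ∷ []
    eq rewrite idle-id cs | ++-identityʳ (Store.out σ) | sim-input s | track-current tk = refl
   lift-step {σ = σ} (emit {K} {e}) s@(sim {cs = cs} refl inp refl tk cn refl) κ =
    one-step (sim-space {emit e ∷ K} s) (cong (λ cs → (K , _ , _ ∷ _ ∷ cs , Store.out σ ++ e ∷ []) ∷ []) (idle-id cs)) (κ (sim refl inp refl tk cn refl))
   lift-step {σ = σ} (inc {i = i} lt) s@(sim {u} {cs} refl inp refl tk cn refl) κ =
    counter-op {cs = cs} {vs = cnt σ} {i = i} (sim-track-space s) cn
     (λ {ls} {ds} {m} h val f bd → subst (λ z → Ran (2 + r) inc (mk ls (cells ds m)) ls r z (length ds)) (cong suc val)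
       (inc-run ds m ls r f bd (≤-trans (+-monoˡ-≤ r (home-length h)) (n≤1+n _))))
     lt (λ cn′ → κ (sim refl inp refl tk cn′ refl))
   lift-step {σ = σ} (dec {i = i} lt) s@(sim {u} {cs} refl inp refl tk cn refl) κ =
    counter-op {cs = cs} {vs = cnt σ} {i = i} (sim-track-space s) cn (λ {ls} {ds} {m} → run {ls} {ds} {m})
     (≤-trans pred[n]≤n (Counter.bound (cn i))) (λ cn′ → κ (sim refl inp refl tk cn′ refl)) where
    run : ∀ {ls ds m} → Home ls → digitsValue ds ≡ Vec.lookup (cnt σ) i → length (cells ds m) ≤ r → length ds < r →
      Ran (2 + r) dec (mk ls (cells ds m)) ls r (pred (Vec.lookup (cnt σ) i)) (length ds)
    run {ds = []} h val f bd = ⊥-elim (<-irrefl val lt)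
    run {ls} {d ∷ ds} {m} h val f bd = subst (λ z → Ran (2 + r) dec (mk ls (cells (d ∷ ds) m)) ls r z (suc (length ds))) (cong pred val)
     (dec-run d ds m ls r f bd (≤-trans (+-monoˡ-≤ r (home-length h)) (n≤1+n _)))
   lift-step (seq {K} {p} {q}) s@(sim refl inp refl tk cn refl) κ = one-step (sim-space {p ⨾ q ∷ K} s) settle (κ s)
   lift-step {σ = σ} (ifThen {K} {t} {p} {q} {c = c} e) s@(sim {u} {cs} refl inp refl tk cn refl) κ =
    one-step (sim-space {ifThen t p q ∷ K} s) eq (κ s) where
    eq : lnext w (conf σ (ifThen t p q ∷ K) u cs) ≡ (conf σ ((if c then p else q) ∷ K) u cs) ∷ []
    eq = cong₂ (λ d (x : Vec WorkTape nc × Word b) → ((if d then p else q) ∷ K , length (lefts σ) , u ∷ tape [] (reg σ) [] ∷ proj₁ x , proj₂ x) ∷ [])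
     (trans (sim-test s t) e) (cong₂ _,_ (idle-id cs) (++-identityʳ (Store.out σ)))
   lift-step {σ = σ} (while {K} {t} {p} {c = c} e) s@(sim {u} {cs} refl inp refl tk cn refl) κ =
    one-step (sim-space {while t p ∷ K} s) eq (κ s) where
    eq : lnext w (conf σ (while t p ∷ K) u cs) ≡ (conf σ ((if c then p ∷ while t p ∷ K else K)) u cs) ∷ []
    eq = cong₂ (λ d (x : Vec WorkTape nc × Word b) → ((if d then p ∷ while t p ∷ K else K) , length (lefts σ) , u ∷ tape [] (reg σ) [] ∷ proj₁ x , proj₂ x) ∷ [])
     (trans (sim-test s t) e) (cong₂ _,_ (idle-id cs) (++-identityʳ (Store.out σ)))
   lift-step {σ = σ} (switch {K} {f = f} {p} refl) s@(sim {u} {cs} refl inp refl tk cn refl) κ =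
    one-step (sim-space {switch f p ∷ K} s) eq (κ s) where
    eq : lnext w (conf σ (switch f p ∷ K) u cs) ≡ (p (f (proj₁ (focus σ)) (proj₂ (focus σ)) (reg σ)) ∷ K , length (lefts σ) , u ∷ tape [] (reg σ) [] ∷ cs , Store.out σ) ∷ []
    eq rewrite idle-id cs | ++-identityʳ (Store.out σ) | sim-input s | track-current tk = refl
   lift-tree : ∀ {t K σ p ws o A} → ATree M P t (K , σ) A → Sim σ p ws o → LTree w S P (τ * t) (K , p , ws , o) A
   lift-tree {K = K} (leaf h x) s@(sim refl inp refl tk cn refl) = leaf h (sim-space {K} s) x
   lift-tree {suc t} (step st x) s = weakenTree (≡⇒≥ (*-suc τ t)) (lift-step st s (lift-tree x))
   lift-tree {suc t} {σ = σ} (fork {K = K} {d} {p} {q} x y) s@(sim {u} {cs} refl inp refl tk cn refl) =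
    weakenTree (≤-trans (s≤s (m≤n+m (τ * t) (3 + 2 * r))) (≡⇒≥ (*-suc τ t)))
     (fork (sim-space {choose d p q ∷ K} s) (cong₂ (λ cs o → (p ∷ K , length (lefts σ) , _ ∷ _ ∷ cs , o) ∷ (q ∷ K , length (lefts σ) , _ ∷ _ ∷ cs , o) ∷ [])
      (idle-id cs) (++-identityʳ (Store.out σ))) (lift-tree x s) (lift-tree y s))

 weakenA : ∀ {M P t t′ c A} → t ≤ t′ → ATree M P t c A → ATree M P t′ c A
 weakenA le (leaf h p) = leaf h p
 weakenA (s≤s le) (step s x) = step s (weakenA le x)
 weakenA (s≤s le) (fork x y) = fork (weakenA le x) (weakenA le y)

 -- Started in the first store, the program ends in the second one within t
 -- steps; in continuation-passing form, so that composition is that of functions.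
 record Runs (M : ℕ) (p : Prog) (σ : Store) (t : ℕ) (σ′ : Store) : Set₁ where
  constructor runs
  field exec : ∀ {K P A s} → ATree M P s (K , σ′) A → ATree M P (t + s) (p ∷ K , σ) A

 open Runs public

 module _ {M : ℕ} where

  runs-≤ : ∀ {p σ s t σ′} → s ≤ t → Runs M p σ s σ′ → Runs M p σ t σ′
  runs-≤ le f = runs λ x → weakenA (+-monoˡ-≤ _ le) (exec f x)

  runs-seq : ∀ {p q σ s σ′ t σ″} → Runs M p σ s σ′ → Runs M q σ′ t σ″ → Runs M (p ⨾ q) σ (suc (s + t)) σ″
  runs-seq {s = s} {t = t} f g = runs λ x → step seq (weakenA (≡⇒≥ (+-assoc s t _)) (exec f (exec g x)))

  runs-if : ∀ {t p q σ s σ′ c} → test σ t ≡ c → Runs M (if c then p else q) σ s σ′ → Runs M (ifThen t p q) σ (suc s) σ′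
  runs-if e f = runs λ x → step (ifThen e) (exec f x)

  runs-stop : ∀ {t p σ} → test σ t ≡ false → Runs M (while t p) σ 1 σ
  runs-stop e = runs (step (while e))

  runs-loop : ∀ {t p σ s σ′ s′ σ″} → test σ t ≡ true → Runs M p σ s σ′ → Runs M (while t p) σ′ s′ σ″ →
    Runs M (while t p) σ (suc (s + s′)) σ″
  runs-loop {s = s} {s′ = s′} e f g =
   runs λ x → step (while e) (weakenA (≡⇒≥ (+-assoc s s′ _)) (exec f (exec g x)))

  runs-switch : ∀ {n f p σ i s σ′} → f (proj₁ (focus σ)) (proj₂ (focus σ)) (reg σ) ≡ i →
    Runs M (p i) σ s σ′ → Runs M (switch {n} f p) σ (suc s) σ′
  runs-switch e f = runs λ x → step (switch e) (exec f x)

  runs-goL : ∀ {l L h R u vs o} → Runs M goL (store (l ∷ L) h R u vs o) 1 (store L l (h ∷ R) u vs o)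
  runs-goL = runs (step goL)

  runs-goR : ∀ {L h x R u vs o} → Runs M goR (store L h (x ∷ R) u vs o) 1 (store (h ∷ L) x R u vs o)
  runs-goR = runs (step goR)

  runs-setReg : ∀ {f L a x R u vs o} → Runs M (setReg f) (store L (a , x) R u vs o) 1 (store L (a , x) R (f a x u) vs o)
  runs-setReg = runs (step setReg)

  runs-emit : ∀ {e L h R u vs o} → Runs M (emit e) (store L h R u vs o) 1 (store L h R u vs (o ++ e ∷ []))
  runs-emit = runs (step emit)

  runs-inc : ∀ {i L h R u vs o} → Vec.lookup vs i < M →
    Runs M (counter inc i) (store L h R u vs o) 1 (store L h R u (vs [ i ]≔ suc (Vec.lookup vs i)) o)
  runs-inc lt = runs (step (inc lt))

  runs-dec : ∀ {i L h R u vs o} → 0 < Vec.lookup vs i →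
    Runs M (counter dec i) (store L h R u vs o) 1 (store L h R u (vs [ i ]≔ pred (Vec.lookup vs i)) o)
  runs-dec lt = runs (step (dec lt))

 initStore : Word k → Store
 initStore w = store [] (⊢ , blank) (map (_, blank) (map sym w ++ ⊣ ∷ [])) blank (Vec.replicate nc 0) []

 AccLeaf : Cont → Word b → Set → Set
 AccLeaf K o A = T (accepts K) ⇔ A

 module Results (p₀ : Prog) where

  open Compiled p₀ public using (machine; deterministic)
  open Compiled p₀ hiding (machine; deterministic)

  bits : ℕ → ℕ
  bits M = suc ⌊log₂ suc M ⌋

  spaceUsed : ℕ → ℕ → ℕ
  spaceUsed n M = (if tr then 2 + n else 1) + (1 + nc * (2 + bits M))

  timeUsed : ℕ → ℕ → ℕ
  timeUsed t M = (4 + 2 * bits M) * t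

  module _ (w : Word k) {M t A P} (tree : ATree M P t (p₀ ∷ [] , initStore w) A) where

   open Refinement w M (bits M) digits-bound
   private
    blank-annotations : ∀ (xs : List (InputSymbol k)) → map proj₂ (map {B = Cell} (_, blank) xs) ≡ replicate (length xs) blank
    blank-annotations [] = refl
    blank-annotations (x ∷ xs) = cong (blank ∷_) (blank-annotations xs)
    letters : ∀ (xs : List (InputSymbol k)) → map proj₁ (map {B = Cell} (_, blank) xs) ≡ xs
    letters [] = refl
    letters (x ∷ xs) = cong (x ∷_) (letters xs)
    all-blank : ∀ n → All {A = Sym} (_≡ blank) (replicate n blank)
    all-blank zero = []
    all-blank (suc n) = refl ∷ all-blank n
    initial-track : ∀ c → tr ≡ c → Track [] blank (replicate (length (map sym w ++ ⊣ ∷ [])) blank) blankTape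
    initial-track true e = synced _ e refl
    initial-track false e = absent e [] (all-blank _)
    initial-sim : Sim (initStore w) 0 (Vec.replicate (2 + nc) blankTape) []
    initial-sim = sim refl (cong (⊢ ∷_) (letters _)) refl
     (subst (λ R → Track [] blank R blankTape) (symm (blank-annotations _)) (initial-track tr refl))
     (λ i → subst₂ (Counter _ _) (symm (lookup-replicate i 0)) (symm (lookup-replicate i blankTape))
      (counter! [] 0 refl fresh refl z≤n z≤n))
     refl
   low-tree : LTree w (spaceUsed (length w) M) P (timeUsed t M) (low (Machine.initialConfig machine)) A
   low-tree = subst (λ c → LTree w S P (timeUsed t M) c A) (symm low-initial) (lift-tree tree initial-sim)
   program-time : ∀ {n c} → Machine.Reaches machine w n c → n ≤ timeUsed t M
   program-time r with tree-reach w _ P low-tree r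
   ... | s , B , le , _ = ≤-trans (m≤m+n _ s) le
   program-space : ∀ {n c} → Machine.Reaches machine w n c → Machine.space machine c ≤ spaceUsed (length w) M
   program-space {c = c} r with tree-reach w _ P low-tree r
   ... | s , B , le , x , _ = tree-space w _ P {c = c} x
   program-halts : ∃[ n ] ∃[ c ] ∃[ B ] Machine.Reaches machine w n c × Machine.Halted machine w c × P (proj₁ (low c)) (Machine.output c) B
   program-halts = tree-halts w _ P (Machine.initialConfig machine) low-tree Machine.start

  module _ (w : Word k) {M t A} (tree : ATree M AccLeaf t (p₀ ∷ [] , initStore w) A) where

   program-accepts : Machine.Accepts machine w ⇔ A
   program-accepts = mk⇔
    (tree-rejects w _ AccLeaf Equivalence.to (low-tree w tree))
    (tree-accepts w _ AccLeaf Equivalence.from (Machine.initialConfig machine) (low-tree w tree) Machine.start)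

data Expr (v : ℕ) : Set where
 var : Fin v → Expr v
 con : ℕ → Expr v
 _⊕_ _⊗_ : Expr v → Expr v → Expr v

infixl 6 _⊕_
infixl 7 _⊗_

variable v : ℕ

⟦_⟧ᴱ : Expr v → Vec ℕ v → ℕ
⟦ var x ⟧ᴱ η = lookup η x
⟦ con c ⟧ᴱ η = c
⟦ e ⊕ e′ ⟧ᴱ η = ⟦ e ⟧ᴱ η + ⟦ e′ ⟧ᴱ η
⟦ e ⊗ e′ ⟧ᴱ η = ⟦ e ⟧ᴱ η * ⟦ e′ ⟧ᴱ η

concatUpTo : {A : Set} → ℕ → (ℕ → List A) → List A
concatUpTo zero f = []
concatUpTo (suc n) f = f 0 ++ concatUpTo n (f ∘ suc)

infixr 5 _·_

-- Texts written by nested for-loops over indices that are polynomial in the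
-- length of the input; `read i f` branches on the input symbol in cell i.
data Gen (k b : ℕ) : ℕ → Set where
 ε : Gen k b v
 letter : Fin b → Gen k b v
 _·_ : Gen k b v → Gen k b v → Gen k b v
 for : Expr v → Gen k b (suc v) → Gen k b v
 read : Fin v → (InputSymbol k → Gen k b v) → Gen k b v

⟦_⟧ᴳ : ∀ {k b v} → Gen k b v → Word k → Vec ℕ v → Word b
⟦ ε ⟧ᴳ w η = []
⟦ letter a ⟧ᴳ w η = a ∷ []
⟦ g · h ⟧ᴳ w η = ⟦ g ⟧ᴳ w η ++ ⟦ h ⟧ᴳ w η
⟦ for e g ⟧ᴳ w η = concatUpTo (⟦ e ⟧ᴱ η) (λ i → ⟦ g ⟧ᴳ w (i ∷ η))
⟦ read x f ⟧ᴳ w η = ⟦ f (readInput w (lookup η x)) ⟧ᴳ w η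

mapGen : ∀ {k b b′ v} → (Fin b → Fin b′) → Gen k b v → Gen k b′ v
mapGen f ε = ε
mapGen f (letter a) = letter (f a)
mapGen f (g · h) = mapGen f g · mapGen f h
mapGen f (for e g) = for e (mapGen f g)
mapGen f (read x h) = read x (λ a → mapGen f (h a))

mapGen-⟦⟧ : ∀ {k b b′ v} (f : Fin b → Fin b′) (g : Gen k b v) w η → ⟦ mapGen f g ⟧ᴳ w η ≡ map f (⟦ g ⟧ᴳ w η)
mapGen-⟦⟧ f ε w η = refl
mapGen-⟦⟧ f (letter a) w η = refl
mapGen-⟦⟧ f (g · h) w η = trans (cong₂ _++_ (mapGen-⟦⟧ f g w η) (mapGen-⟦⟧ f h w η)) (symm (map-++ f (⟦ g ⟧ᴳ w η) _))
mapGen-⟦⟧ {b = b} {b′} f (for e g) w η = go (⟦ e ⟧ᴱ η) (λ i → mapGen-⟦⟧ f g w (i ∷ η)) where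
 go : ∀ n {F : ℕ → List (Fin b′)} {G : ℕ → List (Fin b)} → (∀ i → F i ≡ map f (G i)) → concatUpTo n F ≡ map f (concatUpTo n G)
 go zero e = refl
 go (suc n) {F} {G} e = trans (cong₂ _++_ (e 0) (go n (e ∘ suc))) (symm (map-++ f (G 0) _))
mapGen-⟦⟧ f (read x h) w η = mapGen-⟦⟧ f (h (readInput w (lookup η x))) w η

sumFin : ∀ n → (Fin n → ℕ) → ℕ
sumFin zero f = 0
sumFin (suc n) f = f zero + sumFin n (f ∘ suc)

sumSymbols : ∀ {k} → (InputSymbol k → ℕ) → ℕ
sumSymbols {k} f = f ⊢ + (f ⊣ + sumFin k (λ a → f (sym a)))

≤-sumSymbols : ∀ {k} (f : InputSymbol k → ℕ) s → f s ≤ sumSymbols f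
≤-sumSymbols f ⊢ = m≤m+n (f ⊢) _
≤-sumSymbols f ⊣ = ≤-trans (m≤m+n (f ⊣) _) (m≤n+m _ (f ⊢))
≤-sumSymbols {k} f (sym a) = ≤-trans (go k (f ∘ sym) a) (≤-trans (m≤n+m _ (f ⊣)) (m≤n+m _ (f ⊢)))
 where
 go : ∀ n (h : Fin n → ℕ) a → h a ≤ sumFin n h
 go (suc n) h zero = m≤m+n (h zero) _
 go (suc n) h (suc a) = ≤-trans (go n (h ∘ suc) a) (m≤n+m _ (h zero))

-- The running time and the values of the counters, when all variables are at
-- most m and the input has at most N cells.
bound : Expr v → ℕ → ℕ
bound (var x) m = m
bound (con c) m = c
bound (e ⊕ e′) m = bound e m + bound e′ m
bound (e ⊗ e′) m = bound e m + bound e m * bound e′ m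

addTime : Expr v → ℕ → ℕ
addTime (var x) m = suc ((m * 6 + 1) + (m * 4 + 1))
addTime (con c) m = c * 2 + 1
addTime (e ⊕ e′) m = suc (addTime e m + addTime e′ m)
addTime (e ⊗ e′) m = suc (addTime e m + (bound e m * (3 + addTime e′ m) + 1))

genBound : ∀ {k b v} → Gen k b v → ℕ → ℕ
genBound ε m = m
genBound (letter a) m = m
genBound (g · h) m = genBound g m + genBound h m
genBound (for e g) m = m + bound e m + genBound g (m + bound e m)
genBound (read x f) m = m + sumSymbols (λ a → genBound (f a) m)

genTime : ∀ {k b v} → Gen k b v → ℕ → ℕ → ℕ
genTime ε m N = 1
genTime (letter a) m N = 1
genTime (g · h) m N = suc (genTime g m N + genTime h m N)
genTime (for e g) m N = suc (addTime e m + suc ((bound e m * (5 + genTime g (m + bound e m) N) + 1) + (bound e m * 2 + 1)))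
genTime (read x f) m N = suc ((N * 2 + 1) + suc (addTime (var x) m + suc ((m * 5 + 1) + suc (sumSymbols (λ a → genTime (f a) m N)))))

exprWidth : Expr v → ℕ
exprWidth (var x) = 0
exprWidth (con c) = 0
exprWidth (e ⊕ e′) = exprWidth e + exprWidth e′
exprWidth (e ⊗ e′) = suc (exprWidth e + exprWidth e′)

genWidth : ∀ {k b v} → Gen k b v → ℕ
genWidth ε = 0
genWidth (letter a) = 0
genWidth (g · h) = genWidth g + genWidth h
genWidth (for e g) = 2 + (exprWidth e + genWidth g)
genWidth (read x f) = suc (sumSymbols (λ a → genWidth (f a)))

pb-bound : ∀ (e : Expr v) {f} → PolyBound f → PolyBound (λ n → bound e (f n))
pb-bound (var x) F = F
pb-bound (con c) F = pb-const c
pb-bound (e ⊕ e′) F = pb-+ (pb-bound e F) (pb-bound e′ F)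
pb-bound (e ⊗ e′) F = pb-+ (pb-bound e F) (pb-* (pb-bound e F) (pb-bound e′ F))

pb-suc : ∀ {f} → PolyBound f → PolyBound (λ n → suc (f n))
pb-suc F = pb-+ (pb-const 1) F

pb-addTime : ∀ (e : Expr v) {f} → PolyBound f → PolyBound (λ n → addTime e (f n))
pb-addTime (var x) F = pb-suc (pb-+ (pb-+ (pb-* F (pb-const 6)) (pb-const 1)) (pb-+ (pb-* F (pb-const 4)) (pb-const 1)))
pb-addTime (con c) F = pb-const (c * 2 + 1)
pb-addTime (e ⊕ e′) F = pb-suc (pb-+ (pb-addTime e F) (pb-addTime e′ F))
pb-addTime (e ⊗ e′) F = pb-suc (pb-+ (pb-addTime e F) (pb-+ (pb-* (pb-bound e F) (pb-+ (pb-const 3) (pb-addTime e′ F))) (pb-const 1)))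

pb-sum : ∀ {k} {f : InputSymbol k → ℕ → ℕ} → (∀ a → PolyBound (f a)) → PolyBound (λ n → sumSymbols (λ a → f a n))
pb-sum {k} F = pb-+ (F ⊢) (pb-+ (F ⊣) (go k (F ∘ sym))) where
 go : ∀ n {f : Fin n → ℕ → ℕ} → (∀ a → PolyBound (f a)) → PolyBound (λ m → sumFin n (λ a → f a m))
 go zero F = pb-const 0
 go (suc n) F = pb-+ (F zero) (go n (F ∘ suc))

pb-genBound : ∀ {k b v} (g : Gen k b v) {f} → PolyBound f → PolyBound (λ n → genBound g (f n))
pb-genBound ε F = F
pb-genBound (letter a) F = F
pb-genBound (g · h) F = pb-+ (pb-genBound g F) (pb-genBound h F)
pb-genBound (for e g) F = pb-+ (pb-+ F (pb-bound e F)) (pb-genBound g (pb-+ F (pb-bound e F)))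
pb-genBound (read x h) F = pb-+ F (pb-sum (λ a → pb-genBound (h a) F))

pb-genTime : ∀ {k b v} (g : Gen k b v) {f h} → PolyBound f → PolyBound h → PolyBound (λ n → genTime g (f n) (h n))
pb-genTime ε F H = pb-const 1
pb-genTime (letter a) F H = pb-const 1
pb-genTime (g · g′) F H = pb-suc (pb-+ (pb-genTime g F H) (pb-genTime g′ F H))
pb-genTime (for e g) F H = pb-suc (pb-+ (pb-addTime e F) (pb-suc (pb-+
 (pb-+ (pb-* (pb-bound e F) (pb-+ (pb-const 5) (pb-genTime g (pb-+ F (pb-bound e F)) H))) (pb-const 1))
 (pb-+ (pb-* (pb-bound e F) (pb-const 2)) (pb-const 1)))))
pb-genTime (read x f) F H = pb-suc (pb-+ (pb-+ (pb-* H (pb-const 2)) (pb-const 1)) (pb-suc (pb-+ (pb-addTime (var x) F)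
 (pb-suc (pb-+ (pb-+ (pb-* F (pb-const 5)) (pb-const 1)) (pb-suc (pb-sum (λ a → pb-genTime (f a) F H))))))))

bound-mono : ∀ (e : Expr v) η {m} → (∀ i → lookup η i ≤ m) → ⟦ e ⟧ᴱ η ≤ bound e m
bound-mono (var x) η h = h x
bound-mono (con c) η h = ≤-refl
bound-mono (e ⊕ e′) η h = +-mono-≤ (bound-mono e η h) (bound-mono e′ η h)
bound-mono (e ⊗ e′) η h = ≤-trans (*-mono-≤ (bound-mono e η h) (bound-mono e′ η h)) (m≤n+m _ _)

m≤genBound : ∀ {k b v} (g : Gen k b v) m → m ≤ genBound g m
m≤genBound ε m = ≤-refl
m≤genBound (letter a) m = ≤-refl
m≤genBound (g · h) m = ≤-trans (m≤genBound g m) (m≤m+n _ _)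
m≤genBound (for e g) m = ≤-trans (m≤m+n m _) (m≤m+n _ _)
m≤genBound (read x f) m = m≤m+n m _

module Compile (k b nc′ : ℕ) where

 nc : ℕ
 nc = suc nc′

 open Programs k b 0 nc false false using (Cell; Prog; Runs; Store; Sym; Test; _⨾_; blank; counter; dec; emit; goL; goR; ifThen; inc; isZero; local; neg; runs-dec; runs-emit; runs-goL; runs-goR; runs-if; runs-inc; runs-loop; runs-seq; runs-setReg; runs-stop; runs-switch; runs-≤; setReg; store; switch; while; zero?; skip; times; positive?)

 idx : ∀ n → ℕ → Fin (suc n)
 idx n zero = zero
 idx zero (suc s) = zero
 idx (suc n) (suc s) = suc (idx n s)

 toℕ-idx : ∀ {n s} → s ≤ n → toℕ (idx n s) ≡ s
 toℕ-idx z≤n = refl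
 toℕ-idx (s≤s s≤n) = cong suc (toℕ-idx s≤n)

 ctr : ℕ → Fin nc
 ctr = idx nc′

 transfer : Fin nc → Fin nc → Prog
 transfer x t = while (positive? x) (counter dec x ⨾ counter inc zero ⨾ counter inc t) ⨾
   while (positive? zero) (counter dec zero ⨾ counter inc x)

 -- Counter 0 is scratch for copying; the counters from s on are free.
 addTo : Expr v → Vec (Fin nc) v → ℕ → Fin nc → Prog
 addTo (var x) names s t = transfer (lookup names x) t
 addTo (con c) names s t = times c (counter inc t)
 addTo (e ⊕ e′) names s t = addTo e names s t ⨾ addTo e′ names s t
 addTo (e ⊗ e′) names s t = addTo e names (suc s) (ctr s) ⨾
  while (positive? (ctr s)) (counter dec (ctr s) ⨾ addTo e′ names (suc s) t)

 rewind : Prog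
 rewind = while (neg (local (λ a _ _ → isStart a))) goL

 advance : Fin nc → Prog
 advance r = while (positive? r) (counter dec r ⨾ ifThen (local (λ a _ _ → isEnd a)) skip goR)

 -- Counter 1 receives the length of the input.
 counting : Prog
 counting = while (neg (local (λ a _ _ → isEnd a))) (counter inc (ctr 1) ⨾ goR)

 compile : Gen k b v → Vec (Fin nc) v → ℕ → Prog
 compile ε names s = skip
 compile (letter a) names s = emit a
 compile (g · h) names s = compile g names s ⨾ compile h names s
 compile (for e g) names s =
  addTo e names (suc s) (ctr s) ⨾
  while (positive? (ctr s)) (counter dec (ctr s) ⨾ compile g (ctr (suc s) ∷ names) (2 + s) ⨾ counter inc (ctr (suc s))) ⨾
  while (positive? (ctr (suc s))) (counter dec (ctr (suc s)))
 compile (read x f) names s =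
  rewind ⨾ addTo (var x) names (suc s) (ctr s) ⨾ advance (ctr s) ⨾
  switch (λ a _ _ → symCode a) (λ i → compile (f (symDecode i)) names s)

 record Inv {v : ℕ} (s : ℕ) (η : Vec ℕ v) (names : Vec (Fin nc) v) (vs : Vec ℕ nc) : Set where
  field
   vals : ∀ j → lookup vs (lookup names j) ≡ lookup η j
   below : ∀ j → toℕ (lookup names j) < s
   positive : ∀ j → 0 < toℕ (lookup names j)
   free : ∀ i → s ≤ toℕ i → lookup vs i ≡ 0
   scratch : lookup vs zero ≡ 0

 open Inv

 toℕ-≢ : ∀ {n} {i j : Fin n} → toℕ i ≢ toℕ j → i ≢ j
 toℕ-≢ h refl = h refl

 lookup-≢ : ∀ {n} (vs : Vec ℕ n) {i j c} → i ≢ j → lookup (vs [ i ]≔ c) j ≡ lookup vs j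
 lookup-≢ vs {c = c} i≢j = lookup∘update′ (i≢j ∘ symm) vs c

 inv-set : ∀ {v s} {η : Vec ℕ v} {names vs i c} → Inv s η names vs → (∀ j → i ≢ lookup names j) → i ≢ zero →
   (s ≤ toℕ i → c ≡ 0) → Inv s η names (vs [ i ]≔ c)
 inv-set {vs = vs} {i} {c} I n≢ 0≢ hi = record
  { vals = λ j → trans (lookup-≢ vs (n≢ j)) (vals I j)
  ; below = below I ; positive = positive I
  ; free = free′
  ; scratch = trans (lookup-≢ vs 0≢) (scratch I)
  } where
  free′ : ∀ j → _ ≤ toℕ j → lookup (vs [ i ]≔ c) j ≡ 0
  free′ j le with i Fin.≟ j
  ... | yes refl = trans (lookup∘update i vs c) (hi le)
  ... | no i≢j = trans (lookup-≢ vs i≢j) (free I j le)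

 inv-weaken : ∀ {v s s′} {η : Vec ℕ v} {names vs} → s ≤ s′ → Inv s η names vs → Inv s′ η names vs
 inv-weaken le I = record { vals = vals I ; below = λ j → ≤-trans (below I j) le ; positive = positive I
   ; free = λ i h → free I i (≤-trans le h) ; scratch = scratch I }

 inv-bind : ∀ {v s} {η : Vec ℕ v} {names vs i q} → Inv s η names vs → lookup vs q ≡ i → toℕ q < s → 0 < toℕ q →
   Inv s (i ∷ η) (q ∷ names) vs
 inv-bind I e lt pos = record
  { vals = λ { zero → e ; (suc j) → vals I j } ; below = λ { zero → lt ; (suc j) → below I j }
  ; positive = λ { zero → pos ; (suc j) → positive I j } ; free = free I ; scratch = scratch I }

 fresh≢names : ∀ {v s s′} {η : Vec ℕ v} {names vs} → Inv s η names vs → s ≤ s′ → s′ ≤ nc′ → ∀ j → ctr s′ ≢ lookup names j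
 fresh≢names I le sn j = toℕ-≢ λ e → <⇒≢ (≤-trans (below I j) le) (trans (symm e) (toℕ-idx sn))

 ctr≢0 : ∀ {s} → 0 < s → s ≤ nc′ → ctr s ≢ zero
 ctr≢0 pos sn = toℕ-≢ λ e → <⇒≢ pos (trans (symm e) (toℕ-idx sn))

 module _ {M : ℕ} {L : List Cell} {h : Cell} {R : List Cell} {u : Sym} {o : Word b} where

  private
   st : Vec ℕ nc → Store
   st vs = store L h R u vs o

  ending : ∀ {p σ t vs vs′} → vs ≡ vs′ → Runs M p σ t (st vs) → Runs M p σ t (st vs′)
  ending refl f = f

  starting : ∀ {p t vs vs′ σ} → vs ≡ vs′ → Runs M p (st vs) t σ → Runs M p (st vs′) t σ
  starting refl f = f

  runs-inc′ : ∀ {i vs vs′ a} → lookup vs i ≡ a → a < M → vs [ i ]≔ suc a ≡ vs′ → Runs M (counter inc i) (st vs) 1 (st vs′)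
  runs-inc′ refl lt refl = runs-inc lt

  runs-dec′ : ∀ {i vs vs′ a} → lookup vs i ≡ suc a → vs [ i ]≔ a ≡ vs′ → Runs M (counter dec i) (st vs) 1 (st vs′)
  runs-dec′ {i} {vs} {vs′} {a} e e′ = subst (λ z → Runs M (counter dec i) (st vs) 1 (st z))
   (trans (cong (λ x → vs [ i ]≔ pred x) e) e′) (runs-dec (subst (0 <_) (symm e) z<s))

  stop-at-zero : ∀ {i p vs} → lookup vs i ≡ 0 → Runs M (while (positive? i) p) (st vs) 1 (st vs)
  stop-at-zero e = runs-stop (cong (not ∘ zero?) e)

  loop-positive : ∀ {i p vs a σ s s′ σ″} → lookup vs i ≡ suc a → Runs M p (st vs) s σ →
    Runs M (while (positive? i) p) σ s′ σ″ → Runs M (while (positive? i) p) (st vs) (suc (s + s′)) σ″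
  loop-positive e = runs-loop (cong (not ∘ zero?) e)

  runs-transfer : ∀ {vs} x t → x ≢ zero → t ≢ zero → x ≢ t → lookup vs zero ≡ 0 → lookup vs x + lookup vs t ≤ M →
   Runs M (transfer x t) (st vs) (suc ((lookup vs x * 6 + 1) + (lookup vs x * 4 + 1))) (st (vs [ t ]≔ (lookup vs t + lookup vs x)))
  runs-transfer {vs} x t x≢0 t≢0 x≢t z le = runs-seq
    (starting start≡ (first (lookup vs x) 0 (lookup vs t) le (≤-trans (≡⇒≤ (+-identityʳ _)) (≤-trans (m≤m+n _ _) le))))
    (starting mid≡ (ending end≡ (second (lookup vs x) 0 (≤-trans (≡⇒≤ (+-identityʳ _)) (≤-trans (m≤m+n _ _) le)))))
   where
   U : ℕ → ℕ → ℕ → Vec ℕ nc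
   U a p c = vs [ x ]≔ a [ zero ]≔ p [ t ]≔ c
   Ux : ∀ a p c → lookup (U a p c) x ≡ a
   Ux a p c = trans (lookup-≢ (vs [ x ]≔ a [ zero ]≔ p) (x≢t ∘ symm)) (trans (lookup-≢ (vs [ x ]≔ a) (x≢0 ∘ symm)) (lookup∘update x vs a))
   Up : ∀ a p c → lookup (U a p c) zero ≡ p
   Up a p c = trans (lookup-≢ (vs [ x ]≔ a [ zero ]≔ p) t≢0) (lookup∘update zero (vs [ x ]≔ a) p)
   Ut : ∀ a p c → lookup (U a p c) t ≡ c
   Ut a p c = lookup∘update t (vs [ x ]≔ a [ zero ]≔ p) c
   set-x : ∀ a p c a′ → U a p c [ x ]≔ a′ ≡ U a′ p c
   set-x a p c a′ = trans ([]≔-commutes (vs [ x ]≔ a [ zero ]≔ p) t x (x≢t ∘ symm)) (cong (_[ t ]≔ c)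
    (trans ([]≔-commutes (vs [ x ]≔ a) zero x (x≢0 ∘ symm)) (cong (_[ zero ]≔ p) ([]≔-idempotent vs x))))
   set-p : ∀ a p c p′ → U a p c [ zero ]≔ p′ ≡ U a p′ c
   set-p a p c p′ = trans ([]≔-commutes (vs [ x ]≔ a [ zero ]≔ p) t zero t≢0) (cong (_[ t ]≔ c) ([]≔-idempotent (vs [ x ]≔ a) zero))
   set-t : ∀ a p c c′ → U a p c [ t ]≔ c′ ≡ U a p c′
   set-t a p c c′ = []≔-idempotent (vs [ x ]≔ a [ zero ]≔ p) t
   start≡ : U (lookup vs x) 0 (lookup vs t) ≡ vs
   start≡ = trans (cong₂ (λ p c → vs [ x ]≔ lookup vs x [ zero ]≔ p [ t ]≔ c) (symm z) refl)
    (trans (cong (λ s → s [ zero ]≔ lookup vs zero [ t ]≔ lookup vs t) ([]≔-lookup vs x))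
     (trans (cong (_[ t ]≔ lookup vs t) ([]≔-lookup vs zero)) ([]≔-lookup vs t)))
   total : ℕ
   total = lookup vs t + lookup vs x
   first : ∀ a p c → a + c ≤ M → a + p ≤ M → Runs M (while (positive? x) (counter dec x ⨾ counter inc zero ⨾ counter inc t))
     (st (U a p c)) (a * 6 + 1) (st (U 0 (a + p) (a + c)))
   first zero p c _ _ = stop-at-zero (Ux 0 p c)
   first (suc a) p c lc lp = loop-positive (Ux (suc a) p c)
    (runs-seq (runs-dec′ (Ux (suc a) p c) (set-x (suc a) p c a))
     (runs-seq (runs-inc′ (Up a p c) (≤-trans (s≤s (m≤n+m p a)) lp) (set-p a p c (suc p)))
      (runs-inc′ (Ut a (suc p) c) (≤-trans (s≤s (m≤n+m c a)) lc) (set-t a (suc p) c (suc c)))))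
    (ending (cong₂ (U 0) (+-suc a p) (+-suc a c))
     (first a (suc p) (suc c) (≤-trans (≡⇒≤ (+-suc a c)) lc) (≤-trans (≡⇒≤ (+-suc a p)) lp)))
   second : ∀ p a → p + a ≤ M → Runs M (while (positive? zero) (counter dec zero ⨾ counter inc x)) (st (U a p total)) (p * 4 + 1) (st (U (p + a) 0 total))
   second zero a le = stop-at-zero (Up a 0 total)
   second (suc p) a le = loop-positive (Up a (suc p) total)
    (runs-seq (runs-dec′ (Up a (suc p) total) (set-p a (suc p) total p))
     (runs-inc′ (Ux a p total) (≤-trans (s≤s (m≤n+m a p)) le) (set-x a p total (suc a))))
    (ending (cong (λ a′ → U a′ 0 total) (+-suc p a)) (second p (suc a) (≤-trans (≡⇒≤ (+-suc p a)) le)))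
   mid≡ : U 0 (lookup vs x) total ≡ U 0 (lookup vs x + 0) (lookup vs x + lookup vs t)
   mid≡ = cong₂ (U 0) (symm (+-identityʳ _)) (+-comm (lookup vs t) (lookup vs x))
   end≡ : U (lookup vs x + 0) 0 total ≡ vs [ t ]≔ total
   end≡ = cong (_[ t ]≔ total) (trans (cong₂ (λ a p → vs [ x ]≔ a [ zero ]≔ p) (+-identityʳ _) (symm z))
    (trans (cong (_[ zero ]≔ lookup vs zero) ([]≔-lookup vs x)) ([]≔-lookup vs zero)))

  runs-times : ∀ {vs t} c → lookup vs t + c ≤ M → Runs M (times c (counter inc t)) (st vs) (c * 2 + 1) (st (vs [ t ]≔ (lookup vs t + c)))
  runs-times {vs} {t} zero le = ending
   (trans (symm ([]≔-lookup vs t)) (cong (vs [ t ]≔_) (symm (+-identityʳ _)))) runs-setReg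
  runs-times {vs} {t} (suc c) le = runs-seq
   (runs-inc (≤-trans (≤-trans (m≤m+n _ c) (≡⇒≥ (+-suc _ c))) le))
   (ending eq (runs-times c
    (≤-trans (≡⇒≤ (trans (cong (_+ c) (lookup∘update t vs _)) (symm (+-suc _ c)))) le))) where
   eq : vs [ t ]≔ suc (lookup vs t) [ t ]≔ (lookup (vs [ t ]≔ suc (lookup vs t)) t + c) ≡ vs [ t ]≔ (lookup vs t + suc c)
   eq = trans ([]≔-idempotent vs t) (cong (vs [ t ]≔_) (trans (cong (_+ c) (lookup∘update t vs _)) (symm (+-suc _ c))))

  runs-addTo : ∀ (e : Expr v) {η names s t vs m} → Inv s η names vs → 0 < s → s + exprWidth e ≤ nc →
   (∀ j → t ≢ lookup names j) → t ≢ zero → toℕ t < s → (∀ j → lookup η j ≤ m) → lookup vs t + bound e m ≤ M →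
   Runs M (addTo e names s t) (st vs) (addTime e m) (st (vs [ t ]≔ (lookup vs t + ⟦ e ⟧ᴱ η)))
  runs-addTo (var x) {η} {names} {s} {t} {vs} {m} I 0<s wd t≢ t≢0 t<s η≤ le =
   runs-≤ (s≤s (+-mono-≤ (+-monoˡ-≤ 1 (*-monoˡ-≤ 6 x≤)) (+-monoˡ-≤ 1 (*-monoˡ-≤ 4 x≤))))
    (ending (cong (λ a → vs [ t ]≔ (lookup vs t + a)) (vals I x))
     (runs-transfer (lookup names x) t (toℕ-≢ (λ e → <⇒≢ (positive I x) (symm e))) t≢0 (t≢ x ∘ symm) (scratch I)
      (≤-trans (+-monoˡ-≤ _ x≤) (≤-trans (≡⇒≤ (+-comm m _)) le)))) where
   x≤ : lookup vs (lookup names x) ≤ m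
   x≤ = subst (_≤ m) (symm (vals I x)) (η≤ x)
  runs-addTo (con c) I 0<s wd t≢ t≢0 t<s η≤ le = runs-times c le
  runs-addTo (e ⊕ e′) {η} {names} {s} {t} {vs} {m} I 0<s wd t≢ t≢0 t<s η≤ le = runs-seq
   (runs-addTo e I 0<s (≤-trans (+-monoʳ-≤ s (m≤m+n _ _)) wd) t≢ t≢0 t<s η≤ (≤-trans (+-monoʳ-≤ (lookup vs t) (m≤m+n _ _)) le))
   (ending eq
    (runs-addTo e′ (inv-set I t≢ t≢0 (λ h → ⊥-elim (<⇒≱ t<s h))) 0<s (≤-trans (+-monoʳ-≤ s (m≤n+m _ (exprWidth e))) wd) t≢ t≢0 t<s η≤
     (≤-trans (+-monoˡ-≤ _ (≤-trans (≡⇒≤ (lookup∘update t vs _)) (+-monoʳ-≤ (lookup vs t) (bound-mono e η η≤))))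
      (≤-trans (≡⇒≤ (+-assoc (lookup vs t) _ _)) le)))) where
   eq : vs [ t ]≔ (lookup vs t + ⟦ e ⟧ᴱ η) [ t ]≔ (lookup (vs [ t ]≔ (lookup vs t + ⟦ e ⟧ᴱ η)) t + ⟦ e′ ⟧ᴱ η) ≡ vs [ t ]≔ (lookup vs t + (⟦ e ⟧ᴱ η + ⟦ e′ ⟧ᴱ η))
   eq = trans ([]≔-idempotent vs t) (cong (vs [ t ]≔_) (trans (cong (_+ ⟦ e′ ⟧ᴱ η) (lookup∘update t vs _)) (+-assoc (lookup vs t) _ _)))
  runs-addTo (e ⊗ e′) {η} {names} {s} {t} {vs} {m} I 0<s wd t≢ t≢0 t<s η≤ le = runs-seq
   (ending eq₁
    (runs-addTo e (inv-weaken (n≤1+n s) I) z<s (≤-trans (≡⇒≥ (+-suc s _)) (≤-trans (+-monoʳ-≤ s (s≤s (m≤m+n _ _))) wd))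
     (fresh≢names I ≤-refl s≤) r≢0 (≡⇒≤ (cong suc (toℕ-idx s≤))) η≤
     (≤-trans (≡⇒≤ (cong (_+ bound e m) r≡0)) (≤-trans (≤-trans (m≤m+n _ _) (m≤n+m _ (lookup vs t))) le))))
   (runs-≤ (+-monoˡ-≤ 1 (*-monoˡ-≤ (3 + addTime e′ m) (bound-mono e η η≤)))
    (ending eq₂ (loop (⟦ e ⟧ᴱ η) (lookup vs t)
     (≤-trans (+-monoʳ-≤ (lookup vs t) (≤-trans (*-monoˡ-≤ (bound e′ m) (bound-mono e η η≤)) (m≤n+m _ (bound e m)))) le))))
   where
   s≤ : s ≤ nc′
   s≤ = s≤s⁻¹ (≤-trans (≡⇒≥ (+-comm s 1)) (≤-trans (+-monoʳ-≤ s z<s) wd))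
   r : Fin nc
   r = ctr s
   r≡0 : lookup vs r ≡ 0
   r≡0 = free I r (≡⇒≥ (toℕ-idx s≤))
   r≢0 : r ≢ zero
   r≢0 = ctr≢0 0<s s≤
   r≢t : r ≢ t
   r≢t = toℕ-≢ λ h → <⇒≢ t<s (symm (trans (symm (toℕ-idx s≤)) h))
   V : ℕ → ℕ → Vec ℕ nc
   V a c = vs [ r ]≔ a [ t ]≔ c
   Vr : ∀ a c → lookup (V a c) r ≡ a
   Vr a c = trans (lookup-≢ (vs [ r ]≔ a) (r≢t ∘ symm)) (lookup∘update r vs a)
   Vt : ∀ a c → lookup (V a c) t ≡ c
   Vt a c = lookup∘update t (vs [ r ]≔ a) c
   eq₁ : vs [ r ]≔ (lookup vs r + ⟦ e ⟧ᴱ η) ≡ V (⟦ e ⟧ᴱ η) (lookup vs t)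
   eq₁ = trans (cong (λ z → vs [ r ]≔ (z + ⟦ e ⟧ᴱ η)) r≡0)
    (trans (symm ([]≔-lookup (vs [ r ]≔ ⟦ e ⟧ᴱ η) t)) (cong (vs [ r ]≔ ⟦ e ⟧ᴱ η [ t ]≔_) (lookup-≢ vs r≢t)))
   eq₂ : V 0 (lookup vs t + ⟦ e ⟧ᴱ η * ⟦ e′ ⟧ᴱ η) ≡ vs [ t ]≔ (lookup vs t + ⟦ e ⟧ᴱ η * ⟦ e′ ⟧ᴱ η)
   eq₂ = cong (_[ t ]≔ _) (trans (cong (vs [ r ]≔_) (symm r≡0)) ([]≔-lookup vs r))
   loop : ∀ a c → c + a * bound e′ m ≤ M → Runs M (while (positive? r) (counter dec r ⨾ addTo e′ names (suc s) t))
     (st (V a c)) (a * (3 + addTime e′ m) + 1) (st (V 0 (c + a * ⟦ e′ ⟧ᴱ η)))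
   loop zero c _ = ending (cong (V 0) (symm (+-identityʳ c))) (stop-at-zero (Vr 0 c))
   loop (suc a) c lc = runs-≤ (≡⇒≥ (cong (3 +_) (+-assoc (addTime e′ m) (a * (3 + addTime e′ m)) 1)))
    (loop-positive (Vr (suc a) c)
     (runs-seq (runs-dec′ (Vr (suc a) c) (trans ([]≔-commutes (vs [ r ]≔ suc a) t r (r≢t ∘ symm)) (cong (_[ t ]≔ c) ([]≔-idempotent vs r))))
      (ending (trans ([]≔-idempotent (vs [ r ]≔ a) t) (cong (λ z → vs [ r ]≔ a [ t ]≔ (z + ⟦ e′ ⟧ᴱ η)) (Vt a c)))
       (runs-addTo e′ {vs = V a c} I′ z<s
        (≤-trans (≡⇒≥ (+-suc s _)) (≤-trans (+-monoʳ-≤ s (s≤s (m≤n+m _ (exprWidth e)))) wd))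
        t≢ t≢0 (m≤n⇒m≤1+n t<s) η≤
        (≤-trans (+-monoˡ-≤ _ (≡⇒≤ (Vt a c))) (≤-trans (+-monoʳ-≤ c (m≤m+n (bound e′ m) (a * bound e′ m))) lc)))))
     (ending (cong (V 0) (+-assoc c _ _))
      (loop a (c + ⟦ e′ ⟧ᴱ η) (≤-trans (+-monoˡ-≤ _ (+-monoʳ-≤ c (bound-mono e′ η η≤))) (≤-trans (≡⇒≤ (+-assoc c _ _)) lc)))))
    where
    I′ : Inv (suc s) η names (V a c)
    I′ = inv-set (inv-set (inv-weaken (n≤1+n s) I) (fresh≢names I ≤-refl s≤) r≢0 (λ h → ⊥-elim (<⇒≱ (≡⇒≤ (cong suc (toℕ-idx s≤))) h)))
      t≢ t≢0 (λ h → ⊥-elim (<⇒≱ (m≤n⇒m≤1+n t<s) h))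

 module _ (w : Word k) where

  tapeCells : List Cell
  tapeCells = map (_, blank) (ends w)

  record Located (L : List Cell) (h : Cell) (R : List Cell) : Set where
   constructor located
   field zipped : L ʳ++ (h ∷ R) ≡ tapeCells

  N : ℕ
  N = 2 + length w

  located-symbol : ∀ {L h R} → Located L h R → proj₁ h ≡ readInput w (length L)
  located-symbol {L} {h} {R} (located z) = trans (cong proj₁ (trans (symm (at-ʳ++ L {h} {R} {⊣ , blank})) (cong (λ C → at C (⊣ , blank) (length L)) z)))
   (trans (at-map (ends w) (length L)) (symm (readInput-at w (length L)))) where
   at-map : ∀ xs i → proj₁ (at (map {B = Cell} (_, blank) xs) (⊣ , blank) i) ≡ at xs ⊣ i
   at-map [] i = refl
   at-map (x ∷ xs) zero = refl
   at-map (x ∷ xs) (suc i) = at-map xs i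

  located-length : ∀ {L h R} → Located L h R → length L + suc (length R) ≡ N
  located-length {L} (located z) = trans (symm (length-ʳ++ L)) (trans (cong length z) (trans (length-map _ (ends w)) (length-ends w)))

  read-beyond : ∀ (w : Word k) {i} → length w < i → readInput w i ≡ ⊣
  read-beyond [] {suc i} lt = refl
  read-beyond (a ∷ w) {suc (suc i)} (s≤s lt) = read-beyond w lt

  read-within : ∀ (w : Word k) {i} → i ≤ length w → isEnd (readInput w i) ≡ false
  read-within w {zero} le = refl
  read-within (a ∷ w) {suc zero} le = refl
  read-within (a ∷ w) {suc (suc i)} (s≤s le) = read-within w le

  read-not-start : ∀ (w : Word k) i → isStart (readInput w (suc i)) ≡ false
  read-not-start [] i = refl
  read-not-start (a ∷ w) zero = refl
  read-not-start (a ∷ w) (suc i) = read-not-start w i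

  module _ {M : ℕ} {u : Sym} where

   Outcome : Prog → ℕ → List Cell → Cell → List Cell → Vec ℕ nc → Word b → Vec ℕ nc → Word b → Set₁
   Outcome p t L h R vs o vs′ o′ = Σ[ L′ ∈ List Cell ] Σ[ h′ ∈ Cell ] Σ[ R′ ∈ List Cell ]
    Located L′ h′ R′ × Runs M p (store L h R u vs o) t (store L′ h′ R′ u vs′ o′)
   writing : ∀ {p σ t L h R vs o o′} → o ≡ o′ → Runs M p σ t (store L h R u vs o) → Runs M p σ t (store L h R u vs o′)
   writing refl f = f
   runs-rewind : ∀ {L h R vs o} → Located L h R → Σ[ h′ ∈ Cell ] Σ[ R′ ∈ List Cell ]
    Located [] h′ R′ × Runs M rewind (store L h R u vs o) (length L * 2 + 1) (store [] h′ R′ u vs o)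
   runs-rewind {[]} z = _ , _ , z , runs-stop (cong (not ∘ isStart) (located-symbol z))
   runs-rewind {l ∷ L} z@(located c) with runs-rewind {L} (located c)
   ... | h′ , R′ , z′ , f = h′ , R′ , z′ ,
    runs-loop (trans (cong (not ∘ isStart) (located-symbol z)) (cong not (read-not-start w (length L)))) runs-goL f
   runs-advance : ∀ {r vs o} a {L h R} → Located L h R → Σ[ L′ ∈ List Cell ] Σ[ h′ ∈ Cell ] Σ[ R′ ∈ List Cell ]
    Located L′ h′ R′ × proj₁ h′ ≡ readInput w (length L + a) ×
    Runs M (advance r) (store L h R u (vs [ r ]≔ a) o) (a * 5 + 1) (store L′ h′ R′ u (vs [ r ]≔ 0) o)
   runs-advance {r} {vs} zero {L} z = _ , _ , _ , z , trans (located-symbol z) (cong (readInput w) (symm (+-identityʳ (length L)))) ,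
    stop-at-zero (lookup∘update r vs 0)
   runs-advance {r} {vs} (suc a) {L} {h} {[]} z with runs-advance {r} {vs} a z
   ... | L′ , h′ , R′ , z′ , e , f = L′ , h′ , R′ , z′ ,
    trans e (trans (read-beyond w (≤-trans end (m≤m+n _ a))) (symm (read-beyond w (≤-trans end (m≤m+n _ (suc a)))))) ,
    loop-positive (lookup∘update r vs (suc a))
     (runs-seq (runs-dec′ (lookup∘update r vs (suc a)) ([]≔-idempotent vs r))
      (runs-if (trans (cong isEnd (located-symbol z)) (cong isEnd (read-beyond w end))) runs-setReg)) f
    where
    end : suc (length w) ≤ length L
    end = ≡⇒≤ (suc-injective (trans (symm (located-length z)) (+-comm (length L) 1)))
   runs-advance {r} {vs} (suc a) {L} {h} {x ∷ R} z@(located c) with runs-advance {r} {vs} a {h ∷ L} {x} {R} (located c)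
   ... | L′ , h′ , R′ , z′ , e , f = L′ , h′ , R′ , z′ , trans e (cong (readInput w) (symm (+-suc (length L) a))) ,
    loop-positive (lookup∘update r vs (suc a))
     (runs-seq (runs-dec′ (lookup∘update r vs (suc a)) ([]≔-idempotent vs r))
      (runs-if (trans (cong isEnd (located-symbol z)) (read-within w inside)) runs-goR)) f where
    inside : length L ≤ length w
    inside = ≤-trans (m≤m+n (length L) (length R)) (≡⇒≤ (suc-injective (suc-injective
     (trans (cong suc (symm (+-suc (length L) _))) (trans (symm (+-suc (length L) _)) (located-length z))))))
   runs-clear : ∀ {q vs L h R o} a → Runs M (while (positive? q) (counter dec q)) (store L h R u (vs [ q ]≔ a) o) (a * 2 + 1) (store L h R u (vs [ q ]≔ 0) o)
   runs-clear {q} {vs} zero = stop-at-zero (lookup∘update q vs 0)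
   runs-clear {q} {vs} (suc a) = loop-positive (lookup∘update q vs (suc a))
    (runs-dec′ (lookup∘update q vs (suc a)) ([]≔-idempotent vs q)) (runs-clear a)
   running : ∀ {f : InputSymbol k → Gen k b v} {a a′ names s σ t σ′} → a′ ≡ a →
     Runs M (compile (f a′) names s) σ t σ′ → Runs M (compile (f a) names s) σ t σ′
   running refl f = f
   runs-compile : ∀ (g : Gen k b v) {η names s vs m L h R o} → Located L h R → Inv s η names vs → 0 < s →
    s + genWidth g ≤ nc → (∀ j → lookup η j ≤ m) → genBound g m ≤ M →
    Outcome (compile g names s) (genTime g m N) L h R vs o vs (o ++ ⟦ g ⟧ᴳ w η)
   runs-compile ε {L = L} {h} {R} {o} z I pos wd η≤ le = L , h , R , z ,
    writing (symm (++-identityʳ o)) runs-setReg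
   runs-compile (letter a) z I pos wd η≤ le = _ , _ , _ , z , runs-emit
   runs-compile (g · g′) {s = s} {o = o} z I pos wd η≤ le
    with runs-compile g {o = o} z I pos (≤-trans (+-monoʳ-≤ s (m≤m+n _ _)) wd) η≤ (≤-trans (m≤m+n _ _) le)
   ... | L₁ , h₁ , R₁ , z₁ , f
    with runs-compile g′ z₁ I pos (≤-trans (+-monoʳ-≤ s (m≤n+m _ (genWidth g))) wd) η≤ (≤-trans (m≤n+m _ (genBound g _)) le)
   ... | L₂ , h₂ , R₂ , z₂ , f′ = L₂ , h₂ , R₂ , z₂ ,
    runs-seq f (writing (++-assoc o _ _) f′)
   runs-compile (for e g) {η} {names} {s} {vs} {m} {L} {h} {R} {o} z I pos wd η≤ le with whole where
    total : ℕ
    total = ⟦ e ⟧ᴱ η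
    total≤ : total ≤ bound e m
    total≤ = bound-mono e η η≤
    wd′ : 2 + s + (exprWidth e + genWidth g) ≤ nc
    wd′ = ≤-trans (≡⇒≥ (trans (+-suc s _) (cong suc (+-suc s _)))) wd
    sr : s ≤ nc′
    sr = s≤s⁻¹ (≤-trans (m≤n+m (suc s) 1) (≤-trans (m≤m+n (2 + s) _) wd′))
    sq : suc s ≤ nc′
    sq = s≤s⁻¹ (≤-trans (m≤m+n (2 + s) _) wd′)
    r q : Fin nc
    r = ctr s
    q = ctr (suc s)
    r≢q : r ≢ q
    r≢q = toℕ-≢ λ x → <⇒≢ (n<1+n s) (trans (symm (toℕ-idx sr)) (trans x (toℕ-idx sq)))
    r≡0 : lookup vs r ≡ 0
    r≡0 = free I r (≡⇒≥ (toℕ-idx sr))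
    q≡0 : lookup vs q ≡ 0
    q≡0 = free I q (≤-trans (n≤1+n s) (≡⇒≥ (toℕ-idx sq)))
    V : ℕ → ℕ → Vec ℕ nc
    V a i = vs [ r ]≔ a [ q ]≔ i
    Vr : ∀ a i → lookup (V a i) r ≡ a
    Vr a i = trans (lookup-≢ (vs [ r ]≔ a) (r≢q ∘ symm)) (lookup∘update r vs a)
    Vq : ∀ a i → lookup (V a i) q ≡ i
    Vq a i = lookup∘update q (vs [ r ]≔ a) i
    set-r : ∀ a i a′ → V a i [ r ]≔ a′ ≡ V a′ i
    set-r a i a′ = trans ([]≔-commutes (vs [ r ]≔ a) q r (r≢q ∘ symm)) (cong (_[ q ]≔ i) ([]≔-idempotent vs r))
    cleared : V 0 0 ≡ vs
    cleared = trans (cong₂ (λ a i → vs [ r ]≔ a [ q ]≔ i) (symm r≡0) (symm q≡0))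
     (trans (cong (_[ q ]≔ lookup vs q) ([]≔-lookup vs r)) ([]≔-lookup vs q))
    begun : V total 0 ≡ vs [ r ]≔ (lookup vs r + total)
    begun = trans (trans (cong (vs [ r ]≔ total [ q ]≔_) (symm (trans (lookup-≢ vs r≢q) q≡0))) ([]≔-lookup (vs [ r ]≔ total) q))
     (cong (λ c → vs [ r ]≔ (c + total)) (symm r≡0))
    I′ : ∀ a i → Inv (2 + s) (i ∷ η) (q ∷ names) (V a i)
    I′ a i = inv-bind (inv-set (inv-set (inv-weaken (≤-trans (n≤1+n s) (n≤1+n (suc s))) I)
      (fresh≢names I ≤-refl sr) (ctr≢0 pos sr) (λ x → ⊥-elim (<⇒≱ (≤-trans (≡⇒≤ (cong suc (toℕ-idx sr))) (n≤1+n (suc s))) x)))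
      (fresh≢names I (n≤1+n s) sq) (ctr≢0 z<s sq) (λ x → ⊥-elim (<⇒≱ (≡⇒≤ (cong suc (toℕ-idx sq))) x)))
      (Vq a i) (≡⇒≤ (cong suc (toℕ-idx sq))) (subst (0 <_) (symm (toℕ-idx sq)) z<s)
    m′ : ℕ
    m′ = m + bound e m
    loop : ∀ a i {L h R} o (F : ℕ → Word b) → (∀ j → F j ≡ ⟦ g ⟧ᴳ w (i + j ∷ η)) → a + i ≤ bound e m → Located L h R →
      Outcome (while (positive? r) (counter dec r ⨾ compile g (q ∷ names) (2 + s) ⨾ counter inc q))
        (a * (5 + genTime g m′ N) + 1) L h R (V a i) o (V 0 (a + i)) (o ++ concatUpTo a F)
    loop zero i {L} {h} {R} o F Fe ai z = L , h , R , z ,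
     writing (symm (++-identityʳ o)) (stop-at-zero (Vr 0 i))
    loop (suc a) i o F Fe ai z
     with runs-compile g {o = o} z (I′ a i) z<s (≤-trans (+-monoʳ-≤ (2 + s) (m≤n+m _ (exprWidth e))) wd′)
       (λ { zero → ≤-trans (≤-trans (m≤n+m i (suc a)) ai) (m≤n+m _ m) ; (suc j) → ≤-trans (η≤ j) (m≤m+n m _) })
       (≤-trans (m≤n+m _ m′) le)
    ... | L₁ , h₁ , R₁ , z₁ , f₁
     with loop a (suc i) (o ++ ⟦ g ⟧ᴳ w (i ∷ η)) (F ∘ suc) (λ j → trans (Fe (suc j)) (cong (λ x → ⟦ g ⟧ᴳ w (x ∷ η)) (+-suc i j)))
       (≤-trans (≡⇒≤ (+-suc a i)) ai) z₁
    ... | L₂ , h₂ , R₂ , z₂ , f₂ = L₂ , h₂ , R₂ , z₂ ,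
     runs-≤ (≡⇒≤ (cong (4 +_) (trans (cong (_+ (a * (5 + genTime g m′ N) + 1)) (+-comm (genTime g m′ N) 1))
       (cong suc (symm (+-assoc (genTime g m′ N) (a * (5 + genTime g m′ N)) 1))))))
      (loop-positive (Vr (suc a) i)
       (runs-seq (runs-dec′ (Vr (suc a) i) (set-r (suc a) i a))
        (runs-seq f₁ (runs-inc′ (Vq a i) (≤-trans (≤-trans (s≤s (m≤n+m i a)) ai) (≤-trans (m≤n+m _ m) (≤-trans (m≤m+n m′ _) le)))
         ([]≔-idempotent (vs [ r ]≔ a) q))))
       (ending (cong (V 0) (+-suc a i))
        (writing (trans (++-assoc o _ _) (cong (λ x → o ++ x ++ concatUpTo a (F ∘ suc)) (trans (cong (λ x → ⟦ g ⟧ᴳ w (x ∷ η)) (symm (+-identityʳ i))) (symm (Fe 0))))) f₂)))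
    whole : Outcome (compile (for e g) names s) (genTime (for e g) m N) L h R vs o vs (o ++ ⟦ for e g ⟧ᴳ w η)
    whole with loop total 0 {L} {h} {R} o (λ i → ⟦ g ⟧ᴳ w (i ∷ η)) (λ j → refl) (≤-trans (≡⇒≤ (+-identityʳ total)) total≤) z
    ... | L₁ , h₁ , R₁ , z₁ , f₁ = L₁ , h₁ , R₁ , z₁ ,
     runs-seq (runs-addTo e (inv-weaken (n≤1+n s) I) z<s (≤-trans (s≤s (+-monoʳ-≤ s (m≤m+n _ (genWidth g)))) (≤-trans (n≤1+n _) wd′))
       (fresh≢names I ≤-refl sr) (ctr≢0 pos sr) (≡⇒≤ (cong suc (toℕ-idx sr))) η≤
       (≤-trans (+-monoˡ-≤ _ (≡⇒≤ r≡0)) (≤-trans (m≤n+m _ m) (≤-trans (m≤m+n m′ _) le))))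
      (starting begun (runs-seq
       (runs-≤ (+-monoˡ-≤ 1 (*-monoˡ-≤ (5 + genTime g m′ N) total≤)) f₁)
       (ending cleared (starting (cong (V 0) (symm (+-identityʳ total)))
        (runs-≤ (+-monoˡ-≤ 1 (*-monoˡ-≤ 2 total≤)) (runs-clear total))))))
   ... | out = out
   runs-compile (read x f) {η} {names} {s} {vs} {m} {L} {h} {R} {o} z I pos wd η≤ le with runs-rewind {vs = vs} {o} z
   ... | h₀ , R₀ , z₀ , f₀ with runs-advance {ctr s} {vs} {o} (lookup η x) z₀
   ... | L₁ , h₁ , R₁ , z₁ , e₁ , f₁ with runs-compile (f (readInput w (lookup η x))) {o = o} z₁ I pos
     (≤-trans (+-monoʳ-≤ s (≤-trans (≤-sumSymbols (λ a → genWidth (f a)) _) (n≤1+n _))) wd) η≤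
     (≤-trans (≤-sumSymbols (λ a → genBound (f a) m) _) (≤-trans (m≤n+m _ m) le))
   ... | L₂ , h₂ , R₂ , z₂ , f₂ = L₂ , h₂ , R₂ , z₂ ,
    runs-seq (runs-≤ (+-monoˡ-≤ 1 (*-monoˡ-≤ 2 (≤-trans (m≤m+n (length L) (suc (length R))) (≡⇒≤ (located-length z))))) f₀)
     (runs-seq (runs-addTo (var x) (inv-weaken (n≤1+n s) I) z<s (≤-trans (≡⇒≤ (+-identityʳ (suc s))) (s≤s sr))
       (fresh≢names I ≤-refl sr) (ctr≢0 pos sr) (≡⇒≤ (cong suc (toℕ-idx sr))) η≤
       (≤-trans (+-monoˡ-≤ m (≡⇒≤ r≡0)) (≤-trans (m≤m+n m _) le)))
      (starting (cong (λ c → vs [ ctr s ]≔ (c + lookup η x)) (symm r≡0))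
       (runs-seq (ending restored (runs-≤ (+-monoˡ-≤ 1 (*-monoˡ-≤ 5 (η≤ x))) f₁))
        (runs-switch refl (runs-≤ (≤-sumSymbols (λ a → genTime (f a) m N) _)
         (running {f = f} (symm (trans (symDecode-symCode (proj₁ h₁)) e₁)) f₂)))))) where
    sr : s ≤ nc′
    sr = s≤s⁻¹ (≤-trans (≡⇒≤ (+-comm 1 s)) (≤-trans (+-monoʳ-≤ s z<s) wd))
    r≡0 : lookup vs (ctr s) ≡ 0
    r≡0 = free I (ctr s) (≡⇒≥ (toℕ-idx sr))
    restored : vs [ ctr s ]≔ 0 ≡ vs
    restored = trans (cong (vs [ ctr s ]≔_) (symm r≡0)) ([]≔-lookup vs (ctr s))
   runs-counting : ∀ {vs L h R o} c → Located L h R → length L ≡ suc c → length w ≤ M →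
    Outcome counting (length R * 4 + 1) L h R (vs [ ctr 1 ]≔ c) o (vs [ ctr 1 ]≔ length w) o
   runs-counting {vs} {L} {h} {[]} {o} c z e le = L , h , [] , z ,
    ending (cong (vs [ ctr 1 ]≔_) (suc-injective (trans (symm e) end)))
     (runs-stop (cong not (trans (cong isEnd (located-symbol z)) (cong isEnd (read-beyond w (≡⇒≥ end))))))
    where
    end : length L ≡ suc (length w)
    end = suc-injective (trans (+-comm 1 (length L)) (located-length z))
   runs-counting {vs} {L} {h} {x ∷ R} {o} c z@(located q) e le
    with runs-counting {vs} {h ∷ L} {x} {R} {o} (suc c) (located q) (cong suc e) le
   ... | L′ , h′ , R′ , z′ , f = L′ , h′ , R′ , z′ ,
    runs-loop (cong not (trans (cong isEnd (located-symbol z)) (read-within w inside)))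
     (runs-seq (runs-inc′ (lookup∘update (ctr 1) vs c) (≤-trans (≡⇒≥ e) (≤-trans inside le)) ([]≔-idempotent vs (ctr 1)))
      runs-goR) f where
    inside : length L ≤ length w
    inside = ≤-trans (m≤m+n (length L) (length R)) (≡⇒≤ (suc-injective (suc-injective
     (trans (cong suc (symm (+-suc (length L) _))) (trans (symm (+-suc (length L) _)) (located-length z))))))

log≤ : ∀ n → ⌊log₂ n ⌋ ≤ n
log≤ n = ≤-trans (⌊log₂⌋-mono-≤ (n≤2^n n)) (≡⇒≤ (⌊log₂[2^n]⌋≡n n)) where
 n≤2^n : ∀ n → n ≤ 2 ^ n
 n≤2^n zero = z≤n
 n≤2^n (suc n) = ≤-trans (+-mono-≤ (m^n>0 2 n) (n≤2^n n)) (≡⇒≤ (cong (2 ^ n +_) (symm (+-identityʳ (2 ^ n)))))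

pb-log : ∀ {f} → PolyBound f → PolyBound (λ n → ⌊log₂ f n ⌋)
pb-log F = pb-≤ (λ n → log≤ _) F

gen-computable : ∀ {k b} (g : Gen k b 1) → PolyTimeComputable (λ w → ⟦ g ⟧ᴳ w (length w ∷ []))
gen-computable {k} {b} g = machine , proj₁ time , deterministic refl , (λ w n c r → ≤-trans (program-time w (tree w) r) (proj₂ time (length w))) ,
  λ w → let n , c , _ , r , h , e = program-halts w (tree w) in n , c , r , h , e
 where
 open Compile k b (1 + genWidth g) using (Inv; compile; counting; ctr; located; located-length; lookup-≢; nc; runs-compile; runs-counting; toℕ-≢)
 open Programs k b 0 nc false false using (ATree; leaf; Cell; Cont; Prog; _⨾_; blank; ended; exec; goR; initStore; runs-goR; runs-seq; runs-≤; store)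

 p₀ : Prog
 p₀ = goR ⨾ counting ⨾ compile g (ctr 1 ∷ []) 2

 open Programs.Results k b 0 nc false false p₀ using (machine; deterministic; timeUsed; program-time; program-halts)

 steps : ℕ → ℕ
 steps n = suc (1 + suc ((n * 4 + 1) + genTime g n (2 + n)))

 M : ℕ → ℕ
 M n = genBound g n

 time : PolyBound (λ n → timeUsed (steps n + 0) (M n))
 time = pb-* (pb-+ (pb-const 4) (pb-* (pb-const 2) (pb-suc (pb-log (pb-suc (pb-genBound g pb-id))))))
  (pb-+ (pb-suc (pb-suc (pb-suc (pb-+ (pb-+ (pb-* pb-id (pb-const 4)) (pb-const 1)) (pb-genTime g pb-id (pb-+ (pb-const 2) pb-id)))))) (pb-const 0))

 tree : ∀ w → ATree (M (length w)) (λ K o A → o ≡ ⟦ g ⟧ᴳ w (length w ∷ [])) (steps (length w) + 0) (p₀ ∷ [] , initStore w) ⊤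
 tree w = go (proj₁ (nonempty w)) (proj₁ (proj₂ (nonempty w))) (proj₂ (proj₂ (nonempty w))) where
  nonempty : ∀ w → Σ[ x ∈ Cell ] Σ[ R ∈ List Cell ] map (_, blank) (map sym w ++ ⊣ ∷ []) ≡ x ∷ R
  nonempty [] = _ , _ , refl
  nonempty (a ∷ w) = _ , _ , refl
  go : ∀ x R → map (_, blank) (map sym w ++ ⊣ ∷ []) ≡ x ∷ R →
    ATree (M (length w)) (λ K o A → o ≡ ⟦ g ⟧ᴳ w (length w ∷ [])) (steps (length w) + 0) (p₀ ∷ [] , initStore w) ⊤
  go x R e with runs-counting w {M (length w)} {blank} {Vec.replicate nc 0} {(⊢ , blank) ∷ []} {x} {R} {[]} 0 (located (cong (_ ∷_) (symm e))) refl (m≤genBound g _)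
  ... | L₁ , h₁ , R₁ , z₁ , f₁ with runs-compile w {M (length w)} {blank} g {length w ∷ []} {ctr 1 ∷ []} {2} {_} {length w} {o = []} z₁ inv z<s ≤-refl (λ { zero → ≤-refl }) ≤-refl
   where
   inv : Inv 2 (length w ∷ []) (ctr 1 ∷ []) (Vec.replicate nc 0 [ ctr 1 ]≔ length w)
   inv = record
    { vals = λ { zero → lookup∘update (ctr 1) (Vec.replicate nc 0) (length w) }
    ; below = λ { zero → ≤-refl } ; positive = λ { zero → ≤-refl }
    ; free = λ i h → trans (lookup-≢ (Vec.replicate nc 0) (toℕ-≢ (<⇒≢ h))) (lookup-replicate i 0)
    ; scratch = refl }
  ... | L₂ , h₂ , R₂ , z₂ , f₂ =
   subst (λ cs → ATree (M (length w)) (λ K o A → o ≡ ⟦ g ⟧ᴳ w (length w ∷ [])) (steps (length w) + 0) (p₀ ∷ [] , store [] (⊢ , blank) cs blank (Vec.replicate nc 0) []) ⊤) (symm e) (exec (runs-seq runs-goR (runs-seq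
     (runs-≤ (+-monoˡ-≤ 1 (*-monoˡ-≤ 4 (≡⇒≤ (suc-injective (suc-injective (located-length w (located {L = (⊢ , blank) ∷ []} {x} {R} (cong (_ ∷_) (symm e))))))))) f₁) f₂))
     (leaf ended refl))

open Equivalence using (to; from)

-- The positive sentences of the complement structure are the negations of
-- those of B, up to exchanging ∧ with ∨ and ∀ with ∃.
complement : ∀ {σ} → Structure σ → Structure σ
complement record { size = n ; size-nonZero = nz ; Rel = R ; rel? = R? } = record
 { size = n ; size-nonZero = nz ; Rel = λ r xs → ¬ R r xs ; rel? = λ r xs → ¬? (R? r xs) }

element : ∀ {σ} (B : Structure σ) → Dom B
element record { size = n ; size-nonZero = nz } = fromℕ< {0} (>-nonZero⁻¹ n {{nz}})

dualQ : Quantifier → Quantifier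
dualQ forAll = exists
dualQ exists = forAll

dual : ∀ {σ n} → Formula σ n → Formula σ n
dual (atom r xs) = atom r xs
dual (φ ∧ ψ) = dual φ ∨ dual ψ
dual (φ ∨ ψ) = dual φ ∧ dual ψ
dual (quant Q φ) = quant (dualQ Q) (dual φ)

dual-close : ∀ {σ k} (Qs : Vec Quantifier k) (φ : Formula σ k) → dual (close Qs φ) ≡ close (Vec.map dualQ Qs) (dual φ)
dual-close [] φ = refl
dual-close (Q ∷ Qs) φ = dual-close Qs (quant Q φ)

⟦_⟧Q : Quantifier → ∀ {D : Set} → (D → Set) → Set
⟦ forAll ⟧Q {D} P = (d : D) → P d
⟦ exists ⟧Q {D} P = ∃ P

pick : {D : Set} → D → D → Quantifier → D
pick a e forAll = a
pick a e exists = e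

lift : ∀ {m n} → (Fin m → Fin n) → Fin (suc m) → Fin (suc n)
lift f zero = zero
lift f (suc i) = suc (f i)

rename : ∀ {σ m n} → (Fin m → Fin n) → Formula σ m → Formula σ n
rename f (atom r xs) = atom r (Vec.map f xs)
rename f (φ ∧ ψ) = rename f φ ∧ rename f ψ
rename f (φ ∨ ψ) = rename f φ ∨ rename f ψ
rename f (quant Q φ) = quant Q (rename (lift f) φ)

quant-⇔ : ∀ {D : Set} Q {P P′ : D → Set} → (∀ b → P b ⇔ P′ b) → ⟦ Q ⟧Q P ⇔ ⟦ Q ⟧Q P′
quant-⇔ forAll e = mk⇔ (λ f b → to (e b) (f b)) (λ f b → from (e b) (f b))
quant-⇔ exists e = mk⇔ (λ (b , x) → b , to (e b) x) (λ (b , x) → b , from (e b) x)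

quant-mono : ∀ {D : Set} Q {P P′ : D → Set} → (∀ b → P b → P′ b) → ⟦ Q ⟧Q P → ⟦ Q ⟧Q P′
quant-mono forAll e f = λ b → e b (f b)
quant-mono exists e (b , x) = b , e b x

Closure : ∀ {D : Set} {k} → Vec Quantifier k → (Vec D k → Set) → Set
Closure [] P = P []
Closure (Q ∷ Qs) P = Closure Qs (λ ρ → ⟦ Q ⟧Q (λ b → P (b ∷ ρ)))

cl-mono : ∀ {D : Set} {k} (Qs : Vec Quantifier k) {P P′ : Vec D k → Set} → (∀ ρ → P ρ → P′ ρ) → Closure Qs P → Closure Qs P′
cl-mono [] f = f []
cl-mono (Q ∷ Qs) f = cl-mono Qs (λ ρ → quant-mono Q (λ b → f (b ∷ ρ)))

cl-⇔ : ∀ {D : Set} {k} (Qs : Vec Quantifier k) {P P′ : Vec D k → Set} → (∀ ρ → P ρ ⇔ P′ ρ) → Closure Qs P ⇔ Closure Qs P′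
cl-⇔ Qs e = mk⇔ (cl-mono Qs (λ ρ → to (e ρ))) (cl-mono Qs (λ ρ → from (e ρ)))

cl-++ : ∀ {D : Set} {k m} (Qs : Vec Quantifier k) (Rs : Vec Quantifier m) {P : Vec D (k + m) → Set} →
  Closure (Qs Vec.++ Rs) P ≡ Closure Rs (λ ρ → Closure Qs (λ τ → P (τ Vec.++ ρ)))
cl-++ [] Rs = refl
cl-++ (Q ∷ Qs) Rs = cl-++ Qs Rs

module Semantics {σ : Signature} (B : Structure σ) where

 D : Set
 D = Dom B

 point : D
 point = element B

 quant-dec : ∀ Q {P : D → Set} → (∀ b → Dec (P b)) → Dec (⟦ Q ⟧Q P)
 quant-dec forAll d = all? d
 quant-dec exists d = any? d

 quant-dual : ∀ Q {P : D → Set} → (∀ b → Dec (P b)) → (¬ ⟦ Q ⟧Q P) ⇔ ⟦ dualQ Q ⟧Q (λ b → ¬ P b)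
 quant-dual forAll d = mk⇔ (λ f → FinP.¬∀⟶∃¬ _ _ d f) (λ (b , ¬p) f → ¬p (f b))
 quant-dual exists d = mk⇔ (λ f b p → f (b , p)) (λ f (b , p) → f b p)

 sat-quant : ∀ {n} {ρ : Vec D n} Q {φ} → Sat B ρ (quant Q φ) ⇔ ⟦ Q ⟧Q (λ b → Sat B (b ∷ ρ) φ)
 sat-quant forAll = ⇔P.refl
 sat-quant exists = ⇔P.refl

 sat? : ∀ {n} (ρ : Vec D n) φ → Dec (Sat B ρ φ)
 sat? ρ (atom r xs) = Structure.rel? B r _
 sat? ρ (φ ∧ ψ) = sat? ρ φ ×-dec sat? ρ ψ
 sat? ρ (φ ∨ ψ) = sat? ρ φ ⊎-dec sat? ρ ψ
 sat? ρ (quant forAll φ) = all? (λ b → sat? (b ∷ ρ) φ)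
 sat? ρ (quant exists φ) = any? (λ b → sat? (b ∷ ρ) φ)

 sat-rename : ∀ {m n} (f : Fin m → Fin n) {ρ ρ′} → (∀ i → lookup ρ (f i) ≡ lookup ρ′ i) →
   ∀ φ → Sat B ρ (rename f φ) ⇔ Sat B ρ′ φ
 sat-rename f {ρ} e (atom r xs) = mk⇔ (subst (Rel B r) eq) (subst (Rel B r) (symm eq))
  where eq = trans (symm (map-∘ (lookup ρ) f xs)) (map-cong e xs)
 sat-rename f e (φ ∧ ψ) = sat-rename f e φ ×-⇔ sat-rename f e ψ
 sat-rename f e (φ ∨ ψ) = sat-rename f e φ ⊎-⇔ sat-rename f e ψ
 sat-rename f e (quant Q φ) = ⇔P.trans (sat-quant Q) (⇔P.trans
  (quant-⇔ Q (λ b → sat-rename (lift f) (λ { zero → refl ; (suc i) → e i }) φ)) (⇔P.sym (sat-quant Q)))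

 cl-dec : ∀ {k} (Qs : Vec Quantifier k) {P : Vec D k → Set} → (∀ ρ → Dec (P ρ)) → Dec (Closure Qs P)
 cl-dec [] d = d []
 cl-dec (Q ∷ Qs) d = cl-dec Qs (λ ρ → quant-dec Q (λ b → d (b ∷ ρ)))

 cl-dual : ∀ {k} (Qs : Vec Quantifier k) {P : Vec D k → Set} → (∀ ρ → Dec (P ρ)) →
   (¬ Closure Qs P) ⇔ Closure (Vec.map dualQ Qs) (λ ρ → ¬ P ρ)
 cl-dual [] d = ⇔P.refl
 cl-dual (Q ∷ Qs) d = ⇔P.trans (cl-dual Qs (λ ρ → quant-dec Q (λ b → d (b ∷ ρ))))
  (cl-⇔ (Vec.map dualQ Qs) (λ ρ → quant-dual Q (λ b → d (b ∷ ρ))))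

 cl-close : ∀ {k} (Qs : Vec Quantifier k) φ → B ⊨ close Qs φ ⇔ Closure Qs (λ ρ → Sat B ρ φ)
 cl-close [] φ = ⇔P.refl
 cl-close (Q ∷ Qs) φ = ⇔P.trans (cl-close Qs (quant Q φ)) (cl-⇔ Qs (λ ρ → sat-quant Q))

 Definable : ∀ {k} → (Vec D k → Set) → Set
 Definable {k} P = Σ[ φ ∈ Formula σ k ] (∀ ρ → Sat B ρ φ ⇔ P ρ)

 def-dec : ∀ {k} {P : Vec D k → Set} → Definable P → ∀ ρ → Dec (P ρ)
 def-dec (φ , e) ρ = map′ (to (e ρ)) (from (e ρ)) (sat? ρ φ)

 def-sat : ∀ {k} (φ : Formula σ k) → Definable (λ ρ → Sat B ρ φ)
 def-sat φ = φ , λ _ → ⇔P.refl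

 def-× : ∀ {k} {P P′ : Vec D k → Set} → Definable P → Definable P′ → Definable (λ ρ → P ρ × P′ ρ)
 def-× (φ , e) (ψ , f) = φ ∧ ψ , λ ρ → e ρ ×-⇔ f ρ

 def-⊎ : ∀ {k} {P P′ : Vec D k → Set} → Definable P → Definable P′ → Definable (λ ρ → P ρ ⊎ P′ ρ)
 def-⊎ (φ , e) (ψ , f) = φ ∨ ψ , λ ρ → e ρ ⊎-⇔ f ρ

 def-quant : ∀ {k} Q {P : Vec D (suc k) → Set} → Definable P → Definable (λ ρ → ⟦ Q ⟧Q (λ b → P (b ∷ ρ)))
 def-quant Q (φ , e) = quant Q φ , λ ρ → ⇔P.trans (sat-quant Q) (quant-⇔ Q (λ b → e (b ∷ ρ)))

 def-reindex : ∀ {m n} (f : Fin m → Fin n) (g : Vec D n → Vec D m) → (∀ ρ i → lookup ρ (f i) ≡ lookup (g ρ) i) →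
   ∀ {P : Vec D m → Set} → Definable P → Definable (λ ρ → P (g ρ))
 def-reindex f g e (φ , h) = rename f φ , λ ρ → ⇔P.trans (sat-rename f (e ρ) φ) (h (g ρ))

 Splits∧ : Set
 Splits∧ = ∀ {k} (Qs : Vec Quantifier k) φ ψ → B ⊨ close Qs φ → B ⊨ close Qs ψ → B ⊨ close Qs (φ ∧ ψ)

 unbroken⇒splits : ¬ ∃ (Breaks∧ B) → Splits∧
 unbroken⇒splits nb Qs φ ψ p q = decidable-stable (sat? [] (close Qs (φ ∧ ψ))) λ n → nb (_ , _ , Qs , φ , ψ , refl , n , p , q)

 -- With Q = ∃ and c = e this is satisfaction of the formula in which every ∃ is
 -- replaced by the constant e; dually for Q = ∀.
 SatAt : Quantifier → D → ∀ {n} → Vec D n → Formula σ n → Set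
 SatAt Q c ρ (atom r xs) = Rel B r (Vec.map (lookup ρ) xs)
 SatAt Q c ρ (φ ∧ ψ) = SatAt Q c ρ φ × SatAt Q c ρ ψ
 SatAt Q c ρ (φ ∨ ψ) = SatAt Q c ρ φ ⊎ SatAt Q c ρ ψ
 SatAt forAll c ρ (quant forAll φ) = SatAt forAll c (c ∷ ρ) φ
 SatAt forAll c ρ (quant exists φ) = ∃[ b ] SatAt forAll c (b ∷ ρ) φ
 SatAt exists c ρ (quant forAll φ) = ∀ b → SatAt exists c (b ∷ ρ) φ
 SatAt exists c ρ (quant exists φ) = SatAt exists c (c ∷ ρ) φ

 satAt∃⇒sat : ∀ {e n} {ρ : Vec D n} φ → SatAt exists e ρ φ → Sat B ρ φ
 satAt∃⇒sat (atom r xs) s = s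
 satAt∃⇒sat (φ ∧ ψ) (s , t) = satAt∃⇒sat φ s , satAt∃⇒sat ψ t
 satAt∃⇒sat (φ ∨ ψ) (inj₁ s) = inj₁ (satAt∃⇒sat φ s)
 satAt∃⇒sat (φ ∨ ψ) (inj₂ s) = inj₂ (satAt∃⇒sat ψ s)
 satAt∃⇒sat (quant forAll φ) f b = satAt∃⇒sat φ (f b)
 satAt∃⇒sat {e} (quant exists φ) s = e , satAt∃⇒sat φ s

 sat⇒satAt∀ : ∀ {a n} {ρ : Vec D n} φ → Sat B ρ φ → SatAt forAll a ρ φ
 sat⇒satAt∀ (atom r xs) s = s
 sat⇒satAt∀ (φ ∧ ψ) (s , t) = sat⇒satAt∀ φ s , sat⇒satAt∀ ψ t
 sat⇒satAt∀ (φ ∨ ψ) (inj₁ s) = inj₁ (sat⇒satAt∀ φ s)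
 sat⇒satAt∀ (φ ∨ ψ) (inj₂ s) = inj₂ (sat⇒satAt∀ ψ s)
 sat⇒satAt∀ {a} (quant forAll φ) f = sat⇒satAt∀ φ (f a)
 sat⇒satAt∀ (quant exists φ) (b , s) = b , sat⇒satAt∀ φ s

 module _ (splits : Splits∧) where

  cl-× : ∀ {k} (Qs : Vec Quantifier k) {P P′ : Vec D k → Set} → Definable P → Definable P′ →
    Closure Qs P → Closure Qs P′ → Closure Qs (λ ρ → P ρ × P′ ρ)
  cl-× Qs (φ , e) (ψ , f) p q = cl-mono Qs (λ ρ → to (e ρ ×-⇔ f ρ))
   (to (cl-close Qs (φ ∧ ψ)) (splits Qs φ ψ
    (from (cl-close Qs φ) (cl-mono Qs (λ ρ → from (e ρ)) p))
    (from (cl-close Qs ψ) (cl-mono Qs (λ ρ → from (f ρ)) q))))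

  def-all : ∀ {k n} {P : Fin (suc n) → Vec D k → Set} → (∀ i → Definable (P i)) → Definable (λ ρ → ∀ i → P i ρ)
  def-all {n = zero} d = proj₁ (d zero) , λ ρ → mk⇔ (λ s → λ { zero → to (proj₂ (d zero) ρ) s }) (λ f → from (proj₂ (d zero) ρ) (f zero))
  def-all {n = suc n} d with def-× (d zero) (def-all (d ∘ suc))
  ... | φ , e = φ , λ ρ → ⇔P.trans (e ρ) (mk⇔ (λ { (p , q) zero → p ; (p , q) (suc i) → q i }) (λ f → f zero , f ∘ suc))

  cl-all : ∀ {k n} (Qs : Vec Quantifier k) {P : Fin (suc n) → Vec D k → Set} → (∀ i → Definable (P i)) →
    (∀ i → Closure Qs (P i)) → Closure Qs (λ ρ → ∀ i → P i ρ)
  cl-all {n = zero} Qs d p = cl-mono Qs (λ { ρ x zero → x }) (p zero)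
  cl-all {n = suc n} Qs d p = cl-mono Qs (λ { ρ (x , y) zero → x ; ρ (x , y) (suc i) → y i })
   (cl-× Qs (d zero) (def-all (d ∘ suc)) (p zero) (cl-all Qs (d ∘ suc) (p ∘ suc)))

  cl-allD : ∀ {k} (Qs : Vec Quantifier k) {P : D → Vec D k → Set} → (∀ i → Definable (P i)) →
    (∀ i → Closure Qs (P i)) → Closure Qs (λ ρ → ∀ i → P i ρ)
  cl-allD = go point where
   go : ∀ {n} → Fin n → ∀ {k} (Qs : Vec Quantifier k) {P : Fin n → Vec D k → Set} → (∀ i → Definable (P i)) →
     (∀ i → Closure Qs (P i)) → Closure Qs (λ ρ → ∀ i → P i ρ)
   go {suc n} _ = cl-all

  foralls : ∀ n {P : Vec D n → Set} → Closure (Vec.replicate n forAll) P ⇔ (∀ zs → P zs)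
  foralls zero = mk⇔ (λ { p [] → p }) (λ f → f [])
  foralls (suc n) = ⇔P.trans (foralls n) (mk⇔ (λ { f (z ∷ zs) → f zs z }) (λ f zs z → f (z ∷ zs)))

  existss : ∀ n {P : Vec D n → Set} → Closure (Vec.replicate n exists) P ⇔ ∃ P
  existss zero = mk⇔ ([] ,_) (λ { ([] , p) → p })
  existss (suc n) = ⇔P.trans (existss n) (mk⇔ (λ (zs , z , p) → z ∷ zs , p) (λ { (z ∷ zs , p) → zs , z , p }))

  -- Give the ∃-player all values of z at once, as the values of one universal
  -- variable for each element; since ∧ splits, one witness y serves them all.
  swap∀∃ : ∀ {m} (Rs : Vec Quantifier m) {P : Vec D (2 + m) → Set} → Definable P →
    Closure Rs (λ ρ → ∀ z → ∃[ y ] P (y ∷ z ∷ ρ)) → Closure Rs (λ ρ → ∃[ y ] (∀ z → P (y ∷ z ∷ ρ)))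
  swap∀∃ {m} Rs {P} d c = cl-mono Rs diagonal
    (subst id (cl-++ (exists ∷ Vec.replicate N forAll) Rs {λ τ → ∀ j → P (copy j τ)})
     (cl-allD (exists ∷ Vec.replicate N forAll Vec.++ Rs) copy-def λ j →
      subst id (symm (cl-++ (exists ∷ Vec.replicate N forAll) Rs {λ τ → P (copy j τ)}))
       (cl-mono Rs (λ ρ f → from (foralls N {λ zs → ∃[ y ] P (copy j (y ∷ zs Vec.++ ρ))}) λ zs →
        proj₁ (f (lookup zs j)) , subst₂ (λ z ρ′ → P (proj₁ (f (lookup zs j)) ∷ z ∷ ρ′))
         (symm (lookup-++ˡ zs ρ j)) (symm (drops zs ρ)) (proj₂ (f (lookup zs j)))) c))) where
   N = Structure.size B
   rest : Vec D (N + m) → Vec D m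
   rest τ = Vec.tabulate (λ i → lookup τ (N ↑ʳ i))
   drops : ∀ zs ρ → rest (zs Vec.++ ρ) ≡ ρ
   drops zs ρ = trans (tabulate-cong (lookup-++ʳ zs ρ)) (tabulate∘lookup ρ)
   copy : D → Vec D (suc (N + m)) → Vec D (2 + m)
   copy j (y ∷ τ) = y ∷ lookup τ (j ↑ˡ m) ∷ rest τ
   index : D → Fin (2 + m) → Fin (suc (N + m))
   index j zero = zero
   index j (suc zero) = suc (j ↑ˡ m)
   index j (suc (suc i)) = suc (N ↑ʳ i)
   index-correct : ∀ j τ i → lookup τ (index j i) ≡ lookup (copy j τ) i
   index-correct j (y ∷ τ) zero = refl
   index-correct j (y ∷ τ) (suc zero) = refl
   index-correct j (y ∷ τ) (suc (suc i)) = symm (lookup∘tabulate _ i)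
   copy-def : ∀ j → Definable (λ τ → P (copy j τ))
   copy-def j = def-reindex (index j) (copy j) (index-correct j) d
   diagonal : ∀ ρ → Closure (exists ∷ Vec.replicate N forAll) (λ τ → ∀ j → P (copy j (τ Vec.++ ρ))) → ∃[ y ] (∀ z → P (y ∷ z ∷ ρ))
   diagonal ρ c with to (foralls N {λ zs → ∃[ y ] (∀ j → P (copy j (y ∷ zs Vec.++ ρ)))}) c (Vec.allFin N)
   ... | y , f = y , λ z → subst (λ z′ → P (y ∷ z′ ∷ ρ)) (trans (lookup-++ˡ (Vec.allFin N) ρ z) (lookup-allFin z))
     (subst (λ ρ′ → P (y ∷ lookup (Vec.allFin N Vec.++ ρ) (z ↑ˡ m) ∷ ρ′)) (drops (Vec.allFin N) ρ) (f z))

  -- Among |B| + 1 existential variables, two take the same value.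
  merge∃ : ∀ {m} (Rs : Vec Quantifier m) {P : Vec D (2 + m) → Set} → Definable P →
    Closure Rs (λ ρ → ∃[ e ] ∃[ y ] P (y ∷ e ∷ ρ)) → Closure Rs (λ ρ → ∃[ e ] P (e ∷ e ∷ ρ))
  merge∃ {m} Rs {P} d c = cl-mono Rs collide
    (subst id (cl-++ (Vec.replicate N exists) Rs {λ τ → ∀ i j → Pair i j τ})
     (cl-all (Vec.replicate N exists Vec.++ Rs) (λ i → def-all (λ j → pair-def i j)) λ i →
      cl-all (Vec.replicate N exists Vec.++ Rs) (pair-def i) λ j →
       subst id (symm (cl-++ (Vec.replicate N exists) Rs {Pair i j}))
        (cl-mono Rs (λ ρ (e , y , p) → from (existss N {λ τ → Pair i j (τ Vec.++ ρ)})
         (witness i j e y , witnessed i j e y ρ p)) c))) where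
   N = suc (Structure.size B)
   rest : Vec D (N + m) → Vec D m
   rest τ = Vec.tabulate (λ i → lookup τ (N ↑ʳ i))
   drops : ∀ zs ρ → rest (zs Vec.++ ρ) ≡ ρ
   drops zs ρ = trans (tabulate-cong (lookup-++ʳ zs ρ)) (tabulate∘lookup ρ)
   pair : Fin N → Fin N → Vec D (N + m) → Vec D (2 + m)
   pair i j τ = lookup τ (i ↑ˡ m) ∷ lookup τ (j ↑ˡ m) ∷ rest τ
   index : Fin N → Fin N → Fin (2 + m) → Fin (N + m)
   index i j zero = i ↑ˡ m
   index i j (suc zero) = j ↑ˡ m
   index i j (suc (suc l)) = N ↑ʳ l
   index-correct : ∀ i j τ l → lookup τ (index i j l) ≡ lookup (pair i j τ) l
   index-correct i j τ zero = refl
   index-correct i j τ (suc zero) = refl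
   index-correct i j τ (suc (suc l)) = symm (lookup∘tabulate _ l)
   -- For i = j the requirement is vacuous; it is replaced by ∃ y to stay definable.
   Pair : Fin N → Fin N → Vec D (N + m) → Set
   Pair i j τ with i Fin.≟ j
   ... | yes _ = ∃[ e ] ∃[ y ] P (y ∷ e ∷ rest τ)
   ... | no _ = P (pair i j τ)
   pair-def : ∀ i j → Definable (Pair i j)
   pair-def i j with i Fin.≟ j
   ... | yes _ = def-quant exists (def-quant exists (def-reindex
     (λ { zero → zero ; (suc zero) → suc zero ; (suc (suc l)) → suc (suc (N ↑ʳ l)) })
     (λ { (y ∷ e ∷ τ) → y ∷ e ∷ rest τ })
     (λ { (y ∷ e ∷ τ) zero → refl ; (y ∷ e ∷ τ) (suc zero) → refl
       ; (y ∷ e ∷ τ) (suc (suc l)) → symm (lookup∘tabulate _ l) }) d))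
   ... | no _ = def-reindex (index i j) (pair i j) (index-correct i j) d
   witness : Fin N → Fin N → D → D → Vec D N
   witness i j e y = Vec.replicate N e Vec.[ i ]≔ y
   witnessed : ∀ i j e y ρ → P (y ∷ e ∷ ρ) → Pair i j (witness i j e y Vec.++ ρ)
   witnessed i j e y ρ p with i Fin.≟ j
   ... | yes _ = e , y , subst (λ ρ′ → P (y ∷ e ∷ ρ′)) (symm (drops (witness i j e y) ρ)) p
   ... | no i≢j rewrite lookup-++ˡ (witness i j e y) ρ i | lookup-++ˡ (witness i j e y) ρ j
    | lookup∘update i (Vec.replicate N e) y | lookup∘update′ (i≢j ∘ symm) (Vec.replicate N e) y
    | lookup-replicate j e | drops (witness i j e y) ρ = p
   collide : ∀ ρ → Closure (Vec.replicate N exists) (λ τ → ∀ i j → Pair i j (τ Vec.++ ρ)) → ∃[ e ] P (e ∷ e ∷ ρ)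
   collide ρ c with to (existss N {λ τ → ∀ i j → Pair i j (τ Vec.++ ρ)}) c
   ... | xs , f with pigeonhole (≤-refl {N}) (lookup xs)
   ... | i , j , i<j , eq with i Fin.≟ j | f i j
   ... | yes i≡j | _ = ⊥-elim (FinP.<⇒≢ i<j i≡j)
   ... | no _ | p = lookup xs i , subst₂ (λ a b → P (a ∷ b ∷ ρ)) (lookup-++ˡ xs ρ i)
     (trans (lookup-++ˡ xs ρ j) (symm eq))
     (subst (λ ρ′ → P (lookup (xs Vec.++ ρ) (i ↑ˡ m) ∷ lookup (xs Vec.++ ρ) (j ↑ˡ m) ∷ ρ′)) (drops xs ρ) p)

  swap₂ : ∀ {n} → Fin (2 + n) → Fin (2 + n)
  swap₂ zero = suc zero
  swap₂ (suc zero) = zero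
  swap₂ (suc (suc i)) = suc (suc i)
  swapV : ∀ {n} → Vec D (2 + n) → Vec D (2 + n)
  swapV (z ∷ y ∷ ρ) = y ∷ z ∷ ρ
  swap-correct : ∀ {n} (ρ : Vec D (2 + n)) i → lookup ρ (swap₂ i) ≡ lookup (swapV ρ) i
  swap-correct (z ∷ y ∷ ρ) zero = refl
  swap-correct (z ∷ y ∷ ρ) (suc zero) = refl
  swap-correct (z ∷ y ∷ ρ) (suc (suc i)) = refl

  absorb∃ : ∀ {k m} (Qs : Vec Quantifier k) (Rs : Vec Quantifier m) {P : Vec D (suc (k + suc m)) → Set} → Definable P →
    Closure (exists ∷ (Qs Vec.++ exists ∷ Rs)) P → Closure (Qs Vec.++ exists ∷ Rs) (λ σ → P (lookup σ (k ↑ʳ zero) ∷ σ))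
  absorb∃ [] Rs d c = merge∃ Rs d c
  absorb∃ (forAll ∷ Qs) Rs d c = absorb∃ Qs Rs (def-quant forAll (def-reindex swap₂ swapV swap-correct d)) (swap∀∃ (Qs Vec.++ exists ∷ Rs) d c)
  absorb∃ (exists ∷ Qs) Rs d c = absorb∃ Qs Rs (def-quant exists (def-reindex swap₂ swapV swap-correct d))
    (cl-mono (Qs Vec.++ exists ∷ Rs) (λ { ρ (z , y , p) → y , z , p }) c)

  constant : ∀ k → Vec D (k + 1) → D
  constant k σ = lookup σ (k ↑ʳ zero)

  without : ∀ k → Vec D (k + 1) → Vec D k
  without k σ = Vec.tabulate (λ i → lookup σ (i ↑ˡ 1))

  def-without : ∀ {k} {P : Vec D k → Set} → Definable P → Definable (λ σ → P (without k σ))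
  def-without {k} = def-reindex (_↑ˡ 1) (without k) (λ σ i → symm (lookup∘tabulate _ i))

  def-satAt : ∀ {k} (φ : Formula σ k) → Definable (λ σ → SatAt exists (constant k σ) (without k σ) φ)
  def-satAt (atom r xs) = def-without (def-sat (atom r xs))
  def-satAt (φ ∧ ψ) = def-× (def-satAt φ) (def-satAt ψ)
  def-satAt (φ ∨ ψ) = def-⊎ (def-satAt φ) (def-satAt ψ)
  def-satAt (quant forAll φ) = def-quant forAll (def-satAt φ)
  def-satAt {k} (quant exists φ) = def-reindex (λ { zero → k ↑ʳ zero ; (suc i) → i }) (λ σ → constant k σ ∷ σ)
   (λ { σ zero → refl ; σ (suc i) → refl }) (def-satAt φ)

  -- The side disjunct Ψ makes the induction pass through ∨, by which prefixes
  -- do not distribute.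
  collapse-under : ∀ {k} (Qs : Vec Quantifier k) φ {Ψ : Vec D (k + 1) → Set} → Definable Ψ →
   Closure (Qs Vec.++ exists ∷ []) (λ σ → Sat B (without k σ) φ ⊎ Ψ σ) →
   Closure (Qs Vec.++ exists ∷ []) (λ σ → SatAt exists (constant k σ) (without k σ) φ ⊎ Ψ σ)
  collapse-under Qs (atom r xs) d c = c
  collapse-under {k} Qs (φ ∧ ψ) {Ψ} d c = cl-mono R
   (λ { σ (inj₁ p , inj₁ q) → inj₁ (p , q) ; σ (inj₁ _ , inj₂ y) → inj₂ y ; σ (inj₂ y , _) → inj₂ y })
   (cl-× R (def-⊎ (def-satAt φ) d) (def-⊎ (def-satAt ψ) d)
    (collapse-under Qs φ d (cl-mono R (λ { σ (inj₁ (p , _)) → inj₁ p ; σ (inj₂ y) → inj₂ y }) c))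
    (collapse-under Qs ψ d (cl-mono R (λ { σ (inj₁ (_ , q)) → inj₁ q ; σ (inj₂ y) → inj₂ y }) c)))
   where R = Qs Vec.++ exists ∷ []
  collapse-under {k} Qs (φ ∨ ψ) {Ψ} d c = cl-mono R
   (λ { σ (inj₁ q) → inj₁ (inj₂ q) ; σ (inj₂ (inj₁ p)) → inj₁ (inj₁ p) ; σ (inj₂ (inj₂ y)) → inj₂ y })
   (collapse-under Qs ψ (def-⊎ (def-satAt φ) d) (cl-mono R
    (λ { σ (inj₁ p) → inj₂ (inj₁ p) ; σ (inj₂ (inj₁ q)) → inj₁ q ; σ (inj₂ (inj₂ y)) → inj₂ (inj₂ y) })
    (collapse-under Qs φ (def-⊎ (def-without (def-sat ψ)) d) (cl-mono R
     (λ { σ (inj₁ (inj₁ p)) → inj₁ p ; σ (inj₁ (inj₂ q)) → inj₂ (inj₁ q) ; σ (inj₂ y) → inj₂ (inj₂ y) }) c))))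
   where R = Qs Vec.++ exists ∷ []
  collapse-under {k} Qs (quant forAll φ) {Ψ} d c = cl-mono R
   (λ σ f → [ inj₂ , (λ n → inj₁ λ b → [ id , ⊥-elim ∘ n ]′ (f b)) ]′ (decide (def-dec d σ)))
   (collapse-under (forAll ∷ Qs) φ (def-reindex suc Vec.tail (λ { (b ∷ σ) i → refl }) d)
    (cl-mono R (λ { σ (inj₁ f) b → inj₁ (f b) ; σ (inj₂ y) b → inj₂ y }) c)) where
   R = Qs Vec.++ exists ∷ []
   decide : ∀ {A : Set} → Dec A → A ⊎ ¬ A
   decide (yes a) = inj₁ a
   decide (no n) = inj₂ n
  collapse-under {k} Qs (quant exists φ) {Ψ} d c =
   absorb∃ Qs [] (def-⊎ (def-satAt φ) d′)
    (collapse-under (exists ∷ Qs) φ d′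
     (cl-mono (Qs Vec.++ exists ∷ []) (λ { σ (inj₁ (b , p)) → b , inj₁ p ; σ (inj₂ y) → point , inj₂ y }) c))
   where
   d′ : Definable (λ σ → Ψ (Vec.tail σ))
   d′ = def-reindex suc Vec.tail (λ { (b ∷ σ) i → refl }) d

  collapse∃ : ∀ θ → B ⊨ θ → ∃[ e ] SatAt exists e [] θ
  collapse∃ θ (s) with collapse-under [] θ (def-satAt θ) (point , inj₁ s)
  ... | e , inj₁ p = e , p
  ... | e , inj₂ p = e , p

  collapse-prefix : ∀ {k} (Qs : Vec Quantifier k) {P : Vec D (k + 2) → Set} → Definable P →
   Closure (Qs Vec.++ exists ∷ forAll ∷ []) P → ∀ a → ∃[ e ] P (Vec.map (pick a e) Qs Vec.++ e ∷ a ∷ [])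
  collapse-prefix [] d c = c
  collapse-prefix {suc k} (forAll ∷ Qs) {P} d c a with collapse-prefix Qs
   (def-reindex (λ { zero → k ↑ʳ suc zero ; (suc i) → i }) (λ σ → lookup σ (k ↑ʳ suc zero) ∷ σ) (λ { σ zero → refl ; σ (suc i) → refl }) d)
   (cl-mono (Qs Vec.++ exists ∷ forAll ∷ []) (λ σ f → f (lookup σ (k ↑ʳ suc zero))) c) a
  ... | e , p = e , subst (λ b → P (b ∷ Vec.map (pick a e) Qs Vec.++ e ∷ a ∷ [])) (lookup-++ʳ (Vec.map (pick a e) Qs) (e ∷ a ∷ []) (suc zero)) p
  collapse-prefix {suc k} (exists ∷ Qs) {P} d c a with collapse-prefix Qs
   (def-reindex (λ { zero → k ↑ʳ zero ; (suc i) → i }) (λ σ → lookup σ (k ↑ʳ zero) ∷ σ) (λ { σ zero → refl ; σ (suc i) → refl }) d)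
   (absorb∃ Qs (forAll ∷ []) d c) a
  ... | e , p = e , subst (λ b → P (b ∷ Vec.map (pick a e) Qs Vec.++ e ∷ a ∷ [])) (lookup-++ʳ (Vec.map (pick a e) Qs) (e ∷ a ∷ []) zero) p

  collapse-closure : ∀ {k} (Qs : Vec Quantifier k) {P : Vec D k → Set} → Definable P → Closure Qs P →
    ∀ a → ∃[ e ] P (Vec.map (pick a e) Qs)
  collapse-closure {k} Qs {P} d c a with collapse-prefix Qs {λ σ → P (front σ)}
   (def-reindex (_↑ˡ 2) front (λ σ i → symm (lookup∘tabulate _ i)) d)
   (subst id (symm (cl-++ Qs (exists ∷ forAll ∷ []) {λ σ → P (front σ)}))
    (λ a → point , cl-mono Qs (λ ρ → subst P (symm (front-++ ρ _))) c)) a where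
   front : Vec D (k + 2) → Vec D k
   front σ = Vec.tabulate (λ i → lookup σ (i ↑ˡ 2))
   front-++ : ∀ ρ τ → front (ρ Vec.++ τ) ≡ ρ
   front-++ ρ τ = trans (tabulate-cong (lookup-++ˡ ρ τ)) (tabulate∘lookup ρ)
  ... | e , p = e , subst P (trans (tabulate-cong (lookup-++ˡ (Vec.map (pick a e) Qs) _)) (tabulate∘lookup _)) p

module Dual {σ : Signature} (B : Structure σ) where

 open Semantics B using (D; Definable; SatAt; Splits∧; cl-close; cl-dec; cl-dual; collapse-closure; def-dec; def-reindex; def-sat; quant-dual; sat-quant; sat?; swap∀∃)
 module C = Semantics (complement B) using (SatAt; Splits∧; unbroken⇒splits; sat-quant; collapse-closure; collapse∃)

 sat-dual : ∀ {n} {ρ : Vec D n} φ → Sat (complement B) ρ (dual φ) ⇔ (¬ Sat B ρ φ)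
 sat-dual (atom r xs) = ⇔P.refl
 sat-dual {ρ = ρ} (φ ∧ ψ) = ⇔P.trans (sat-dual φ ⊎-⇔ sat-dual ψ) (mk⇔
  (λ { (inj₁ n) (s , _) → n s ; (inj₂ n) (_ , s) → n s })
  (λ n → case-dec (sat? ρ φ) (λ s → inj₂ (λ t → n (s , t))) inj₁)) where
  case-dec : ∀ {A B : Set} → Dec A → (A → B) → (¬ A → B) → B
  case-dec (yes a) f g = f a
  case-dec (no n) f g = g n
 sat-dual (φ ∨ ψ) = ⇔P.trans (sat-dual φ ×-⇔ sat-dual ψ) (mk⇔ (λ (p , q) → [ p , q ]′) (λ f → f ∘ inj₁ , f ∘ inj₂))
 sat-dual {ρ = ρ} (quant Q φ) = ⇔P.trans (C.sat-quant (dualQ Q)) (⇔P.trans (quant-⇔ (dualQ Q) (λ b → sat-dual φ))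
  (⇔P.trans (⇔P.sym (quant-dual Q (λ b → sat? (b ∷ ρ) φ)))
   (mk⇔ (_∘ to (sat-quant Q)) (_∘ from (sat-quant Q)))))

 dual-involutive : ∀ {n} (φ : Formula σ n) → dual (dual φ) ≡ φ
 dual-involutive (atom r xs) = refl
 dual-involutive (φ ∧ ψ) = cong₂ _∧_ (dual-involutive φ) (dual-involutive ψ)
 dual-involutive (φ ∨ ψ) = cong₂ _∨_ (dual-involutive φ) (dual-involutive ψ)
 dual-involutive (quant forAll φ) = cong (quant forAll) (dual-involutive φ)
 dual-involutive (quant exists φ) = cong (quant exists) (dual-involutive φ)

 sat-dual′ : ∀ {n} {ρ : Vec D n} φ → Sat B ρ (dual φ) ⇔ (¬ Sat (complement B) ρ φ)
 sat-dual′ {ρ = ρ} φ = mk⇔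
  (λ s c → to (sat-dual (dual φ)) (subst (Sat (complement B) ρ) (symm (dual-involutive φ)) c) s)
  (λ n → decidable-stable (sat? ρ (dual φ)) λ m → n (subst (Sat (complement B) ρ) (dual-involutive φ) (from (sat-dual (dual φ)) m)))

 breaks∨⇒ : ∃ (Breaks∨ B) → ∃ (Breaks∧ (complement B))
 breaks∨⇒ (_ , k , Qs , φ , ψ , refl , s , m , n) = _ , k , Vec.map dualQ Qs , dual φ , dual ψ , refl ,
  (λ t → to (sat-dual (close Qs (φ ∨ ψ))) (subst (complement B ⊨_) (symm (dual-close Qs (φ ∨ ψ))) t) s) ,
  subst (complement B ⊨_) (dual-close Qs φ) (from (sat-dual (close Qs φ)) m) ,
  subst (complement B ⊨_) (dual-close Qs ψ) (from (sat-dual (close Qs ψ)) n)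

 breaks∧ᶜ⇒ : ∃ (Breaks∧ (complement B)) → ∃ (Breaks∨ B)
 breaks∧ᶜ⇒ (_ , k , Qs , φ , ψ , refl , n , s , t) = _ , k , Vec.map dualQ Qs , dual φ , dual ψ , refl ,
  subst (B ⊨_) (dual-close Qs (φ ∧ ψ)) (from (sat-dual′ (close Qs (φ ∧ ψ))) n) ,
  (λ x → to (sat-dual′ (close Qs φ)) (subst (B ⊨_) (symm (dual-close Qs φ)) x) s) ,
  (λ x → to (sat-dual′ (close Qs ψ)) (subst (B ⊨_) (symm (dual-close Qs ψ)) x) t)

 unbroken∨⇒splits : ¬ ∃ (Breaks∨ B) → C.Splits∧
 unbroken∨⇒splits nb = C.unbroken⇒splits (nb ∘ breaks∧ᶜ⇒)

 satAt-dual : ∀ {c n} {ρ : Vec D n} φ → C.SatAt exists c ρ (dual φ) → ¬ SatAt forAll c ρ φ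
 satAt-dual (atom r xs) s = s
 satAt-dual (φ ∧ ψ) (inj₁ s) (t , _) = satAt-dual φ s t
 satAt-dual (φ ∧ ψ) (inj₂ s) (_ , t) = satAt-dual ψ s t
 satAt-dual (φ ∨ ψ) (s , _) (inj₁ t) = satAt-dual φ s t
 satAt-dual (φ ∨ ψ) (_ , s) (inj₂ t) = satAt-dual ψ s t
 satAt-dual (quant forAll φ) s t = satAt-dual φ s t
 satAt-dual (quant exists φ) f (b , t) = satAt-dual φ (f b) t

 collapse∀ : C.Splits∧ → ∀ θ → (∀ a → SatAt forAll a [] θ) → B ⊨ θ
 collapse∀ sp θ f = decidable-stable (sat? [] θ) λ n →
  let e , s = C.collapse∃ sp (dual θ) (from (sat-dual θ) n) in satAt-dual θ s (f e)

 module Table (splits : Splits∧) (splitsᶜ : C.Splits∧) where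

  AtomTable : ∀ r → Vec Quantifier (arity σ r) → Set
  AtomTable r qs = ∀ a → ∃[ e ] Rel B r (Vec.map (pick a e) qs)

  TableSat : ∀ {k} → Vec Quantifier k → Formula σ k → Set
  TableSat Qs (atom r xs) = AtomTable r (Vec.map (lookup Qs) xs)
  TableSat Qs (φ ∧ ψ) = TableSat Qs φ × TableSat Qs ψ
  TableSat Qs (φ ∨ ψ) = TableSat Qs φ ⊎ TableSat Qs ψ
  TableSat Qs (quant Q φ) = TableSat (Q ∷ Qs) φ

  atom-table : ∀ {k} (Qs : Vec Quantifier k) {P : Vec D k → Set} → Definable P →
    Closure Qs P ⇔ (∀ a → ∃[ e ] P (Vec.map (pick a e) Qs))
  atom-table {k} Qs {P} d = mk⇔ (collapse-closure splits Qs d) λ f →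
   decidable-stable (cl-dec Qs (def-dec d)) λ n →
    let e , g = swap∀∃ splits [] {Picked} picked f
        a , q = C.collapse-closure splitsᶜ (Vec.map dualQ Qs) {λ ρ → ¬ P ρ}
             (dual (proj₁ d) , λ ρ → ⇔P.trans (sat-dual (proj₁ d)) (mk⇔ (_∘ from (proj₂ d ρ)) (_∘ to (proj₂ d ρ))))
             (to (cl-dual Qs (def-dec d)) n) e
    in q (subst P (symm (trans (symm (map-∘ _ dualQ Qs)) (map-cong (swapped e a) Qs))) (g a))
   where
   swapped : ∀ e a Q → pick e a (dualQ Q) ≡ pick a e Q
   swapped e a forAll = refl
   swapped e a exists = refl
   ix : Quantifier → Fin 2
   ix forAll = suc zero
   ix exists = zero
   Picked : Vec D 2 → Set
   Picked (y ∷ z ∷ []) = P (Vec.map (pick z y) Qs)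
   picked : Definable Picked
   picked with def-reindex (λ i → ix (lookup Qs i)) (λ ρ → Vec.tabulate (λ i → lookup ρ (ix (lookup Qs i))))
     (λ ρ i → symm (lookup∘tabulate _ i)) d
   ... | φ , h = φ , λ { (y ∷ z ∷ []) → ⇔P.trans (h (y ∷ z ∷ [])) (mk⇔ (subst P (eq y z)) (subst P (symm (eq y z)))) }
    where
    ixp : ∀ y z Q → lookup (y ∷ z ∷ []) (ix Q) ≡ pick z y Q
    ixp y z forAll = refl
    ixp y z exists = refl
    eq : ∀ y z → Vec.tabulate (λ i → lookup (y ∷ z ∷ []) (ix (lookup Qs i))) ≡ Vec.map (pick z y) Qs
    eq y z = trans (tabulate-cong (λ i → trans (ixp y z (lookup Qs i)) (symm (lookup-map i (pick z y) Qs)))) (tabulate∘lookup _)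

  table : ∀ {k} (Qs : Vec Quantifier k) φ → B ⊨ close Qs φ ⇔ TableSat Qs φ
  table Qs (atom r xs) = ⇔P.trans (cl-close Qs (atom r xs)) (⇔P.trans (atom-table Qs (def-sat (atom r xs)))
   (mk⇔ (λ f a → proj₁ (f a) , subst (Rel B r) (eq a (proj₁ (f a))) (proj₂ (f a)))
     (λ f a → proj₁ (f a) , subst (Rel B r) (symm (eq a (proj₁ (f a)))) (proj₂ (f a))))) where
   eq : ∀ a e → Vec.map (lookup (Vec.map (pick a e) Qs)) xs ≡ Vec.map (pick a e) (Vec.map (lookup Qs) xs)
   eq a e = trans (map-cong (λ i → lookup-map i (pick a e) Qs) xs) (map-∘ (pick a e) (lookup Qs) xs)
  table Qs (φ ∧ ψ) = ⇔P.trans (mk⇔ (λ s → project proj₁ s , project proj₂ s) (λ (p , q) → splits Qs φ ψ p q)) (table Qs φ ×-⇔ table Qs ψ)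
   where
   project : ∀ {χ} → (∀ {ρ} → Sat B ρ (φ ∧ ψ) → Sat B ρ χ) → B ⊨ close Qs (φ ∧ ψ) → B ⊨ close Qs χ
   project {χ} f s = from (cl-close Qs χ) (cl-mono Qs (λ ρ → f) (to (cl-close Qs (φ ∧ ψ)) s))
  table Qs (φ ∨ ψ) = ⇔P.trans (mk⇔ split [ include inj₁ , include inj₂ ]′) (table Qs φ ⊎-⇔ table Qs ψ)
   where
   include : ∀ {χ} → (∀ {ρ} → Sat B ρ χ → Sat B ρ (φ ∨ ψ)) → B ⊨ close Qs χ → B ⊨ close Qs (φ ∨ ψ)
   include {χ} f s = from (cl-close Qs (φ ∨ ψ)) (cl-mono Qs (λ ρ → f) (to (cl-close Qs χ) s))
   split : B ⊨ close Qs (φ ∨ ψ) → B ⊨ close Qs φ ⊎ B ⊨ close Qs ψ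
   split s = decidable-stable (sat? [] (close Qs φ) ⊎-dec sat? [] (close Qs ψ)) λ n →
    to (sat-dual (close Qs (φ ∨ ψ)))
     (subst (complement B ⊨_) (symm (dual-close Qs (φ ∨ ψ)))
      (splitsᶜ (Vec.map dualQ Qs) (dual φ) (dual ψ)
       (subst (complement B ⊨_) (dual-close Qs φ) (from (sat-dual (close Qs φ)) (n ∘ inj₁)))
       (subst (complement B ⊨_) (dual-close Qs ψ) (from (sat-dual (close Qs ψ)) (n ∘ inj₂))))) s
  table Qs (quant Q φ) = table (Q ∷ Qs) φ

module _ (σ : Signature) where

 ticks-injective : ∀ {m n} {u v : List (Letter σ)} →
  replicate m (tick-letter) ++ stop-letter ∷ u ≡ replicate n (tick-letter) ++ stop-letter ∷ v → m ≡ n × u ≡ v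
 ticks-injective {zero} {zero} refl = refl , refl
 ticks-injective {suc m} {suc n} e with ticks-injective {m} {n} (∷-injectiveʳ e)
 ... | refl , e′ = refl , e′

 encodeVars-injective : ∀ {n m} (xs ys : Vec (Fin n) m) {u v} → encodeVars σ xs ++ u ≡ encodeVars σ ys ++ v → xs ≡ ys × u ≡ v
 encodeVars-injective [] [] e = refl , e
 encodeVars-injective (x ∷ xs) (y ∷ ys) {u} {v} e
  with ticks-injective {toℕ x} {toℕ y} (trans (symm (++-assoc (replicate (toℕ x) _) _ u)) (trans e (++-assoc (replicate (toℕ y) _) _ v)))
 ... | xy , e′ with encodeVars-injective xs ys e′
 ... | refl , e″ = cong (_∷ xs) (toℕ-injective xy) , e″

 encode-prefix : ∀ {n} (φ ψ : Formula σ n) {u v} → encode σ φ ++ u ≡ encode σ ψ ++ v → φ ≡ ψ × u ≡ v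
 encode-pair : ∀ {n} (φ₁ φ₂ ψ₁ ψ₂ : Formula σ n) {u v} →
  (encode σ φ₁ ++ encode σ φ₂) ++ u ≡ (encode σ ψ₁ ++ encode σ ψ₂) ++ v → φ₁ ≡ ψ₁ × φ₂ ≡ ψ₂ × u ≡ v
 encode-pair φ₁ φ₂ ψ₁ ψ₂ {u} {v} e
  with encode-prefix φ₁ ψ₁ (trans (symm (++-assoc (encode σ φ₁) _ u)) (trans e (++-assoc (encode σ ψ₁) _ v)))
 ... | refl , e′ with encode-prefix φ₂ ψ₂ e′
 ... | refl , e″ = refl , refl , e″
 encode-prefix (atom r xs) (atom s ys) e with ↑ʳ-injective 6 r s (∷-injectiveˡ e)
 ... | refl with encodeVars-injective xs ys (∷-injectiveʳ e)
 ... | refl , e′ = refl , e′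
 encode-prefix (φ₁ ∧ φ₂) (ψ₁ ∧ ψ₂) e with encode-pair φ₁ φ₂ ψ₁ ψ₂ (∷-injectiveʳ e)
 ... | refl , refl , e′ = refl , e′
 encode-prefix (φ₁ ∨ φ₂) (ψ₁ ∨ ψ₂) e with encode-pair φ₁ φ₂ ψ₁ ψ₂ (∷-injectiveʳ e)
 ... | refl , refl , e′ = refl , e′
 encode-prefix (quant forAll φ) (quant forAll ψ) e with encode-prefix φ ψ (∷-injectiveʳ e)
 ... | refl , e′ = refl , e′
 encode-prefix (quant exists φ) (quant exists ψ) e with encode-prefix φ ψ (∷-injectiveʳ e)
 ... | refl , e′ = refl , e′
 encode-prefix (atom r xs) (quant forAll _) ()
 encode-prefix (atom r xs) (quant exists _) ()
 encode-prefix (_ ∧ _) (quant forAll _) ()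
 encode-prefix (_ ∧ _) (quant exists _) ()
 encode-prefix (_ ∨ _) (quant forAll _) ()
 encode-prefix (_ ∨ _) (quant exists _) ()

 encode-injective : ∀ {n} (φ ψ : Formula σ n) → encode σ φ ≡ encode σ ψ → φ ≡ ψ
 encode-injective φ ψ e = proj₁ (encode-prefix φ ψ {[]} {[]} (cong (_++ []) e))

mc-encode : ∀ {σ} (B : Structure σ) θ → MC B (encode σ θ) ⇔ B ⊨ θ
mc-encode {σ} B θ = mk⇔ (λ (θ′ , e , h) → subst (B ⊨_) (encode-injective σ θ′ θ e) h) (λ h → θ , refl , h)

-- Quantified Boolean formulas in negation normal form; a literal records the
-- quantifier of its variable, since the two kinds are translated differently.
data QBF : Set where
 lit : Quantifier → Bool → ℕ → QBF
 and or : QBF → QBF → QBF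
 qu : Quantifier → QBF → QBF

get : {A : Set} → List A → ℕ → Maybe A
get [] i = nothing
get (x ∷ xs) zero = just x
get (x ∷ xs) (suc i) = get xs i

True : List Bool → QBF → Set
True ρ (lit Q b i) = get ρ i ≡ just b
True ρ (and q r) = True ρ q × True ρ r
True ρ (or q r) = True ρ q ⊎ True ρ r
True ρ (qu forAll q) = ∀ b → True (b ∷ ρ) q
True ρ (qu exists q) = ∃[ b ] True (b ∷ ρ) q

Scoped : (Quantifier → Set) → List Quantifier → QBF → Set
Scoped U Γ (lit Q b i) = get Γ i ≡ just Q
Scoped U Γ (and q r) = Scoped U Γ q × Scoped U Γ r
Scoped U Γ (or q r) = Scoped U Γ q × Scoped U Γ r
Scoped U Γ (qu Q q) = U Q × Scoped U (Q ∷ Γ) q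

index : {A : Set} (xs : List A) {i : ℕ} {x : A} → get xs i ≡ just x → Fin (length xs)
index (x ∷ xs) {zero} e = zero
index (x ∷ xs) {suc i} e = suc (index xs e)

toℕ-index : {A : Set} (xs : List A) {i : ℕ} {x : A} (e : get xs i ≡ just x) → toℕ (index xs e) ≡ i
toℕ-index (x ∷ xs) {zero} e = refl
toℕ-index (x ∷ xs) {suc i} e = cong suc (toℕ-index xs e)

Only : Quantifier → Quantifier → Set
Only Q Q′ = Q′ ≡ Q

Any : Quantifier → Set
Any Q = ⊤

module _ {σ : Signature} where

 encodeVars′ : ∀ {n m} → (Fin n → ℕ) → Vec (Fin n) m → List (Letter σ)
 encodeVars′ f [] = []
 encodeVars′ f (x ∷ xs) = replicate (f x) tick-letter ++ stop-letter ∷ encodeVars′ f xs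

 liftℕ : ∀ {n} → (Fin n → ℕ) → Fin (suc n) → ℕ
 liftℕ f zero = 0
 liftℕ f (suc i) = suc (f i)

 encode′ : ∀ {n} → (Fin n → ℕ) → Formula σ n → List (Letter σ)
 encode′ f (atom r xs) = rel-letter σ r ∷ encodeVars′ f xs
 encode′ f (φ ∧ ψ) = and-letter ∷ encode′ f φ ++ encode′ f ψ
 encode′ f (φ ∨ ψ) = or-letter ∷ encode′ f φ ++ encode′ f ψ
 encode′ f (quant Q φ) = quantifier-letter σ Q ∷ encode′ (liftℕ f) φ

 encode-rename : ∀ {m n} (f : Fin m → Fin n) g → (∀ i → toℕ (f i) ≡ g i) → ∀ φ → encode σ (rename f φ) ≡ encode′ g φ
 encode-rename f g e (atom r xs) = cong (rel-letter σ r ∷_) (go xs) where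
  go : ∀ {m} (xs : Vec _ m) → encodeVars σ (Vec.map f xs) ≡ encodeVars′ g xs
  go [] = refl
  go (x ∷ xs) = cong₂ (λ n t → replicate n tick-letter ++ stop-letter ∷ t) (e x) (go xs)
 encode-rename f g e (φ ∧ ψ) = cong₂ (λ s t → and-letter ∷ s ++ t) (encode-rename f g e φ) (encode-rename f g e ψ)
 encode-rename f g e (φ ∨ ψ) = cong₂ (λ s t → or-letter ∷ s ++ t) (encode-rename f g e φ) (encode-rename f g e ψ)
 encode-rename f g e (quant Q φ) = cong (quantifier-letter σ Q ∷_)
  (encode-rename (lift f) (liftℕ g) (λ { zero → refl ; (suc i) → cong suc (e i) }) φ)

 prefixText : ∀ {k} → Vec Quantifier k → List (Letter σ)
 prefixText [] = []
 prefixText (Q ∷ Qs) = prefixText Qs ++ quantifier-letter σ Q ∷ []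

 encode-close : ∀ {k} (Qs : Vec Quantifier k) φ → encode σ (close Qs φ) ≡ prefixText Qs ++ encode σ φ
 encode-close [] φ = refl
 encode-close (Q ∷ Qs) φ = trans (encode-close Qs (quant Q φ)) (symm (++-assoc (prefixText Qs) _ _))

module _ {σ : Signature} (B : Structure σ) where

 open Semantics B using (D; cl-close; sat-rename; sat?)

 LiteralGood LiteralBad : Quantifier → (Bool → D → Set) → Set
 LiteralGood exists lits = ∀ b → ∃[ x ] lits b x
 LiteralGood forAll lits = ∀ x → ∃[ b ] lits b x
 LiteralBad exists lits = ∃[ x ] (∀ b → lits b x)
 LiteralBad forAll lits = ∃[ b ] (∀ x → lits b x)

 -- `lits Q b` defines, after the prefix P, the elements that stand for the value
 -- b of a variable quantified by Q, for the quantifiers in U.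
 record Gadget (U : Quantifier → Set) : Set where
  field
   {arity′} : ℕ
   prefix : Vec Quantifier arity′
   lits : Quantifier → Bool → Formula σ (suc arity′)

  Lits : Vec D arity′ → Quantifier → Bool → D → Set
  Lits y Q b x = Sat B (x ∷ y) (lits Q b)

  field
   good : Closure prefix (λ y → ∀ Q → U Q → LiteralGood Q (Lits y Q))
   bad : ¬ Closure prefix (λ y → ∃[ Q ] U Q × LiteralBad Q (Lits y Q))

 module Translate {U : Quantifier → Set} (U? : ∀ Q → Dec (U Q)) (G : Gadget U) where

  open Gadget G

  place : ∀ (Γ : List Quantifier) {i Q} → get Γ i ≡ just Q → Fin (suc arity′) → Fin (length Γ + arity′)
  place Γ e zero = index Γ e ↑ˡ arity′
  place Γ e (suc j) = length Γ ↑ʳ j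

  tr : ∀ {Γ} q → Scoped U Γ q → Formula σ (length Γ + arity′)
  tr {Γ} (lit Q b i) e = rename (place Γ e) (lits Q b)
  tr (and q r) (s , t) = tr q s ∧ tr r t
  tr (or q r) (s , t) = tr q s ∨ tr r t
  tr (qu Q q) (_ , s) = quant Q (tr q s)

  placeℕ : ℕ → ℕ → Fin (suc arity′) → ℕ
  placeℕ n i zero = i
  placeℕ n i (suc j) = n + toℕ j

  text : ℕ → QBF → List (Letter σ)
  text n (lit Q b i) = encode′ (placeℕ n i) (lits Q b)
  text n (and q r) = and-letter ∷ text n q ++ text n r
  text n (or q r) = or-letter ∷ text n q ++ text n r
  text n (qu Q q) = quantifier-letter σ Q ∷ text (suc n) q

  encode-tr : ∀ {Γ} q (s : Scoped U Γ q) → encode σ (tr q s) ≡ text (length Γ) q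
  encode-tr {Γ} (lit Q b i) e = encode-rename (place Γ e) (placeℕ (length Γ) i)
   (λ { zero → trans (toℕ-↑ˡ (index Γ e) arity′) (toℕ-index Γ e) ; (suc j) → toℕ-↑ʳ (length Γ) j }) (lits Q b)
  encode-tr (and q r) (s , t) = cong₂ (λ x y → and-letter ∷ x ++ y) (encode-tr q s) (encode-tr r t)
  encode-tr (or q r) (s , t) = cong₂ (λ x y → or-letter ∷ x ++ y) (encode-tr q s) (encode-tr r t)
  encode-tr (qu Q q) (_ , s) = cong (quantifier-letter σ Q ∷_) (encode-tr q s)

  sat-lit : ∀ {Γ i Q} (e : get Γ i ≡ just Q) (xs : Vec D (length Γ)) y b →
    Sat B (xs Vec.++ y) (rename (place Γ e) (lits Q b)) ⇔ Lits y Q b (lookup xs (index Γ e))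
  sat-lit {Γ} {Q = Q} e xs y b = sat-rename (place Γ e)
   (λ { zero → lookup-++ˡ xs y (index Γ e) ; (suc j) → lookup-++ʳ xs y j }) (lits Q b)

  data Matches⁺ (y : Vec D arity′) : ∀ Γ → Vec D (length Γ) → List Bool → Set where
   [] : Matches⁺ y [] [] []
   _∷_ : ∀ {Q Γ x xs b ρ} → Lits y Q b x → Matches⁺ y Γ xs ρ → Matches⁺ y (Q ∷ Γ) (x ∷ xs) (b ∷ ρ)

  data Matches⁻ (y : Vec D arity′) : ∀ Γ → Vec D (length Γ) → List Bool → Set where
   [] : Matches⁻ y [] [] []
   _∷_ : ∀ {Q Γ x xs b ρ} → (∀ b′ → Lits y Q b′ x → b ≡ b′) → Matches⁻ y Γ xs ρ → Matches⁻ y (Q ∷ Γ) (x ∷ xs) (b ∷ ρ)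

  matches⁺ : ∀ {y Γ xs ρ i Q b} → Matches⁺ y Γ xs ρ → (e : get Γ i ≡ just Q) → get ρ i ≡ just b → Lits y Q b (lookup xs (index Γ e))
  matches⁺ {i = zero} (l ∷ m) refl refl = l
  matches⁺ {i = suc i} (l ∷ m) e f = matches⁺ m e f

  matches⁻ : ∀ {y Γ xs ρ i Q b} → Matches⁻ y Γ xs ρ → (e : get Γ i ≡ just Q) → Lits y Q b (lookup xs (index Γ e)) → get ρ i ≡ just b
  matches⁻ {i = zero} (f ∷ m) refl l = cong just (f _ l)
  matches⁻ {i = suc i} (f ∷ m) e l = matches⁻ m e l

  true⇒sat : ∀ {Γ xs ρ y} q (s : Scoped U Γ q) → (∀ Q → U Q → LiteralGood Q (Lits y Q)) → Matches⁺ y Γ xs ρ →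
    True ρ q → Sat B (xs Vec.++ y) (tr q s)
  true⇒sat {Γ} {xs} {y = y} (lit Q b i) e g m t = from (sat-lit {Γ} e xs y b) (matches⁺ m e t)
  true⇒sat (and q r) (s , s′) g m (t , t′) = true⇒sat q s g m t , true⇒sat r s′ g m t′
  true⇒sat (or q r) (s , s′) g m (inj₁ t) = inj₁ (true⇒sat q s g m t)
  true⇒sat (or q r) (s , s′) g m (inj₂ t) = inj₂ (true⇒sat r s′ g m t)
  true⇒sat (qu forAll q) (u , s) g m t x = let b , l = g forAll u x in true⇒sat q s g (l ∷ m) (t b)
  true⇒sat (qu exists q) (u , s) g m (b , t) = let x , l = g exists u b in x , true⇒sat q s g (l ∷ m) t

  sat⇒true : ∀ {Γ xs ρ y} q (s : Scoped U Γ q) → ¬ (∃[ Q ] U Q × LiteralBad Q (Lits y Q)) → Matches⁻ y Γ xs ρ →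
    Sat B (xs Vec.++ y) (tr q s) → True ρ q
  sat⇒true {Γ} {xs} {y = y} (lit Q b i) e g m t = matches⁻ m e (to (sat-lit {Γ} e xs y b) t)
  sat⇒true (and q r) (s , s′) g m (t , t′) = sat⇒true q s g m t , sat⇒true r s′ g m t′
  sat⇒true (or q r) (s , s′) g m (inj₁ t) = inj₁ (sat⇒true q s g m t)
  sat⇒true (or q r) (s , s′) g m (inj₂ t) = inj₂ (sat⇒true r s′ g m t)
  sat⇒true {y = y} (qu forAll q) (u , s) g m t b
   with ¬∀⟶∃¬ _ (λ x → Lits y forAll (not b) x) (λ x → sat? (x ∷ y) (lits forAll (not b))) (λ f → g (forAll , u , not b , f))
  ... | x , n = sat⇒true q s g (only b n ∷ m) (t x) where
   only : ∀ b {x} → ¬ Lits y forAll (not b) x → ∀ b′ → Lits y forAll b′ x → b ≡ b′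
   only false n false l = refl
   only false n true l = ⊥-elim (n l)
   only true n false l = ⊥-elim (n l)
   only true n true l = refl
  sat⇒true {y = y} (qu exists q) (u , s) g m (x , t) with sat? (x ∷ y) (lits exists true)
  ... | yes p = true , sat⇒true q s g ((λ { true _ → refl ; false l → ⊥-elim (g (exists , u , x , λ { true → p ; false → l })) }) ∷ m) t
  ... | no n = false , sat⇒true q s g ((λ { true l → ⊥-elim (n l) ; false _ → refl }) ∷ m) t

  bad? : ∀ y → Dec (∃[ Q ] U Q × LiteralBad Q (Lits y Q))
  bad? y with U? exists ×-dec any? (λ x → both? x) | U? forAll ×-dec either? where
   both? : ∀ x → Dec (∀ b → Lits y exists b x)
   both? x with sat? (x ∷ y) (lits exists true) | sat? (x ∷ y) (lits exists false)
   ... | yes p | yes q = yes λ { true → p ; false → q }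
   ... | no p | _ = no λ f → p (f true)
   ... | _ | no q = no λ f → q (f false)
   either? : Dec (∃[ b ] (∀ x → Lits y forAll b x))
   either? with all? (λ x → sat? (x ∷ y) (lits forAll true)) | all? (λ x → sat? (x ∷ y) (lits forAll false))
   ... | yes p | _ = yes (true , p)
   ... | _ | yes q = yes (false , q)
   ... | no p | no q = no λ { (true , f) → p f ; (false , f) → q f }
  ... | yes p | _ = yes (exists , p)
  ... | _ | yes q = yes (forAll , q)
  ... | no p | no q = no λ { (exists , x) → p x ; (forAll , x) → q x }

  sentence : ∀ q → Scoped U [] q → Sentence σ
  sentence q s = close prefix (tr q s)

  sentence-correct : ∀ q (s : Scoped U [] q) → B ⊨ sentence q s ⇔ True [] q
  sentence-correct q s = ⇔-trans (cl-close prefix (tr q s)) (mk⇔ sound complete) where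
   ⇔-trans : ∀ {X Y Z : Set} → X ⇔ Y → Y ⇔ Z → X ⇔ Z
   ⇔-trans f g = mk⇔ (to g ∘ to f) (from f ∘ from g)
   complete : True [] q → Closure prefix (λ y → Sat B y (tr q s))
   complete t = cl-mono prefix (λ y g → true⇒sat q s g [] t) good
   true? : ∀ ρ q → Dec (True ρ q)
   true? ρ (lit Q b i) with get ρ i
   ... | nothing = no λ ()
   ... | just true with b
   ... | true = yes refl
   ... | false = no λ ()
   true? ρ (lit Q b i) | just false with b
   ... | true = no λ ()
   ... | false = yes refl
   true? ρ (and q r) = true? ρ q ×-dec true? ρ r
   true? ρ (or q r) = true? ρ q ⊎-dec true? ρ r
   true? ρ (qu forAll q) with true? (true ∷ ρ) q | true? (false ∷ ρ) q
   ... | yes p | yes r = yes λ { true → p ; false → r }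
   ... | no p | _ = no λ f → p (f true)
   ... | _ | no r = no λ f → r (f false)
   true? ρ (qu exists q) with true? (true ∷ ρ) q | true? (false ∷ ρ) q
   ... | yes p | _ = yes (true , p)
   ... | _ | yes r = yes (false , r)
   ... | no p | no r = no λ { (true , t) → p t ; (false , t) → r t }
   sound : Closure prefix (λ y → Sat B y (tr q s)) → True [] q
   sound c = decidable-stable (true? [] q) λ n → bad (cl-mono prefix
    (λ y t → decidable-stable (bad? y) λ g → n (sat⇒true q s g [] t)) c)

  encode-sentence : ∀ q s → encode σ (sentence q s) ≡ prefixText prefix ++ text 0 q
  encode-sentence q s = trans (encode-close prefix (tr q s)) (cong (prefixText prefix ++_) (encode-tr q s))

 chosen : ∀ {n} → Formula σ n → Formula σ n → Bool → Formula σ n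
 chosen φ ψ true = φ
 chosen φ ψ false = ψ

 -- The first point, counted from the outside, at which the two conjuncts can no
 -- longer be satisfied together must be an existential quantifier.
 gadget∃ : ∃ (Breaks∧ B) → Gadget (Only exists)
 gadget∃ (_ , k , Qs , φ , ψ , refl , n , s , t) = go Qs φ ψ n s t where
  go : ∀ {k} (Qs : Vec Quantifier k) φ ψ → B ⊭ close Qs (φ ∧ ψ) → B ⊨ close Qs φ → B ⊨ close Qs ψ → Gadget (Only exists)
  go [] φ ψ n s t = ⊥-elim (n (s , t))
  go (Q ∷ Qs) φ ψ n s t with sat? [] (close Qs (quant Q φ ∧ quant Q ψ))
  ... | no n′ = go Qs (quant Q φ) (quant Q ψ) n′ s t
  go (forAll ∷ Qs) φ ψ n s t | yes y = ⊥-elim (n (from (cl-close Qs (quant forAll (φ ∧ ψ)))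
   (cl-mono Qs (λ ρ (f , g) b → f b , g b) (to (cl-close Qs (quant forAll φ ∧ quant forAll ψ)) y))))
  go (exists ∷ Qs) φ ψ n s t | yes y = record
   { prefix = Qs
   ; lits = λ _ → chosen φ ψ
   ; good = cl-mono Qs (λ { ρ (f , g) _ refl true → f ; ρ (f , g) _ refl false → g }) (to (cl-close Qs (quant exists φ ∧ quant exists ψ)) y)
   ; bad = λ c → n (from (cl-close Qs (quant exists (φ ∧ ψ))) (cl-mono Qs (λ { ρ (_ , refl , x , f) → x , f true , f false }) c))
   }

 gadget∀ : ∃ (Breaks∨ B) → Gadget (Only forAll)
 gadget∀ (_ , k , Qs , φ , ψ , refl , s , m , n) = go Qs φ ψ s m n where
  go : ∀ {k} (Qs : Vec Quantifier k) φ ψ → B ⊨ close Qs (φ ∨ ψ) → B ⊭ close Qs φ → B ⊭ close Qs ψ → Gadget (Only forAll)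
  go [] φ ψ s m n = ⊥-elim ([ m , n ]′ s)
  go (Q ∷ Qs) φ ψ s m n with sat? [] (close Qs (quant Q φ ∨ quant Q ψ))
  ... | yes s′ = go Qs (quant Q φ) (quant Q ψ) s′ m n
  go (exists ∷ Qs) φ ψ s m n | no n′ = ⊥-elim (n′ (from (cl-close Qs (quant exists φ ∨ quant exists ψ))
   (cl-mono Qs (λ { ρ (x , inj₁ p) → inj₁ (x , p) ; ρ (x , inj₂ p) → inj₂ (x , p) }) (to (cl-close Qs (quant exists (φ ∨ ψ))) s))))
  go (forAll ∷ Qs) φ ψ s m n | no n′ = record
   { prefix = Qs
   ; lits = λ _ → chosen φ ψ
   ; good = cl-mono Qs (λ { ρ f _ refl x → [ true ,_ , false ,_ ]′ (f x) }) (to (cl-close Qs (quant forAll (φ ∨ ψ))) s)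
   ; bad = λ c → n′ (from (cl-close Qs (quant forAll φ ∨ quant forAll ψ)) (cl-mono Qs
     (λ { ρ (_ , refl , true , f) → inj₁ f ; ρ (_ , refl , false , f) → inj₂ f }) c))
   }

 gadget-both : Gadget (Only exists) → Gadget (Only forAll) → Gadget Any
 gadget-both G H = record
  { prefix = G.prefix Vec.++ H.prefix
  ; lits = literals
  ; good = subst id (symm (cl-++ G.prefix H.prefix)) (cl-mono H.prefix
    (λ ρ h → cl-mono G.prefix (λ τ g → λ
     { exists _ b → let x , l = g exists refl b in x , from (left-sat b) l
     ; forAll _ x → let b , l = h forAll refl x in b , from (right-sat τ b) l }) G.good) H.good)
  ; bad = λ c → H.bad (cl-mono H.prefix (λ ρ d → decidable-stable (Hᵗ.bad? ρ) λ nb → G.bad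
    (cl-mono G.prefix (λ τ → λ
     { (exists , _ , x , f) → exists , refl , x , λ b → to (left-sat b) (f b)
     ; (forAll , _ , b , f) → ⊥-elim (nb (forAll , refl , b , λ x → to (right-sat τ b) (f x))) }) d))
    (subst id (cl-++ G.prefix H.prefix) c))
  } where
  module G = Gadget G
  module H = Gadget H
  is∀? : ∀ Q → Dec (Q ≡ forAll)
  is∀? forAll = yes refl
  is∀? exists = no λ ()
  module Hᵗ = Translate is∀? H
  inL : Fin (suc G.arity′) → Fin (suc (G.arity′ + H.arity′))
  inL zero = zero
  inL (suc i) = suc (i ↑ˡ H.arity′)
  inR : Fin (suc H.arity′) → Fin (suc (G.arity′ + H.arity′))
  inR zero = zero
  inR (suc i) = suc (G.arity′ ↑ʳ i)
  literals : Quantifier → Bool → Formula σ (suc (G.arity′ + H.arity′))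
  literals exists b = rename inL (G.lits exists b)
  literals forAll b = rename inR (H.lits forAll b)
  left-sat : ∀ {x τ ρ} b → Sat B (x ∷ τ Vec.++ ρ) (literals exists b) ⇔ G.Lits τ exists b x
  left-sat {x} {τ} {ρ} b = sat-rename inL (λ { zero → refl ; (suc i) → lookup-++ˡ τ ρ i }) (G.lits exists b)
  right-sat : ∀ {x ρ} τ b → Sat B (x ∷ τ Vec.++ ρ) (literals forAll b) ⇔ H.Lits ρ forAll b x
  right-sat {x} {ρ} τ b = sat-rename inR (λ { zero → refl ; (suc i) → lookup-++ʳ τ ρ i }) (H.lits forAll b)

shift : Expr v → Expr (suc v)
shift (var x) = var (suc x)
shift (con c) = con c
shift (e ⊕ e′) = shift e ⊕ shift e′
shift (e ⊗ e′) = shift e ⊗ shift e′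

⟦shift⟧ : ∀ (e : Expr v) i η → ⟦ shift e ⟧ᴱ (i ∷ η) ≡ ⟦ e ⟧ᴱ η
⟦shift⟧ (var x) i η = refl
⟦shift⟧ (con c) i η = refl
⟦shift⟧ (e ⊕ e′) i η = cong₂ _+_ (⟦shift⟧ e i η) (⟦shift⟧ e′ i η)
⟦shift⟧ (e ⊗ e′) i η = cong₂ _*_ (⟦shift⟧ e i η) (⟦shift⟧ e′ i η)

-- Schemas of quantifier-free formulas, with conjunctions of polynomial length;
-- `⋀ e s r` is s₀ ∧ (s₁ ∧ … ∧ r), which needs no empty conjunction.
data Sch (k : ℕ) : ℕ → Set where
 lit : Quantifier → Bool → Expr v → Sch k v
 and or : Sch k v → Sch k v → Sch k v
 ⋀ : Expr v → Sch k (suc v) → Sch k v → Sch k v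
 read : Fin v → (InputSymbol k → Sch k v) → Sch k v

conjUpTo : ℕ → (ℕ → QBF) → QBF → QBF
conjUpTo zero F r = r
conjUpTo (suc n) F r = and (F 0) (conjUpTo n (F ∘ suc) r)

⟦_⟧ˢ : ∀ {k v} → Sch k v → Word k → Vec ℕ v → QBF
⟦ lit Q b e ⟧ˢ w η = lit Q b (⟦ e ⟧ᴱ η)
⟦ and s r ⟧ˢ w η = and (⟦ s ⟧ˢ w η) (⟦ r ⟧ˢ w η)
⟦ or s r ⟧ˢ w η = or (⟦ s ⟧ˢ w η) (⟦ r ⟧ˢ w η)
⟦ ⋀ e s r ⟧ˢ w η = conjUpTo (⟦ e ⟧ᴱ η) (λ i → ⟦ s ⟧ˢ w (i ∷ η)) (⟦ r ⟧ˢ w η)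
⟦ read x f ⟧ˢ w η = ⟦ f (readInput w (lookup η x)) ⟧ˢ w η

true-conj : ∀ {ρ} n {F r} → True ρ (conjUpTo n F r) ⇔ ((∀ i → i < n → True ρ (F i)) × True ρ r)
true-conj zero = mk⇔ (λ t → (λ i ()) , t) proj₂
true-conj (suc n) {F} = mk⇔
 (λ (t , t′) → (λ { zero lt → t ; (suc i) (s≤s lt) → proj₁ (to (true-conj n {F ∘ suc}) t′) i lt }) , proj₂ (to (true-conj n {F ∘ suc}) t′))
 (λ (f , t) → f 0 z<s , from (true-conj n {F ∘ suc}) ((λ i lt → f (suc i) (s≤s lt)) , t))

scoped-conj : ∀ {U Γ} n {F r} → (∀ i → i < n → Scoped U Γ (F i)) → Scoped U Γ r → Scoped U Γ (conjUpTo n F r)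
scoped-conj zero f s = s
scoped-conj (suc n) f s = f 0 z<s , scoped-conj n (λ i lt → f (suc i) (s≤s lt)) s

data Item (k v : ℕ) : Set where
 quants : Quantifier → Expr v → Item k v
 conj : Sch k v → Item k v

quantTimes : ℕ → Quantifier → QBF → QBF
quantTimes zero Q q = q
quantTimes (suc n) Q q = qu Q (quantTimes n Q q)

⟦_⟧ᴵ : ∀ {k v} → List (Item k v) → Word k → Vec ℕ v → QBF → QBF
⟦ [] ⟧ᴵ w η q = q
⟦ quants Q e ∷ is ⟧ᴵ w η q = quantTimes (⟦ e ⟧ᴱ η) Q (⟦ is ⟧ᴵ w η q)
⟦ conj s ∷ is ⟧ᴵ w η q = and (⟦ s ⟧ˢ w η) (⟦ is ⟧ᴵ w η q)

width : ∀ {k v} → List (Item k v) → Expr v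
width [] = con 0
width (quants Q e ∷ is) = e ⊕ width is
width (conj s ∷ is) = width is

iterateQ : ℕ → (ℕ → QBF → QBF) → QBF → QBF
iterateQ zero F q = q
iterateQ (suc n) F q = F 0 (iterateQ n (F ∘ suc) q)

-- Nothing in the chunk need refer to the loop index: its copies differ in their
-- texts only through the number of variables in scope.
record Plan (k : ℕ) : Set where
 field
  header : List (Item k 1)
  count : Expr 1
  chunk : List (Item k 2)
  chunkWidth : Expr 1
  width-≡ : ∀ t n → ⟦ width chunk ⟧ᴱ (t ∷ n ∷ []) ≡ ⟦ chunkWidth ⟧ᴱ (n ∷ [])
  final : Sch k 1

 formula : Word k → QBF
 formula w = ⟦ header ⟧ᴵ w η (iterateQ (⟦ count ⟧ᴱ η) (λ t → ⟦ chunk ⟧ᴵ w (t ∷ η)) (⟦ final ⟧ˢ w η))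
  where η = length w ∷ []

module Texts {σ : Signature} (k : ℕ) where

 #σ : ℕ
 #σ = #letters σ

 word : List (Fin #σ) → Gen k #σ v
 word [] = ε
 word (a ∷ as) = letter a · word as

 ⟦word⟧ : ∀ {v} as w (η : Vec ℕ v) → ⟦ word as ⟧ᴳ w η ≡ as
 ⟦word⟧ [] w η = refl
 ⟦word⟧ (a ∷ as) w η = cong (a ∷_) (⟦word⟧ as w η)

 repeated : ∀ n {a : Fin #σ} → concatUpTo n (λ _ → a ∷ []) ≡ replicate n a
 repeated zero = refl
 repeated (suc n) = cong (_ ∷_) (repeated n)

 liftᴱ : ∀ {v n} → (Fin n → Expr v) → Fin (suc n) → Expr v
 liftᴱ f zero = con 0
 liftᴱ f (suc i) = con 1 ⊕ f i

 genVars : ∀ {v n m} → (Fin n → Expr v) → Vec (Fin n) m → Gen k #σ v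
 genVars f [] = ε
 genVars f (x ∷ xs) = for (f x) (letter tick-letter) · letter stop-letter · genVars f xs

 genFormula : ∀ {v n} → (Fin n → Expr v) → Formula σ n → Gen k #σ v
 genFormula f (atom r xs) = letter (rel-letter σ r) · genVars f xs
 genFormula f (φ ∧ ψ) = letter and-letter · genFormula f φ · genFormula f ψ
 genFormula f (φ ∨ ψ) = letter or-letter · genFormula f φ · genFormula f ψ
 genFormula f (quant Q φ) = letter (quantifier-letter σ Q) · genFormula (liftᴱ f) φ

 ⟦genFormula⟧ : ∀ {v n} (f : Fin n → Expr v) (h : Fin n → ℕ) w η → (∀ x → ⟦ f x ⟧ᴱ η ≡ h x) →
   ∀ φ → ⟦ genFormula f φ ⟧ᴳ w η ≡ encode′ h φ
 ⟦genFormula⟧ f h w η e (atom r xs) = cong (_ ∷_) (go xs) where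
  go : ∀ {m} (xs : Vec _ m) → ⟦ genVars f xs ⟧ᴳ w η ≡ encodeVars′ {σ} h xs
  go [] = refl
  go (x ∷ xs) = cong₂ (λ s t → s ++ stop-letter ∷ t) (trans (repeated (⟦ f x ⟧ᴱ η)) (cong (λ n → replicate n tick-letter) (e x))) (go xs)
 ⟦genFormula⟧ f h w η e (φ ∧ ψ) = cong₂ (λ s t → _ ∷ s ++ t) (⟦genFormula⟧ f h w η e φ) (⟦genFormula⟧ f h w η e ψ)
 ⟦genFormula⟧ f h w η e (φ ∨ ψ) = cong₂ (λ s t → _ ∷ s ++ t) (⟦genFormula⟧ f h w η e φ) (⟦genFormula⟧ f h w η e ψ)
 ⟦genFormula⟧ f h w η e (quant Q φ) = cong (_ ∷_)
  (⟦genFormula⟧ (liftᴱ f) (liftℕ {σ} h) w η (λ { zero → refl ; (suc i) → cong suc (e i) }) φ)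

 module _ (B : Structure σ) {U : Quantifier → Set} (U? : ∀ Q → Dec (U Q)) (G : Gadget B U) where

  open Gadget G
  open Translate B U? G using (encode-sentence; sentence; text)

  at-depth : Expr v → Expr v → Fin (suc arity′) → Expr v
  at-depth d e zero = e
  at-depth d e (suc j) = d ⊕ con (toℕ j)

  genSch : Sch k v → Expr v → Gen k #σ v
  genSch (lit Q b e) d = genFormula (at-depth d e) (lits Q b)
  genSch (and s r) d = letter and-letter · genSch s d · genSch r d
  genSch (or s r) d = letter or-letter · genSch s d · genSch r d
  genSch (⋀ e s r) d = for e (letter and-letter · genSch s (shift d)) · genSch r d
  genSch (read x f) d = read x (λ a → genSch (f a) d)

  ⟦genSch⟧ : ∀ (s : Sch k v) d w η → ⟦ genSch s d ⟧ᴳ w η ≡ text (⟦ d ⟧ᴱ η) (⟦ s ⟧ˢ w η)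
  ⟦genSch⟧ (lit Q b e) d w η = ⟦genFormula⟧ (at-depth d e) _ w η (λ { zero → refl ; (suc j) → refl }) (lits Q b)
  ⟦genSch⟧ (and s r) d w η = cong₂ (λ x y → _ ∷ x ++ y) (⟦genSch⟧ s d w η) (⟦genSch⟧ r d w η)
  ⟦genSch⟧ (or s r) d w η = cong₂ (λ x y → _ ∷ x ++ y) (⟦genSch⟧ s d w η) (⟦genSch⟧ r d w η)
  ⟦genSch⟧ (⋀ e s r) d w η = trans (cong (concatUpTo (⟦ e ⟧ᴱ η) (λ i → and-letter ∷ ⟦ genSch s (shift d) ⟧ᴳ w (i ∷ η)) ++_) (⟦genSch⟧ r d w η))
   (go (⟦ e ⟧ᴱ η) (λ i → trans (⟦genSch⟧ s (shift d) w (i ∷ η)) (cong (λ n → text n (⟦ s ⟧ˢ w (i ∷ η))) (⟦shift⟧ d i η))))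
   where
   go : ∀ n {T : ℕ → List (Fin #σ)} {F : ℕ → QBF} {r} → (∀ i → T i ≡ text (⟦ d ⟧ᴱ η) (F i)) →
     concatUpTo n (λ i → and-letter ∷ T i) ++ text (⟦ d ⟧ᴱ η) r ≡ text (⟦ d ⟧ᴱ η) (conjUpTo n F r)
   go zero h = refl
   go (suc n) {T} h = cong (and-letter ∷_) (trans (++-assoc (T 0) _ _) (cong₂ _++_ (h 0) (go n (h ∘ suc))))
  ⟦genSch⟧ (read x f) d w η = ⟦genSch⟧ (f (readInput w (lookup η x))) d w η

  genItems : List (Item k v) → Expr v → Gen k #σ v
  genItems [] d = ε
  genItems (quants Q e ∷ is) d = for e (letter (quantifier-letter σ Q)) · genItems is (d ⊕ e)
  genItems (conj s ∷ is) d = letter and-letter · genSch s d · genItems is d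

  ⟦genItems⟧ : ∀ (is : List (Item k v)) d w η q →
    ⟦ genItems is d ⟧ᴳ w η ++ text (⟦ d ⟧ᴱ η + ⟦ width is ⟧ᴱ η) q ≡ text (⟦ d ⟧ᴱ η) (⟦ is ⟧ᴵ w η q)
  ⟦genItems⟧ [] d w η q = cong (λ n → text n q) (+-identityʳ _)
  ⟦genItems⟧ (quants Q e ∷ is) d w η q = trans (++-assoc (concatUpTo (⟦ e ⟧ᴱ η) (λ _ → quantifier-letter σ Q ∷ [])) _ _)
   (trans (cong (concatUpTo (⟦ e ⟧ᴱ η) (λ _ → quantifier-letter σ Q ∷ []) ++_) (trans (cong (λ n → ⟦ genItems is (d ⊕ e) ⟧ᴳ w η ++ text n q) (symm (+-assoc (⟦ d ⟧ᴱ η) _ _))) (⟦genItems⟧ is (d ⊕ e) w η q)))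
    (go (⟦ e ⟧ᴱ η) (⟦ d ⟧ᴱ η))) where
   go : ∀ n m {r} → concatUpTo n (λ _ → quantifier-letter σ Q ∷ []) ++ text (m + n) r ≡ text m (quantTimes n Q r)
   go zero m {r} = cong (λ n → text n r) (+-identityʳ m)
   go (suc n) m {r} = cong (quantifier-letter σ Q ∷_) (trans (cong (λ x → concatUpTo n (λ _ → quantifier-letter σ Q ∷ []) ++ text x r) (+-suc m n)) (go n (suc m)))
  ⟦genItems⟧ (conj s ∷ is) d w η q = cong (and-letter ∷_) (trans (++-assoc (⟦ genSch s d ⟧ᴳ w η) _ _)
   (cong₂ _++_ (⟦genSch⟧ s d w η) (⟦genItems⟧ is d w η q)))

  module _ (plan : Plan k) where

   open Plan plan
   start : Expr 1
   start = width header
   genPlan : Gen k #σ 1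
   genPlan = word (prefixText {σ} prefix) · genItems header (con 0) ·
    for count (genItems chunk (shift start ⊕ var zero ⊗ shift (chunkWidth))) ·
    genSch final (start ⊕ count ⊗ chunkWidth)
   ⟦genPlan⟧ : ∀ w (s : Scoped U [] (formula w)) → ⟦ genPlan ⟧ᴳ w (length w ∷ []) ≡ encode σ (sentence (formula w) s)
   ⟦genPlan⟧ w s = trans (cong₂ _++_ (⟦word⟧ (prefixText {σ} prefix) w η) body) (symm (encode-sentence (formula w) s))
    where
    η = length w ∷ []
    δ = ⟦ chunkWidth ⟧ᴱ η
    F : ℕ → QBF → QBF
    F t = ⟦ chunk ⟧ᴵ w (t ∷ η)
    go : ∀ n i m {T : ℕ → List (Fin #σ)} {H : ℕ → QBF → QBF} → m ≡ ⟦ start ⟧ᴱ η + i * δ → (∀ j → H j ≡ F (i + j)) →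
      (∀ j → T j ≡ ⟦ genItems chunk (shift start ⊕ var zero ⊗ shift chunkWidth) ⟧ᴳ w (i + j ∷ η)) →
      concatUpTo n T ++ text (m + n * δ) (⟦ final ⟧ˢ w η) ≡ text m (iterateQ n H (⟦ final ⟧ˢ w η))
    go zero i m e Hh h = cong (λ x → text x (⟦ final ⟧ˢ w η)) (+-identityʳ m)
    go (suc n) i m {T} {H} e Hh h = trans (++-assoc (T 0) _ _)
     (trans (cong₂ _++_ (trans (h 0) (cong (λ x → ⟦ genItems chunk D ⟧ᴳ w (x ∷ η)) (+-identityʳ i)))
      (trans (cong (λ x → concatUpTo n (T ∘ suc) ++ text x (⟦ final ⟧ˢ w η)) (symm (+-assoc m δ (n * δ))))
       (trans (go n (suc i) (m + δ) {T ∘ suc} {H ∘ suc} (trans (cong (_+ δ) e) (trans (+-assoc (⟦ start ⟧ᴱ η) _ _) (cong (⟦ start ⟧ᴱ η +_) (+-comm (i * δ) δ))))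
         (λ j → trans (Hh (suc j)) (cong F (+-suc i j)))
         (λ j → trans (h (suc j)) (cong (λ x → ⟦ genItems chunk D ⟧ᴳ w (x ∷ η)) (+-suc i j))))
        (cong (λ x → text x rest) (cong₂ _+_ (symm D≡) (symm (width-≡ i (length w))))))))
      (trans (⟦genItems⟧ chunk D w (i ∷ η) rest) (cong₂ text D≡ (cong (λ f → f rest) (trans (cong F (symm (+-identityʳ i))) (symm (Hh 0)))))))
     where
     D = shift start ⊕ var zero ⊗ shift (chunkWidth)
     rest = iterateQ n (H ∘ suc) (⟦ final ⟧ˢ w η)
     D≡ : ⟦ D ⟧ᴱ (i ∷ η) ≡ m
     D≡ = trans (cong₂ (λ a b → a + i * b) (⟦shift⟧ start i η) (⟦shift⟧ (chunkWidth) i η)) (symm e)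
    body : ⟦ genItems header (con 0) ⟧ᴳ w η ++ _ ≡ text 0 (formula w)
    body = trans (cong (⟦ genItems header (con 0) ⟧ᴳ w η ++_)
     (trans (cong (concatUpTo (⟦ count ⟧ᴱ η) (λ i → ⟦ genItems chunk (shift start ⊕ var zero ⊗ shift (chunkWidth)) ⟧ᴳ w (i ∷ η)) ++_)
       (⟦genSch⟧ final (start ⊕ count ⊗ chunkWidth) w η))
      (go (⟦ count ⟧ᴱ η) 0 (⟦ start ⟧ᴱ η) (symm (+-identityʳ (⟦ start ⟧ᴱ η))) (λ j → refl) (λ j → refl))))
     (⟦genItems⟧ header (con 0) w η (iterateQ (⟦ count ⟧ᴱ η) F (⟦ final ⟧ˢ w η)))

-- An expression in the length of the input, usable under any number of loops.
record Term : Set where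
 field
  expr : Fin v → Expr v
  value : ℕ → ℕ
  correct : ∀ (x : Fin v) η → ⟦ expr x ⟧ᴱ η ≡ value (lookup η x)

open Term

constᵀ : ℕ → Term
constᵀ c = record { expr = λ _ → con c ; value = λ _ → c ; correct = λ _ _ → refl }

_+ᵀ_ _*ᵀ_ : Term → Term → Term
s +ᵀ t = record { expr = λ x → expr s x ⊕ expr t x ; value = λ n → value s n + value t n ; correct = λ x η → cong₂ _+_ (correct s x η) (correct t x η) }
s *ᵀ t = record { expr = λ x → expr s x ⊗ expr t x ; value = λ n → value s n * value t n ; correct = λ x η → cong₂ _*_ (correct s x η) (correct t x η) }

lengthᵀ : Term
lengthᵀ = record { expr = var ; value = id ; correct = λ _ _ → refl }

polyᵀ : Polynomial → Term
polyᵀ [] = constᵀ 0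
polyᵀ (a ∷ p) = constᵀ a +ᵀ (lengthᵀ *ᵀ polyᵀ p)

poly-value : ∀ p n → value (polyᵀ p) n ≡ eval p n
poly-value [] n = refl
poly-value (a ∷ p) n = cong (λ z → a + n * z) (poly-value p n)

get-++ˡ : {A : Set} (xs ys : List A) {i : ℕ} → i < length xs → get (xs ++ ys) i ≡ get xs i
get-++ˡ (x ∷ xs) ys {zero} lt = refl
get-++ˡ (x ∷ xs) ys {suc i} (s≤s lt) = get-++ˡ xs ys lt

get-++ʳ : {A : Set} (xs ys : List A) (i : ℕ) → get (xs ++ ys) (length xs + i) ≡ get ys i
get-++ʳ [] ys i = refl
get-++ʳ (x ∷ xs) ys i = get-++ʳ xs ys i

infixr 5 _▸_
_▸_ : {A : Set} → List A → (ℕ → A) → ℕ → A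
([] ▸ s) e = s e
((x ∷ u) ▸ s) zero = x
((x ∷ u) ▸ s) (suc e) = (u ▸ s) e

map-▸ : ∀ {A B : Set} (h : A → B) u s e → h ((u ▸ s) e) ≡ (map h u ▸ (h ∘ s)) e
map-▸ h [] s e = refl
map-▸ h (x ∷ u) s zero = refl
map-▸ h (x ∷ u) s (suc e) = map-▸ h u s e

-- Blocks of m · L existential variables, read as m sequences of L bits.
module Blocks (k m : ℕ) (R : Term) where

 L : ℕ → ℕ
 L n = suc (suc (value R n))

 Lᵀ W : Term
 Lᵀ = constᵀ 2 +ᵀ R
 W = constᵀ m *ᵀ Lᵀ

 cell : ℕ → ℕ → Fin m → ℕ → ℕ
 cell n b κ e = b + (toℕ κ * L n + e)

 addr : Term → Fin m → Fin v → Expr v → Expr v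
 addr b κ x e = expr b x ⊕ (con (toℕ κ) ⊗ expr Lᵀ x ⊕ e)

 ⟦addr⟧ : ∀ {v} b κ (x : Fin v) e η → ⟦ addr b κ x e ⟧ᴱ η ≡ cell (lookup η x) (value b (lookup η x)) κ (⟦ e ⟧ᴱ η)
 ⟦addr⟧ b κ x e η = cong₂ (λ β l → β + (toℕ κ * l + ⟦ e ⟧ᴱ η)) (correct b x η) (correct Lᵀ x η)

 cell-bound : ∀ n b κ {e} → e < L n → cell n b κ e < b + value W n
 cell-bound n b κ {e} lt = ≤-trans (≡⇒≥ (+-suc b _)) (+-monoʳ-≤ b (≤-trans
  (≤-trans (≡⇒≤ (trans (symm (+-suc _ e)) (+-comm _ (suc e)))) (+-monoˡ-≤ (toℕ κ * L n) lt)) (*-monoˡ-≤ (L n) (toℕ<n κ))))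

 Bit : List Bool → ℕ → ℕ → Fin m → ℕ → Bool → Set
 Bit ρ n b κ e x = get ρ (cell n b κ e) ≡ just x

 record Holds (ρ : List Bool) (n b : ℕ) (f : Fin m → ℕ → Bool) : Set where
  constructor holds
  field holdsAt : ∀ κ e → e < L n → Bit ρ n b κ e (f κ e)

 open Holds public

 encodeBlock : ∀ {m} → ℕ → (Fin m → ℕ → Bool) → List Bool
 encodeBlock {zero} l f = []
 encodeBlock {suc m} l f = applyUpTo (f zero) l ++ encodeBlock l (f ∘ suc)

 length-encodeBlock : ∀ {m} l (f : Fin m → ℕ → Bool) → length (encodeBlock l f) ≡ m * l
 length-encodeBlock {zero} l f = refl
 length-encodeBlock {suc m} l f = trans (length-++ (applyUpTo (f zero) l)) (cong₂ _+_ (length-applyUpTo (f zero) l) (length-encodeBlock l (f ∘ suc)))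

 get-encodeBlock : ∀ {m} l (f : Fin m → ℕ → Bool) κ {e} → e < l → get (encodeBlock l f) (toℕ κ * l + e) ≡ just (f κ e)
 get-encodeBlock l f zero {e} lt = trans (get-++ˡ (applyUpTo (f zero) l) _ (subst (e <_) (symm (length-applyUpTo (f zero) l)) lt)) (go (f zero) l lt)
  where
  go : ∀ (f : ℕ → Bool) l {e} → e < l → get (applyUpTo f l) e ≡ just (f e)
  go f (suc l) {zero} lt = refl
  go f (suc l) {suc e} (s≤s lt) = go (f ∘ suc) l lt
 get-encodeBlock {suc m} l f (suc κ) {e} lt = trans
  (cong (get (applyUpTo (f zero) l ++ encodeBlock l (f ∘ suc)))
   (trans (+-assoc l (toℕ κ * l) e) (cong (_+ (toℕ κ * l + e)) (symm (length-applyUpTo (f zero) l)))))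
  (trans (get-++ʳ (applyUpTo (f zero) l) _ (toℕ κ * l + e)) (get-encodeBlock l (f ∘ suc) κ lt))

 true-quants : ∀ {ρ} n q → True ρ (quantTimes n exists q) ⇔ (Σ[ v ∈ List Bool ] length v ≡ n × True (v ++ ρ) q)
 true-quants zero q = mk⇔ (λ t → [] , refl , t) (λ { ([] , _ , t) → t })
 true-quants {ρ} (suc n) q = mk⇔
  (λ (b , t) → let v , e , t′ = to (true-quants n q) t in
   v ++ b ∷ [] , trans (length-++ v) (trans (+-comm _ 1) (cong suc e)) , subst (λ z → True z q) (symm (++-assoc v (b ∷ []) ρ)) t′)
  (λ (v , e , t) → back v e t) where
  split : ∀ (v : List Bool) {n} → length v ≡ suc n → Σ[ u ∈ List Bool ] Σ[ b ∈ Bool ] v ≡ u ++ b ∷ [] × length u ≡ n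
  split (x ∷ []) refl = [] , x , refl , refl
  split (x ∷ y ∷ v) {suc n} e with split (y ∷ v) {n} (cong pred e)
  ... | u , b , e′ , l = x ∷ u , b , cong (x ∷_) e′ , cong suc l
  back : ∀ v → length v ≡ suc n → True (v ++ ρ) q → ∃[ b ] True (b ∷ ρ) (quantTimes n exists q)
  back v e t with split v e
  ... | u , b , refl , l = b , from (true-quants n q) (u , l , subst (λ z → True z q) (++-assoc u (b ∷ []) ρ) t)

 holds-new : ∀ {n b f} ρ u → length u ≡ b → Holds (u ++ encodeBlock (L n) f ++ ρ) n b f
 holds-new {n} {b} {f} ρ u refl = holds λ κ e lt → trans (get-++ʳ u _ (toℕ κ * L n + e))
  (trans (get-++ˡ (encodeBlock (L n) f) ρ (≤-trans (cell-bound n 0 κ lt) (≡⇒≥ (length-encodeBlock (L n) f))))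
   (get-encodeBlock (L n) f κ lt))

 holds-strengthen : ∀ {ρ n b f} u {b′} → b′ ≡ length u + b → Holds (u ++ ρ) n b′ f → Holds ρ n b f
 holds-strengthen {ρ} {n} {b} u refl h = holds λ κ e lt → trans (symm (get-++ʳ u ρ _)) (trans (cong (get (u ++ ρ)) (symm (+-assoc (length u) b _))) (holdsAt h κ e lt))

 holds-weaken : ∀ {ρ n b f} u {b′} → b′ ≡ length u + b → Holds ρ n b f → Holds (u ++ ρ) n b′ f
 holds-weaken {ρ} {n} {b} u refl h = holds λ κ e lt → trans (cong (get (u ++ ρ)) (+-assoc (length u) b _)) (trans (get-++ʳ u ρ _) (holdsAt h κ e lt))

 bit : Bool → Expr v → Sch k v
 bit = lit exists

 record ⊩ (ρ : List Bool) (w : Word k) {v : ℕ} (η : Vec ℕ v) (s : Sch k v) : Set where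
  constructor ⟨_⟩
  field truth : True ρ (⟦ s ⟧ˢ w η)

 open ⊩ public

 record Closedˢ (U : Quantifier → Set) (Γ : List Quantifier) (w : Word k) {v : ℕ} (η : Vec ℕ v) (s : Sch k v) : Set where
  constructor ⟨_⟩
  field closed : Scoped U Γ (⟦ s ⟧ˢ w η)

 open Closedˢ public

 iff : Expr v → Expr v → Sch k v
 iff i j = or (and (bit true i) (bit true j)) (and (bit false i) (bit false j))

 andFin : ∀ {v} n → (Fin n → Sch k v) → Sch k v → Sch k v
 andFin zero F r = r
 andFin (suc n) F r = and (F zero) (andFin n (F ∘ suc) r)

 orList : ∀ {A : Set} → List A → (A → Sch k v) → Sch k v → Sch k v
 orList [] F r = r
 orList (x ∷ xs) F r = or (F x) (orList xs F r)

 -- Tautology and contradiction in variable 0, which is always existential here.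
 ⊤ˢ ⊥ˢ : Sch k v
 ⊤ˢ = or (bit true (con 0)) (bit false (con 0))
 ⊥ˢ = and (bit true (con 0)) (bit false (con 0))

 variable η : Vec ℕ v

 module _ {ρ : List Bool} {w : Word k} where

  ⊩-bit : ∀ {x i} → ⊩ ρ w η (bit x i) ⇔ get ρ (⟦ i ⟧ᴱ η) ≡ just x
  ⊩-bit = mk⇔ truth ⟨_⟩

  ⊩-and : ∀ {s r} → ⊩ ρ w η (and s r) ⇔ (⊩ ρ w η s × ⊩ ρ w η r)
  ⊩-and = mk⇔ (λ { ⟨ t , t′ ⟩ → ⟨ t ⟩ , ⟨ t′ ⟩ }) (λ { (⟨ t ⟩ , ⟨ t′ ⟩) → ⟨ t , t′ ⟩ })

  ⊩-⋀ : ∀ {e s r} → ⊩ ρ w η (⋀ e s r) ⇔ ((∀ i → i < ⟦ e ⟧ᴱ η → ⊩ ρ w (i ∷ η) s) × ⊩ ρ w η r)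
  ⊩-⋀ {η = η} {e} = mk⇔
   (λ { ⟨ t ⟩ → let f , t′ = to (true-conj (⟦ e ⟧ᴱ η)) t in (λ i lt → ⟨ f i lt ⟩) , ⟨ t′ ⟩ })
   (λ { (f , ⟨ t ⟩) → ⟨ from (true-conj (⟦ e ⟧ᴱ η)) ((λ i lt → truth (f i lt)) , t) ⟩ })

  ⊩-iff : ∀ {i j} → ⊩ ρ w η (iff i j) ⇔ (∃[ x ] get ρ (⟦ i ⟧ᴱ η) ≡ just x × get ρ (⟦ j ⟧ᴱ η) ≡ just x)
  ⊩-iff = mk⇔ (λ { ⟨ inj₁ (p , q) ⟩ → true , p , q ; ⟨ inj₂ (p , q) ⟩ → false , p , q })
   (λ { (true , p , q) → ⟨ inj₁ (p , q) ⟩ ; (false , p , q) → ⟨ inj₂ (p , q) ⟩ })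

  ⊩-andFin : ∀ {n F r} → ⊩ ρ w η (andFin n F r) ⇔ ((∀ i → ⊩ ρ w η (F i)) × ⊩ ρ w η r)
  ⊩-andFin {n = zero} = mk⇔ (λ t → (λ ()) , t) proj₂
  ⊩-andFin {n = suc n} = mk⇔
   (λ { ⟨ t , t′ ⟩ → let f , s = to (⊩-andFin {n = n}) ⟨ t′ ⟩ in (λ { zero → ⟨ t ⟩ ; (suc i) → f i }) , s })
   (λ (f , s) → ⟨ truth (f zero) , truth (from (⊩-andFin {n = n}) (f ∘ suc , s)) ⟩)

  ⊩-orList : ∀ {A : Set} {xs : List A} {F r} →
    ⊩ ρ w η (orList xs F r) ⇔ ((∃[ x ] x ∈ xs × ⊩ ρ w η (F x)) ⊎ ⊩ ρ w η r)
  ⊩-orList {xs = []} = mk⇔ inj₂ (λ { (inj₁ (_ , () , _)) ; (inj₂ t) → t })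
  ⊩-orList {η = η} {xs = x ∷ xs} {F} {r} = mk⇔
   (λ { ⟨ inj₁ t ⟩ → inj₁ (x , here refl , ⟨ t ⟩) ; ⟨ inj₂ t ⟩ → later (to (⊩-orList {xs = xs}) ⟨ t ⟩) })
   (λ { (inj₁ (_ , here refl , ⟨ t ⟩)) → ⟨ inj₁ t ⟩ ; (inj₁ (y , there m , t)) → ⟨ inj₂ (truth (from (⊩-orList {xs = xs} {F} {r}) (inj₁ (y , m , t)))) ⟩
     ; (inj₂ t) → ⟨ inj₂ (truth (from (⊩-orList {xs = xs} {F} {r}) (inj₂ t))) ⟩ }) where
   later : (∃[ y ] y ∈ xs × ⊩ ρ w η (F y)) ⊎ ⊩ ρ w η r → (∃[ y ] y ∈ x ∷ xs × ⊩ ρ w η (F y)) ⊎ ⊩ ρ w η r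
   later (inj₁ (y , m , p)) = inj₁ (y , there m , p)
   later (inj₂ q) = inj₂ q

  ⊮-⊥ : ¬ ⊩ ρ w η ⊥ˢ
  ⊮-⊥ ⟨ p , q ⟩ with trans (symm p) q
  ... | ()

 ⊩-⊤ : ∀ {b ρ w v} {η : Vec ℕ v} → ⊩ (b ∷ ρ) w η ⊤ˢ
 ⊩-⊤ {true} = ⟨ inj₁ refl ⟩
 ⊩-⊤ {false} = ⟨ inj₂ refl ⟩

 -- The variables below B are in scope and existential.
 record Available (Γ : List Quantifier) (B : ℕ) : Set where
  constructor available
  field
   nonempty : 0 < B
   scope : ∀ i → i < B → get Γ i ≡ just exists

 open Available public

 module _ {U : Quantifier → Set} {Γ : List Quantifier} {w : Word k} where

  closed-bit : ∀ {B x i} → Available Γ B → ⟦ i ⟧ᴱ η < B → Closedˢ U Γ w η (bit x i)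
  closed-bit a lt = ⟨ scope a _ lt ⟩

  closed-and : ∀ {s r} → Closedˢ U Γ w η s → Closedˢ U Γ w η r → Closedˢ U Γ w η (and s r)
  closed-and ⟨ s ⟩ ⟨ r ⟩ = ⟨ s , r ⟩

  closed-or : ∀ {s r} → Closedˢ U Γ w η s → Closedˢ U Γ w η r → Closedˢ U Γ w η (or s r)
  closed-or ⟨ s ⟩ ⟨ r ⟩ = ⟨ s , r ⟩

  closed-⋀ : ∀ {e s r} → (∀ i → i < ⟦ e ⟧ᴱ η → Closedˢ U Γ w (i ∷ η) s) → Closedˢ U Γ w η r → Closedˢ U Γ w η (⋀ e s r)
  closed-⋀ f ⟨ r ⟩ = ⟨ scoped-conj _ (λ i lt → closed (f i lt)) r ⟩

  closed-iff : ∀ {B i j} → Available Γ B → ⟦ i ⟧ᴱ η < B → ⟦ j ⟧ᴱ η < B → Closedˢ U Γ w η (iff i j)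
  closed-iff a p q = ⟨ (scope a _ p , scope a _ q) , (scope a _ p , scope a _ q) ⟩

  closed-⊤ : ∀ {B} → Available Γ B → Closedˢ U Γ w η ⊤ˢ
  closed-⊤ a = ⟨ scope a 0 (nonempty a) , scope a 0 (nonempty a) ⟩

  closed-⊥ : ∀ {B} → Available Γ B → Closedˢ U Γ w η ⊥ˢ
  closed-⊥ a = ⟨ scope a 0 (nonempty a) , scope a 0 (nonempty a) ⟩

  closed-andFin : ∀ {n F r} → (∀ i → Closedˢ U Γ w η (F i)) → Closedˢ U Γ w η r → Closedˢ U Γ w η (andFin n F r)
  closed-andFin {n = zero} f s = s
  closed-andFin {n = suc n} f s = closed-and (f zero) (closed-andFin {n = n} (f ∘ suc) s)

  closed-orList : ∀ {A : Set} {xs : List A} {F r} → (∀ x → Closedˢ U Γ w η (F x)) → Closedˢ U Γ w η r → Closedˢ U Γ w η (orList xs F r)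
  closed-orList {xs = []} f s = s
  closed-orList {xs = x ∷ xs} f s = closed-or (f x) (closed-orList {xs = xs} f s)

 addr-bound : ∀ {v B} (η : Vec ℕ v) b κ x e → value b (lookup η x) + value W (lookup η x) ≤ B → ⟦ e ⟧ᴱ η < L (lookup η x) →
   ⟦ addr b κ x e ⟧ᴱ η < B
 addr-bound {B = B} η b κ x e le lt =
  subst (_< B) (symm (⟦addr⟧ b κ x e η)) (≤-trans (cell-bound (lookup η x) (value b (lookup η x)) κ lt) le)

 opaque
  equalBlocks : Term → Term → Fin v → Sch k v
  equalBlocks b b′ x = andFin m (λ κ → ⋀ (expr Lᵀ x) (iff (addr b κ (suc x) (var zero)) (addr b′ κ (suc x) (var zero))) ⊤ˢ) ⊤ˢ

 record BlockEq (ρ : List Bool) (n b b′ : ℕ) : Set where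
  constructor blockEq
  field blockAt : ∀ κ e → e < L n → ∃[ x ] Bit ρ n b κ e x × Bit ρ n b′ κ e x

 open BlockEq public

 InScope : List Quantifier → ℕ → ℕ → Set
 InScope Γ n b = ∀ κ e → e < L n → get Γ (cell n b κ e) ≡ just exists

 available⇒inScope : ∀ {Γ B n} b → Available Γ B → b + value W n ≤ B → InScope Γ n b
 available⇒inScope {n = n} b a le κ e lt = scope a _ (≤-trans (cell-bound n b κ lt) le)

 inScope-weaken : ∀ {Γ n b} Δ {b′} → b′ ≡ length Δ + b → InScope Γ n b → InScope (Δ ++ Γ) n b′
 inScope-weaken {Γ} {n} {b} Δ refl h κ e lt = trans (cong (get (Δ ++ Γ)) (+-assoc (length Δ) b _)) (trans (get-++ʳ Δ Γ _) (h κ e lt))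

 module _ {v} {w : Word k} (η : Vec ℕ v) (x : Fin v) where

  private
   n = lookup η x

  opaque
   unfolding equalBlocks
   ⊩-equalBlocks : ∀ {h ρ} b b′ → ⊩ (h ∷ ρ) w η (equalBlocks b b′ x) ⇔ BlockEq (h ∷ ρ) n (value b n) (value b′ n)
   ⊩-equalBlocks {h} {ρ} b b′ = mk⇔
    (λ t → blockEq λ κ e lt → let y , p , q = to ⊩-iff (proj₁ (to ⊩-⋀ (proj₁ (to (⊩-andFin {n = m}) t) κ)) e (subst (e <_) (symm (correct Lᵀ x η)) lt)) in
     y , subst (λ i → get (h ∷ ρ) i ≡ just y) (⟦addr⟧ b κ (suc x) (var zero) (e ∷ η)) p
      , subst (λ i → get (h ∷ ρ) i ≡ just y) (⟦addr⟧ b′ κ (suc x) (var zero) (e ∷ η)) q)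
    (λ f → from (⊩-andFin {n = m}) ((λ κ → from ⊩-⋀ ((λ e lt →
      let y , p , q = blockAt f κ e (subst (e <_) (correct Lᵀ x η) lt) in
      from ⊩-iff (y , subst (λ i → get (h ∷ ρ) i ≡ just y) (symm (⟦addr⟧ b κ (suc x) (var zero) (e ∷ η))) p
        , subst (λ i → get (h ∷ ρ) i ≡ just y) (symm (⟦addr⟧ b′ κ (suc x) (var zero) (e ∷ η))) q)) , ⊩-⊤)) , ⊩-⊤))

  opaque
   unfolding equalBlocks
   closed-equalBlocks : ∀ {U Γ} → get Γ 0 ≡ just exists → ∀ b b′ → InScope Γ n (value b n) → InScope Γ n (value b′ n) →
     Closedˢ U Γ w η (equalBlocks b b′ x)
   closed-equalBlocks {U} {Γ} z b b′ h h′ = closed-andFin {n = m} (λ κ → closed-⋀ (λ e lt →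
    let p = subst (λ i → get Γ i ≡ just exists) (symm (⟦addr⟧ b κ (suc x) (var zero) (e ∷ η))) (h κ e (subst (e <_) (correct Lᵀ x η) lt))
        q = subst (λ i → get Γ i ≡ just exists) (symm (⟦addr⟧ b′ κ (suc x) (var zero) (e ∷ η))) (h′ κ e (subst (e <_) (correct Lᵀ x η) lt))
    in ⟨ (p , q) , (p , q) ⟩) ⟨ z , z ⟩) ⟨ z , z ⟩

 holds-equal : ∀ {ρ n b b′ f} → Holds ρ n b f → BlockEq ρ n b b′ → Holds ρ n b′ f
 holds-equal h q = holds λ κ e lt → let x , p , p′ = blockAt q κ e lt in trans p′ (trans (symm p) (holdsAt h κ e lt))

 blockEq-sym : ∀ {ρ n b b′} → BlockEq ρ n b b′ → BlockEq ρ n b′ b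
 blockEq-sym q = blockEq λ κ e lt → let x , p , p′ = blockAt q κ e lt in x , p′ , p

 equal-holds : ∀ {ρ n b b′ f} → Holds ρ n b f → Holds ρ n b′ f → BlockEq ρ n b b′
 equal-holds {f = f} h h′ = blockEq λ κ e lt → f κ e , holdsAt h κ e lt , holdsAt h′ κ e lt

 Rᵀ⁺ : Term
 Rᵀ⁺ = constᵀ 1 +ᵀ R

 -- Sequence κ of block t is that of block s with its first bit replaced by the
 -- word u; at the far end x, the value beyond the block, is shifted in.
 pushed : List Bool → Bool → Term → Term → Fin m → Fin v → Sch k v
 pushed [] y s t κ x = ⋀ (expr Rᵀ⁺ x) (iff (addr t κ (suc x) (var zero)) (addr s κ (suc x) (con 1 ⊕ var zero)))
   (bit y (addr t κ x (expr Rᵀ⁺ x)))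
 pushed (b ∷ []) y s t κ x = ⋀ (expr Rᵀ⁺ x) (iff (addr t κ (suc x) (con 1 ⊕ var zero)) (addr s κ (suc x) (con 1 ⊕ var zero)))
   (bit b (addr t κ x (con 0)))
 pushed (b ∷ c ∷ _) y s t κ x = ⋀ (expr R x) (iff (addr t κ (suc x) (con 2 ⊕ var zero)) (addr s κ (suc x) (con 1 ⊕ var zero)))
   (and (bit b (addr t κ x (con 0))) (bit c (addr t κ x (con 1))))

 module _ {v} {w : Word k} (η : Vec ℕ v) (x : Fin v) (s t : Term) (κ : Fin m) where

  private
   n = lookup η x

  module _ {ρ : List Bool} (f : ℕ → Bool) (src : ∀ e → e < L n → Bit ρ n (value s n) κ e (f e)) where

   private
    Target : ℕ → Bool → Set
    Target = Bit ρ n (value t n) κ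
    at-t : ∀ {y} e → get ρ (⟦ addr t κ x e ⟧ᴱ η) ≡ just y ⇔ Target (⟦ e ⟧ᴱ η) y
    at-t {y} e = mk⇔ (subst (λ i → get ρ i ≡ just y) (⟦addr⟧ t κ x e η)) (subst (λ i → get ρ i ≡ just y) (symm (⟦addr⟧ t κ x e η)))
    copies : ∀ i e e′ → ⟦ e′ ⟧ᴱ (i ∷ η) < L n →
      ⊩ ρ w (i ∷ η) (iff (addr t κ (suc x) e) (addr s κ (suc x) e′)) ⇔ Target (⟦ e ⟧ᴱ (i ∷ η)) (f (⟦ e′ ⟧ᴱ (i ∷ η)))
    copies i e e′ lt = mk⇔
     (λ h → let y , p , q = to ⊩-iff h in
       trans (subst (λ j → get ρ j ≡ just y) (⟦addr⟧ t κ (suc x) e (i ∷ η)) p)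
        (trans (symm (subst (λ j → get ρ j ≡ just y) (⟦addr⟧ s κ (suc x) e′ (i ∷ η)) q)) (src (⟦ e′ ⟧ᴱ (i ∷ η)) lt)))
     (λ h → from ⊩-iff (f (⟦ e′ ⟧ᴱ (i ∷ η)) ,
       subst (λ j → get ρ j ≡ just (f (⟦ e′ ⟧ᴱ (i ∷ η)))) (symm (⟦addr⟧ t κ (suc x) e (i ∷ η))) h ,
       subst (λ j → get ρ j ≡ just (f (⟦ e′ ⟧ᴱ (i ∷ η)))) (symm (⟦addr⟧ s κ (suc x) e′ (i ∷ η))) (src (⟦ e′ ⟧ᴱ (i ∷ η)) lt)))
    R≡ : ⟦ expr R x ⟧ᴱ η ≡ value R n
    R≡ = correct R x η
    R⁺≡ : ⟦ expr Rᵀ⁺ x ⟧ᴱ η ≡ suc (value R n)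
    R⁺≡ = cong suc R≡
   ⊩-pushed : ∀ u {y} → f (L n) ≡ y → length u ≤ 2 → ⊩ ρ w η (pushed u y s t κ x) ⇔ (∀ e → e < L n → Target e ((u ▸ (f ∘ suc)) e))
   ⊩-pushed [] {y} last le = mk⇔
    (λ h e lt → let c , z = to ⊩-⋀ h in split c z e (m≤n⇒m<n∨m≡n (s≤s⁻¹ lt)))
    (λ h → from ⊩-⋀ ((λ i lt → from (copies i (var zero) (con 1 ⊕ var zero) (s≤s (lt′ lt))) (h i (m≤n⇒m≤1+n (lt′ lt)))) ,
     from ⊩-bit (from (at-t (expr Rᵀ⁺ x)) (subst (λ i → Target i y) (symm R⁺≡) (trans (h (suc (value R n)) ≤-refl) (cong just last))))))
    where
    lt′ : ∀ {i} → i < ⟦ expr Rᵀ⁺ x ⟧ᴱ η → i < suc (value R n)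
    lt′ {i} = subst (i <_) R⁺≡
    split : _ → _ → ∀ e → e < suc (value R n) ⊎ e ≡ suc (value R n) → Target e (f (suc e))
    split c z e (inj₁ lt) = to (copies e (var zero) (con 1 ⊕ var zero) (s≤s lt)) (c e (subst (e <_) (symm R⁺≡) lt))
    split c z e (inj₂ refl) = trans (subst (λ i → Target i y) R⁺≡ (to (at-t (expr Rᵀ⁺ x)) (to ⊩-bit z))) (cong just (symm last))
   ⊩-pushed (b ∷ []) last le = mk⇔
    (λ { h zero lt → to (at-t (con 0)) (to ⊩-bit (proj₂ (to ⊩-⋀ h)))
      ; h (suc e) lt → to (copies e (con 1 ⊕ var zero) (con 1 ⊕ var zero) lt) (proj₁ (to ⊩-⋀ h) e (subst (e <_) (symm R⁺≡) (s≤s⁻¹ lt))) })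
    (λ h → from ⊩-⋀ ((λ i lt → from (copies i (con 1 ⊕ var zero) (con 1 ⊕ var zero) (s≤s (subst (i <_) R⁺≡ lt)))
      (h (suc i) (s≤s (subst (i <_) R⁺≡ lt)))) , from ⊩-bit (from (at-t (con 0)) (h 0 z<s))))
   ⊩-pushed (b ∷ c ∷ []) last le = mk⇔
    (λ { h zero lt → to (at-t (con 0)) (to ⊩-bit (proj₁ (to ⊩-and (proj₂ (to ⊩-⋀ h)))))
      ; h (suc zero) lt → to (at-t (con 1)) (to ⊩-bit (proj₂ (to ⊩-and (proj₂ (to ⊩-⋀ h)))))
      ; h (suc (suc e)) lt → to (copies e (con 2 ⊕ var zero) (con 1 ⊕ var zero) (≤-trans (n≤1+n _) lt))
        (proj₁ (to ⊩-⋀ h) e (subst (e <_) (symm R≡) (s≤s⁻¹ (s≤s⁻¹ lt)))) })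
    (λ h → from ⊩-⋀ ((λ i lt → from (copies i (con 2 ⊕ var zero) (con 1 ⊕ var zero) (s≤s (m≤n⇒m≤1+n (subst (i <_) R≡ lt))))
      (h (suc (suc i)) (s≤s (s≤s (subst (i <_) R≡ lt))))) ,
     from ⊩-and (from ⊩-bit (from (at-t (con 0)) (h 0 z<s)) , from ⊩-bit (from (at-t (con 1)) (h 1 (s≤s z<s))))))
   ⊩-pushed (b ∷ c ∷ d ∷ u) last (s≤s (s≤s ()))

  closed-pushed : ∀ {U Γ B} → Available Γ B → value s n + value W n ≤ B → value t n + value W n ≤ B →
    ∀ u y → Closedˢ U Γ w η (pushed u y s t κ x)
  closed-pushed a le le′ [] y = closed-⋀
   (λ e lt → closed-iff a (addr-bound (e ∷ η) t κ (suc x) (var zero) le′ (m≤n⇒m≤1+n (subst (e <_) (correct Rᵀ⁺ x η) lt)))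
     (addr-bound (e ∷ η) s κ (suc x) (con 1 ⊕ var zero) le (s≤s (subst (e <_) (correct Rᵀ⁺ x η) lt))))
   (closed-bit a (addr-bound η t κ x (expr Rᵀ⁺ x) le′ (≡⇒≤ (cong suc (correct Rᵀ⁺ x η)))))
  closed-pushed a le le′ (b ∷ []) y = closed-⋀
   (λ e lt → closed-iff a (addr-bound (e ∷ η) t κ (suc x) (con 1 ⊕ var zero) le′ (s≤s (subst (e <_) (correct Rᵀ⁺ x η) lt)))
     (addr-bound (e ∷ η) s κ (suc x) (con 1 ⊕ var zero) le (s≤s (subst (e <_) (correct Rᵀ⁺ x η) lt))))
   (closed-bit a (addr-bound η t κ x (con 0) le′ z<s))
  closed-pushed a le le′ (b ∷ c ∷ _) y = closed-⋀
   (λ e lt → closed-iff a (addr-bound (e ∷ η) t κ (suc x) (con 2 ⊕ var zero) le′ (s≤s (s≤s (subst (e <_) (correct R x η) lt))))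
     (addr-bound (e ∷ η) s κ (suc x) (con 1 ⊕ var zero) le (s≤s (m≤n⇒m≤1+n (subst (e <_) (correct R x η) lt)))))
   (closed-and (closed-bit a (addr-bound η t κ x (con 0) le′ z<s)) (closed-bit a (addr-bound η t κ x (con 1) le′ (s≤s z<s))))

open Term

allVecs : ∀ m n → List (Vec (Fin m) n)
allVecs m zero = [] ∷ []
allVecs m (suc n) = cartesianProductWith _∷_ (allFin m) (allVecs m n)

∈-allVecs : ∀ {m n} (v : Vec (Fin m) n) → v ∈ allVecs m n
∈-allVecs [] = here refl
∈-allVecs (x ∷ v) = ∈-cartesianProductWith⁺ _∷_ (∈-allFin x) (∈-allVecs v)

allSymbols : ∀ k → List (InputSymbol k)
allSymbols k = ⊢ ∷ ⊣ ∷ map sym (allFin k)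

∈-allSymbols : ∀ {k} (a : InputSymbol k) → a ∈ allSymbols k
∈-allSymbols ⊢ = here refl
∈-allSymbols ⊣ = there (here refl)
∈-allSymbols (sym a) = there (there (∈-map⁺ sym (∈-allFin a)))

module Encoding {k : ℕ} (M : Acceptor k) (R : Term) where

 open Machine M

 G r m : ℕ
 G = #states + ((2 + k) + suc #symbols)
 r = 3 + (#tapes + #tapes)
 m = r * G

 codeS : Fin #states → Fin G
 codeS s = s ↑ˡ ((2 + k) + suc #symbols)

 symbolIndex : InputSymbol k → Fin (2 + k)
 symbolIndex ⊢ = zero
 symbolIndex ⊣ = suc zero
 symbolIndex (sym a) = suc (suc a)

 codeI : InputSymbol k → Fin G
 codeI a = #states ↑ʳ (symbolIndex a ↑ˡ suc #symbols)

 codeW : Fin (suc #symbols) → Fin G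
 codeW x = #states ↑ʳ ((2 + k) ↑ʳ x)

 codeS-injective : ∀ {s s′} → codeS s ≡ codeS s′ → s ≡ s′
 codeS-injective = ↑ˡ-injective _ _ _

 codeI-injective : ∀ {a a′} → codeI a ≡ codeI a′ → a ≡ a′
 codeI-injective e = go _ _ (↑ˡ-injective _ _ _ (↑ʳ-injective #states _ _ e)) where
  go : ∀ a a′ → symbolIndex a ≡ symbolIndex a′ → a ≡ a′
  go ⊢ ⊢ e = refl
  go ⊣ ⊣ e = refl
  go (sym a) (sym a′) e = cong sym (FinP.suc-injective (FinP.suc-injective e))

 codeW-injective : ∀ {x x′} → codeW x ≡ codeW x′ → x ≡ x′
 codeW-injective e = ↑ʳ-injective (2 + k) _ _ (↑ʳ-injective #states _ _ e)

 -- A configuration is kept as streams of symbols, each starting at the head.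
 data Track : Set where
  control before after : Track
  leftOf rightOf : Fin #tapes → Track

 trackOf : Fin r → Track
 trackOf zero = control
 trackOf (suc zero) = before
 trackOf (suc (suc zero)) = after
 trackOf (suc (suc (suc j))) with splitAt #tapes j
 ... | inj₁ i = leftOf i
 ... | inj₂ i = rightOf i

 rank : Track → Fin r
 rank control = zero
 rank before = suc zero
 rank after = suc (suc zero)
 rank (leftOf i) = suc (suc (suc (i ↑ˡ #tapes)))
 rank (rightOf i) = suc (suc (suc (#tapes ↑ʳ i)))

 trackOf-rank : ∀ τ → trackOf (rank τ) ≡ τ
 trackOf-rank control = refl
 trackOf-rank before = refl
 trackOf-rank after = refl
 trackOf-rank (leftOf i) rewrite splitAt-↑ˡ #tapes i #tapes = refl
 trackOf-rank (rightOf i) rewrite splitAt-↑ʳ #tapes #tapes i = refl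

 filler : Fin G
 filler = codeI ⊢

 works-of : Config → Fin #tapes → Tape #symbols
 works-of c i = lookup (works c) i

 stream : Word k → Config → Track → ℕ → Fin G
 stream w c control zero = codeS (state c)
 stream w c control (suc e) = filler
 stream w c before e = codeI (readInput w (position c ∸ suc e))
 stream w c after e = codeI (readInput w (position c + e))
 stream w c (leftOf i) e = codeW (at (Tape.before (works-of c i)) zero e)
 stream w c (rightOf i) zero = codeW (Tape.current (works-of c i))
 stream w c (rightOf i) (suc e) = codeW (at (Tape.after (works-of c i)) zero e)

 beyond : Track → Fin G
 beyond control = filler
 beyond before = codeI ⊢
 beyond after = codeI ⊣
 beyond (leftOf i) = codeW zero
 beyond (rightOf i) = codeW zero

 record Rule : Set where
  field
   guard : Track → Fin G
   push : Track → List (Fin G)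

 record View : Set where
  constructor view
  field
   vState : Fin #states
   vLeft vHere : InputSymbol k
   vLefts vHeres : Vec (Fin (suc #symbols)) #tapes

 open View

 guardOf : View → Track → Fin G
 guardOf v control = codeS (vState v)
 guardOf v before = codeI (vLeft v)
 guardOf v after = codeI (vHere v)
 guardOf v (leftOf i) = codeW (lookup (vLefts v) i)
 guardOf v (rightOf i) = codeW (lookup (vHeres v) i)

 -- The input head stays put when it is told to leave the marked input.
 effective : InputSymbol k → Move → Move
 effective ⊢ left = stay
 effective ⊣ right = stay
 effective a mv = mv

 pushLeft pushRight : {A : Set} → Move → A → A → List A
 pushLeft left l x = []
 pushLeft stay l x = l ∷ []
 pushLeft right l x = x ∷ l ∷ []
 pushRight left l x = l ∷ x ∷ []
 pushRight stay l x = x ∷ []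
 pushRight right l x = []

 Act : Set
 Act = Action k 0 #states #tapes #symbols

 ruleOf : View → Act → Rule
 ruleOf v a = record { guard = guardOf v ; push = λ
  { control → codeS (Action.nextState a) ∷ []
  ; before → pushLeft (effective (vHere v) (Action.inputMove a)) (codeI (vLeft v)) (codeI (vHere v))
  ; after → pushRight (effective (vHere v) (Action.inputMove a)) (codeI (vLeft v)) (codeI (vHere v))
  ; (leftOf i) → pushLeft (proj₂ (lookup (Action.workMoves a) i)) (codeW (lookup (vLefts v) i)) (codeW (proj₁ (lookup (Action.workMoves a) i)))
  ; (rightOf i) → pushRight (proj₂ (lookup (Action.workMoves a) i)) (codeW (lookup (vLefts v) i)) (codeW (proj₁ (lookup (Action.workMoves a) i))) } }

 headOf : List (Fin (suc #symbols)) → Fin (suc #symbols)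
 headOf xs = at xs zero 0

 viewOf : Word k → Config → View
 viewOf w c = view (state c) (readInput w (position c ∸ 1)) (readInput w (position c))
  (Vec.map (headOf ∘ Tape.before) (works c)) (Vec.map Tape.current (works c))

 allViews : List View
 allViews = cartesianProductWith (λ f x → f x)
  (cartesianProductWith (λ f x → f x)
   (cartesianProductWith (λ f x → f x)
    (cartesianProductWith (λ s l → view s l) (allFin #states) (allSymbols k))
    (allSymbols k))
   (allVecs (suc #symbols) #tapes))
  (allVecs (suc #symbols) #tapes)

 ∈-allViews : ∀ v → v ∈ allViews
 ∈-allViews (view s l a ls xs) = ∈-cartesianProductWith⁺ (λ f x → f x)
  (∈-cartesianProductWith⁺ (λ f x → f x)
   (∈-cartesianProductWith⁺ (λ f x → f x)
    (∈-cartesianProductWith⁺ (λ s l → view s l) (∈-allFin s) (∈-allSymbols l)) (∈-allSymbols a))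
   (∈-allVecs ls)) (∈-allVecs xs)

 actionsOf : View → List Act
 actionsOf v = δ (vState v) (vHere v) (vHeres v)

 guard-stream : ∀ w c v → (∀ τ → guardOf v τ ≡ stream w c τ 0) → v ≡ viewOf w c
 guard-stream w c (view s l a ls xs) h
  with codeS-injective (h control) | codeI-injective {a′ = readInput w (position c ∸ 1)} (h before) | codeI-injective {a′ = readInput w (position c)} (trans (h after) (cong (λ p → codeI (readInput w p)) (+-identityʳ (position c))))
    | same ls (Vec.map (headOf ∘ Tape.before) (works c)) (λ i → trans (codeW-injective (h (leftOf i))) (symm (lookup-map i (headOf ∘ Tape.before) (works c))))
    | same xs (Vec.map Tape.current (works c)) (λ i → trans (codeW-injective (h (rightOf i))) (symm (lookup-map i Tape.current (works c))))
  where
  same : ∀ {n} (xs ys : Vec (Fin (suc #symbols)) n) → (∀ i → lookup xs i ≡ lookup ys i) → xs ≡ ys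
  same xs ys h = trans (symm (tabulate∘lookup xs)) (trans (tabulate-cong h) (tabulate∘lookup ys))
 ... | refl | refl | refl | refl | refl = refl

 guard-view : ∀ w c τ → guardOf (viewOf w c) τ ≡ stream w c τ 0
 guard-view w c control = refl
 guard-view w c before = refl
 guard-view w c after = cong (λ p → codeI (readInput w p)) (symm (+-identityʳ (position c)))
 guard-view w c (leftOf i) = cong codeW (lookup-map i (headOf ∘ Tape.before) (works c))
 guard-view w c (rightOf i) = cong codeW (lookup-map i Tape.current (works c))

 at-move-left : ∀ mv x (t : Tape #symbols) e →
  codeW (at (Tape.before (moveTape mv (write x t))) zero e) ≡
  (pushLeft mv (codeW (headOf (Tape.before t))) (codeW x) ▸ (λ e → codeW (at (Tape.before t) zero (suc e)))) e
 at-move-left left x (tape [] a rs) e = refl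
 at-move-left left x (tape (l ∷ ls) a rs) e = refl
 at-move-left stay x (tape ls a rs) zero = refl
 at-move-left stay x (tape ls a rs) (suc e) = refl
 at-move-left right x (tape ls a []) zero = refl
 at-move-left right x (tape ls a []) (suc zero) = refl
 at-move-left right x (tape ls a []) (suc (suc e)) = refl
 at-move-left right x (tape ls a (y ∷ rs)) zero = refl
 at-move-left right x (tape ls a (y ∷ rs)) (suc zero) = refl
 at-move-left right x (tape ls a (y ∷ rs)) (suc (suc e)) = refl

 rights-of : Tape #symbols → ℕ → Fin G
 rights-of t zero = codeW (Tape.current t)
 rights-of t (suc e) = codeW (at (Tape.after t) zero e)

 at-move-right : ∀ mv x (t : Tape #symbols) e →
  rights-of (moveTape mv (write x t)) e ≡
  (pushRight mv (codeW (headOf (Tape.before t))) (codeW x) ▸ (λ e → codeW (at (Tape.after t) zero e))) e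
 at-move-right left x (tape [] a rs) zero = refl
 at-move-right left x (tape [] a rs) (suc zero) = refl
 at-move-right left x (tape [] a rs) (suc (suc e)) = refl
 at-move-right left x (tape (l ∷ ls) a rs) zero = refl
 at-move-right left x (tape (l ∷ ls) a rs) (suc zero) = refl
 at-move-right left x (tape (l ∷ ls) a rs) (suc (suc e)) = refl
 at-move-right stay x (tape ls a rs) zero = refl
 at-move-right stay x (tape ls a rs) (suc e) = refl
 at-move-right right x (tape ls a []) zero = refl
 at-move-right right x (tape ls a []) (suc e) = refl
 at-move-right right x (tape ls a (y ∷ rs)) zero = refl
 at-move-right right x (tape ls a (y ∷ rs)) (suc e) = refl

 data InputCase (w : Word k) (mv : Move) (p : ℕ) : Set where
  moved-left : ∀ p′ → p ≡ suc p′ → moveInput w mv p ≡ p′ → effective (readInput w p) mv ≡ left → InputCase w mv p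
  stayed : moveInput w mv p ≡ p → effective (readInput w p) mv ≡ stay → InputCase w mv p
  moved-right : moveInput w mv p ≡ suc p → effective (readInput w p) mv ≡ right → InputCase w mv p

 read-past : ∀ (w : Word k) → readInput w (suc (length w)) ≡ ⊣
 read-past [] = refl
 read-past (a ∷ w) = go w where
  go : ∀ w → readInput w (suc (length w)) ≡ ⊣
  go [] = refl
  go (a ∷ w) = go w

 read-inside : ∀ (w : Word k) p → p < length w → ∃[ a ] readInput w (suc p) ≡ sym a
 read-inside (a ∷ w) zero lt = a , refl
 read-inside (a ∷ w) (suc p) (s≤s lt) = read-inside w p lt

 input-case : ∀ w mv p → p ≤ suc (length w) → InputCase w mv p
 input-case w left zero le = stayed refl refl
 input-case w stay zero le = stayed refl refl
 input-case w right zero le = moved-right refl refl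
 input-case w mv (suc p) (s≤s le) with m≤n⇒m<n∨m≡n le
 ... | inj₂ refl = at-end mv (read-past w) where
  at-end : ∀ mv → readInput w (suc (length w)) ≡ ⊣ → InputCase w mv (suc (length w))
  at-end left e = moved-left _ refl refl (cong (λ a → effective a left) e)
  at-end stay e = stayed refl (cong (λ a → effective a stay) e)
  at-end right e = stayed (cong suc (m≥n⇒m⊓n≡n (n≤1+n (length w)))) (cong (λ a → effective a right) e)
 ... | inj₁ lt = within mv (read-inside w p lt) where
  within : ∀ mv → ∃[ a ] readInput w (suc p) ≡ sym a → InputCase w mv (suc p)
  within left (a , e) = moved-left _ refl refl (cong (λ a → effective a left) e)
  within stay (a , e) = stayed refl (cong (λ a → effective a stay) e)
  within right (a , e) = moved-right (cong suc (m≤n⇒m⊓n≡m lt)) (cong (λ a → effective a right) e)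

 stream-step : ∀ w c a → position c ≤ suc (length w) → ∀ τ e →
  stream w (perform w c a) τ e ≡ (Rule.push (ruleOf (viewOf w c) a) τ ▸ (stream w c τ ∘ suc)) e
 stream-step w c a le control zero = refl
 stream-step w c a le control (suc e) = refl
 stream-step w c a le (leftOf i) e
  rewrite lookup-zipWith (λ (x , m) t → moveTape m (write x t)) i (Action.workMoves a) (works c)
    | lookup-map i (headOf ∘ Tape.before) (works c) = at-move-left (proj₂ act) (proj₁ act) (works-of c i) e
  where act = lookup (Action.workMoves a) i
 stream-step w c a le (rightOf i) e = trans (rights e) go where
  act = lookup (Action.workMoves a) i
  rights : ∀ e → stream w (perform w c a) (rightOf i) e ≡ rights-of (works-of (perform w c a) i) e
  rights zero = refl
  rights (suc e) = refl
  go : rights-of (works-of (perform w c a) i) e ≡ (Rule.push (ruleOf (viewOf w c) a) (rightOf i) ▸ (stream w c (rightOf i) ∘ suc)) e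
  go rewrite lookup-zipWith (λ (x , m) t → moveTape m (write x t)) i (Action.workMoves a) (works c)
    | lookup-map i (headOf ∘ Tape.before) (works c) = at-move-right (proj₂ act) (proj₁ act) (works-of c i) e
 stream-step w c a le before e with input-case w (Action.inputMove a) (position c) le
 ... | moved-left p e₁ e₂ e₃ rewrite e₃ | e₂ | e₁ = refl
 ... | stayed e₂ e₃ rewrite e₃ | e₂ = go e where
  go : ∀ e → codeI (readInput w (position c ∸ suc e)) ≡ ((codeI (readInput w (position c ∸ 1)) ∷ []) ▸ _) e
  go zero = refl
  go (suc e) = refl
 ... | moved-right e₂ e₃ rewrite e₃ | e₂ = go e where
  go : ∀ e → codeI (readInput w (suc (position c) ∸ suc e)) ≡ ((codeI (readInput w (position c)) ∷ codeI (readInput w (position c ∸ 1)) ∷ []) ▸ _) e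
  go zero = refl
  go (suc zero) = refl
  go (suc (suc e)) = refl
 stream-step w c a le after e with input-case w (Action.inputMove a) (position c) le
 ... | moved-left p e₁ e₂ e₃ rewrite e₃ | e₂ | e₁ = go e where
  go : ∀ e → codeI (readInput w (p + e)) ≡ ((codeI (readInput w p) ∷ codeI (readInput w (suc p)) ∷ []) ▸ _) e
  go zero = cong (codeI ∘ readInput w) (+-identityʳ p)
  go (suc zero) = cong (codeI ∘ readInput w) (+-comm p 1)
  go (suc (suc e)) = cong (codeI ∘ readInput w) (+-suc p (suc e))
 ... | stayed e₂ e₃ rewrite e₃ | e₂ = go e where
  go : ∀ e → codeI (readInput w (position c + e)) ≡ ((codeI (readInput w (position c)) ∷ []) ▸ _) e
  go zero = cong (codeI ∘ readInput w) (+-identityʳ (position c))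
  go (suc e) = refl
 ... | moved-right e₂ e₃ rewrite e₃ | e₂ = cong (codeI ∘ readInput w) (symm (+-suc (position c) e))

 open Blocks k m R using (Available; Closedˢ; Holds; L; Lᵀ; W; addr; addr-bound; andFin; bit; closed-andFin; closed-bit; closed-orList; closed-pushed; closed-⊤; closed-⊥; closed-⋀; holds; holdsAt; orList; pushed; scope; truth; ⊤ˢ; ⊥ˢ; ⊩; ⊩-andFin; ⊩-orList; ⊩-pushed; ⊩-⊤; ⊩-⋀; ⊮-⊥; ⟦addr⟧; ⟨_⟩)

 bitOf : (Track → ℕ → Fin G) → Fin m → ℕ → Bool
 bitOf st κ e = does (st (trackOf (proj₁ (remQuot {r} G κ))) e Fin.≟ proj₂ (remQuot {r} G κ))

 bitsOf : Word k → Config → Fin m → ℕ → Bool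
 bitsOf w c = bitOf (stream w c)

 guardSch : (Track → Fin G) → Sch k v → Term → Fin v → Sch k v
 guardSch g rest s x = andFin r (λ j → bit true (addr s (combine j (g (trackOf j))) x (con 0))) rest

 ruleSch : Rule → Term → Term → Fin v → Sch k v
 ruleSch ru s t x = guardSch (Rule.guard ru) (andFin m (λ κ →
  let τ = trackOf (proj₁ (remQuot {r} G κ)) ; a = proj₂ (remQuot {r} G κ) in
  pushed (map (λ y → does (y Fin.≟ a)) (Rule.push ru τ)) (does (beyond τ Fin.≟ a)) s t κ x) ⊤ˢ) s x

 opaque
  nextSch : Term → Term → Fin v → Sch k v
  nextSch s t x = orList allViews (λ v → orList (actionsOf v) (λ a → ruleSch (ruleOf v a) s t x) ⊥ˢ) ⊥ˢ

 acceptingView : View → Bool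
 acceptingView v = accepting (vState v) Bool.∧ List.null (actionsOf v)

 verdict : Bool → Sch k v
 verdict true = ⊤ˢ
 verdict false = ⊥ˢ

 opaque
  acceptSch : Term → Fin v → Sch k v
  acceptSch s x = orList allViews (λ v → guardSch (guardOf v) (verdict (acceptingView v)) s x) ⊥ˢ

 initTrack : Track → InputSymbol k → Fin G
 initTrack control ⊢ = codeS initial
 initTrack control _ = filler
 initTrack before a = codeI ⊢
 initTrack after a = codeI a
 initTrack (leftOf i) a = codeW zero
 initTrack (rightOf i) a = codeW zero

 opaque
  initSch : Term → Fin v → Sch k v
  initSch b x = andFin m (λ κ → ⋀ (expr Lᵀ x) (read zero (λ a →
   bit (does (initTrack (trackOf (proj₁ (remQuot {r} G κ))) a Fin.≟ proj₂ (remQuot {r} G κ))) (addr b κ (suc x) (var zero)))) ⊤ˢ) ⊤ˢ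

 stream-initial : ∀ w τ e → stream w initialConfig τ e ≡ initTrack τ (readInput w e)
 stream-initial w control zero = refl
 stream-initial w control (suc e) = go w e where
  go : ∀ w e → filler ≡ initTrack control (readInput w (suc e))
  go [] e = refl
  go (a ∷ w) zero = refl
  go (a ∷ w) (suc e) = go w e
 stream-initial w before e = refl
 stream-initial w after e = refl
 stream-initial w (leftOf i) e rewrite lookup-replicate i (blankTape {#symbols}) = refl
 stream-initial w (rightOf i) zero rewrite lookup-replicate i (blankTape {#symbols}) = refl
 stream-initial w (rightOf i) (suc e) rewrite lookup-replicate i (blankTape {#symbols}) = refl

 push-length : ∀ v a τ → length (Rule.push (ruleOf v a) τ) ≤ 2
 push-length v a control = s≤s z≤n
 push-length v a before with effective (vHere v) (Action.inputMove a)
 ... | left = z≤n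
 ... | stay = s≤s z≤n
 ... | right = ≤-refl
 push-length v a after with effective (vHere v) (Action.inputMove a)
 ... | left = ≤-refl
 ... | stay = s≤s z≤n
 ... | right = z≤n
 push-length v a (leftOf i) with proj₂ (lookup (Action.workMoves a) i)
 ... | left = z≤n
 ... | stay = s≤s z≤n
 ... | right = ≤-refl
 push-length v a (rightOf i) with proj₂ (lookup (Action.workMoves a) i)
 ... | left = ≤-refl
 ... | stay = s≤s z≤n
 ... | right = z≤n

 module _ {v : ℕ} (w : Word k) (η : Vec ℕ v) (x : Fin v) {h : Bool} {ρ : List Bool} where

  private
   n = lookup η x
   H : ℕ → (Fin m → ℕ → Bool) → Set
   H = Holds (h ∷ ρ) n
   ⊩′ : Sch k v → Set
   ⊩′ = ⊩ (h ∷ ρ) w η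

  opaque
   unfolding initSch
   ⊩-init : ∀ b → ⊩′ (initSch b x) ⇔ H (value b n) (bitsOf w initialConfig)
   ⊩-init b = mk⇔
    (λ t → holds λ κ e lt → trans (subst (λ i → get (h ∷ ρ) i ≡ just (cellBit κ e)) (⟦addr⟧ b κ (suc x) (var zero) (e ∷ η))
      (truth (proj₁ (to ⊩-⋀ (proj₁ (to (⊩-andFin {n = m}) t) κ)) e (subst (e <_) (symm (correct Lᵀ x η)) lt)))) (cong just (symm (same κ e))))
    (λ f → from (⊩-andFin {n = m}) ((λ κ → from ⊩-⋀ ((λ e lt → ⟨ subst (λ i → get (h ∷ ρ) i ≡ just (cellBit κ e))
      (symm (⟦addr⟧ b κ (suc x) (var zero) (e ∷ η))) (trans (holdsAt f κ e (subst (e <_) (correct Lᵀ x η) lt)) (cong just (same κ e))) ⟩) , ⊩-⊤)) , ⊩-⊤))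
    where
    cellBit : Fin m → ℕ → Bool
    cellBit κ e = does (initTrack (trackOf (proj₁ (remQuot {r} G κ))) (readInput w e) Fin.≟ proj₂ (remQuot {r} G κ))
    same : ∀ κ e → bitsOf w initialConfig κ e ≡ cellBit κ e
    same κ e = cong (λ y → does (y Fin.≟ proj₂ (remQuot {r} G κ))) (stream-initial w (trackOf (proj₁ (remQuot {r} G κ))) e)

  ⊩-guard : ∀ s st g rest → H (value s n) (bitOf st) → ⊩′ (guardSch g rest s x) ⇔ ((∀ τ → g τ ≡ st τ 0) × ⊩′ rest)
  ⊩-guard s st g rest hs = mk⇔
   (λ t → let f , t′ = to (⊩-andFin {n = r} {F}) t in
    (λ τ → subst (λ τ → g τ ≡ st τ 0) (trackOf-rank τ) (agree (rank τ) (truth (f (rank τ))))) , t′)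
   (λ (f , t′) → from (⊩-andFin {n = r} {F}) ((λ j → ⟨ set j (f (trackOf j)) ⟩) , t′)) where
   F : Fin r → Sch k v
   F j = bit true (addr s (combine j (g (trackOf j))) x (con 0))
   κ : Fin r → Fin m
   κ j = combine j (g (trackOf j))
   current : ∀ j → get (h ∷ ρ) (⟦ addr s (κ j) x (con 0) ⟧ᴱ η) ≡ just (does (st (trackOf j) 0 Fin.≟ g (trackOf j)))
   current j = trans (cong (get (h ∷ ρ)) (⟦addr⟧ s (κ j) x (con 0) η)) (trans (holdsAt hs (κ j) 0 z<s)
    (cong (λ (i , a) → just (does (st (trackOf i) 0 Fin.≟ a))) (remQuot-combine j (g (trackOf j)))))
   agree : ∀ j → get (h ∷ ρ) (⟦ addr s (κ j) x (con 0) ⟧ᴱ η) ≡ just true → g (trackOf j) ≡ st (trackOf j) 0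
   agree j e with st (trackOf j) 0 Fin.≟ g (trackOf j) | trans (symm (current j)) e
   ... | yes p | _ = symm p
   ... | no _ | ()
   set : ∀ j → g (trackOf j) ≡ st (trackOf j) 0 → get (h ∷ ρ) (⟦ addr s (κ j) x (con 0) ⟧ᴱ η) ≡ just true
   set j e = trans (current j) (cong just (dec-true (st (trackOf j) 0 Fin.≟ g (trackOf j)) (symm e)))

  ⊩-rule : ∀ s t st ru → H (value s n) (bitOf st) → (∀ τ → st τ (L n) ≡ beyond τ) → (∀ τ → length (Rule.push ru τ) ≤ 2) →
    ⊩′ (ruleSch ru s t x) ⇔ ((∀ τ → Rule.guard ru τ ≡ st τ 0) × H (value t n) (bitOf (λ τ → Rule.push ru τ ▸ (st τ ∘ suc))))
  ⊩-rule s t st ru hs last short = mk⇔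
   (λ p → let g , q = to guarding p in g , holds λ κ e lt → trans (to (pushing κ) (proj₁ (to (⊩-andFin {n = m}) q) κ) e lt) (cong just (symm (shifted κ e))))
   (λ (g , q) → from guarding (g , from (⊩-andFin {n = m}) ((λ κ → from (pushing κ) (λ e lt → trans (holdsAt q κ e lt) (cong just (shifted κ e)))) , ⊩-⊤)))
   where
   τ : Fin m → Track
   τ κ = trackOf (proj₁ (remQuot {r} G κ))
   test : Fin m → Fin G → Bool
   test κ y = does (y Fin.≟ proj₂ (remQuot {r} G κ))
   guarding : _
   guarding = ⊩-guard s st (Rule.guard ru) _ hs
   pushing : ∀ κ → _
   pushing κ = ⊩-pushed {w = w} η x s t κ {h ∷ ρ} (bitOf st κ) (holdsAt hs κ) (map (test κ) (Rule.push ru (τ κ)))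
    (cong (test κ) (last (τ κ))) (≤-trans (≡⇒≤ (length-map (test κ) (Rule.push ru (τ κ)))) (short (τ κ)))
   shifted : ∀ κ e → bitOf (λ τ → Rule.push ru τ ▸ (st τ ∘ suc)) κ e ≡ (map (test κ) (Rule.push ru (τ κ)) ▸ (bitOf st κ ∘ suc)) e
   shifted κ e = map-▸ (test κ) (Rule.push ru (τ κ)) (st (τ κ) ∘ suc) e

  module _ (s : Term) {c : Config} (hs : H (value s n) (bitsOf w c)) where

   opaque
    unfolding nextSch
    ⊩-next : ∀ t → position c ≤ suc (length w) → (∀ τ → stream w c τ (L n) ≡ beyond τ) →
      ⊩′ (nextSch s t x) ⇔ (∃[ c′ ] c′ ∈ successors w c × H (value t n) (bitsOf w c′))
    ⊩-next t le last = mk⇔ sound complete where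
     same : ∀ {a} κ e → bitOf (λ τ → Rule.push (ruleOf (viewOf w c) a) τ ▸ (stream w c τ ∘ suc)) κ e ≡ bitsOf w (perform w c a) κ e
     same {a} κ e = cong (λ y → does (y Fin.≟ proj₂ (remQuot {r} G κ))) (symm (stream-step w c a le (trackOf (proj₁ (remQuot {r} G κ))) e))
     sound : ⊩′ (nextSch s t x) → ∃[ c′ ] c′ ∈ successors w c × H (value t n) (bitsOf w c′)
     sound p with to ⊩-orList p
     ... | inj₂ f = ⊥-elim (⊮-⊥ f)
     ... | inj₁ (v , _ , q) with to ⊩-orList q
     ... | inj₂ f = ⊥-elim (⊮-⊥ f)
     ... | inj₁ (a , a∈ , p′) with to (⊩-rule s t (stream w c) (ruleOf v a) hs last (push-length v a)) p′
     ... | g , hs′ with guard-stream w c v g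
     ... | refl = perform w c a , ∈-map⁺ (perform w c) a∈ , holds λ κ e lt → trans (holdsAt hs′ κ e lt) (cong just (same {a} κ e))
     complete : ∃[ c′ ] c′ ∈ successors w c × H (value t n) (bitsOf w c′) → ⊩′ (nextSch s t x)
     complete (c′ , m′ , hs′) with ∈-map⁻ (perform w c) m′
     ... | a , a∈ , refl = from ⊩-orList (inj₁ (viewOf w c , ∈-allViews (viewOf w c) , from ⊩-orList (inj₁ (a , a∈ ,
      from (⊩-rule s t (stream w c) (ruleOf (viewOf w c) a) hs last (push-length (viewOf w c) a))
       (guard-view w c , holds λ κ e lt → trans (holdsAt hs′ κ e lt) (cong just (symm (same {a} κ e))))))))
   opaque
    unfolding acceptSch
    ⊩-accept : ⊩′ (acceptSch s x) ⇔ (Halted w c × Accepting c)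
    ⊩-accept = mk⇔ sound complete where
     verdict-sound : ∀ y → ⊩′ (verdict y) → y ≡ true
     verdict-sound true z = refl
     verdict-sound false z = ⊥-elim (⊮-⊥ z)
     both : ∀ y z → y Bool.∧ z ≡ true → y ≡ true × z ≡ true
     both true true e = refl , refl
     nothing-next : ∀ {A B : Set} {f : A → B} xs → List.null xs ≡ true → map f xs ≡ []
     nothing-next [] _ = refl
     sound : ⊩′ (acceptSch s x) → Halted w c × Accepting c
     sound p with to ⊩-orList p
     ... | inj₂ f = ⊥-elim (⊮-⊥ f)
     ... | inj₁ (v , _ , q) with to (⊩-guard s (stream w c) (guardOf v) (verdict (acceptingView v)) hs) q
     ... | g , z with guard-stream w c v g
     ... | refl with both (accepting (state c)) _ (verdict-sound (acceptingView (viewOf w c)) z)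
     ... | e , e′ = nothing-next _ e′ , from T-≡ e
     complete : Halted w c × Accepting c → ⊩′ (acceptSch s x)
     complete (e , acc) = from ⊩-orList (inj₁ (viewOf w c , ∈-allViews (viewOf w c) , from (⊩-guard s (stream w c) (guardOf (viewOf w c)) (verdict (acceptingView (viewOf w c))) hs) (guard-view w c , final)))
      where
      none : ∀ {A B : Set} {f : A → B} xs → map f xs ≡ [] → List.null xs ≡ true
      none [] _ = refl
      final : ⊩′ (verdict (acceptingView (viewOf w c)))
      final = subst (λ y → ⊩′ (verdict y)) (symm (cong₂ Bool._∧_ (to T-≡ acc) (none (actionsOf (viewOf w c)) e))) ⊩-⊤

 module _ {v : ℕ} {w : Word k} {U : Quantifier → Set} {Γ : List Quantifier} {B : ℕ} (a : Available Γ B) (η : Vec ℕ v) (x : Fin v) where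

  private
   n = lookup η x

  closed-guard : ∀ s {g rest} → value s n + value W n ≤ B → Closedˢ U Γ w η rest → Closedˢ U Γ w η (guardSch g rest s x)
  closed-guard s {g} le cl = closed-andFin {n = r} (λ j →
   closed-bit {x = true} {i = addr s (combine j (g (trackOf j))) x (con 0)} a (addr-bound η s (combine j (g (trackOf j))) x (con 0) le z<s)) cl

  opaque
   unfolding initSch
   closed-init : ∀ b → value b n + value W n ≤ B → Closedˢ U Γ w η (initSch b x)
   closed-init b le = closed-andFin {n = m} (λ κ → closed-⋀ (λ e lt →
    ⟨ scope a _ (addr-bound (e ∷ η) b κ (suc x) (var zero) le (subst (e <_) (correct Lᵀ x η) lt)) ⟩) (closed-⊤ a)) (closed-⊤ a)

  opaque
   unfolding nextSch
   closed-next : ∀ s t → value s n + value W n ≤ B → value t n + value W n ≤ B → Closedˢ U Γ w η (nextSch s t x)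
   closed-next s t le le′ = closed-orList {xs = allViews} (λ v → closed-orList {xs = actionsOf v} (λ act →
    closed-guard s {guardOf v} le (closed-andFin {n = m} (λ κ → closed-pushed η x s t κ a le le′ _ _) (closed-⊤ a))) (closed-⊥ a)) (closed-⊥ a)

  opaque
   unfolding acceptSch
   closed-accept : ∀ s → value s n + value W n ≤ B → Closedˢ U Γ w η (acceptSch s x)
   closed-accept s le = closed-orList {xs = allViews} (λ v → closed-guard s {guardOf v} le (either (acceptingView v))) (closed-⊥ a)
    where
    either : ∀ y → Closedˢ U Γ w η (verdict y)
    either true = closed-⊤ a
    either false = closed-⊥ a

open Term

scoped-quants : ∀ {U Γ} n Q q → U Q → Scoped U (replicate n Q ++ Γ) q → Scoped U Γ (quantTimes n Q q)
scoped-quants zero Q q u s = s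
scoped-quants {U} {Γ} (suc n) Q q u s = u , scoped-quants n Q q u (subst (λ Δ → Scoped U Δ q) (symm (go n)) s)
 where
 go : ∀ n → replicate n Q ++ Q ∷ Γ ≡ Q ∷ replicate n Q ++ Γ
 go zero = refl
 go (suc n) = cong (Q ∷_) (go n)

scoped-quants-≡ : ∀ U Γ {c n} Q q → c ≡ n → U Q → Scoped U (replicate n Q ++ Γ) q → Scoped U Γ (quantTimes c Q q)
scoped-quants-≡ U Γ {c} Q q refl = scoped-quants c Q q

get-replicate : ∀ {A : Set} n {x : A} {ys i} → i < n → get (replicate n x ++ ys) i ≡ just x
get-replicate (suc n) {i = zero} lt = refl
get-replicate (suc n) {i = suc i} (s≤s lt) = get-replicate n lt

get-beyond : ∀ {A : Set} n {x : A} {ys} i → get (replicate n x ++ ys) (n + i) ≡ get ys i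
get-beyond zero i = refl
get-beyond (suc n) i = get-beyond n i

module Computation {k : ℕ} (M : Acceptor k) (p : Polynomial)
 (fit : ∀ w n c → Machine.Reaches M w n c → ∀ i → tapeSpace (lookup (Machine.Config.works c) i) ≤ suc (eval p (length w))) where

 open Machine M
 open Encoding M (polyᵀ p +ᵀ lengthᵀ) using (acceptSch; bitsOf; closed-accept; closed-init; closed-next; codeI; codeW; initSch; m; nextSch; stream; works-of; ⊩-accept; ⊩-init; ⊩-next; beyond; leftOf; rightOf; before; after; control; G; filler; r)
 open Blocks k m (polyᵀ p +ᵀ lengthᵀ) using (Available; BlockEq; Holds; InScope; L; W; available; available⇒inScope; blockEq-sym; closed; closed-equalBlocks; encodeBlock; equal-holds; equalBlocks; holds; holds-equal; holds-new; holds-strengthen; holds-weaken; holdsAt; inScope-weaken; length-encodeBlock; nonempty; scope; true-quants; truth; ⊩-equalBlocks; ⟨_⟩)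

 data Path (w : Word k) : ℕ → Config → Config → Set where
  [] : ∀ {c} → Path w 0 c c
  _∷_ : ∀ {n c c′ d} → c′ ∈ successors w c → Path w n c′ d → Path w (suc n) c d

 snoc : ∀ {w n c d e} → Path w n c d → e ∈ successors w d → Path w (suc n) c e
 snoc [] m = m ∷ []
 snoc (x ∷ p) m = x ∷ snoc p m

 append : ∀ {w m n c d e} → Path w m c d → Path w n d e → Path w (m + n) c e
 append [] q = q
 append (x ∷ p) q = x ∷ append p q

 reaches⇒path : ∀ {w n c} → Reaches w n c → Path w n initialConfig c
 reaches⇒path start = []
 reaches⇒path (step r m) = snoc (reaches⇒path r) m

 Reachable : Word k → Config → Set
 Reachable w c = ∃[ n ] Reaches w n c

 reach : ∀ {w n c d} → Reachable w c → Path w n c d → Reachable w d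
 reach r [] = r
 reach (_ , r) (x ∷ p) = reach (_ , step r x) p

 visit : ∀ {w n c d} → Path w n c d → ∀ i → i ≤ n → ∃[ e ] Path w i c e × Path w (n ∸ i) e d
 visit p zero le = _ , [] , p
 visit (x ∷ p) (suc i) (s≤s le) = let e , q , r = visit p i le in e , x ∷ q , r

 split-path : ∀ {w n c d} a b → Path w n c d → n ≤ a + b → ∃[ e ] ∃[ i ] ∃[ j ] i ≤ a × j ≤ b × Path w i c e × Path w j e d
 split-path zero b q le = _ , 0 , _ , z≤n , le , [] , q
 split-path (suc a) b [] le = _ , 0 , 0 , z≤n , z≤n , [] , []
 split-path (suc a) b (x ∷ q) (s≤s le) with split-path a b q le
 ... | e , i , j , i≤ , j≤ , q₁ , q₂ = e , suc i , j , s≤s i≤ , j≤ , x ∷ q₁ , q₂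

 position≤ : ∀ {w n c} → Reaches w n c → position c ≤ suc (length w)
 position≤ start = z≤n
 position≤ {w} (step {c = c} r m) with ∈-successor m where
  ∈-successor : ∀ {c c′} → c′ ∈ successors w c → ∃[ a ] c′ ≡ perform w c a
  ∈-successor {c} m = go _ m where
   go : ∀ as {c′} → c′ ∈ map (perform w c) as → ∃[ a ] c′ ≡ perform w c a
   go (a ∷ as) (here refl) = a , refl
   go (a ∷ as) (there m) = go as m
 ... | a , refl with Action.inputMove a
 ... | left = ≤-trans pred[n]≤n (position≤ r)
 ... | stay = position≤ r
 ... | right = s≤s (m⊓n≤n (position c) (length w))

 at-beyond : ∀ {A : Set} (xs : List A) {d e} → length xs ≤ e → at xs d e ≡ d
 at-beyond [] le = refl
 at-beyond (x ∷ xs) (s≤s le) = at-beyond xs le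

 read-beyond : ∀ (w : Word k) {i} → length w < i → readInput w i ≡ ⊣
 read-beyond [] {suc i} lt = refl
 read-beyond (a ∷ w) {suc (suc i)} (s≤s lt) = read-beyond w lt

 stream-beyond : ∀ {w c} → Reachable w c → ∀ τ → stream w c τ (L (length w)) ≡ beyond τ
 stream-beyond r control = refl
 stream-beyond {w} {c} (_ , r) before = cong (codeI ∘ readInput w) (m≤n⇒m∸n≡0
  (≤-trans (position≤ r) (s≤s (≤-trans (m≤n+m (length w) (value (polyᵀ p) (length w))) (≤-trans (n≤1+n _) (n≤1+n _))))))
 stream-beyond {w} {c} _ after = cong codeI (read-beyond w (≤-trans (s≤s (≤-trans (m≤n+m (length w) (value (polyᵀ p) (length w))) (n≤1+n _))) (m≤n+m _ (position c))))
 stream-beyond {w} {c} (n , r) (leftOf i) = cong codeW (at-beyond (Tape.before (works-of c i))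
  (≤-trans (m≤m+n _ _) (≤-trans (fit w n c r i) (s≤s (≤-trans (≡⇒≥ (poly-value p (length w))) (≤-trans (m≤m+n _ (length w)) (n≤1+n _)))))))
 stream-beyond {w} {c} (n , r) (rightOf i) = cong codeW (at-beyond (Tape.after (works-of c i))
  (≤-trans (s≤s⁻¹ (≤-trans (m≤n+m _ (length (Tape.before (works-of c i)))) (fit w n c r i)))
   (≤-trans (≡⇒≥ (poly-value p (length w))) (≤-trans (m≤m+n _ (length w)) (n≤1+n _)))))

 zeroᵀ : Term
 zeroᵀ = constᵀ 0

 stepSch : Term → Term → Fin v → Sch k v
 stepSch s t x = or (equalBlocks s t x) (nextSch s t x)

 Wn : Word k → ℕ
 Wn w = value W (length w)

 0<W : ∀ w → 0 < Wn w
 0<W w = *-mono-≤ (≤-trans z<s (toℕ<n (combine {r} {G} zero filler))) (s≤s {0} z≤n)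

 bits : Word k → Config → List Bool
 bits w c = encodeBlock (L (length w)) (bitsOf w c)

 length-bits : ∀ w c → length (bits w c) ≡ Wn w
 length-bits w c = length-encodeBlock (L (length w)) (bitsOf w c)

 module _ (w : Word k) {v : ℕ} (η : Vec ℕ v) (x : Fin v)
   (last : ∀ {c} → Reachable w c → ∀ τ → stream w c τ (L (lookup η x)) ≡ beyond τ) where

  private
   n = lookup η x

  H : List Bool → ℕ → Config → Set
  H ρ b c = Holds ρ n b (bitsOf w c)

  step-sound : ∀ {ρ c} s t → 0 < length ρ → Reachable w c → H ρ (value s n) c → True ρ (⟦ stepSch s t x ⟧ˢ w η) →
    ∃[ j ] ∃[ d ] j ≤ 1 × Path w j c d × H ρ (value t n) d
  step-sound {h ∷ ρ} {c} s t lt r hs tr with tr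
  ... | inj₁ e = 0 , c , z≤n , [] , holds-equal hs (to (⊩-equalBlocks {w = w} η x s t) ⟨ e ⟩)
  ... | inj₂ e with to (⊩-next w η x s hs t (position≤ (proj₂ r)) (last r)) ⟨ e ⟩
  ... | d , m , hd = 1 , d , ≤-refl , m ∷ [] , hd

  stay-complete : ∀ {ρ c} s t → 0 < length ρ → H ρ (value s n) c → H ρ (value t n) c → True ρ (⟦ stepSch s t x ⟧ˢ w η)
  stay-complete {h ∷ ρ} s t lt hs ht = inj₁ (truth (from (⊩-equalBlocks {w = w} η x s t) (equal-holds hs ht)))

  next-complete : ∀ {ρ c d} s t → 0 < length ρ → Reachable w c → H ρ (value s n) c → d ∈ successors w c → H ρ (value t n) d →
    True ρ (⟦ stepSch s t x ⟧ˢ w η)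
  next-complete {h ∷ ρ} {c} {d} s t lt r hs m hd = inj₂ (truth (from (⊩-next w η x s hs t (position≤ (proj₂ r)) (last r)) (d , m , hd)))

  accept-⇔ : ∀ {ρ c} s → 0 < length ρ → H ρ (value s n) c → True ρ (⟦ acceptSch s x ⟧ˢ w η) ⇔ (Halted w c × Accepting c)
  accept-⇔ {h ∷ ρ} {c} s lt hs = mk⇔ (λ t → to (⊩-accept w η x s hs) ⟨ t ⟩) (λ a → truth (from (⊩-accept w η x s hs) a))

  init-⇔ : ∀ {ρ} b → 0 < length ρ → True ρ (⟦ initSch b x ⟧ˢ w η) ⇔ H ρ (value b n) initialConfig
  init-⇔ {h ∷ ρ} b lt = mk⇔ (λ t → to (⊩-init w η x b) ⟨ t ⟩) (λ a → truth (from (⊩-init w η x b) a))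

  equal-⇔ : ∀ {ρ} s t → 0 < length ρ → True ρ (⟦ equalBlocks s t x ⟧ˢ w η) ⇔ BlockEq ρ n (value s n) (value t n)
  equal-⇔ {h ∷ ρ} s t lt = mk⇔ (λ e → to (⊩-equalBlocks {w = w} η x s t) ⟨ e ⟩) (λ e → truth (from (⊩-equalBlocks {w = w} η x s t) e))

 pos-++ : ∀ {n} (u ρ : List Bool) → length u ≡ n → 0 < n → 0 < length (u ++ ρ)
 pos-++ (h ∷ u) ρ e lt = s≤s z≤n
 pos-++ [] ρ e lt = ⊥-elim (<⇒≢ lt e)

 extend : ∀ {Γ B} n → Available Γ B → Available (replicate n exists ++ Γ) (n + B)
 extend {Γ} {B} n (available lt f) = available (≤-trans lt (m≤n+m B n)) (go n) where
  go : ∀ n i → i < n + B → get (replicate n exists ++ Γ) i ≡ just exists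
  go zero i lt = f i lt
  go (suc n) zero lt = refl
  go (suc n) (suc i) (s≤s lt) = go n i lt

 block-available : ∀ {Γ} n → 0 < n → Available (replicate n exists ++ Γ) n
 block-available n lt = available lt (λ i → get-replicate n)

 npPlan : Plan k
 npPlan = record
  { header = quants exists (expr W zero) ∷ conj (initSch zeroᵀ zero) ∷ []
  ; count = expr (polyᵀ p) zero
  ; chunk = quants exists (expr W (suc zero)) ∷ conj (stepSch W zeroᵀ (suc zero)) ∷ []
  ; chunkWidth = expr W zero ⊕ con 0
  ; width-≡ = λ t n → cong (_+ 0) (trans (correct W (suc zero) (t ∷ n ∷ [])) (symm (correct W zero (n ∷ []))))
  ; final = acceptSch zeroᵀ zero
  }

 module NPTableau (time : RunsInTime (eval p)) (w : Word k) where

  private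
   n : ℕ
   n = length w
   η : Vec ℕ 1
   η = n ∷ []

  Ends : ℕ → Config → Set
  Ends T c = ∃[ j ] ∃[ d ] j ≤ T × Path w j c d × Halted w d × Accepting d

  Correct : ℕ → QBF → Set
  Correct T q = ∀ ρ c → 0 < length ρ → Reachable w c → Holds ρ n 0 (bitsOf w c) → True ρ q ⇔ Ends T c

  acceptQ : QBF
  acceptQ = ⟦ acceptSch zeroᵀ zero ⟧ˢ w η

  chunkQ : ℕ → QBF → QBF
  chunkQ t = ⟦ Plan.chunk npPlan ⟧ᴵ w (t ∷ η)

  np-final : Correct 0 acceptQ
  np-final ρ c lt r hs = mk⇔ (λ t → let h , a = to eq t in 0 , c , z≤n , [] , h , a)
    (λ { (0 , .c , _ , [] , h , a) → from eq (h , a) }) where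
   eq : True ρ acceptQ ⇔ (Halted w c × Accepting c)
   eq = accept-⇔ w η zero stream-beyond {ρ} {c} zeroᵀ lt hs

  np-step : ∀ T t rest → Correct T rest → Correct (suc T) (chunkQ t rest)
  np-step T t rest IH ρ c lt r hs = mk⇔ sound complete where
   W≡ : ⟦ expr W (suc zero) ⟧ᴱ (t ∷ η) ≡ Wn w
   W≡ = correct W (suc zero) (t ∷ η)
   stepQ : QBF
   stepQ = ⟦ stepSch W zeroᵀ (suc zero) ⟧ˢ w (t ∷ η)
   source : ∀ u → length u ≡ Wn w → Holds (u ++ ρ) n (Wn w) (bitsOf w c)
   source u e = holds-weaken u (trans (symm e) (symm (+-identityʳ (length u)))) hs
   sound : True ρ (chunkQ t rest) → Ends (suc T) c
   sound tr with to (true-quants (⟦ expr W (suc zero) ⟧ᴱ (t ∷ η)) (and stepQ rest)) tr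
   ... | u , len , s , tr′ with pos-++ u ρ (trans len W≡) (0<W w)
   ... | lt′ with step-sound w (t ∷ η) (suc zero) stream-beyond {u ++ ρ} {c} W zeroᵀ lt′ r (source u (trans len W≡)) s
   ... | j , d , j≤ , path , hd with to (IH (u ++ ρ) d lt′ (reach r path) hd) tr′
   ... | i , e , i≤ , path′ , acc = j + i , e , +-mono-≤ j≤ i≤ , append path path′ , acc
   continue : ∀ {d} → Reachable w d → True (bits w d ++ ρ) stepQ → Ends T d → True ρ (chunkQ t rest)
   continue {d} rd s end = from (true-quants (⟦ expr W (suc zero) ⟧ᴱ (t ∷ η)) (and stepQ rest)) (bits w d , trans (length-bits w d) (symm W≡) , s ,
    from (IH (bits w d ++ ρ) d (pos-++ (bits w d) ρ (length-bits w d) (0<W w)) rd (holds-new ρ [] refl)) end)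
   complete : Ends (suc T) c → True ρ (chunkQ t rest)
   complete (zero , .c , _ , [] , acc) = continue r
    (stay-complete w (t ∷ η) (suc zero) stream-beyond {bits w c ++ ρ} {c} W zeroᵀ (pos-++ (bits w c) ρ (length-bits w c) (0<W w))
     (source (bits w c) (length-bits w c)) (holds-new ρ [] refl)) (0 , c , z≤n , [] , acc)
   complete (suc j , e , s≤s j≤ , _∷_ {c′ = d} m path , acc) = continue (reach r (m ∷ []))
    (next-complete w (t ∷ η) (suc zero) stream-beyond {bits w d ++ ρ} {c} {d} W zeroᵀ (pos-++ (bits w d) ρ (length-bits w d) (0<W w)) r
     (source (bits w d) (length-bits w d)) m (holds-new ρ [] refl)) (j , e , j≤ , path , acc)

  np-iterate : ∀ T (F : ℕ → QBF → QBF) → (∀ j → ∃[ t ] F j ≡ chunkQ t) → Correct T (iterateQ T F acceptQ)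
  np-iterate zero F eF = np-final
  np-iterate (suc T) F eF = subst (λ f → Correct (suc T) (f (iterateQ T (F ∘ suc) acceptQ))) (symm (proj₂ (eF 0)))
   (np-step T (proj₁ (eF 0)) (iterateQ T (F ∘ suc) acceptQ) (np-iterate T (F ∘ suc) (eF ∘ suc)))

  np-correct : True [] (Plan.formula npPlan w) ⇔ Accepts w
  np-correct = mk⇔ sound complete where
   count = ⟦ expr (polyᵀ p) zero ⟧ᴱ η
   rest initQ : QBF
   rest = iterateQ count chunkQ acceptQ
   initQ = ⟦ initSch zeroᵀ zero ⟧ˢ w η
   rest-⇔ : Correct count rest
   rest-⇔ = np-iterate count chunkQ (λ j → j , refl)
   sound : True [] (Plan.formula npPlan w) → Accepts w
   sound tr with to (true-quants (⟦ expr W zero ⟧ᴱ η) (and initQ rest)) tr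
   ... | u , len , i , tr′ with pos-++ u [] (trans len (correct W zero η)) (0<W w)
   ... | lt with to (rest-⇔ (u ++ []) initialConfig lt (0 , start) (to (init-⇔ w η zero stream-beyond {u ++ []} zeroᵀ lt) i)) tr′
   ... | j , d , _ , path , h , a = let i , r = reach (0 , start) path in i , d , r , h , a
   complete : Accepts w → True [] (Plan.formula npPlan w)
   complete (j , d , r , h , a) = from (true-quants (⟦ expr W zero ⟧ᴱ η) (and initQ rest))
    (u , trans (length-bits w initialConfig) (symm (correct W zero η)) ,
     from (init-⇔ w η zero stream-beyond {u ++ []} zeroᵀ lt) hs ,
     from (rest-⇔ (u ++ []) initialConfig lt (0 , start) hs)
      (j , d , ≤-trans (time w j d r) (≡⇒≥ (trans (correct (polyᵀ p) zero η) (poly-value p n))) , reaches⇒path r , h , a))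
    where
    u : List Bool
    u = bits w initialConfig
    lt : 0 < length (u ++ [])
    lt = pos-++ u [] (length-bits w initialConfig) (0<W w)
    hs : Holds (u ++ []) n 0 (bitsOf w initialConfig)
    hs = holds-new [] [] refl

 module _ {U : Quantifier → Set} (u∃ : U exists) (w : Word k) where

  private
   n : ℕ
   n = length w
   η : Vec ℕ 1
   η = n ∷ []

  closed-step : ∀ {v Γ B} → Available Γ B → (η : Vec ℕ v) (x : Fin v) → ∀ s t → let n = lookup η x in
    value s n + value W n ≤ B → value t n + value W n ≤ B → Scoped U Γ (⟦ stepSch s t x ⟧ˢ w η)
  closed-step {Γ = Γ} a η x s t le le′ = closed {U} {Γ} {w} {s = equalBlocks s t x} (closed-equalBlocks {w = w} η x (scope a 0 (Available.nonempty a)) s t (available⇒inScope _ a le) (available⇒inScope _ a le′)) , closed {U} {Γ} {w} {s = nextSch s t x} (closed-next a η x s t le le′)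

  np-scoped : Scoped U [] (Plan.formula npPlan w)
  np-scoped = scoped-quants _ exists body u∃ (subst (λ i → Scoped U (replicate i exists ++ []) body) (symm (correct W zero η))
    (closed {U} {s = initSch zeroᵀ zero} (closed-init first η zero zeroᵀ ≤-refl) , go (⟦ expr (polyᵀ p) zero ⟧ᴱ η) F₀ (λ j → j , refl) first))
   where
   F₀ : ℕ → QBF → QBF
   F₀ t = ⟦ Plan.chunk npPlan ⟧ᴵ w (t ∷ η)
   body : QBF
   body = and (⟦ initSch zeroᵀ zero ⟧ˢ w η) (iterateQ (⟦ expr (polyᵀ p) zero ⟧ᴱ η) F₀ (⟦ acceptSch zeroᵀ zero ⟧ˢ w η))
   first : Available (replicate (Wn w) exists ++ []) (Wn w)
   first = block-available (Wn w) (0<W w)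
   go : ∀ T (F : ℕ → QBF → QBF) → (∀ j → ∃[ t ] F j ≡ F₀ t) → ∀ {Γ} → Available Γ (Wn w) →
     Scoped U Γ (iterateQ T F (⟦ acceptSch zeroᵀ zero ⟧ˢ w η))
   go zero F eF a = closed {U} {s = acceptSch zeroᵀ zero} (closed-accept a η zero zeroᵀ ≤-refl)
   go (suc T) F eF {Γ} a with F 0 | eF 0
   ... | _ | t , refl = scoped-quants _ exists body′ u∃ (subst (λ i → Scoped U (replicate i exists ++ Γ) body′) (symm (correct W (suc zero) (t ∷ η)))
     (closed-step (extend (Wn w) a) (t ∷ η) (suc zero) W zeroᵀ ≤-refl (m≤m+n (Wn w) (Wn w)) ,
      go T (F ∘ suc) (eF ∘ suc) (block-available (Wn w) (0<W w)))) where
    body′ : QBF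
    body′ = and (⟦ stepSch W zeroᵀ (suc zero) ⟧ˢ w (t ∷ η)) (iterateQ T (F ∘ suc) (⟦ acceptSch zeroᵀ zero ⟧ˢ w η))

 Uᵀ middleᵀ oldYᵀ oldXᵀ : Term
 Uᵀ = W +ᵀ W
 middleᵀ = Uᵀ +ᵀ constᵀ 1
 oldYᵀ = middleᵀ +ᵀ W
 oldXᵀ = oldYᵀ +ᵀ W

 -- With u the universal bit, x and y the blocks of the previous level and c the
 -- middle block: (x′ , y′) is (x , c) or (c , y), according to u.
 splitSch : Fin v → Sch k v
 splitSch x = or (and (lit forAll true (expr Uᵀ x)) (and (equalBlocks oldXᵀ W x) (equalBlocks middleᵀ zeroᵀ x)))
   (and (lit forAll false (expr Uᵀ x)) (and (equalBlocks middleᵀ W x) (equalBlocks oldYᵀ zeroᵀ x)))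

 psPlan : Plan k
 psPlan = record
  { header = quants exists (expr W zero) ∷ conj (initSch zeroᵀ zero) ∷ quants exists (expr W zero) ∷ conj (acceptSch zeroᵀ zero) ∷ []
  ; count = expr W zero
  ; chunk = quants exists (expr W (suc zero)) ∷ quants forAll (con 1) ∷ quants exists (expr Uᵀ (suc zero)) ∷ conj (splitSch (suc zero)) ∷ []
  ; chunkWidth = expr W zero ⊕ (con 1 ⊕ (expr Uᵀ zero ⊕ con 0))
  ; width-≡ = λ t n → cong₂ (λ a b → a + (1 + (b + 0)))
    (trans (correct W (suc zero) (t ∷ n ∷ [])) (symm (correct W zero (n ∷ []))))
    (trans (correct Uᵀ (suc zero) (t ∷ n ∷ [])) (symm (correct Uᵀ zero (n ∷ []))))
  ; final = stepSch W zeroᵀ zero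
  }

 module PSTableau (det : Deterministic) (halts : ∀ w → HaltsOn w) (w : Word k) where

  private
   n : ℕ
   n = length w
   η : Vec ℕ 1
   η = n ∷ []
   ω : ℕ
   ω = Wn w

  Leads : ℕ → List Bool → Config → Set
  Leads T ρ c = ∃[ j ] ∃[ d ] j ≤ 2 ^ T × Path w j c d × Holds ρ n 0 (bitsOf w d)

  Correct : ℕ → QBF → Set
  Correct T q = ∀ ρ c → 0 < length ρ → Reachable w c → Holds ρ n ω (bitsOf w c) → True ρ q ⇔ Leads T ρ c

  finalQ : QBF
  finalQ = ⟦ stepSch W zeroᵀ zero ⟧ˢ w η

  chunkQ : ℕ → QBF → QBF
  chunkQ t = ⟦ Plan.chunk psPlan ⟧ᴵ w (t ∷ η)

  ps-final : Correct 0 finalQ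
  ps-final ρ c lt r hs = mk⇔ (step-sound w η zero stream-beyond {ρ} {c} W zeroᵀ lt r hs) complete
   where
   complete : Leads 0 ρ c → True ρ finalQ
   complete (0 , .c , _ , [] , hd) = stay-complete w η zero stream-beyond {ρ} {c} W zeroᵀ lt hs hd
   complete (1 , d , _ , m ∷ [] , hd) = next-complete w η zero stream-beyond {ρ} {c} {d} W zeroᵀ lt r hs m hd
   complete (suc (suc j) , d , s≤s () , _)

  module _ (u₂ : List Bool) (b : Bool) (u₁ ρ : List Bool) (e₂ : length u₂ ≡ ω + ω) (e₁ : length u₁ ≡ ω) where

   ρ₂ : List Bool
   ρ₂ = u₂ ++ b ∷ u₁ ++ ρ
   outer-index : ∀ β → (ω + ω) + 1 + ω + β ≡ length u₂ + (1 + (length u₁ + β))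
   outer-index β rewrite e₂ | e₁ = trans (+-assoc ((ω + ω) + 1) ω β) (+-assoc (ω + ω) 1 (ω + β))
   to-outer : ∀ {β f} → Holds ρ n β f → Holds ρ₂ n ((ω + ω) + 1 + ω + β) f
   to-outer {β} h = holds-weaken u₂ (outer-index β) (holds-weaken (b ∷ []) refl (holds-weaken u₁ refl h))
   from-outer : ∀ {β f} → Holds ρ₂ n ((ω + ω) + 1 + ω + β) f → Holds ρ n β f
   from-outer {β} h = holds-strengthen u₁ refl (holds-strengthen (b ∷ []) refl (holds-strengthen u₂ (outer-index β) h))
   middle-index : (ω + ω) + 1 ≡ length u₂ + (1 + 0)
   middle-index = cong (_+ 1) (symm e₂)
   to-middle : ∀ {f} → Holds (u₁ ++ ρ) n 0 f → Holds ρ₂ n ((ω + ω) + 1) f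
   to-middle h = holds-weaken u₂ middle-index (holds-weaken (b ∷ []) refl h)
   from-middle : ∀ {f} → Holds ρ₂ n ((ω + ω) + 1) f → Holds (u₁ ++ ρ) n 0 f
   from-middle h = holds-strengthen (b ∷ []) refl (holds-strengthen u₂ middle-index h)
   switch-bit : get ρ₂ (ω + ω) ≡ just b
   switch-bit = trans (cong (get ρ₂) (trans (symm e₂) (symm (+-identityʳ (length u₂))))) (get-++ʳ u₂ (b ∷ u₁ ++ ρ) 0)

  two-blocks : ∀ c d X → Holds ((bits w c ++ bits w d) ++ X) n 0 (bitsOf w c) × Holds ((bits w c ++ bits w d) ++ X) n ω (bitsOf w d)
  two-blocks c d X = subst (λ z → Holds z n 0 (bitsOf w c)) (symm (++-assoc (bits w c) (bits w d) X)) (holds-new (bits w d ++ X) [] refl) ,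
   subst (λ z → Holds z n ω (bitsOf w d)) (symm (++-assoc (bits w c) (bits w d) X)) (holds-new X (bits w c) (length-bits w c))

  length-two : ∀ c d → length (bits w c ++ bits w d) ≡ ω + ω
  length-two c d = trans (length-++ (bits w c)) (cong₂ _+_ (length-bits w c) (length-bits w d))

  ps-step : ∀ T t rest → Correct T rest → Correct (suc T) (chunkQ t rest)
  ps-step T t rest IH ρ c lt r hs = mk⇔ sound complete where
   W≡ : ⟦ expr W (suc zero) ⟧ᴱ (t ∷ η) ≡ ω
   W≡ = correct W (suc zero) (t ∷ η)
   U≡ : ⟦ expr Uᵀ (suc zero) ⟧ᴱ (t ∷ η) ≡ ω + ω
   U≡ = correct Uᵀ (suc zero) (t ∷ η)
   splitQ inner outer : QBF
   splitQ = ⟦ splitSch (suc zero) ⟧ˢ w (t ∷ η)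
   inner = quantTimes (⟦ expr Uᵀ (suc zero) ⟧ᴱ (t ∷ η)) exists (and splitQ rest)
   outer = qu forAll inner
   blocks : ∀ ρ s s′ → 0 < length ρ → True ρ (⟦ equalBlocks s s′ (suc zero) ⟧ˢ w (t ∷ η)) ⇔ BlockEq ρ n (value s n) (value s′ n)
   blocks ρ s s′ lt = equal-⇔ w (t ∷ η) (suc zero) stream-beyond {ρ} s s′ lt
   selected : ∀ u₂ b u₁ x → length u₂ ≡ ω + ω → length u₁ ≡ ω →
     get (u₂ ++ b ∷ u₁ ++ ρ) (⟦ expr Uᵀ (suc zero) ⟧ᴱ (t ∷ η)) ≡ just x ⇔ b ≡ x
   selected u₂ b u₁ x e₂ e₁ = mk⇔ (λ h → just-injective (trans (symm at-u) h)) (λ e → trans at-u (cong just e))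
    where
    at-u : get (u₂ ++ b ∷ u₁ ++ ρ) (⟦ expr Uᵀ (suc zero) ⟧ᴱ (t ∷ η)) ≡ just b
    at-u = trans (cong (get (u₂ ++ b ∷ u₁ ++ ρ)) U≡) (switch-bit u₂ b u₁ ρ e₂ e₁)
   long : ∀ (u₂ X : List Bool) → length u₂ ≡ ω + ω → 0 < length (u₂ ++ X)
   long u₂ X e = pos-++ u₂ X e (≤-trans (0<W w) (m≤m+n ω ω))
   sound : True ρ (chunkQ t rest) → Leads (suc T) ρ c
   sound tr with to (true-quants (⟦ expr W (suc zero) ⟧ᴱ (t ∷ η)) outer) tr
   ... | u₁ , l₁ , f with to (true-quants (⟦ expr Uᵀ (suc zero) ⟧ᴱ (t ∷ η)) (and splitQ rest)) (f true)
   ... | u₂ , l₂ , inj₂ (b≡ , _) , _ with to (selected u₂ true u₁ false (trans l₂ U≡) (trans l₁ W≡)) b≡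
   ... | ()
   sound tr | u₁ , l₁ , f | u₂ , l₂ , inj₁ (_ , p , q) , t₁
    with to (IH (u₂ ++ true ∷ u₁ ++ ρ) c (long u₂ (true ∷ u₁ ++ ρ) (trans l₂ U≡)) r
      (holds-equal (to-outer u₂ true u₁ ρ (trans l₂ U≡) (trans l₁ W≡) hs) (to (blocks (u₂ ++ true ∷ u₁ ++ ρ) oldXᵀ W (long u₂ (true ∷ u₁ ++ ρ) (trans l₂ U≡))) p))) t₁
   ... | i , d , i≤ , path , hd
    with from-middle u₂ true u₁ ρ (trans l₂ U≡) (trans l₁ W≡) (holds-equal hd (blockEq-sym (to (blocks (u₂ ++ true ∷ u₁ ++ ρ) middleᵀ zeroᵀ (long u₂ (true ∷ u₁ ++ ρ) (trans l₂ U≡))) q)))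
   ... | hm with to (true-quants (⟦ expr Uᵀ (suc zero) ⟧ᴱ (t ∷ η)) (and splitQ rest)) (f false)
   ... | u₃ , l₃ , inj₁ (b≡ , _) , _ with to (selected u₃ false u₁ true (trans l₃ U≡) (trans l₁ W≡)) b≡
   ... | ()
   sound tr | u₁ , l₁ , f | u₂ , l₂ , inj₁ _ , t₁ | i , d , i≤ , path , hd | hm | u₃ , l₃ , inj₂ (_ , p , q) , t₂
    with to (IH (u₃ ++ false ∷ u₁ ++ ρ) d (long u₃ (false ∷ u₁ ++ ρ) (trans l₃ U≡)) (reach r path)
      (holds-equal (to-middle u₃ false u₁ ρ (trans l₃ U≡) (trans l₁ W≡) hm) (to (blocks (u₃ ++ false ∷ u₁ ++ ρ) middleᵀ W (long u₃ (false ∷ u₁ ++ ρ) (trans l₃ U≡))) p))) t₂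
   ... | j , e , j≤ , path′ , he = i + j , e , +-mono-≤ i≤ (≤-trans j≤ (m≤m+n _ 0)) , append path path′ ,
    from-outer u₃ false u₁ ρ (trans l₃ U≡) (trans l₁ W≡) (subst (λ β → Holds (u₃ ++ false ∷ u₁ ++ ρ) n β (bitsOf w e)) (symm (+-identityʳ _))
     (holds-equal he (blockEq-sym (to (blocks (u₃ ++ false ∷ u₁ ++ ρ) oldYᵀ zeroᵀ (long u₃ (false ∷ u₁ ++ ρ) (trans l₃ U≡))) q))))
   complete : Leads (suc T) ρ c → True ρ (chunkQ t rest)
   complete (j , d , j≤ , path , hd) with split-path (2 ^ T) (2 ^ T) path (≤-trans j≤ (≡⇒≤ (cong (2 ^ T +_) (+-identityʳ _))))
   ... | e , i₁ , i₂ , i₁≤ , i₂≤ , path₁ , path₂ =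
    from (true-quants (⟦ expr W (suc zero) ⟧ᴱ (t ∷ η)) outer) (u₁ , trans (length-bits w e) (symm W≡) , λ
     { true → from (true-quants (⟦ expr Uᵀ (suc zero) ⟧ᴱ (t ∷ η)) (and splitQ rest))
       (bits w e ++ bits w c , trans (length-two e c) (symm U≡) ,
        inj₁ (from (selected (bits w e ++ bits w c) true u₁ true (length-two e c) (length-bits w e)) refl ,
         from (blocks _ oldXᵀ W (long (bits w e ++ bits w c) (true ∷ u₁ ++ ρ) (length-two e c)))
          (equal-holds (to-outer _ true u₁ ρ (length-two e c) (length-bits w e) hs) (proj₂ (two-blocks e c _))) ,
         from (blocks _ middleᵀ zeroᵀ (long (bits w e ++ bits w c) (true ∷ u₁ ++ ρ) (length-two e c)))
          (equal-holds (to-middle _ true u₁ ρ (length-two e c) (length-bits w e) (holds-new ρ [] refl)) (proj₁ (two-blocks e c _)))) ,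
        from (IH _ c (long (bits w e ++ bits w c) (true ∷ u₁ ++ ρ) (length-two e c)) r (proj₂ (two-blocks e c _))) (i₁ , e , i₁≤ , path₁ , proj₁ (two-blocks e c _)))
     ; false → from (true-quants (⟦ expr Uᵀ (suc zero) ⟧ᴱ (t ∷ η)) (and splitQ rest))
       (bits w d ++ bits w e , trans (length-two d e) (symm U≡) ,
        inj₂ (from (selected (bits w d ++ bits w e) false u₁ false (length-two d e) (length-bits w e)) refl ,
         from (blocks _ middleᵀ W (long (bits w d ++ bits w e) (false ∷ u₁ ++ ρ) (length-two d e)))
          (equal-holds (to-middle _ false u₁ ρ (length-two d e) (length-bits w e) (holds-new ρ [] refl)) (proj₂ (two-blocks d e _))) ,
         from (blocks _ oldYᵀ zeroᵀ (long (bits w d ++ bits w e) (false ∷ u₁ ++ ρ) (length-two d e)))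
          (equal-holds (subst (λ β → Holds ((bits w d ++ bits w e) ++ false ∷ u₁ ++ ρ) n β (bitsOf w d)) (+-identityʳ _)
           (to-outer _ false u₁ ρ (length-two d e) (length-bits w e) hd)) (proj₁ (two-blocks d e _)))) ,
        from (IH _ e (long (bits w d ++ bits w e) (false ∷ u₁ ++ ρ) (length-two d e)) (reach r path₁) (proj₂ (two-blocks d e _))) (i₂ , d , i₂≤ , path₂ , proj₁ (two-blocks d e _)))
     }) where
    u₁ : List Bool
    u₁ = bits w e

  ps-iterate : ∀ T (F : ℕ → QBF → QBF) → (∀ j → ∃[ t ] F j ≡ chunkQ t) → Correct T (iterateQ T F finalQ)
  ps-iterate zero F eF = ps-final
  ps-iterate (suc T) F eF = subst (λ f → Correct (suc T) (f (iterateQ T (F ∘ suc) finalQ))) (symm (proj₂ (eF 0)))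
   (ps-step T (proj₁ (eF 0)) (iterateQ T (F ∘ suc) finalQ) (ps-iterate T (F ∘ suc) (eF ∘ suc)))

  Similar : Config → Config → Set
  Similar c d = ∀ κ e → e < L n → bitsOf w c κ e ≡ bitsOf w d κ e

  similar-step : ∀ {c d c′} → Reachable w c → Reachable w d → Similar c d → c′ ∈ successors w c → ∃[ d′ ] d′ ∈ successors w d × Similar c′ d′
  similar-step {c} {d} {c′} rc rd sm m = go (bits w c′ ++ bits w c ++ []) refl where
   lt : 0 < length (bits w c′ ++ bits w c ++ [])
   lt = pos-++ (bits w c′) _ (length-bits w c′) (0<W w)
   go : ∀ ρ → ρ ≡ bits w c′ ++ bits w c ++ [] → ∃[ d′ ] d′ ∈ successors w d × Similar c′ d′
   go [] e = ⊥-elim (<⇒≢ lt (cong length e))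
   go (h ∷ ρ) e = let d′ , m′ , hd = to (⊩-next w η zero W hs-d zeroᵀ (position≤ (proj₂ rd)) (stream-beyond rd))
                               (from (⊩-next w η zero W hs-c zeroᵀ (position≤ (proj₂ rc)) (stream-beyond rc)) (c′ , m , hs-c′))
     in d′ , m′ , λ κ i lt → just-injective (trans (symm (holdsAt hs-c′ κ i lt)) (holdsAt hd κ i lt))
    where
    hs-c : Holds (h ∷ ρ) n ω (bitsOf w c)
    hs-c = subst (λ z → Holds z n ω (bitsOf w c)) (symm e) (holds-new [] (bits w c′) (length-bits w c′))
    hs-d : Holds (h ∷ ρ) n ω (bitsOf w d)
    hs-d = holds λ κ i lt → trans (holdsAt hs-c κ i lt) (cong just (sm κ i lt))
    hs-c′ : Holds (h ∷ ρ) n 0 (bitsOf w c′)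
    hs-c′ = subst (λ z → Holds z n 0 (bitsOf w c′)) (symm e) (holds-new (bits w c ++ []) [] refl)

  unique : ∀ {A : Set} {xs : List A} {x y} → length xs ≤ 1 → x ∈ xs → y ∈ xs → x ≡ y
  unique {xs = _ ∷ []} le (here refl) (here refl) = refl
  unique {xs = _ ∷ _ ∷ _} (s≤s ()) p q

  similar-halts : ∀ {a b c d e h} → Reachable w c → Reachable w d → Similar c d → Path w a c e → Path w b d h → Halted w h → a ≤ b
  similar-halts rc rd sm [] q hh = z≤n
  similar-halts rc rd sm (m ∷ p) q hh with similar-step rc rd sm m
  similar-halts rc rd sm (m ∷ p) [] hh | d′ , m′ , sm′ with subst (d′ ∈_) hh m′
  ... | ()
  similar-halts {d = d} rc rd sm (m ∷ p) (m″ ∷ q) hh | d′ , m′ , sm′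
   with unique (≤-trans (≡⇒≤ (length-map (perform w d) (δ (state d) (readInput w (position d)) (Vec.map Tape.current (works d)))))
     (det (state d) (readInput w (position d)) (Vec.map Tape.current (works d)))) m′ m″
  ... | refl = s≤s (similar-halts (reach rc (m ∷ [])) (reach rd (m″ ∷ [])) sm′ p q hh)

  code : Config → Fin (2 ^ ω)
  code c = funToFin {ω} (λ i → let κ , e = remQuot {m} (L n) i in if bitsOf w c κ (toℕ e) then suc zero else zero)

  code-similar : ∀ c d → code c ≡ code d → Similar c d
  code-similar c d eq κ e lt = bool (trans (symm (at-code c)) (trans (cong (λ z → finToFun {2} {ω} z (combine κ (fromℕ< lt))) eq) (at-code d)))
   where
   bool : ∀ {x y} → (if x then suc zero else zero {1}) ≡ (if y then suc zero else zero) → x ≡ y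
   bool {true} {true} e = refl
   bool {false} {false} e = refl
   bool {true} {false} ()
   bool {false} {true} ()
   at-code : ∀ c → finToFun {2} {ω} (code c) (combine κ (fromℕ< lt)) ≡ (if bitsOf w c κ e then suc zero else zero)
   at-code c = trans (finToFun-funToFin {m = ω} _ (combine κ (fromℕ< lt)))
    (cong₂ (λ j i → if bitsOf w c j i then suc zero else zero)
     (cong proj₁ (remQuot-combine {m} {L n} κ (fromℕ< lt)))
     (trans (cong (toℕ ∘ proj₂) (remQuot-combine {m} {L n} κ (fromℕ< lt))) (toℕ-fromℕ< lt)))

  short : ∀ {N d} → Path w N initialConfig d → Halted w d → N ≤ 2 ^ ω
  short {N} {d} path hd with N ≤? 2 ^ ω
  ... | yes le = le
  ... | no nle = ⊥-elim (contradict (pigeonhole (n<1+n (2 ^ ω)) (λ i → code (proj₁ (point i)))))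
   where
   below : ∀ (i : Fin (suc (2 ^ ω))) → toℕ i ≤ N
   below i = ≤-trans (s≤s⁻¹ (toℕ<n i)) (<⇒≤ (≰⇒> nle))
   point : ∀ (i : Fin (suc (2 ^ ω))) → ∃[ e ] Path w (toℕ i) initialConfig e × Path w (N ∸ toℕ i) e d
   point i = visit path (toℕ i) (below i)
   contradict : (∃[ i ] ∃[ j ] toℕ i < toℕ j × code (proj₁ (point i)) ≡ code (proj₁ (point j))) → ⊥
   contradict (i , j , i<j , eq) = <⇒≱ (∸-monoʳ-< i<j (below j))
    (similar-halts (reach (0 , start) (proj₁ (proj₂ (point i)))) (reach (0 , start) (proj₁ (proj₂ (point j))))
     (code-similar (proj₁ (point i)) (proj₁ (point j)) eq) (proj₂ (proj₂ (point i))) (proj₂ (proj₂ (point j))) hd)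

  ps-correct : True [] (Plan.formula psPlan w) ⇔ Accepts w
  ps-correct = mk⇔ sound complete where
   count : ℕ
   count = ⟦ expr W zero ⟧ᴱ η
   W≡ : count ≡ ω
   W≡ = correct W zero η
   initQ acceptQ rest : QBF
   initQ = ⟦ initSch zeroᵀ zero ⟧ˢ w η
   acceptQ = ⟦ acceptSch zeroᵀ zero ⟧ˢ w η
   rest = iterateQ count chunkQ finalQ
   rest-⇔ : Correct count rest
   rest-⇔ = ps-iterate count chunkQ (λ j → j , refl)
   second : QBF
   second = quantTimes count exists (and acceptQ rest)
   sound : True [] (Plan.formula psPlan w) → Accepts w
   sound tr with to (true-quants count (and initQ second)) tr
   ... | u , len , i , tr′ with pos-++ u [] (trans len W≡) (0<W w) | to (true-quants count (and acceptQ rest)) tr′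
   ... | lt | u′ , len′ , a , tr″ with pos-++ u′ (u ++ []) (trans len′ W≡) (0<W w)
   ... | lt′ with to (rest-⇔ (u′ ++ u ++ []) initialConfig lt′ (0 , start)
     (holds-weaken u′ (trans (symm (trans len′ W≡)) (symm (+-identityʳ _))) (to (init-⇔ w η zero stream-beyond {u ++ []} zeroᵀ lt) i))) tr″
   ... | j , d , _ , path , hd with to (accept-⇔ w η zero stream-beyond {u′ ++ u ++ []} {d} zeroᵀ lt′ hd) a
   ... | h , acc = let i , r = reach (0 , start) path in i , d , r , h , acc
   complete : Accepts w → True [] (Plan.formula psPlan w)
   complete (j , d , r , h , acc) = from (true-quants count (and initQ second))
    (u , trans (length-bits w initialConfig) (symm W≡) , from (init-⇔ w η zero stream-beyond {u ++ []} zeroᵀ lt) hs ,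
     from (true-quants count (and acceptQ rest)) (bits w d , trans (length-bits w d) (symm W≡) ,
      from (accept-⇔ w η zero stream-beyond {bits w d ++ u ++ []} {d} zeroᵀ lt′ hd) (h , acc) ,
      from (rest-⇔ (bits w d ++ u ++ []) initialConfig lt′ (0 , start)
        (holds-weaken (bits w d) (trans (symm (length-bits w d)) (symm (+-identityʳ _))) hs))
       (j , d , ≤-trans (short (reaches⇒path r) h) (≡⇒≤ (cong (2 ^_) (symm W≡))) , reaches⇒path r , hd)))
    where
    u : List Bool
    u = bits w initialConfig
    lt : 0 < length (u ++ [])
    lt = pos-++ u [] (length-bits w initialConfig) (0<W w)
    lt′ : 0 < length (bits w d ++ u ++ [])
    lt′ = pos-++ (bits w d) _ (length-bits w d) (0<W w)
    hs : Holds (u ++ []) n 0 (bitsOf w initialConfig)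
    hs = holds-new [] [] refl
    hd : Holds (bits w d ++ u ++ []) n 0 (bitsOf w d)
    hd = holds-new (u ++ []) [] refl

 module _ {U : Quantifier → Set} (u∃ : U exists) (u∀ : U forAll) (w : Word k) where

  private
   n : ℕ
   n = length w
   η : Vec ℕ 1
   η = n ∷ []
   ω : ℕ
   ω = Wn w

  ps-scoped : Scoped U [] (Plan.formula psPlan w)
  ps-scoped = scoped-quants-≡ U [] exists (and (⟦ initSch zeroᵀ zero ⟧ˢ w η) second) W≡ u∃
   (closed {U} {s = initSch zeroᵀ zero} (closed-init first η zero zeroᵀ ≤-refl) ,
    scoped-quants-≡ U Γ₁ exists (and (⟦ acceptSch zeroᵀ zero ⟧ˢ w η) rest) W≡ u∃
     (closed {U} {s = acceptSch zeroᵀ zero} (closed-accept (extend ω first) η zero zeroᵀ (m≤m+n ω ω)) ,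
     go count F₀ (λ j → j , refl) (extend ω first))) where
   count : ℕ
   count = ⟦ expr W zero ⟧ᴱ η
   W≡ : count ≡ ω
   W≡ = correct W zero η
   Γ₁ : List Quantifier
   Γ₁ = replicate ω exists ++ []
   F₀ : ℕ → QBF → QBF
   F₀ t = ⟦ Plan.chunk psPlan ⟧ᴵ w (t ∷ η)
   finalQ rest second : QBF
   finalQ = ⟦ stepSch W zeroᵀ zero ⟧ˢ w η
   rest = iterateQ count F₀ finalQ
   second = quantTimes count exists (and (⟦ acceptSch zeroᵀ zero ⟧ˢ w η) rest)
   first : Available (replicate ω exists ++ []) ω
   first = block-available ω (0<W w)
   go : ∀ T (F : ℕ → QBF → QBF) → (∀ j → ∃[ t ] F j ≡ F₀ t) → ∀ {Γ} → Available Γ (ω + ω) → Scoped U Γ (iterateQ T F finalQ)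
   go zero F eF a = closed-step u∃ w a η zero W zeroᵀ ≤-refl (m≤m+n ω ω)
   go (suc T) F eF {Γ} a = subst (λ f → Scoped U Γ (f (iterateQ T (F ∘ suc) finalQ))) (symm (proj₂ (eF 0)))
     (scoped-quants-≡ U Γ exists (qu forAll (quantTimes (⟦ expr Uᵀ (suc zero) ⟧ᴱ (t ∷ η)) exists body)) (correct W (suc zero) (t ∷ η)) u∃
      (u∀ , scoped-quants-≡ U (forAll ∷ replicate ω exists ++ Γ) exists body U≡ u∃ (split , go T (F ∘ suc) (eF ∘ suc) inner)))
    where
    t : ℕ
    t = proj₁ (eF 0)
    U≡ : ⟦ expr Uᵀ (suc zero) ⟧ᴱ (t ∷ η) ≡ ω + ω
    U≡ = correct Uᵀ (suc zero) (t ∷ η)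
    body : QBF
    body = and (⟦ splitSch (suc zero) ⟧ˢ w (t ∷ η)) (iterateQ T (F ∘ suc) finalQ)
    Γ′ : List Quantifier
    Γ′ = replicate (ω + ω) exists ++ forAll ∷ replicate ω exists ++ Γ
    inner : Available Γ′ (ω + ω)
    inner = block-available (ω + ω) (≤-trans (0<W w) (m≤m+n ω ω))
    zero-scope : get Γ′ 0 ≡ just exists
    zero-scope = scope inner 0 (Available.nonempty inner)
    switch : get Γ′ (⟦ expr Uᵀ (suc zero) ⟧ᴱ (t ∷ η)) ≡ just forAll
    switch = trans (cong (get Γ′) (trans U≡ (symm (+-identityʳ (ω + ω))))) (get-beyond (ω + ω) 0)
    long : length (replicate (ω + ω) exists) ≡ ω + ω
    long = length-replicate (ω + ω)
    deeper : ∀ {Δ b} → InScope Δ n b → InScope (replicate (ω + ω) exists ++ forAll ∷ Δ) n ((ω + ω) + (1 + b))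
    deeper {Δ} {b} h = inScope-weaken {forAll ∷ Δ} {n} {1 + b} (replicate (ω + ω) exists) (cong (_+ (1 + b)) (symm long)) (inScope-weaken {Δ} {n} {b} (forAll ∷ []) refl h)
    block : ∀ {Δ} → InScope (replicate ω exists ++ Δ) n 0
    block = available⇒inScope 0 (block-available ω (0<W w)) ≤-refl
    middle : InScope Γ′ n (ω + ω + 1)
    middle = deeper block
    outer : ∀ {b} → InScope Γ n b → InScope Γ′ n (ω + ω + 1 + (ω + b))
    outer {b} h = subst (InScope Γ′ n) (symm (+-assoc (ω + ω) 1 (ω + b)))
     (deeper (inScope-weaken (replicate ω exists) (cong (_+ b) (symm (length-replicate ω))) h))
    oldY : InScope Γ′ n (ω + ω + 1 + ω)
    oldY = subst (λ b → InScope Γ′ n (ω + ω + 1 + b)) (+-identityʳ ω) (outer (available⇒inScope 0 a (m≤m+n ω ω)))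
    oldX : InScope Γ′ n (ω + ω + 1 + ω + ω)
    oldX = subst (InScope Γ′ n) (symm (+-assoc (ω + ω + 1) ω ω)) (outer (available⇒inScope ω a ≤-refl))
    new : ∀ b → b + ω ≤ ω + ω → InScope Γ′ n b
    new b le = available⇒inScope b inner le
    eqs : ∀ s s′ → InScope Γ′ n (value s n) → InScope Γ′ n (value s′ n) → Scoped U Γ′ (⟦ equalBlocks s s′ (suc zero) ⟧ˢ w (t ∷ η))
    eqs s s′ h h′ = closed (closed-equalBlocks {w = w} (t ∷ η) (suc zero) zero-scope s s′ h h′)
    split : Scoped U Γ′ (⟦ splitSch (suc zero) ⟧ˢ w (t ∷ η))
    split = (switch , eqs oldXᵀ W oldX (new ω ≤-refl) , eqs middleᵀ zeroᵀ middle (new 0 (m≤m+n ω ω))) ,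
      (switch , eqs middleᵀ W middle (new ω ≤-refl) , eqs oldYᵀ zeroᵀ oldY (new 0 (m≤m+n ω ω)))

tapeSpace-moveTape : ∀ {g} m (t : Tape g) → tapeSpace (moveTape m t) ≤ suc (tapeSpace t)
tapeSpace-moveTape left (tape [] a rs) = ≤-refl
tapeSpace-moveTape left (tape (l ∷ ls) a rs) = ≤-trans (≡⇒≤ (+-suc (length ls) _)) (n≤1+n _)
tapeSpace-moveTape stay t = n≤1+n _
tapeSpace-moveTape right (tape ls a []) = ≤-refl
tapeSpace-moveTape right (tape ls a (r ∷ rs)) = ≤-trans (≡⇒≥ (+-suc (length ls) _)) (n≤1+n _)

module _ {k : ℕ} (M : Acceptor k) where

 open Machine M

 private
  widest : Config → Fin #tapes → ℕ
  widest c i = tapeSpace (lookup (works c) i)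

 reaches-space : ∀ {w n c} → Reaches w n c → ∀ i → widest c i ≤ suc n
 reaches-space start i = ≡⇒≤ (cong tapeSpace (lookup-replicate i blankTape))
 reaches-space {w} (step {c = c} r m) i with ∈-map⁻ (perform w c) m
 ... | a , _ , refl = ≤-trans (≡⇒≤ (cong tapeSpace (lookup-zipWith _ i (Action.workMoves a) (works c))))
  (≤-trans (tapeSpace-moveTape (proj₂ (lookup (Action.workMoves a) i)) (write _ (lookup (works c) i))) (s≤s (reaches-space r i)))

 widest≤space : ∀ c i → widest c i ≤ space c
 widest≤space c i = go (works c) i where
  go : ∀ {m} (ts : Vec (Tape #symbols) m) i → tapeSpace (lookup ts i) ≤ Vec.sum (Vec.map tapeSpace ts)
  go (t ∷ ts) zero = m≤m+n _ _
  go (t ∷ ts) (suc i) = ≤-trans (go ts i) (m≤n+m _ (tapeSpace t))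

⇔-trans : ∀ {X Y Z : Set} → X ⇔ Y → Y ⇔ Z → X ⇔ Z
⇔-trans f g = mk⇔ (to g ∘ to f) (from f ∘ from g)

⇔-sym : ∀ {X Y : Set} → X ⇔ Y → Y ⇔ X
⇔-sym e = mk⇔ (from e) (to e)

only-exists? : ∀ Q → Dec (Only exists Q)
only-exists? exists = yes refl
only-exists? forAll = no λ ()

module _ {σ : Signature} (B : Structure σ) where

 record Reduction {j} (L : Language j) : Set where
  field
   text : Gen j (#letters σ) 1
   image : Word j → Sentence σ
   text≡ : ∀ w → ⟦ text ⟧ᴳ w (length w ∷ []) ≡ encode σ (image w)
   reduces : ∀ w → L w ⇔ B ⊨ image w

 np-reduction : ∃ (Breaks∧ B) → ∀ {j} (L : Language j) → NP L → Reduction L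
 np-reduction br {j} L (M , p , time , sound , complete) = record
  { text = genPlan B only-exists? G npPlan
  ; image = λ w → Tr.sentence (Plan.formula npPlan w) (np-scoped refl w)
  ; text≡ = λ w → ⟦genPlan⟧ B only-exists? G npPlan w (np-scoped refl w)
  ; reduces = λ w → ⇔-trans (mk⇔ sound complete)
    (⇔-sym (⇔-trans (Tr.sentence-correct _ (np-scoped refl w)) (Computation.NPTableau.np-correct M p fit time w)))
  } where
  G : Gadget B (Only exists)
  G = gadget∃ B br
  fit : ∀ w n c → Machine.Reaches M w n c → ∀ i → tapeSpace (lookup (Machine.Config.works c) i) ≤ suc (eval p (length w))
  fit w n c r i = ≤-trans (reaches-space M r i) (s≤s (time w n c r))
  open Computation M p fit using (npPlan; np-scoped)
  open Texts {σ} j using (genPlan; ⟦genPlan⟧)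
  module Tr = Translate B only-exists? G using (sentence; sentence-correct)

 pspace-reduction : ∃ (Breaks∧ B) → ∃ (Breaks∨ B) → ∀ {j} (L : Language j) → Pspace L → Reduction L
 pspace-reduction br∧ br∨ {j} L (M , p , det , halts , bounded , sound , complete) = record
  { text = genPlan B anyQuantifier? G psPlan
  ; image = λ w → Tr.sentence (Plan.formula psPlan w) (ps-scoped tt tt w)
  ; text≡ = λ w → ⟦genPlan⟧ B anyQuantifier? G psPlan w (ps-scoped tt tt w)
  ; reduces = λ w → ⇔-trans (mk⇔ sound complete)
    (⇔-sym (⇔-trans (Tr.sentence-correct _ (ps-scoped tt tt w)) (Computation.PSTableau.ps-correct M p fit det halts w)))
  } where
  G : Gadget B Any
  G = gadget-both B (gadget∃ B br∧) (gadget∀ B br∨)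
  anyQuantifier? : ∀ Q → Dec (Any Q)
  anyQuantifier? Q = yes tt
  fit : ∀ w n c → Machine.Reaches M w n c → ∀ i → tapeSpace (lookup (Machine.Config.works c) i) ≤ suc (eval p (length w))
  fit w n c r i = ≤-trans (widest≤space M c i) (≤-trans (bounded w n c r) (n≤1+n _))
  open Computation M p fit using (psPlan; ps-scoped)
  open Texts {σ} j using (genPlan; ⟦genPlan⟧)
  module Tr = Translate B anyQuantifier? G using (sentence; sentence-correct)

 reduction⇒≤ₚ : ∀ {j} {L : Language j} → Reduction L → L ≤ₚ MC B
 reduction⇒≤ₚ R = (λ w → ⟦ text ⟧ᴳ w (length w ∷ [])) , gen-computable text ,
  λ w → ⇔-trans (reduces w) (subst (λ u → B ⊨ image w ⇔ MC B u) (symm (text≡ w)) (⇔-sym (mc-encode B (image w))))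
  where open Reduction R

 np-hard : ∃ (Breaks∧ B) → Hard NP (MC B)
 np-hard br L np = reduction⇒≤ₚ (np-reduction br L np)

 pspace-hard : ∃ (Breaks∧ B) → ∃ (Breaks∨ B) → Hard Pspace (MC B)
 pspace-hard br∧ br∨ L ps = reduction⇒≤ₚ (pspace-reduction br∧ br∨ L ps)

dualLetter : ∀ σ → Letter σ → Letter σ
dualLetter σ forAll-letter = exists-letter
dualLetter σ exists-letter = forAll-letter
dualLetter σ and-letter = or-letter
dualLetter σ or-letter = and-letter
dualLetter σ a = a

encode-dual : ∀ {σ n} (φ : Formula σ n) → encode σ (dual φ) ≡ map (dualLetter σ) (encode σ φ)
encode-dual {σ} (atom r xs) = cong (rel-letter σ r ∷_) (go xs) where
 ticks : ∀ n → map (dualLetter σ) (replicate n (tick-letter)) ≡ replicate n (tick-letter)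
 ticks zero = refl
 ticks (suc n) = cong (_ ∷_) (ticks n)
 go : ∀ {n m} (xs : Vec (Fin n) m) → encodeVars σ xs ≡ map (dualLetter σ) (encodeVars σ xs)
 go [] = refl
 go (x ∷ xs) = symm (trans (map-++ (dualLetter σ) (replicate (toℕ x) (tick-letter)) _)
  (cong₂ _++_ (ticks (toℕ x)) (cong (stop-letter ∷_) (symm (go xs)))))
encode-dual {σ} (φ ∧ ψ) = cong (or-letter ∷_) (trans (cong₂ _++_ (encode-dual φ) (encode-dual ψ)) (symm (map-++ (dualLetter σ) (encode σ φ) _)))
encode-dual {σ} (φ ∨ ψ) = cong (and-letter ∷_) (trans (cong₂ _++_ (encode-dual φ) (encode-dual ψ)) (symm (map-++ (dualLetter σ) (encode σ φ) _)))
encode-dual {σ} (quant forAll φ) = cong (exists-letter ∷_) (encode-dual φ)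
encode-dual {σ} (quant exists φ) = cong (forAll-letter ∷_) (encode-dual φ)

conp-hard : ∀ {σ} (B : Structure σ) → ∃ (Breaks∨ B) → Hard coNP (MC B)
conp-hard {σ} B br L (L′ , np , L⊆ , ⊆L) = reduction⇒≤ₚ B record
  { text = mapGen (dualLetter σ) text
  ; image = dual ∘ image
  ; text≡ = λ w → trans (mapGen-⟦⟧ (dualLetter σ) text w _) (trans (cong (map (dualLetter σ)) (text≡ w)) (symm (encode-dual (image w))))
  ; reduces = λ w → mk⇔ (λ l → from (Dual.sat-dual′ B (image w)) (L⊆ l ∘ from (reduces w)))
    (λ h → ⊆L (to (Dual.sat-dual′ B (image w)) h ∘ to (reduces w)))
  } where
 open Reduction (np-reduction (complement B) (Dual.breaks∨⇒ B br) L′ np)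

module Parsing (σ : Signature) where

 tickWord : ℕ → Word (#letters σ) → Word (#letters σ)
 tickWord n u = replicate n tick-letter ++ u

 data Head (P : Letter σ → Set) : Word (#letters σ) → Set where
  none : Head P []
  first : ∀ {a u} → P a → Head P (a ∷ u)

 NoVariable NoFormula : Letter σ → Set
 NoVariable a = a ≢ tick-letter × a ≢ stop-letter
 NoFormula a = a ≡ tick-letter ⊎ a ≡ stop-letter

 data BadVars (n : ℕ) : ℕ → Word (#letters σ) → Set where
  no-stop : ∀ {m u} k → Head NoVariable u → BadVars n (suc m) (tickWord k u)
  too-big : ∀ {m u} k → n ≤ k → BadVars n (suc m) (tickWord k (stop-letter ∷ u))
  later : ∀ {m u} (x : Fin n) → BadVars n m u → BadVars n (suc m) (tickWord (toℕ x) (stop-letter ∷ u))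

 data Binary : Letter σ → Set where
  conj : Binary and-letter
  disj : Binary or-letter

 data Bad : ℕ → Word (#letters σ) → Set where
  no-start : ∀ {n u} → Head NoFormula u → Bad n u
  bad-vars : ∀ {n r u} → BadVars n (arity σ r) u → Bad n (rel-letter σ r ∷ u)
  in-left : ∀ {n c u} → Binary c → Bad n u → Bad n (c ∷ u)
  in-right : ∀ {n c u} → Binary c → (φ : Formula σ n) → Bad n u → Bad n (c ∷ encode σ φ ++ u)
  beneath : ∀ {n Q u} → Bad (suc n) u → Bad n (quantifier-letter σ Q ∷ u)

 record Split {A : Set} (f : A → Word (#letters σ)) (u : Word (#letters σ)) : Set where
  constructor split
  field
   {value} : A
   {rest} : Word (#letters σ)
   shape : u ≡ f value ++ rest

 parseVars : ∀ n m u → Split (encodeVars σ {n} {m}) u ⊎ BadVars n m u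
 parseVars n zero u = inj₁ (split {value = []} refl)
 parseVars n (suc m) u with ticking u where
  ticking : ∀ u → ∃[ k ] ∃[ v ] u ≡ tickWord k v × (Head NoVariable v ⊎ (∃[ v′ ] v ≡ stop-letter ∷ v′))
  ticking [] = 0 , [] , refl , inj₁ none
  ticking (tick-letter ∷ u) with ticking u
  ... | k , v , e , h = suc k , v , cong (tick-letter ∷_) e , h
  ticking (stop-letter ∷ u) = 0 , _ , refl , inj₂ (u , refl)
  ticking (forAll-letter ∷ u) = 0 , _ , refl , inj₁ (first ((λ ()) , (λ ())))
  ticking (exists-letter ∷ u) = 0 , _ , refl , inj₁ (first ((λ ()) , (λ ())))
  ticking (and-letter ∷ u) = 0 , _ , refl , inj₁ (first ((λ ()) , (λ ())))
  ticking (or-letter ∷ u) = 0 , _ , refl , inj₁ (first ((λ ()) , (λ ())))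
  ticking (suc (suc (suc (suc (suc (suc r))))) ∷ u) = 0 , _ , refl , inj₁ (first ((λ ()) , (λ ())))
 ... | k , v , refl , inj₁ h = inj₂ (no-stop k h)
 ... | k , v , refl , inj₂ (v′ , refl) with k <? n
 ... | no k≮n = inj₂ (too-big k (≮⇒≥ k≮n))
 ... | yes k<n with parseVars n m v′
 ... | inj₁ (split {xs} {v″} refl) = inj₁ (split {value = fromℕ< k<n ∷ xs} {rest = v″}
   (trans (cong (λ j → tickWord j (stop-letter ∷ encodeVars σ xs ++ v″)) (symm (toℕ-fromℕ< k<n)))
     (symm (++-assoc (replicate (toℕ (fromℕ< k<n)) _) _ v″))))
 ... | inj₂ b = inj₂ (subst (λ j → BadVars n (suc m) (tickWord j (stop-letter ∷ v′))) (toℕ-fromℕ< k<n) (later (fromℕ< k<n) b))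

 no-vars : ∀ {n m u} → BadVars n m u → (xs : Vec (Fin n) m) → ∀ v → u ≢ encodeVars σ xs ++ v
 no-vars b (x ∷ xs) v e = go b (trans e (++-assoc (replicate (toℕ x) _) _ v)) where
  no-head : ∀ k j {u w} → Head NoVariable u → tickWord k u ≢ tickWord j (stop-letter ∷ w)
  no-head zero zero (first (_ , n)) e = n (∷-injectiveˡ e)
  no-head zero (suc j) (first (n , _)) e = n (∷-injectiveˡ e)
  no-head (suc k) (suc j) h e = no-head k j h (∷-injectiveʳ e)
  go : ∀ {u} → BadVars _ _ u → u ≢ tickWord (toℕ x) (stop-letter ∷ encodeVars σ xs ++ v)
  go (no-stop k h) e = no-head k (toℕ x) h e
  go (too-big k le) e with ticks-injective σ {k} {toℕ x} e
  ... | refl , _ = <⇒≱ (toℕ<n x) le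
  go (later y b) e with ticks-injective σ {toℕ y} {toℕ x} e
  ... | _ , refl = no-vars b xs v refl

 parse : ∀ fuel n u → length u ≤ fuel → Split (encode σ {n}) u ⊎ Bad n u
 parseBinary : ∀ fuel n u {c} → Binary c → (_⊛_ : Formula σ n → Formula σ n → Formula σ n) →
  (∀ φ ψ → encode σ (φ ⊛ ψ) ≡ c ∷ encode σ φ ++ encode σ ψ) → length u ≤ fuel → Split (encode σ {n}) (c ∷ u) ⊎ Bad n (c ∷ u)
 parseBinary fuel n u {c} bc _⊛_ enc le with parse fuel n u le
 ... | inj₂ b = inj₂ (in-left bc b)
 ... | inj₁ (split {φ} {u′} refl) with parse fuel n u′ (≤-trans (≤-trans (m≤n+m _ (length (encode σ φ))) (≡⇒≥ (length-++ (encode σ φ)))) le)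
 ... | inj₂ b = inj₂ (in-right bc φ b)
 ... | inj₁ (split {ψ} {u″} refl) = inj₁ (split {value = φ ⊛ ψ} {rest = u″}
   (trans (cong (c ∷_) (symm (++-assoc (encode σ φ) (encode σ ψ) u″))) (cong (_++ u″) (symm (enc φ ψ)))))
 parse fuel n [] le = inj₂ (no-start none)
 parse (suc fuel) n (forAll-letter ∷ u) (s≤s le) with parse fuel (suc n) u le
 ... | inj₁ (split {φ} refl) = inj₁ (split {value = quant forAll φ} refl)
 ... | inj₂ b = inj₂ (beneath {Q = forAll} b)
 parse (suc fuel) n (exists-letter ∷ u) (s≤s le) with parse fuel (suc n) u le
 ... | inj₁ (split {φ} refl) = inj₁ (split {value = quant exists φ} refl)
 ... | inj₂ b = inj₂ (beneath {Q = exists} b)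
 parse (suc fuel) n (and-letter ∷ u) (s≤s le) = parseBinary fuel n u conj _∧_ (λ _ _ → refl) le
 parse (suc fuel) n (or-letter ∷ u) (s≤s le) = parseBinary fuel n u disj _∨_ (λ _ _ → refl) le
 parse fuel n (tick-letter ∷ u) le = inj₂ (no-start (first (inj₁ refl)))
 parse fuel n (stop-letter ∷ u) le = inj₂ (no-start (first (inj₂ refl)))
 parse fuel n (suc (suc (suc (suc (suc (suc r))))) ∷ u) le with parseVars n (arity σ r) u
 ... | inj₁ (split {xs} refl) = inj₁ (split {value = atom r xs} refl)
 ... | inj₂ b = inj₂ (bad-vars b)

 no-formula : ∀ {n u} → Bad n u → ∀ (φ : Formula σ n) v → u ≢ encode σ φ ++ v
 no-formula (no-start none) (quant Q φ) v ()
 no-formula (no-start (first (inj₁ refl))) (quant forAll φ) v ()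
 no-formula (no-start (first (inj₁ refl))) (quant exists φ) v ()
 no-formula (no-start (first (inj₂ refl))) (quant forAll φ) v ()
 no-formula (no-start (first (inj₂ refl))) (quant exists φ) v ()
 no-formula (bad-vars {r = r} b) (atom s xs) v e with ↑ʳ-injective 6 r s (∷-injectiveˡ e)
 ... | refl = no-vars b xs v (∷-injectiveʳ e)
 no-formula (bad-vars b) (quant forAll φ) v ()
 no-formula (bad-vars b) (quant exists φ) v ()
 no-formula (in-left conj b) (φ ∧ ψ) v e = no-formula b φ _ (trans (∷-injectiveʳ e) (++-assoc (encode σ φ) _ v))
 no-formula (in-left disj b) (φ ∨ ψ) v e = no-formula b φ _ (trans (∷-injectiveʳ e) (++-assoc (encode σ φ) _ v))
 no-formula (in-left conj b) (quant forAll φ) v ()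
 no-formula (in-left conj b) (quant exists φ) v ()
 no-formula (in-left disj b) (quant forAll φ) v ()
 no-formula (in-left disj b) (quant exists φ) v ()
 no-formula (in-right conj φ b) (φ′ ∧ ψ) v e with encode-prefix σ φ φ′ (trans (∷-injectiveʳ e) (++-assoc (encode σ φ′) _ v))
 ... | _ , e′ = no-formula b ψ v e′
 no-formula (in-right disj φ b) (φ′ ∨ ψ) v e with encode-prefix σ φ φ′ (trans (∷-injectiveʳ e) (++-assoc (encode σ φ′) _ v))
 ... | _ , e′ = no-formula b ψ v e′
 no-formula (in-right conj _ b) (quant forAll φ) v ()
 no-formula (in-right conj _ b) (quant exists φ) v ()
 no-formula (in-right disj _ b) (quant forAll φ) v ()
 no-formula (in-right disj _ b) (quant exists φ) v ()
 no-formula (beneath {Q = forAll} b) (quant forAll φ) v e = no-formula b φ v (∷-injectiveʳ e)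
 no-formula (beneath {Q = exists} b) (quant exists φ) v e = no-formula b φ v (∷-injectiveʳ e)

module Machines {σ : Signature} (g : ℕ) (tr nd : Bool)
 (val : Quantifier → Fin (3 + g) → Fin (3 + g)) (verdict : Bool)
 (relate : ∀ r → Vec (Fin (3 + g)) (arity σ r) → Bool) where

 open Programs (#letters σ) 0 g 4 tr nd public using (ATree; AccLeaf; Cell; Cont; Prog; Runs; Step; Store; store; Sym; Test; _⨾_; blank; one; two; both; choose; counter; dec; inc; evalTest; exec; fork; goL; goR; halt; halted; ifThen; initStore; isZero; leaf; local; neg; runs; seq; setAnn; setReg; step; switch; test; weakenA; while; zero?; skip; times; positive?)
 open Parsing σ using (Bad; BadVars; Binary; Head; NoVariable; Split; bad-vars; beneath; conj; disj; first; in-left; in-right; later; no-formula; no-start; no-stop; none; parse; split; tickWord; too-big)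

 Input : Set
 Input = InputSymbol (#letters σ)

 -- Annotations are placed on the quantifiers only.
 Ann : ∀ {n} → Formula σ n → Set
 Ann (atom r xs) = ⊤
 Ann (φ ∧ ψ) = Ann φ × Ann ψ
 Ann (φ ∨ ψ) = Ann φ × Ann ψ
 Ann (quant Q φ) = Sym × Ann φ

 plain : Letter σ → Cell
 plain a = sym a , blank

 quantCell : Quantifier → Sym → Cell
 quantCell Q s = sym (quantifier-letter σ Q) , s

 ticks : ℕ → List Cell → List Cell
 ticks zero L = L
 ticks (suc n) L = plain tick-letter ∷ ticks n L

 ticks-snoc : ∀ n L → ticks n (plain tick-letter ∷ L) ≡ plain tick-letter ∷ ticks n L
 ticks-snoc zero L = refl
 ticks-snoc (suc n) L = cong (plain tick-letter ∷_) (ticks-snoc n L)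

 pushedVars aheadVars : ∀ {n m} → Vec (Fin n) m → List Cell → List Cell
 pushedVars [] L = L
 pushedVars (x ∷ xs) L = pushedVars xs (plain stop-letter ∷ ticks (toℕ x) L)
 aheadVars [] R = R
 aheadVars (x ∷ xs) R = ticks (toℕ x) (plain stop-letter ∷ aheadVars xs R)

 -- The cells left of the head after the head has passed an annotated formula,
 -- and those right of it before.
 pushed ahead : ∀ {n} (φ : Formula σ n) → Ann φ → List Cell → List Cell
 pushed (atom r xs) α L = pushedVars xs (plain (rel-letter σ r) ∷ L)
 pushed (φ ∧ ψ) (α , β) L = pushed ψ β (pushed φ α (plain and-letter ∷ L))
 pushed (φ ∨ ψ) (α , β) L = pushed ψ β (pushed φ α (plain or-letter ∷ L))
 pushed (quant Q φ) (a , α) L = pushed φ α (quantCell Q a ∷ L)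
 ahead (atom r xs) α R = plain (rel-letter σ r) ∷ aheadVars xs R
 ahead (φ ∧ ψ) (α , β) R = plain and-letter ∷ ahead φ α (ahead ψ β R)
 ahead (φ ∨ ψ) (α , β) R = plain or-letter ∷ ahead φ α (ahead ψ β R)
 ahead (quant Q φ) (a , α) R = quantCell Q a ∷ ahead φ α R

 Counters : Set
 Counters = Vec ℕ 4

 pattern ⟨_,_,_,_⟩ b x d p = b ∷ x ∷ d ∷ p ∷ []
 pattern #b = zero
 pattern #x = suc zero
 pattern #d = suc (suc zero)
 pattern #p = suc (suc (suc zero))

 -- The head scans the first cell of the first list (resp. of the second one).
 on front : List Cell → List Cell → Sym → Counters → Store
 on [] R u vs = store [] (⊢ , blank) R u vs []
 on (c ∷ L) R u vs = store L c R u vs []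
 front L [] u vs = store L (⊣ , blank) [] u vs []
 front L (c ∷ R) u vs = store L c R u vs []

 cases : (Input → Prog) → Prog
 cases f = switch (λ a _ _ → symCode a) (f ∘ symDecode)

 isRel isTick isStop isBinary isQuant : Input → Bool
 isRel (sym (suc (suc (suc (suc (suc (suc _))))))) = true
 isRel _ = false
 isTick (sym tick-letter) = true
 isTick _ = false
 isStop (sym stop-letter) = true
 isStop _ = false
 isBinary (sym and-letter) = true
 isBinary (sym or-letter) = true
 isBinary _ = false
 isQuant (sym forAll-letter) = true
 isQuant (sym exists-letter) = true
 isQuant _ = false

 at? : (Input → Bool) → Test
 at? f = local (λ a _ _ → f a)

 scanStep : Input → Prog
 scanStep (sym forAll-letter) = ifThen (both (isZero #b) (positive? #x)) (counter dec #x) skip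
 scanStep (sym exists-letter) = ifThen (both (isZero #b) (positive? #x)) (counter dec #x) skip
 scanStep (sym and-letter) = ifThen (positive? #b) (counter dec #b) skip
 scanStep (sym or-letter) = ifThen (positive? #b) (counter dec #b) skip
 scanStep (sym (suc (suc (suc (suc (suc (suc _))))))) = counter inc #b
 scanStep _ = skip

 -- Going left, #b counts the formulas that have been passed entirely and that
 -- no connective has claimed yet, and #d the cells.
 scan : Test → Prog
 scan t = while t (cases scanStep ⨾ counter inc #d ⨾ goL)

 rewindBy : Prog
 rewindBy = while (positive? #d) (counter dec #d ⨾ goR)

 toRel goLookup goFind : Test
 toRel = neg (at? isRel)
 goLookup = both (neg (at? isStart)) (neg (both (at? isQuant) (both (isZero #b) (isZero #x))))
 goFind = both (neg (at? isStart)) (neg (both (at? isBinary) (isZero #b)))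

 valOf : Input → Sym → Sym → Sym
 valOf (sym forAll-letter) s _ = val forAll s
 valOf (sym exists-letter) s _ = val exists s
 valOf _ _ u = u

 lookupVar : Prog
 lookupVar = while (at? isTick) (counter inc #x ⨾ goR) ⨾
  ifThen (at? isStop) (scan toRel ⨾ counter inc #d ⨾ goL ⨾ scan goLookup ⨾
   ifThen (at? isStart) (halt verdict) (setReg valOf ⨾ rewindBy)) (halt verdict)

 Config : Set
 Config = Cont × Store

 bit : Bool → Sym
 bit true = one
 bit false = two

 evalA : ∀ {n} (φ : Formula σ n) → Ann φ → Vec Sym n → Bool
 evalA (atom r xs) α ρ = relate r (Vec.map (lookup ρ) xs)
 evalA (φ ∧ ψ) (α , β) ρ = evalA φ α ρ ∧ᵇ evalA ψ β ρ
 evalA (φ ∨ ψ) (α , β) ρ = evalA φ α ρ ∨ᵇ evalA ψ β ρ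
 evalA (quant Q φ) (a , α) ρ = evalA φ α (val Q a ∷ ρ)

 vars : ∀ m → (Vec Sym m → Bool) → Prog
 vars zero f = setReg (λ _ _ _ → bit (f []))
 vars (suc m) f = goR ⨾ lookupVar ⨾ switch (λ _ _ u → u) (λ s → vars m (f ∘ (s ∷_)))

 atomStep : Input → Prog
 atomStep (sym (suc (suc (suc (suc (suc (suc r))))))) = vars (arity σ r) (relate r)
 atomStep _ = skip

 descend evalAtom find skipFormula handle : Prog
 descend = while toRel goR
 evalAtom = cases atomStep
 find = scan toRel ⨾ counter inc #d ⨾ goL ⨾ scan goFind

 -- #p counts the formulas and variables that are still to be skipped.
 skipStep : Input → Prog
 skipStep (sym and-letter) = counter inc #p
 skipStep (sym or-letter) = counter inc #p
 skipStep (sym stop-letter) = counter dec #p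
 skipStep (sym (suc (suc (suc (suc (suc (suc r))))))) = counter dec #p ⨾ times (arity σ r) (counter inc #p)
 skipStep _ = skip

 skipping : Prog
 skipping = while (positive? #p) (cases skipStep ⨾ goR)

 skipFormula = counter inc #p ⨾ rewindBy ⨾ goR ⨾ skipping ⨾ goL

 undecided : Input → Sym → Sym → Bool
 undecided (sym and-letter) _ one = true
 undecided (sym or-letter) _ two = true
 undecided _ _ _ = false

 handle = ifThen (local undecided) (rewindBy ⨾ goR ⨾ descend ⨾ evalAtom) skipFormula ⨾ find

 climb : Prog
 climb = while (neg (at? isStart)) handle

 vsize : ∀ {n m} → Vec (Fin n) m → ℕ
 vsize [] = 0
 vsize (x ∷ xs) = toℕ x + suc (vsize xs)

 size : ∀ {n} → Formula σ n → ℕ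
 size (atom r xs) = suc (vsize xs)
 size (φ ∧ ψ) = suc (size φ + size ψ)
 size (φ ∨ ψ) = suc (size φ + size ψ)
 size (quant Q φ) = suc (size φ)

 blanks : ∀ {n} (φ : Formula σ n) → Ann φ
 blanks (atom r xs) = tt
 blanks (φ ∧ ψ) = blanks φ , blanks ψ
 blanks (φ ∨ ψ) = blanks φ , blanks ψ
 blanks (quant Q φ) = blank , blanks φ

 raw : Word (#letters σ) → List Cell
 raw [] = (⊣ , blank) ∷ []
 raw (a ∷ u) = plain a ∷ raw u

 raw-initial : ∀ u → map {B = Cell} (_, blank) (map sym u ++ ⊣ ∷ []) ≡ raw u
 raw-initial [] = refl
 raw-initial (a ∷ u) = cong (plain a ∷_) (raw-initial u)

 length-raw : ∀ u → length (raw u) ≡ suc (length u)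
 length-raw [] = refl
 length-raw (a ∷ u) = cong suc (length-raw u)

 raw-ticks : ∀ k u → raw (tickWord k u) ≡ ticks k (raw u)
 raw-ticks zero u = refl
 raw-ticks (suc k) u = cong (plain tick-letter ∷_) (raw-ticks k u)

 raw-vars : ∀ {n m} (xs : Vec (Fin n) m) u → raw (encodeVars σ xs ++ u) ≡ aheadVars xs (raw u)
 raw-vars [] u = refl
 raw-vars (x ∷ xs) u = trans (cong raw (++-assoc (replicate (toℕ x) _) _ u))
  (trans (raw-ticks (toℕ x) _) (cong (λ R → ticks (toℕ x) (plain stop-letter ∷ R)) (raw-vars xs u)))

 raw-formula : ∀ {n} (φ : Formula σ n) u → raw (encode σ φ ++ u) ≡ ahead φ (blanks φ) (raw u)
 raw-formula (atom r xs) u = cong (_ ∷_) (raw-vars xs u)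
 raw-formula (φ ∧ ψ) u = cong (plain and-letter ∷_) (trans (cong raw (++-assoc (encode σ φ) _ u))
  (trans (raw-formula φ _) (cong (ahead φ (blanks φ)) (raw-formula ψ u))))
 raw-formula (φ ∨ ψ) u = cong (plain or-letter ∷_) (trans (cong raw (++-assoc (encode σ φ) _ u))
  (trans (raw-formula φ _) (cong (ahead φ (blanks φ)) (raw-formula ψ u))))
 raw-formula (quant forAll φ) u = cong (_ ∷_) (raw-formula φ u)
 raw-formula (quant exists φ) u = cong (_ ∷_) (raw-formula φ u)

 checkStep : Input → Prog
 checkStep (sym forAll-letter) = goR
 checkStep (sym exists-letter) = goR
 checkStep (sym and-letter) = counter inc #p ⨾ goR
 checkStep (sym or-letter) = counter inc #p ⨾ goR
 checkStep (sym (suc (suc (suc (suc (suc (suc r))))))) = counter dec #p ⨾ vars (arity σ r) (λ _ → true) ⨾ goR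
 checkStep _ = halt verdict

 checking check : Prog
 checking = while (positive? #p) (cases checkStep)
 check = counter inc #p ⨾ goR ⨾ checking ⨾ ifThen (at? isEnd) goL (halt verdict)

 home : Test
 home = neg (at? isStart)

 clear restart evaluation : Prog
 clear = while (positive? #d) (counter dec #d)
 restart = scan home ⨾ counter dec #b ⨾ clear ⨾ goR
 evaluation = restart ⨾ (((descend ⨾ evalAtom) ⨾ find) ⨾ climb) ⨾ rewindBy

 holds : Sym → Bool
 holds one = true
 holds _ = false

 register : Test
 register = local (λ _ _ u → holds u)

 answer : Prog
 answer = ifThen register (halt true) (halt false)

 walking : (Input → Prog) → Prog
 walking f = while (neg (at? isEnd)) (cases f ⨾ goR)

 module Correctness (M : ℕ) where

  record Leads (c : Config) (t : ℕ) (c′ : Config) : Set₁ where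
   constructor leads
   field before : ∀ {P A s} → ATree M P s c′ A → ATree M P (t + s) c A

  open Leads public

  infixr 5 _»_
  _»_ : ∀ {c t c′ t′ c″} → Leads c t c′ → Leads c′ t′ c″ → Leads c (t + t′) c″
  _»_ {t = t} {t′ = t′} f h = leads λ x → weakenA (≡⇒≥ (+-assoc t t′ _)) (before f (before h x))

  idle! : ∀ {c} → Leads c 0 c
  idle! = leads λ x → x

  leads-≤ : ∀ {c t t′ c′} → t ≤ t′ → Leads c t c′ → Leads c t′ c′
  leads-≤ le f = leads λ x → weakenA (+-monoˡ-≤ _ le) (before f x)

  one-step : ∀ {c c′} → Step M c c′ → Leads c 1 c′
  one-step s = leads (step s)

  ending : ∀ {c t c′ c″} → c′ ≡ c″ → Leads c t c′ → Leads c t c″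
  ending refl f = f

  starting : ∀ {c t c′ c″} → c″ ≡ c → Leads c t c′ → Leads c″ t c′
  starting refl f = f

  cases-step : ∀ {f a y L R u vs K} → Leads (cases f ∷ K , on ((a , y) ∷ L) R u vs) 1 (f a ∷ K , on ((a , y) ∷ L) R u vs)
  cases-step {f} {a} {y} {L} {R} {u} {vs} {K} = ending (cong (λ z → f z ∷ K , on ((a , y) ∷ L) R u vs) (symDecode-symCode a)) (one-step (switch refl))

  Positive : List Cell → Set
  Positive Z = 0 < length Z

  go-left : ∀ {c Z R u vs K} → Positive Z → Leads (goL ∷ K , on (c ∷ Z) R u vs) 1 (K , on Z (c ∷ R) u vs)
  go-left {Z = _ ∷ _} pos = one-step goL

  -- `Moved n Z R Z′ R′`: n steps to the right.
  data Moved : ℕ → List Cell → List Cell → List Cell → List Cell → Set where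
   stay : ∀ {Z R} → Moved 0 Z R Z R
   move : ∀ {n c Z R Z′ R′} → Moved n (c ∷ Z) R Z′ R′ → Moved (suc n) Z (c ∷ R) Z′ R′

  moved-trans : ∀ {m n Z R Z′ R′ Z″ R″} → Moved m Z R Z′ R′ → Moved n Z′ R′ Z″ R″ → Moved (m + n) Z R Z″ R″
  moved-trans stay q = q
  moved-trans (move p) q = move (moved-trans p q)

  moved-length : ∀ {n Z R Z′ R′} → Moved n Z R Z′ R′ → length Z′ ≡ n + length Z
  moved-length stay = refl
  moved-length {suc n} {Z = Z} (move p) = trans (moved-length p) (+-suc n (length Z))

  rewind-back : ∀ {n Z R Z′ R′ u b x p K} → Positive Z → Moved n Z R Z′ R′ →
    Leads (rewindBy ∷ K , on Z R u ⟨ b , x , n , p ⟩) (suc (n * 4)) (K , on Z′ R′ u ⟨ b , x , 0 , p ⟩)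
  rewind-back {Z = Z} {R} {u = u} {b} {x} {p} pos stay = one-step (while {c = false} (test-zero Z {R} {u} {b} {x} {p}))
   where
   test-zero : ∀ Z {R u b x p} → test (on Z R u ⟨ b , x , 0 , p ⟩) (positive? #d) ≡ false
   test-zero [] = refl
   test-zero (_ ∷ _) = refl
  rewind-back {suc n} {l ∷ Z} pos (move m) =
   one-step (while refl) » one-step seq » one-step (dec z<s) » one-step goR » rewind-back z<s m

  record Scanned (t : Test) (Z R : List Cell) (b x : ℕ) (Z′ R′ : List Cell) (b′ x′ : ℕ) : Set₁ where
   field
    {distance} : ℕ
    moved : Moved distance Z′ R′ Z R
    grows : b′ ≤ distance + b
    path : ∀ {u d p K} → b ≤ d → d + length Z ≤ M →
     Leads (scan t ∷ K , on Z R u ⟨ b , x , d , p ⟩) (distance * 10) (scan t ∷ K , on Z′ R′ u ⟨ b′ , x′ , distance + d , p ⟩)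

  open Scanned public

  scanned-refl : ∀ {t Z R b x} → Scanned t Z R b x Z R b x
  scanned-refl = record { moved = stay ; grows = ≤-refl ; path = λ _ _ → idle! }

  infixr 5 _⟫_
  _⟫_ : ∀ {t Z R b x Z′ R′ b′ x′ Z″ R″ b″ x″} → Scanned t Z R b x Z′ R′ b′ x′ → Scanned t Z′ R′ b′ x′ Z″ R″ b″ x″ →
    Scanned t Z R b x Z″ R″ b″ x″
  _⟫_ {t} {Z} {Z′ = Z′} {Z″ = Z″} {R″ = R″} {b″ = b″} {x″ = x″} S S′ = record
   { moved = moved-trans (moved S′) (moved S)
   ; grows = ≤-trans (grows S′) (≤-trans (+-monoʳ-≤ n′ (grows S)) (≡⇒≥ (+-assoc n′ n _)))
   ; path = λ {u} {d} {p} {K} b≤d room → ending (cong (λ d → scan t ∷ K , on Z″ R″ u ⟨ b″ , x″ , d , p ⟩) (symm (+-assoc n′ n d)))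
     (leads-≤ (≡⇒≤ (trans (+-comm (n * 10) _) (symm (*-distribʳ-+ 10 n′ n))))
      (path S b≤d room » path S′ (≤-trans (grows S) (+-monoʳ-≤ n b≤d))
       (≤-trans (≡⇒≤ (trans (trans (+-assoc n d _) (trans (cong (n +_) (+-comm d _)) (symm (+-assoc n _ d)))) (trans (cong (_+ d) (symm (moved-length (moved S)))) (+-comm _ d)))) room)))
   } where
   n n′ : ℕ
   n = distance S
   n′ = distance S′

  scan-one : ∀ {t a y Z R b x b′ x′} → (∀ {u d p} → test (on ((a , y) ∷ Z) R u ⟨ b , x , d , p ⟩) t ≡ true) → Positive Z → b′ ≤ suc b →
   (∀ {u d p K} → b < M → Leads (scanStep a ∷ K , on ((a , y) ∷ Z) R u ⟨ b , x , d , p ⟩) 2 (K , on ((a , y) ∷ Z) R u ⟨ b′ , x′ , d , p ⟩)) →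
   Scanned t ((a , y) ∷ Z) R b x Z ((a , y) ∷ R) b′ x′
  scan-one {Z = Z} go pos gr st = record
   { moved = move stay ; grows = gr
   ; path = λ {u} {d} {p} b≤d room → leads-≤ (m≤m+n 8 2)
     (one-step (while go) » one-step seq » cases-step » st (≤-trans (s≤s b≤d) (below d room)) » one-step seq » one-step (inc (below d room)) » go-left pos)
   } where
   below : ∀ d → d + suc (length Z) ≤ M → d < M
   below d room = ≤-trans (s≤s (m≤m+n d (length Z))) (≤-trans (≡⇒≥ (+-suc d _)) room)

  passes : Letter σ → ℕ → Bool
  passes forAll-letter zero = false
  passes exists-letter zero = false
  passes and-letter zero = false
  passes or-letter zero = false
  passes _ _ = true

  record Passable (t : Test) : Set where
   constructor passable
   field passing : ∀ a {y u b x d p} → passes a b ≡ true → evalTest (λ i → zero? (lookup ⟨ b , x , d , p ⟩ i)) (sym a) y u t ≡ true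

  open Passable

  passable-lookup : Passable goLookup
  passable-lookup = passable λ
   { forAll-letter {b = suc b} e → refl
   ; exists-letter {b = suc b} e → refl
   ; and-letter {b = suc b} e → refl
   ; or-letter {b = suc b} e → refl
   ; tick-letter e → refl
   ; stop-letter e → refl
   ; (suc (suc (suc (suc (suc (suc r)))))) e → refl
   }

  passable-find : Passable goFind
  passable-find = passable λ
   { forAll-letter {b = suc b} e → refl
   ; exists-letter {b = suc b} e → refl
   ; and-letter {b = suc b} e → refl
   ; or-letter {b = suc b} e → refl
   ; tick-letter e → refl
   ; stop-letter e → refl
   ; (suc (suc (suc (suc (suc (suc r)))))) e → refl
   }

  pos-ticks : ∀ n {L} → Positive L → Positive (ticks n L)
  pos-ticks zero pos = pos
  pos-ticks (suc n) pos = s≤s z≤n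

  pos-vars : ∀ {n m} (xs : Vec (Fin n) m) {L} → Positive L → Positive (pushedVars xs L)
  pos-vars [] pos = pos
  pos-vars (x ∷ xs) pos = pos-vars xs z<s

  pos-pushed : ∀ {n} (φ : Formula σ n) α {L} → Positive L → Positive (pushed φ α L)
  pos-pushed (atom r xs) α pos = pos-vars xs z<s
  pos-pushed (φ ∧ ψ) (α , β) pos = pos-pushed ψ β (pos-pushed φ α z<s)
  pos-pushed (φ ∨ ψ) (α , β) pos = pos-pushed ψ β (pos-pushed φ α z<s)
  pos-pushed (quant Q φ) (a , α) pos = pos-pushed φ α z<s

  nothing-to-do : ∀ {s K} → Leads (skip ∷ K , s) 1 (K , s)
  nothing-to-do = one-step setReg

  -- Ticks and stops are passed by every scan that does not stop at them.
  record Ignores (t : Test) : Set where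
   constructor ignores
   field ignoring : ∀ a {u b x d p} → a ≡ tick-letter ⊎ a ≡ stop-letter → evalTest (λ i → zero? (lookup ⟨ b , x , d , p ⟩ i)) (sym a) blank u t ≡ true

  open Ignores

  scan-ticks : ∀ {t} → Ignores t → ∀ n {L R b x} → Positive L → Scanned t (ticks n L) R b x L (ticks n R) b x
  scan-ticks ig zero pos = scanned-refl
  scan-ticks {t} ig (suc n) {L} {R} {b} {x} pos =
   scan-one (ignoring ig tick-letter (inj₁ refl)) (pos-ticks n pos) (n≤1+n b) (λ _ → leads-≤ (n≤1+n 1) nothing-to-do) ⟫
   subst (λ R′ → Scanned t (ticks n L) (plain tick-letter ∷ R) b x L R′ b x) (ticks-snoc n R) (scan-ticks ig n pos)

  scan-vars : ∀ {t} → Ignores t → ∀ {n m} (xs : Vec (Fin n) m) {L R b x} → Positive L → Scanned t (pushedVars xs L) R b x L (aheadVars xs R) b x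
  scan-vars ig [] pos = scanned-refl
  scan-vars ig (y ∷ xs) {b = b} pos = scan-vars ig xs z<s ⟫
   (scan-one (ignoring ig stop-letter (inj₂ refl)) (pos-ticks (toℕ y) pos) (n≤1+n b) (λ _ → leads-≤ (n≤1+n 1) nothing-to-do) ⟫
    scan-ticks ig (toℕ y) pos)

  passable⇒ignores : ∀ {t} → Passable t → Ignores t
  passable⇒ignores pt = ignores λ { a (inj₁ refl) → passing pt tick-letter refl ; a (inj₂ refl) → passing pt stop-letter refl }

  scan-rel : ∀ {t} → Passable t → ∀ r {Z R b x} → Positive Z →
    Scanned t (plain (rel-letter σ r) ∷ Z) R b x Z (plain (rel-letter σ r) ∷ R) (suc b) x
  scan-rel pt r pos = scan-one (passing pt (rel-letter σ r) refl) pos ≤-refl (λ lt → leads-≤ (n≤1+n 1) (one-step (inc lt)))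

  scan-binary : ∀ {t} → Passable t → ∀ a → isBinary (sym a) ≡ true → ∀ {Z R b x} → Positive Z →
    Scanned t (plain a ∷ Z) R (suc b) x Z (plain a ∷ R) b x
  scan-binary pt and-letter e {b = b} pos = scan-one (passing pt and-letter refl) pos (≤-trans (n≤1+n b) (n≤1+n _)) (λ lt → one-step (ifThen refl) » one-step (dec z<s))
  scan-binary pt or-letter e {b = b} pos = scan-one (passing pt or-letter refl) pos (≤-trans (n≤1+n b) (n≤1+n _)) (λ lt → one-step (ifThen refl) » one-step (dec z<s))

  scan-quant : ∀ {t} → Passable t → ∀ Q {a Z R b x} → Positive Z →
    Scanned t (quantCell Q a ∷ Z) R (suc b) x Z (quantCell Q a ∷ R) (suc b) x
  scan-quant pt forAll {b = b} pos = scan-one (passing pt forAll-letter refl) pos (n≤1+n _) (λ lt → one-step (ifThen refl) » nothing-to-do)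
  scan-quant pt exists {b = b} pos = scan-one (passing pt exists-letter refl) pos (n≤1+n _) (λ lt → one-step (ifThen refl) » nothing-to-do)

  pass : ∀ {t} → Passable t → ∀ {n} (φ : Formula σ n) α {L R b x} → Positive L →
    Scanned t (pushed φ α L) R b x L (ahead φ α R) (suc b) x
  pass pt (atom r xs) α pos = scan-vars (passable⇒ignores pt) xs z<s ⟫ scan-rel pt r pos
  pass pt (φ ∧ ψ) (α , β) pos = pass pt ψ β (pos-pushed φ α z<s) ⟫ pass pt φ α z<s ⟫ scan-binary pt and-letter refl pos
  pass pt (φ ∨ ψ) (α , β) pos = pass pt ψ β (pos-pushed φ α z<s) ⟫ pass pt φ α z<s ⟫ scan-binary pt or-letter refl pos
  pass pt (quant Q φ) (a , α) pos = pass pt φ α z<s ⟫ scan-quant pt Q pos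

  scan-pending : ∀ {t} → Passable t → ∀ Q {a Z R x} → Positive Z → (∀ {u d p} → test (on (quantCell Q a ∷ Z) R u ⟨ 0 , x , d , p ⟩) t ≡ true) →
    Scanned t (quantCell Q a ∷ Z) R 0 x Z (quantCell Q a ∷ R) 0 (pred x)
  scan-pending pt forAll {x = zero} pos go = scan-one go pos z≤n (λ lt → one-step (ifThen refl) » nothing-to-do)
  scan-pending pt forAll {x = suc x} pos go = scan-one go pos z≤n (λ lt → one-step (ifThen refl) » one-step (dec z<s))
  scan-pending pt exists {x = zero} pos go = scan-one go pos z≤n (λ lt → one-step (ifThen refl) » nothing-to-do)
  scan-pending pt exists {x = suc x} pos go = scan-one go pos z≤n (λ lt → one-step (ifThen refl) » one-step (dec z<s))

  -- The cells left of a position at which a formula with the environment ρ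
  -- is expected.
  data Env : List Cell → ∀ {n} → Vec Sym n → Set where
   root : Env ((⊢ , blank) ∷ []) []
   under : ∀ {L n} {ρ : Vec Sym n} Q a → Env L ρ → Env (quantCell Q a ∷ L) (val Q a ∷ ρ)
   leftOf : ∀ {L n} {ρ : Vec Sym n} {c} → isBinary (sym c) ≡ true → Env L ρ → Env (plain c ∷ L) ρ
   rightOf : ∀ {L n m} {ρ : Vec Sym n} {c} → isBinary (sym c) ≡ true → (φ : Formula σ m) (α : Ann φ) → Env L ρ →
     Env (pushed φ α (plain c ∷ L)) ρ

  env-positive : ∀ {L n} {ρ : Vec Sym n} → Env L ρ → Positive L
  env-positive root = s≤s z≤n
  env-positive (under _ _ _) = s≤s z≤n
  env-positive (leftOf _ _) = s≤s z≤n
  env-positive (rightOf _ φ α _) = pos-pushed φ α z<s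

  scan-left-of : ∀ c → isBinary (sym c) ≡ true → ∀ {Z R x} → Positive Z → Scanned goLookup (plain c ∷ Z) R 0 x Z (plain c ∷ R) 0 x
  scan-left-of and-letter e pos = scan-one refl pos z≤n (λ lt → one-step (ifThen refl) » nothing-to-do)
  scan-left-of or-letter e pos = scan-one refl pos z≤n (λ lt → one-step (ifThen refl) » nothing-to-do)

  goes-on : ∀ Q → evalTest (λ i → zero? (lookup ⟨ 0 , 1 , 0 , 0 ⟩ i)) (sym (quantifier-letter σ Q)) blank blank goLookup ≡ true
  goes-on forAll = refl
  goes-on exists = refl

  record Found (L R : List Cell) (x : ℕ) (s : Sym) : Set₁ where
   field
    {quantifier} : Quantifier
    {mark} : Sym
    {Z′ R′} : List Cell
    scanned : Scanned goLookup L R 0 x (quantCell quantifier mark ∷ Z′) R′ 0 0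
    value : val quantifier mark ≡ s

  found-by : ∀ {L R x L′ R′ x′ s} → Scanned goLookup L R 0 x L′ R′ 0 x′ → Found L′ R′ x′ s → Found L R x s
  found-by S F = record { scanned = S ⟫ Found.scanned F ; value = Found.value F }

  find-var : ∀ {L n} {ρ : Vec Sym n} → Env L ρ → ∀ i {R} → Found L R (toℕ i) (lookup ρ i)
  find-var (under Q a E) zero = record { scanned = scanned-refl ; value = refl }
  find-var (under Q a E) (suc i) = found-by (scan-pending passable-lookup Q (env-positive E) (goes-on Q)) (find-var E i)
  find-var (leftOf {c = c} e E) i = found-by (scan-left-of c e (env-positive E)) (find-var E i)
  find-var (rightOf {c = c} e φ α E) i =
   found-by (pass passable-lookup φ α z<s ⟫ scan-binary passable-lookup c e (env-positive E)) (find-var E i)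

  record Missed (L R : List Cell) (x : ℕ) : Set₁ where
   field
    {R′} : List Cell
    {x′} : ℕ
    scanned : Scanned goLookup L R 0 x ((⊢ , blank) ∷ []) R′ 0 x′

  missed-by : ∀ {L R x L′ R′ x′} → Scanned goLookup L R 0 x L′ R′ 0 x′ → Missed L′ R′ x′ → Missed L R x
  missed-by S F = record { scanned = S ⟫ Missed.scanned F }

  miss-var : ∀ {L n} {ρ : Vec Sym n} → Env L ρ → ∀ x → n ≤ x → ∀ {R} → Missed L R x
  miss-var root x le = record { scanned = scanned-refl }
  miss-var (under Q a E) (suc x) (s≤s le) = missed-by (scan-pending passable-lookup Q (env-positive E) (goes-on Q)) (miss-var E x le)
  miss-var (leftOf {c = c} e E) x le = missed-by (scan-left-of c e (env-positive E)) (miss-var E x le)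
  miss-var (rightOf {c = c} e φ α E) x le =
   missed-by (pass passable-lookup φ α z<s ⟫ scan-binary passable-lookup c e (env-positive E)) (miss-var E x le)

  -- `Over Z R L R₁`: going left from (Z , R) over ticks and stops one meets
  -- a relation letter, which (L , R₁) has just passed.
  data Over : List Cell → List Cell → List Cell → List Cell → Set where
   base : ∀ r {L R} → Over (plain (rel-letter σ r) ∷ L) R L (plain (rel-letter σ r) ∷ R)
   tick : ∀ {Z R L R₁} → Over Z (plain tick-letter ∷ R) L R₁ → Over (plain tick-letter ∷ Z) R L R₁
   stop : ∀ {Z R L R₁} → Over Z (plain stop-letter ∷ R) L R₁ → Over (plain stop-letter ∷ Z) R L R₁

  over-ticks : ∀ n {Z R L R₁} → Over Z (ticks n R) L R₁ → Over (ticks n Z) R L R₁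
  over-ticks zero o = o
  over-ticks (suc n) {Z} {R} {L} {R₁} o = tick (over-ticks n (subst (λ R → Over Z R L R₁) (symm (ticks-snoc n R)) o))

  over-vars : ∀ {n m} (xs : Vec (Fin n) m) {Z R L R₁} → Over Z (aheadVars xs R) L R₁ → Over (pushedVars xs Z) R L R₁
  over-vars [] o = o
  over-vars (x ∷ xs) o = over-vars xs (stop (over-ticks (toℕ x) o))

  over-positive : ∀ {Z R L R₁} → Over Z R L R₁ → Positive Z
  over-positive (base r) = s≤s z≤n
  over-positive (tick o) = s≤s z≤n
  over-positive (stop o) = s≤s z≤n

  record Retreat (Z R L R₁ : List Cell) (x : ℕ) : Set₁ where
   field
    {r} : Fin (#rel σ)
    {R′} : List Cell
    scanned : Scanned toRel Z R 0 x (plain (rel-letter σ r) ∷ L) R′ 0 x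
    shape : R₁ ≡ plain (rel-letter σ r) ∷ R′

  retreat : ∀ {Z R L R₁ x} → Over Z R L R₁ → Retreat Z R L R₁ x
  retreat (base r) = record { scanned = scanned-refl ; shape = refl }
  retreat (tick o) = record { scanned = scan-one refl (over-positive o) z≤n (λ _ → leads-≤ (n≤1+n 1) nothing-to-do) ⟫ Retreat.scanned (retreat o)
    ; shape = Retreat.shape (retreat o) }
  retreat (stop o) = record { scanned = scan-one refl (over-positive o) z≤n (λ _ → leads-≤ (n≤1+n 1) nothing-to-do) ⟫ Retreat.scanned (retreat o)
    ; shape = Retreat.shape (retreat o) }

  -- Longer runs are measured in units, one of which is enough for a pass over the input.
  unit : ℕ
  unit = suc M * 10

  infix 4 _⇒[_]_
  record _⇒[_]_ (c : Config) (t : ℕ) (c′ : Config) : Set₁ where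
   constructor within
   field steps : Leads c (t * unit) c′

  open _⇒[_]_ public

  infixr 5 _⇛_
  _⇛_ : ∀ {c t c′ t′ c″} → c ⇒[ t ] c′ → c′ ⇒[ t′ ] c″ → c ⇒[ t + t′ ] c″
  _⇛_ {t = t} {t′ = t′} f h = within (leads-≤ (≡⇒≥ (*-distribʳ-+ unit t t′)) (steps f » steps h))

  ⇒-≤ : ∀ {c t t′ c′} → t ≤ t′ → c ⇒[ t ] c′ → c ⇒[ t′ ] c′
  ⇒-≤ le f = within (leads-≤ (*-monoˡ-≤ unit le) (steps f))

  ⇒-refl : ∀ {c} → c ⇒[ 0 ] c
  ⇒-refl = within idle!

  fast : ∀ {c t c′} → t ≤ 10 → Leads c t c′ → c ⇒[ 1 ] c′
  fast le f = within (leads-≤ (≤-trans le (≤-trans (m≤m+n 10 (M * 10)) (m≤m+n _ 0))) f)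

  !_ : ∀ {c c′} → Step M c c′ → c ⇒[ 1 ] c′
  ! s = fast z<s (one-step s)

  linear : ∀ {c n c′} → n ≤ M → Leads c (n * 10) c′ → c ⇒[ 1 ] c′
  linear le f = within (leads-≤ (≤-trans (*-monoˡ-≤ 10 (m≤n⇒m≤1+n le)) (m≤m+n _ 0)) f)

  landing : ∀ {c t c′ c″} → c′ ≡ c″ → c ⇒[ t ] c′ → c ⇒[ t ] c″
  landing refl f = f

  launching : ∀ {c t c′ c″} → c″ ≡ c → c ⇒[ t ] c′ → c″ ⇒[ t ] c′
  launching refl f = f

  record Retreated (Z R L R₁ : List Cell) (x : ℕ) (q : Prog) : Set₁ where
   field
    {m} : ℕ
    moved : Moved m L R₁ Z R
    path : ∀ {u p K} → ((scan toRel ⨾ counter inc #d ⨾ goL ⨾ q) ∷ K , on Z R u ⟨ 0 , x , 0 , p ⟩) ⇒[ 7 ] (q ∷ K , on L R₁ u ⟨ 0 , x , m , p ⟩)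

  retreated : ∀ {Z R L R₁ x q} → length Z ≤ M → Positive L → Over Z R L R₁ → Retreated Z R L R₁ x q
  retreated {Z} {R} {L} {R₁} {x} {q} room pos o with retreat {x = x} o
  ... | record { r = r ; R′ = R′ ; scanned = S ; shape = refl } = record
   { moved = move (moved S)
   ; path = ! seq ⇛ linear (≤-trans (m≤m+n n (length L)) (<⇒≤ small)) (path S z≤n room) ⇛ ! while refl ⇛ ! seq ⇛
     ! inc (≤-trans (s≤s (≤-trans (≡⇒≤ (+-identityʳ n)) (m≤m+n n (length L)))) small) ⇛ ! seq ⇛
     landing (cong (λ d → q ∷ _ , on L R₁ _ ⟨ 0 , x , suc d , _ ⟩) (+-identityʳ n)) (fast z<s (go-left pos))
   } where
   n : ℕ
   n = distance S
   small : suc (n + length L) ≤ M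
   small = ≤-trans (≡⇒≤ (trans (symm (+-suc n (length L))) (symm (moved-length (moved S))))) room

  record Room (Z R : List Cell) : Set where
   constructor within-room
   field fits : length Z + length R ≤ M

  open Room public

  fits-left : ∀ {Z R} → Room Z R → length Z ≤ M
  fits-left room = ≤-trans (m≤m+n _ _) (fits room)

  fits-right : ∀ {Z R} → Room Z R → length R ≤ M
  fits-right {Z} room = ≤-trans (m≤n+m _ (length Z)) (fits room)

  room-right : ∀ {c Z R} → Room Z (c ∷ R) → Room (c ∷ Z) R
  room-right {Z = Z} {R} room = within-room (≤-trans (≡⇒≥ (+-suc (length Z) (length R))) (fits room))

  room-moved : ∀ {n Z R Z′ R′} → Moved n Z R Z′ R′ → Room Z R → Room Z′ R′
  room-moved stay room = room
  room-moved (move m) room = room-moved m (room-right room)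

  length-ticks : ∀ n {L} → length (ticks n L) ≡ n + length L
  length-ticks zero = refl
  length-ticks (suc n) = cong suc (length-ticks n)

  moved-ticks : ∀ n {Z R} → Moved n Z (ticks n R) (ticks n Z) R
  moved-ticks zero = stay
  moved-ticks (suc n) {Z} {R} = move (subst (λ Z′ → Moved n (plain tick-letter ∷ Z) (ticks n R) Z′ R) (ticks-snoc n Z) (moved-ticks n))

  go-right : ∀ {Z R u vs K} → Positive Z → Positive R → Leads (goR ∷ K , on Z R u vs) 1 (K , front Z R u vs)
  go-right {_ ∷ _} {_ ∷ _} _ _ = one-step goR

  set-reg : ∀ {f Z R u vs K s} → Positive Z → (∀ a x → f a x u ≡ s) → Leads (setReg f ∷ K , on Z R u vs) 1 (K , on Z R s vs)
  set-reg {f} {(a , x) ∷ Z} {R} {u} {vs} {K} _ e = ending (cong (λ s → K , on ((a , x) ∷ Z) R s vs) (e a x)) (one-step setReg)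

  run-ticks : ∀ n {Z c R u x p K} → isTick (proj₁ c) ≡ false → n + x ≤ M →
   Leads (while (at? isTick) (counter inc #x ⨾ goR) ∷ K , front Z (ticks n (c ∷ R)) u ⟨ 0 , x , 0 , p ⟩) (suc (n * 4))
     (K , on (c ∷ ticks n Z) R u ⟨ 0 , n + x , 0 , p ⟩)
  run-ticks zero e le = one-step (while e)
  run-ticks (suc n) {Z} {c} {R} {u} {x} {p} {K} e le = one-step (while refl) » one-step seq » one-step (inc (≤-trans (s≤s (m≤n+m x n)) le)) »
   go-right {plain tick-letter ∷ Z} z<s (pos-ticks n z<s) »
   ending (cong₂ (λ Z′ x′ → K , on (c ∷ Z′) R u ⟨ 0 , x′ , 0 , p ⟩) (ticks-snoc n Z) (+-suc n x))
    (run-ticks n e (≤-trans (≡⇒≤ (+-suc n x)) le))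

  within-unit : ∀ {c n c′} → n ≤ M → Leads c (suc (n * 4)) c′ → c ⇒[ 1 ] c′
  within-unit {n = n} le f = within (leads-≤
   (≤-trans (s≤s (*-mono-≤ le (m≤m+n 4 6))) (≤-trans (+-monoˡ-≤ (M * 10) z<s) (m≤m+n _ 0))) f)

  with-counters : ∀ {c t K L h R u vs vs′ o} → vs ≡ vs′ → c ⇒[ t ] (K , store L h R u vs o) → c ⇒[ t ] (K , store L h R u vs′ o)
  with-counters refl f = f

  with-reg : ∀ {c t K L h R u u′ vs o} → u ≡ u′ → c ⇒[ t ] (K , store L h R u vs o) → c ⇒[ t ] (K , store L h R u′ vs o)
  with-reg refl f = f

  arrive : ∀ Q {a Z R u d p K} →
   (scan goLookup ∷ ifThen (at? isStart) (halt verdict) (setReg valOf ⨾ rewindBy) ∷ K , on (quantCell Q a ∷ Z) R u ⟨ 0 , 0 , d , p ⟩)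
   ⇒[ 4 ] (rewindBy ∷ K , on (quantCell Q a ∷ Z) R (val Q a) ⟨ 0 , 0 , d , p ⟩)
  arrive forAll = ! while refl ⇛ ! ifThen refl ⇛ ! seq ⇛ ! setReg
  arrive exists = ! while refl ⇛ ! ifThen refl ⇛ ! seq ⇛ ! setReg

  run-rewind : ∀ {n Z R Z′ R′ u b x p K} → length Z′ ≤ M → Positive Z → Moved n Z R Z′ R′ →
    (rewindBy ∷ K , on Z R u ⟨ b , x , n , p ⟩) ⇒[ 1 ] (K , on Z′ R′ u ⟨ b , x , 0 , p ⟩)
  run-rewind {n} {Z} room pos m = within-unit (≤-trans (≤-trans (m≤m+n n (length Z)) (≡⇒≥ (moved-length m))) room) (rewind-back pos m)

  run-lookup : ∀ {n} {ρ : Vec Sym n} {Z R L R₁ u p K} i → Env L ρ → Over Z (ticks (toℕ i) (plain stop-letter ∷ R)) L R₁ →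
   Room Z (ticks (toℕ i) (plain stop-letter ∷ R)) →
   (lookupVar ∷ K , front Z (ticks (toℕ i) (plain stop-letter ∷ R)) u ⟨ 0 , 0 , 0 , p ⟩) ⇒[ 17 ]
   (K , on (plain stop-letter ∷ ticks (toℕ i) Z) R (lookup ρ i) ⟨ 0 , 0 , 0 , p ⟩)
  run-lookup {ρ = ρ} {Z} {R} {L} {R₁} {u} {p} {K} i E o room =
   ! seq ⇛ with-counters (cong (λ x → ⟨ 0 , x , 0 , p ⟩) (+-identityʳ (toℕ i)))
    (within-unit i≤M (run-ticks (toℕ i) refl (≤-trans (≡⇒≤ (+-identityʳ _)) i≤M))) ⇛
   ! ifThen refl ⇛ Retreated.path rt ⇛ ! seq ⇛ linear dist≤ (path S z≤n room-L) ⇛ arrive (Found.quantifier F) ⇛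
   with-reg (Found.value F)
    (run-rewind full z<s (moved-trans (moved S) (Retreated.moved rt))) where
   Z′ : List Cell
   Z′ = plain stop-letter ∷ ticks (toℕ i) Z
   full : length Z′ ≤ M
   full = fits-left (room-right (room-moved (moved-ticks (toℕ i)) room))
   i≤M : toℕ i ≤ M
   i≤M = ≤-trans (≤-trans (m≤m+n (toℕ i) (length Z)) (≤-trans (≡⇒≥ (length-ticks (toℕ i))) (n≤1+n _))) full
   rt : Retreated Z′ R L R₁ (toℕ i) _
   rt = retreated full (env-positive E) (stop (over-ticks (toℕ i) o))
   F : Found L R₁ (toℕ i) (lookup ρ i)
   F = find-var E i
   S = Found.scanned F
   room-L : Retreated.m rt + length L ≤ M
   room-L = ≤-trans (≡⇒≥ (moved-length (Retreated.moved rt))) full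
   dist≤ : distance S ≤ M
   dist≤ = ≤-trans (≤-trans (m≤m+n _ _) (≡⇒≥ (moved-length (moved S)))) (≤-trans (m≤n+m _ (Retreated.m rt)) room-L)

  run-vars : ∀ {n m} {ρ : Vec Sym n} (xs : Vec (Fin n) m) f {Z R L R₁ u p K} → Env L ρ → Over Z (aheadVars xs R) L R₁ → Room Z (aheadVars xs R) →
   (vars m f ∷ K , on Z (aheadVars xs R) u ⟨ 0 , 0 , 0 , p ⟩) ⇒[ suc (vsize xs * 30) ]
   (K , on (pushedVars xs Z) R (bit (f (Vec.map (lookup ρ) xs))) ⟨ 0 , 0 , 0 , p ⟩)
  run-vars [] f E o room = fast z<s (set-reg (over-positive o) (λ _ _ → refl))
  run-vars {ρ = ρ} (x ∷ xs) f {Z} {R} {K = K} E o room = ⇒-≤ enough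
   (! seq ⇛ fast z<s (go-right (over-positive o) (pos-ticks (toℕ x) z<s)) ⇛ ! seq ⇛ run-lookup x E o room ⇛ ! switch refl ⇛
    run-vars xs (f ∘ (lookup ρ x ∷_)) E (stop (over-ticks (toℕ x) o)) (room-right (room-moved (moved-ticks (toℕ x)) room)))
   where
   enough : 21 + suc (vsize xs * 30) ≤ suc ((toℕ x + suc (vsize xs)) * 30)
   enough = s≤s (≤-trans (+-monoˡ-≤ (suc (vsize xs * 30)) (m≤m+n 20 9)) (≤-trans (≡⇒≤ (+-suc 29 (vsize xs * 30))) (*-monoˡ-≤ 30 (m≤n+m (suc (vsize xs)) (toℕ x)))))

  run-times : ∀ n {L h R u b x d p o K} → n + p ≤ M →
   (times n (counter inc #p) ∷ K , store L h R u ⟨ b , x , d , p ⟩ o) ⇒[ suc (n * 2) ] (K , store L h R u ⟨ b , x , d , n + p ⟩ o)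
  run-times zero le = ! setReg
  run-times (suc n) {b = b} {x} {d} {p} le = ! seq ⇛ ! inc (≤-trans (s≤s (m≤n+m p n)) le) ⇛
   with-counters (cong (λ p → ⟨ b , x , d , p ⟩) (+-suc n p)) (run-times n (≤-trans (≡⇒≤ (+-suc n p)) le))

  pos-ahead : ∀ {n} (φ : Formula σ n) α {R} → Positive (ahead φ α R)
  pos-ahead (atom r xs) α = s≤s z≤n
  pos-ahead (φ ∧ ψ) (α , β) = s≤s z≤n
  pos-ahead (φ ∨ ψ) (α , β) = s≤s z≤n
  pos-ahead (quant Q φ) (a , α) = s≤s z≤n

  pos-aheadVars : ∀ {n m} (xs : Vec (Fin n) m) {R} → Positive R → Positive (aheadVars xs R)
  pos-aheadVars [] pos = pos
  pos-aheadVars (x ∷ xs) pos = pos-ticks (toℕ x) z<s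

  skip-one : ∀ {a y Z R u p p′ t K} → Positive R →
   (∀ {K} → (skipStep a ∷ K , on ((a , y) ∷ Z) R u ⟨ 0 , 0 , 0 , suc p ⟩) ⇒[ t ] (K , on ((a , y) ∷ Z) R u ⟨ 0 , 0 , 0 , p′ ⟩)) →
   (skipping ∷ K , front Z ((a , y) ∷ R) u ⟨ 0 , 0 , 0 , suc p ⟩) ⇒[ 3 + (t + 1) ] (skipping ∷ K , front ((a , y) ∷ Z) R u ⟨ 0 , 0 , 0 , p′ ⟩)
  skip-one {a} {y} {Z} pos st = ! while refl ⇛ ! seq ⇛ fast z<s cases-step ⇛ st ⇛ fast z<s (go-right {(a , y) ∷ Z} z<s pos)

  skip-ticks : ∀ n {Z R u p K} → Positive R →
   (skipping ∷ K , front Z (ticks n R) u ⟨ 0 , 0 , 0 , suc p ⟩) ⇒[ n * 5 ] (skipping ∷ K , front (ticks n Z) R u ⟨ 0 , 0 , 0 , suc p ⟩)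
  skip-ticks zero pos = ⇒-refl
  skip-ticks (suc n) {Z} {R} {u} {p} {K} pos = skip-one {Z = Z} (pos-ticks n pos) (! setReg) ⇛
   landing (cong (λ Z → skipping ∷ K , front Z R u ⟨ 0 , 0 , 0 , suc p ⟩) (ticks-snoc n Z)) (skip-ticks n pos)

  skip-vars : ∀ {n m} (xs : Vec (Fin n) m) {Z R u p K} → Positive R →
   (skipping ∷ K , front Z (aheadVars xs R) u ⟨ 0 , 0 , 0 , m + p ⟩) ⇒[ vsize xs * 5 ] (skipping ∷ K , front (pushedVars xs Z) R u ⟨ 0 , 0 , 0 , p ⟩)
  skip-vars [] pos = ⇒-refl
  skip-vars (x ∷ xs) {Z} pos = ⇒-≤ (≡⇒≥ (*-distribʳ-+ 5 (toℕ x) (suc (vsize xs))))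
   (skip-ticks (toℕ x) z<s ⇛ skip-one {Z = ticks (toℕ x) Z} (pos-aheadVars xs pos) (! dec z<s) ⇛ skip-vars xs pos)

  length≤vsize : ∀ {n m} (xs : Vec (Fin n) m) → m ≤ vsize xs
  length≤vsize [] = z≤n
  length≤vsize (x ∷ xs) = ≤-trans (s≤s (length≤vsize xs)) (m≤n+m _ (toℕ x))

  length-aheadVars : ∀ {n m} (xs : Vec (Fin n) m) {R} → length (aheadVars xs R) ≡ vsize xs + length R
  length-aheadVars [] = refl
  length-aheadVars (x ∷ xs) = trans (length-ticks (toℕ x)) (trans (cong (λ l → toℕ x + suc l) (length-aheadVars xs)) (symm (+-assoc (toℕ x) (suc (vsize xs)) _)))

  both-parts : ∀ {a} m n → a ≤ 60 → a + (m * 60 + n * 60) ≤ suc (m + n) * 60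
  both-parts m n le = ≤-trans (+-monoˡ-≤ _ le) (≡⇒≤ (cong (60 +_) (symm (*-distribʳ-+ 60 m n))))

  length-ahead : ∀ {n} (φ : Formula σ n) α {R} → length (ahead φ α R) ≡ size φ + length R
  length-ahead (atom r xs) α = cong suc (length-aheadVars xs)
  length-ahead (φ ∧ ψ) (α , β) = cong suc (trans (length-ahead φ α) (trans (cong (size φ +_) (length-ahead ψ β)) (symm (+-assoc (size φ) _ _))))
  length-ahead (φ ∨ ψ) (α , β) = cong suc (trans (length-ahead φ α) (trans (cong (size φ +_) (length-ahead ψ β)) (symm (+-assoc (size φ) _ _))))
  length-ahead (quant Q φ) (a , α) = cong suc (length-ahead φ α)

  skip-room : ∀ {n} (φ : Formula σ n) α {R} p → p + suc (length (ahead φ α R)) ≤ M → suc p < M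
  skip-room φ α p le = ≤-trans (≡⇒≤ (+-comm 2 p)) (≤-trans (+-monoʳ-≤ p (s≤s (pos-ahead φ α))) le)

  skip-formula : ∀ {n} (φ : Formula σ n) α {Z R u p K} → Positive R → p + length (ahead φ α R) ≤ M →
   (skipping ∷ K , front Z (ahead φ α R) u ⟨ 0 , 0 , 0 , suc p ⟩) ⇒[ size φ * 60 ] (skipping ∷ K , front (pushed φ α Z) R u ⟨ 0 , 0 , 0 , p ⟩)
  skip-formula (atom r xs) α {Z} {p = p} pos le = ⇒-≤ enough
   (skip-one {Z = Z} (pos-aheadVars xs pos) (! seq ⇛ ! dec z<s ⇛ run-times (arity σ r) arity≤) ⇛ skip-vars xs pos)
   where
   m≤ : arity σ r ≤ vsize xs
   m≤ = length≤vsize xs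
   arity≤ : arity σ r + p ≤ M
   arity≤ = ≤-trans (≤-trans (+-monoˡ-≤ p (≤-trans m≤ (≤-trans (m≤m+n _ _) (≤-trans (≡⇒≥ (length-aheadVars xs)) (n≤1+n _))))) (≡⇒≤ (+-comm _ p))) le
   enough : 3 + (2 + suc (arity σ r * 2) + 1) + vsize xs * 5 ≤ suc (vsize xs) * 60
   enough = ≤-trans (+-monoˡ-≤ (vsize xs * 5) (s≤s (s≤s (s≤s (s≤s (s≤s (s≤s (+-monoˡ-≤ 1 (*-monoˡ-≤ 2 m≤)))))))))
    (≤-trans (≡⇒≤ (solve 1 (λ v → con 6 :+ (v :* con 2 :+ con 1) :+ v :* con 5 := con 7 :+ v :* con 7) refl (vsize xs)))
     (+-mono-≤ (m≤m+n 7 53) (*-monoʳ-≤ (vsize xs) (m≤m+n 7 53))))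
    where open +-*-Solver
  skip-formula (φ ∧ ψ) (α , β) {Z} {R} {p = p} pos le = ⇒-≤ (both-parts (size φ) (size ψ) (m≤m+n 5 55))
   (skip-one {Z = Z} (pos-ahead φ α) (! inc (skip-room φ α p le)) ⇛
    skip-formula φ α (pos-ahead ψ β) (≤-trans (≡⇒≥ (+-suc p _)) le) ⇛
    skip-formula ψ β pos (≤-trans (+-monoʳ-≤ p (≤-trans (m≤n+m _ (size φ)) (≤-trans (≡⇒≥ (length-ahead φ α)) (n≤1+n _)))) le))
  skip-formula (φ ∨ ψ) (α , β) {Z} {R} {p = p} pos le = ⇒-≤ (both-parts (size φ) (size ψ) (m≤m+n 5 55))
   (skip-one {Z = Z} (pos-ahead φ α) (! inc (skip-room φ α p le)) ⇛
    skip-formula φ α (pos-ahead ψ β) (≤-trans (≡⇒≥ (+-suc p _)) le) ⇛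
    skip-formula ψ β pos (≤-trans (+-monoʳ-≤ p (≤-trans (m≤n+m _ (size φ)) (≤-trans (≡⇒≥ (length-ahead φ α)) (n≤1+n _)))) le))
  skip-formula (quant forAll φ) (a , α) {Z} pos le = ⇒-≤ (+-monoˡ-≤ (size φ * 60) (m≤m+n 5 55))
   (skip-one {Z = Z} (pos-ahead φ α) (! setReg) ⇛ skip-formula φ α pos (≤-trans (+-monoʳ-≤ _ (n≤1+n _)) le))
  skip-formula (quant exists φ) (a , α) {Z} pos le = ⇒-≤ (+-monoˡ-≤ (size φ * 60) (m≤m+n 5 55))
   (skip-one {Z = Z} (pos-ahead φ α) (! setReg) ⇛ skip-formula φ α pos (≤-trans (+-monoʳ-≤ _ (n≤1+n _)) le))

  off : ∀ {n} (φ : Formula σ n) α {L R} → Positive L →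
   ∃[ L₁ ] ∃[ R₁ ] Over (pushed φ α L) R L₁ R₁ × Positive L₁ × Scanned goFind L₁ R₁ 0 0 L (ahead φ α R) 0 0
  off (atom r xs) α pos = _ , _ , over-vars xs (base r) , pos , scanned-refl
  off (φ ∧ ψ) (α , β) pos with off ψ β (pos-pushed φ α z<s)
  ... | L₁ , R₁ , o , pos₁ , S = L₁ , R₁ , o , pos₁ , (S ⟫ pass passable-find φ α z<s ⟫ scan-binary passable-find and-letter refl pos)
  off (φ ∨ ψ) (α , β) pos with off ψ β (pos-pushed φ α z<s)
  ... | L₁ , R₁ , o , pos₁ , S = L₁ , R₁ , o , pos₁ , (S ⟫ pass passable-find φ α z<s ⟫ scan-binary passable-find or-letter refl pos)
  off (quant Q φ) (a , α) pos with off φ α z<s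
  ... | L₁ , R₁ , o , pos₁ , S = L₁ , R₁ , o , pos₁ , (S ⟫ scan-pending passable-find Q pos (goes Q))
   where
   goes : ∀ Q → evalTest (λ i → zero? (lookup ⟨ 0 , 0 , 0 , 0 ⟩ i)) (sym (quantifier-letter σ Q)) blank blank goFind ≡ true
   goes forAll = refl
   goes exists = refl

  record Back (L R : List Cell) (Z R′ : List Cell) (u : Sym) (p : ℕ) : Set₁ where
   field
    {m} : ℕ
    moved : Moved m L R Z R′
    path : ∀ {K} → (find ∷ K , on Z R′ u ⟨ 0 , 0 , 0 , p ⟩) ⇒[ 10 ] (K , on L R u ⟨ 0 , 0 , m , p ⟩)

  run-find : ∀ {n} (φ : Formula σ n) α {L R u p} → Positive L → length (pushed φ α L) ≤ M →
   (∀ {d} → test (on L (ahead φ α R) u ⟨ 0 , 0 , d , p ⟩) goFind ≡ false) → Back L (ahead φ α R) (pushed φ α L) R u p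
  run-find φ α {L} pos room stops with off φ α {L} pos
  ... | L₁ , R₁ , o , pos₁ , S = record
   { moved = moved-trans (moved S) (Retreated.moved rt)
   ; path = Retreated.path rt ⇛ linear {n = distance S} (≤-trans (≤-trans (m≤m+n _ _) (≤-trans (≡⇒≥ (moved-length (moved S))) (m≤n+m _ (Retreated.m rt)))) room₁) (path S z≤n room₁) ⇛
     ⇒-≤ z<s (! while stops)
   } where
   rt : Retreated (pushed φ α L) _ L₁ R₁ 0 (scan goFind)
   rt = retreated room pos₁ o
   room₁ : Retreated.m rt + length L₁ ≤ M
   room₁ = ≤-trans (≡⇒≥ (moved-length (Retreated.moved rt))) room

  spread : ∀ m n b c → 12 + b + c ≤ 60 → 2 + (m * 60 + 10) + (b + (n * 60 + c)) ≤ suc (m + n) * 60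
  spread m n b c le = ≤-trans
   (≡⇒≤ (solve 4 (λ b c m n → con 2 :+ (m :+ con 10) :+ (b :+ (n :+ c)) := (con 12 :+ b :+ c) :+ (m :+ n)) refl b c (m * 60) (n * 60)))
   (both-parts m n le)
   where open +-*-Solver

  0s : Counters
  0s = ⟨ 0 , 0 , 0 , 0 ⟩

  room-pushed : ∀ {n} (φ : Formula σ n) α {L R} → Positive L → Room L (ahead φ α R) → Room (pushed φ α L) R
  room-pushed φ α pos = room-moved (moved (pass passable-find φ α {b = 0} {x = 0} pos))

  run-undecided : ∀ {c u Z R n K L m R′} (ψ : Formula σ n) β → undecided (sym c) blank u ≡ true →
   Moved m (plain c ∷ L) R′ Z (ahead ψ β R) → length Z ≤ M → Positive Z →
   (climb ∷ K , on (plain c ∷ L) R′ u ⟨ 0 , 0 , m , 0 ⟩) ⇒[ 9 ] (descend ∷ evalAtom ∷ find ∷ climb ∷ K , front Z (ahead ψ β R) u 0s)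
  run-undecided ψ β e mv room pos =
   ! while refl ⇛ ! seq ⇛ ! ifThen e ⇛ ! seq ⇛ run-rewind room z<s mv ⇛ ! seq ⇛ fast z<s (go-right pos (pos-ahead ψ β)) ⇛ ⇒-≤ (n≤1+n 1) (! seq)

  run-decided : ∀ {c u Z R n K L m R′} (ψ : Formula σ n) β → undecided (sym c) blank u ≡ false →
   Moved m (plain c ∷ L) R′ Z (ahead ψ β R) → Room Z (ahead ψ β R) → Positive Z → Positive R →
   (climb ∷ K , on (plain c ∷ L) R′ u ⟨ 0 , 0 , m , 0 ⟩) ⇒[ 10 + (size ψ * 60 + 2) ] (find ∷ climb ∷ K , on (pushed ψ β Z) R u 0s)
  run-decided {R = r ∷ R} ψ β e mv room posZ posR =
   (! while refl ⇛ ! seq ⇛ ! ifThen e ⇛ ! seq ⇛ ! inc 0<M ⇛ ! seq ⇛ run-rewind (fits-left room) z<s mv ⇛ ! seq ⇛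
    fast z<s (go-right posZ (pos-ahead ψ β)) ⇛ ! seq) ⇛
   skip-formula ψ β posR (fits-right room) ⇛ ! while refl ⇛ fast z<s (go-left (pos-pushed ψ β posZ))
   where
   0<M : 0 < M
   0<M = ≤-trans posZ (fits-left room)

  eval-formula : ∀ {n} (φ : Formula σ n) α {ρ : Vec Sym n} {L R u K} → Env L ρ → Positive R → Room L (ahead φ α R) →
   (descend ∷ evalAtom ∷ find ∷ climb ∷ K , front L (ahead φ α R) u 0s) ⇒[ size φ * 60 ]
   (find ∷ climb ∷ K , on (pushed φ α L) R (bit (evalA φ α ρ)) 0s)

  eval-left : ∀ {n} c → isBinary (sym c) ≡ true → ∀ (φ ψ : Formula σ n) α β {ρ : Vec Sym n} {L R u K} → Env L ρ → Positive R →
   Room L (plain c ∷ ahead φ α (ahead ψ β R)) →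
   Σ[ m ∈ ℕ ] Moved m (plain c ∷ L) (ahead φ α (ahead ψ β R)) (pushed φ α (plain c ∷ L)) (ahead ψ β R) ×
   Room (pushed φ α (plain c ∷ L)) (ahead ψ β R) ×
   ((descend ∷ evalAtom ∷ find ∷ climb ∷ K , front L (plain c ∷ ahead φ α (ahead ψ β R)) u 0s) ⇒[ 2 + (size φ * 60 + 10) ]
    (climb ∷ K , on (plain c ∷ L) (ahead φ α (ahead ψ β R)) (bit (evalA φ α ρ)) ⟨ 0 , 0 , m , 0 ⟩))
  eval-left c bin φ ψ α β {ρ} {L} {R} E pos room = Back.m back , Back.moved back , room′ ,
   (! while (descending c bin) ⇛ fast z<s (go-right {plain c ∷ L} z<s (pos-ahead φ α)) ⇛
    eval-formula φ α (leftOf bin E) (pos-ahead ψ β) (room-right room) ⇛ Back.path back) where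
   room′ : Room (pushed φ α (plain c ∷ L)) (ahead ψ β R)
   room′ = room-pushed φ α z<s (room-right room)
   descending : ∀ c → isBinary (sym c) ≡ true → not (isRel (sym c)) ≡ true
   descending and-letter _ = refl
   descending or-letter _ = refl
   stops : ∀ c → isBinary (sym c) ≡ true → evalTest (λ i → zero? (lookup 0s i)) (sym c) blank blank goFind ≡ false
   stops and-letter _ = refl
   stops or-letter _ = refl
   back : Back (plain c ∷ L) (ahead φ α (ahead ψ β R)) (pushed φ α (plain c ∷ L)) (ahead ψ β R) (bit (evalA φ α ρ)) 0
   back = run-find φ α {R = ahead ψ β R} z<s (fits-left room′) (stops c bin)

  eval-binary : ∀ {n} c → (bin : isBinary (sym c) ≡ true) → ∀ (φ ψ : Formula σ n) α β {ρ : Vec Sym n} {L R u K v} → Env L ρ → Positive R →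
   Room L (plain c ∷ ahead φ α (ahead ψ β R)) →
   (undecided (sym c) blank (bit (evalA φ α ρ)) ≡ true × v ≡ evalA ψ β ρ) ⊎
   (undecided (sym c) blank (bit (evalA φ α ρ)) ≡ false × v ≡ evalA φ α ρ) →
   (descend ∷ evalAtom ∷ find ∷ climb ∷ K , front L (plain c ∷ ahead φ α (ahead ψ β R)) u 0s) ⇒[ suc (size φ + size ψ) * 60 ]
   (find ∷ climb ∷ K , on (pushed ψ β (pushed φ α (plain c ∷ L))) R (bit v) 0s)
  eval-binary c bin φ ψ α β {L = L} {R} {u} {K} E pos room (inj₁ (e , refl)) =
   let m , mv , room′ , run = eval-left c bin φ ψ α β {L = L} {R} {u} {K} E pos room in
   ⇒-≤ (spread (size φ) (size ψ) 9 0 (m≤m+n 21 39))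
    (run ⇛ run-undecided ψ β e mv (fits-left room′) (pos-pushed φ α z<s) ⇛ eval-formula ψ β (rightOf bin φ α E) pos room′ ⇛ ⇒-refl)
  eval-binary c bin φ ψ α β {L = L} {R} {u} {K} E pos room (inj₂ (e , refl)) =
   let m , mv , room′ , run = eval-left c bin φ ψ α β {L = L} {R} {u} {K} E pos room in
   ⇒-≤ (spread (size φ) (size ψ) 10 2 (m≤m+n 24 36)) (run ⇛ run-decided ψ β e mv room′ (pos-pushed φ α z<s) pos)

  eval-formula (atom r xs) α {L = L} E pos room = ⇒-≤ (+-mono-≤ (m≤m+n 3 57) (*-monoʳ-≤ (vsize xs) (m≤m+n 30 30)))
   (! while refl ⇛ fast z<s (cases-step {atomStep}) ⇛ run-vars xs (relate r) E (base r) (room-right room))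
  eval-formula (φ ∧ ψ) (α , β) {ρ} E pos room = eval-binary and-letter refl φ ψ α β E pos room (by-value (evalA φ α ρ))
   where
   by-value : ∀ v {w} → (undecided (sym and-letter) blank (bit v) ≡ true × v ∧ᵇ w ≡ w) ⊎ (undecided (sym and-letter) blank (bit v) ≡ false × v ∧ᵇ w ≡ v)
   by-value true = inj₁ (refl , refl)
   by-value false = inj₂ (refl , refl)
  eval-formula (φ ∨ ψ) (α , β) {ρ} E pos room = eval-binary or-letter refl φ ψ α β E pos room (by-value (evalA φ α ρ))
   where
   by-value : ∀ v {w} → (undecided (sym or-letter) blank (bit v) ≡ true × v ∨ᵇ w ≡ w) ⊎ (undecided (sym or-letter) blank (bit v) ≡ false × v ∨ᵇ w ≡ v)
   by-value true = inj₂ (refl , refl)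
   by-value false = inj₁ (refl , refl)
  eval-formula (quant Q φ) (a , α) {L = L} E pos room = ⇒-≤ (+-monoˡ-≤ (size φ * 60) (m≤m+n 2 58))
   (! while (descending Q) ⇛ fast z<s (go-right {quantCell Q a ∷ L} z<s (pos-ahead φ α)) ⇛
    eval-formula φ α (under Q a E) pos (room-right room)) where
   descending : ∀ Q → not (isRel (sym (quantifier-letter σ Q))) ≡ true
   descending forAll = refl
   descending exists = refl

  record Aborts (c : Config) (t : ℕ) : Set₁ where
   constructor aborts
   field run-off : ATree M AccLeaf (t * unit) c (T verdict)

  open Aborts public

  abort-now : ∀ {K s} → Aborts (halt verdict ∷ K , s) 0
  abort-now = aborts (leaf halted (mk⇔ id id))

  infixr 5 _⇛!_
  _⇛!_ : ∀ {c t c′ s} → c ⇒[ t ] c′ → Aborts c′ s → Aborts c (t + s)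
  _⇛!_ {t = t} {s = s} f a = aborts (weakenA (≡⇒≥ (*-distribʳ-+ unit t s)) (before (steps f) (run-off a)))

  aborts-≤ : ∀ {c s t} → s ≤ t → Aborts c s → Aborts c t
  aborts-≤ le a = aborts (weakenA (*-monoˡ-≤ unit le) (run-off a))

  record Cut (P : Input → Set) (u : Word (#letters σ)) : Set where
   field
    {c} : Input
    {R} : List Cell
    cell : raw u ≡ (c , blank) ∷ R
    good : P c

  cut-variable : ∀ {u} → Head NoVariable u → Cut (λ c → isTick c ≡ false × isStop c ≡ false) u
  cut-variable none = record { cell = refl ; good = refl , refl }
  cut-variable (first {forAll-letter} _) = record { cell = refl ; good = refl , refl }
  cut-variable (first {exists-letter} _) = record { cell = refl ; good = refl , refl }
  cut-variable (first {and-letter} _) = record { cell = refl ; good = refl , refl }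
  cut-variable (first {or-letter} _) = record { cell = refl ; good = refl , refl }
  cut-variable (first {tick-letter} (n , _)) = ⊥-elim (n refl)
  cut-variable (first {stop-letter} (_ , n)) = ⊥-elim (n refl)
  cut-variable (first {suc (suc (suc (suc (suc (suc r)))))} _) = record { cell = refl ; good = refl , refl }

  ticks-fit : ∀ k {Z R} → Room Z (ticks k R) → k + 0 ≤ M
  ticks-fit k room = ≤-trans (≤-trans (+-monoʳ-≤ k z≤n) (≡⇒≥ (length-ticks k))) (fits-right room)

  abort-lookup-no-stop : ∀ k {Z c R u p K} → isTick c ≡ false → isStop c ≡ false → Room Z (ticks k ((c , blank) ∷ R)) →
   Aborts (lookupVar ∷ K , front Z (ticks k ((c , blank) ∷ R)) u ⟨ 0 , 0 , 0 , p ⟩) 3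
  abort-lookup-no-stop k nt ns room =
   ! seq ⇛! within-unit (≤-trans (≡⇒≥ (+-identityʳ k)) (ticks-fit k room)) (run-ticks k nt (ticks-fit k room)) ⇛! ! ifThen ns ⇛! abort-now

  abort-lookup-too-big : ∀ {n} {ρ : Vec Sym n} k {Z R L R₁ u p K} → n ≤ k → Env L ρ → Over Z (ticks k (plain stop-letter ∷ R)) L R₁ →
   Room Z (ticks k (plain stop-letter ∷ R)) →
   Aborts (lookupVar ∷ K , front Z (ticks k (plain stop-letter ∷ R)) u ⟨ 0 , 0 , 0 , p ⟩) 14
  abort-lookup-too-big {ρ = ρ} k {Z} {R} {L} {R₁} {p = p} n≤k E o room =
   ! seq ⇛! with-counters (cong (λ x → ⟨ 0 , x , 0 , p ⟩) (+-identityʳ k))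
    (within-unit (≤-trans (≡⇒≥ (+-identityʳ k)) (ticks-fit k room)) (run-ticks k refl (ticks-fit k room))) ⇛!
   ! ifThen refl ⇛! Retreated.path rt ⇛! ! seq ⇛! linear {n = distance S} dist≤ (path S z≤n room-L) ⇛! ! while refl ⇛! ! ifThen refl ⇛! abort-now
   where
   Z′ : List Cell
   Z′ = plain stop-letter ∷ ticks k Z
   full : length Z′ ≤ M
   full = fits-left (room-right (room-moved (moved-ticks k) room))
   rt : Retreated Z′ R L R₁ k _
   rt = retreated full (env-positive E) (stop (over-ticks k o))
   S = Missed.scanned (miss-var E k n≤k {R₁})
   room-L : Retreated.m rt + length L ≤ M
   room-L = ≤-trans (≡⇒≥ (moved-length (Retreated.moved rt))) full
   dist≤ : distance S ≤ M
   dist≤ = ≤-trans (≤-trans (m≤m+n _ _) (≡⇒≥ (moved-length (moved S)))) (≤-trans (m≤n+m _ (Retreated.m rt)) room-L)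

  abort-vars : ∀ {n m u} {ρ : Vec Sym n} → BadVars n m u → ∀ f {Z L R₁ s p K} → Env L ρ → Over Z (raw u) L R₁ → Room Z (raw u) →
   Aborts (vars m f ∷ K , on Z (raw u) s ⟨ 0 , 0 , 0 , p ⟩) (suc (length u) * 30)
  abort-vars (no-stop {u = u} k h) f {Z} {L} {R₁} {s} {p} {K} E o room with cut-variable h
  ... | record { c = c ; R = R ; cell = cell ; good = nt , ns } =
   aborts-≤ (≤-trans (m≤m+n 6 24) (m≤m+n 30 _)) (subst (λ R → Aborts (vars _ f ∷ K , on Z R s ⟨ 0 , 0 , 0 , p ⟩) 6) (symm eq)
   (! seq ⇛! fast z<s (go-right (over-positive o) (pos-ticks k z<s)) ⇛! ! seq ⇛!
    abort-lookup-no-stop k nt ns (subst (Room Z) eq room))) where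
   eq : raw (tickWord k u) ≡ ticks k ((c , blank) ∷ R)
   eq = trans (raw-ticks k u) (cong (ticks k) cell)
  abort-vars (too-big {u = u} k n≤k) f {Z} {L} {R₁} {s} {p} {K} E o room =
   aborts-≤ (≤-trans (m≤m+n 17 13) (m≤m+n 30 _)) (subst (λ R → Aborts (vars _ f ∷ K , on Z R s ⟨ 0 , 0 , 0 , p ⟩) 17) (symm eq)
   (! seq ⇛! fast z<s (go-right (over-positive o) (pos-ticks k z<s)) ⇛! ! seq ⇛!
    abort-lookup-too-big k n≤k E (subst (λ R → Over Z R L R₁) eq o) (subst (Room Z) eq room))) where
   eq : raw (tickWord k (stop-letter ∷ u)) ≡ ticks k (plain stop-letter ∷ raw u)
   eq = raw-ticks k _
  abort-vars {m = suc m} {ρ = ρ} (later {u = u} x b) f {Z} {L} {R₁} {s} {p} {K} E o room =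
   aborts-≤ enough (subst (λ R → Aborts (vars (suc m) f ∷ K , on Z R s ⟨ 0 , 0 , 0 , p ⟩) (21 + suc (length u) * 30)) (symm eq)
   (! seq ⇛! fast z<s (go-right (over-positive o) (pos-ticks (toℕ x) z<s)) ⇛! ! seq ⇛! run-lookup x E o′ room′ ⇛! ! switch refl ⇛!
    abort-vars b (f ∘ (lookup ρ x ∷_)) E (stop (over-ticks (toℕ x) o′)) (room-right (room-moved (moved-ticks (toℕ x)) room′))))
   where
   eq : raw (tickWord (toℕ x) (stop-letter ∷ u)) ≡ ticks (toℕ x) (plain stop-letter ∷ raw u)
   eq = raw-ticks (toℕ x) _
   o′ : Over Z (ticks (toℕ x) (plain stop-letter ∷ raw u)) L R₁
   o′ = subst (λ R → Over Z R L R₁) eq o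
   room′ : Room Z (ticks (toℕ x) (plain stop-letter ∷ raw u))
   room′ = subst (Room Z) eq room
   enough : 21 + suc (length u) * 30 ≤ suc (length (tickWord (toℕ x) (stop-letter ∷ u))) * 30
   enough = ≤-trans (+-monoˡ-≤ (suc (length u) * 30) (m≤m+n 21 9)) (*-monoˡ-≤ 30 (s≤s
    (≤-trans (m≤n+m (suc (length u)) (length (replicate {A = Letter σ} (toℕ x) tick-letter))) (≡⇒≥ (length-++ (replicate (toℕ x) _))))))

  pushed-longer : ∀ {n} (φ : Formula σ n) α {L} → Positive L → length L ≤ length (pushed φ α L)
  pushed-longer φ α pos = ≤-trans (m≤n+m _ _) (≡⇒≥ (moved-length (moved (pass passable-find φ α {R = []} {b = 0} {x = 0} pos))))

  below : ∀ {Z c R p} → Room Z (c ∷ R) → suc p ≤ length Z → suc p < M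
  below {Z} {R = R} room le = ≤-trans (s≤s le) (≤-trans (≡⇒≤ (+-comm 1 (length Z))) (≤-trans (+-monoʳ-≤ (length Z) z<s) (fits room)))

  check-binary : ∀ {c Z R u p K} → Binary c → Positive R → suc p < M →
   (checking ∷ K , front Z (plain c ∷ R) u ⟨ 0 , 0 , 0 , suc p ⟩) ⇒[ 5 ] (checking ∷ K , front (plain c ∷ Z) R u ⟨ 0 , 0 , 0 , 2 + p ⟩)
  check-binary {Z = Z} conj pos lt = ! while refl ⇛ fast z<s (cases-step {checkStep}) ⇛ ! seq ⇛ ! inc lt ⇛ fast z<s (go-right {plain and-letter ∷ Z} z<s pos)
  check-binary {Z = Z} disj pos lt = ! while refl ⇛ fast z<s (cases-step {checkStep}) ⇛ ! seq ⇛ ! inc lt ⇛ fast z<s (go-right {plain or-letter ∷ Z} z<s pos)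

  check-quant : ∀ Q {Z R u p K} → Positive R →
   (checking ∷ K , front Z (quantCell Q blank ∷ R) u ⟨ 0 , 0 , 0 , suc p ⟩) ⇒[ 3 ] (checking ∷ K , front (quantCell Q blank ∷ Z) R u ⟨ 0 , 0 , 0 , suc p ⟩)
  check-quant forAll {Z} pos = ! while refl ⇛ fast z<s (cases-step {checkStep}) ⇛ fast z<s (go-right {quantCell forAll blank ∷ Z} z<s pos)
  check-quant exists {Z} pos = ! while refl ⇛ fast z<s (cases-step {checkStep}) ⇛ fast z<s (go-right {quantCell exists blank ∷ Z} z<s pos)

  binary : ∀ {c} → Binary c → isBinary (sym c) ≡ true
  binary conj = refl
  binary disj = refl

  check-formula : ∀ {n} (φ : Formula σ n) {ρ : Vec Sym n} {Z R u p K} → Env Z ρ → Positive R → Room Z (ahead φ (blanks φ) R) → suc p ≤ length Z →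
   (checking ∷ K , front Z (ahead φ (blanks φ) R) u ⟨ 0 , 0 , 0 , suc p ⟩) ⇒[ size φ * 60 ] (checking ∷ K , front (pushed φ (blanks φ) Z) R (bit true) ⟨ 0 , 0 , 0 , p ⟩)
  check-formula (atom r xs) {Z = Z} E pos room le = ⇒-≤ enough
   (! while refl ⇛ fast z<s (cases-step {checkStep}) ⇛ ! seq ⇛ ! dec z<s ⇛ ! seq ⇛
    run-vars xs (λ _ → true) E (base r) (room-right room) ⇛ fast z<s (go-right (pos-vars xs z<s) pos))
   where
   enough : 5 + (suc (vsize xs * 30) + 1) ≤ suc (vsize xs) * 60
   enough = ≤-trans (≡⇒≤ (cong (6 +_) (+-comm (vsize xs * 30) 1))) (+-mono-≤ (m≤m+n 7 53) (*-monoʳ-≤ (vsize xs) (m≤m+n 30 30)))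
  check-formula (φ ∧ ψ) E pos room le = ⇒-≤ (both-parts (size φ) (size ψ) (m≤m+n 5 55))
   (check-binary conj (pos-ahead φ (blanks φ)) (below room le) ⇛
    check-formula φ (leftOf refl E) (pos-ahead ψ (blanks ψ)) (room-right room) (s≤s le) ⇛
    check-formula ψ (rightOf refl φ (blanks φ) E) pos (room-pushed φ (blanks φ) z<s (room-right room))
     (≤-trans (≤-trans le (n≤1+n _)) (pushed-longer φ (blanks φ) z<s)))
  check-formula (φ ∨ ψ) E pos room le = ⇒-≤ (both-parts (size φ) (size ψ) (m≤m+n 5 55))
   (check-binary disj (pos-ahead φ (blanks φ)) (below room le) ⇛
    check-formula φ (leftOf refl E) (pos-ahead ψ (blanks ψ)) (room-right room) (s≤s le) ⇛
    check-formula ψ (rightOf refl φ (blanks φ) E) pos (room-pushed φ (blanks φ) z<s (room-right room))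
     (≤-trans (≤-trans le (n≤1+n _)) (pushed-longer φ (blanks φ) z<s)))
  check-formula (quant Q φ) E pos room le = ⇒-≤ (+-monoˡ-≤ (size φ * 60) (m≤m+n 3 57))
   (check-quant Q (pos-ahead φ (blanks φ)) ⇛ check-formula φ (under Q blank E) pos (room-right room) (≤-trans le (n≤1+n _)))

  pos-raw : ∀ u → Positive (raw u)
  pos-raw [] = s≤s z≤n
  pos-raw (a ∷ u) = s≤s z≤n

  size-encode : ∀ {n} (φ : Formula σ n) → size φ ≡ length (encode σ φ)
  size-encode φ = +-cancelʳ-≡ 1 _ _ (trans (symm (length-ahead φ (blanks φ) {raw []})) (trans (cong length (symm (raw-formula φ [])))
   (trans (length-raw (encode σ φ ++ [])) (trans (cong (suc ∘ length) (++-identityʳ (encode σ φ))) (+-comm 1 _)))))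

  abort-formula : ∀ {n u} {ρ : Vec Sym n} → Bad n u → ∀ {Z s p K} → Env Z ρ → Room Z (raw u) → suc p ≤ length Z →
   Aborts (checking ∷ K , front Z (raw u) s ⟨ 0 , 0 , 0 , suc p ⟩) (suc (length u) * 60)
  abort-formula (no-start none) E room le = aborts-≤ (m≤m+n 2 58) (! while refl ⇛! fast z<s (cases-step {checkStep}) ⇛! abort-now)
  abort-formula (no-start (first {u = u} (inj₁ refl))) E room le = aborts-≤ (m≤m+n 2 (58 + suc (length u) * 60)) (! while refl ⇛! fast z<s (cases-step {checkStep}) ⇛! abort-now)
  abort-formula (no-start (first {u = u} (inj₂ refl))) E room le = aborts-≤ (m≤m+n 2 (58 + suc (length u) * 60)) (! while refl ⇛! fast z<s (cases-step {checkStep}) ⇛! abort-now)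
  abort-formula (bad-vars {r = r} {u} b) {Z} E room le = aborts-≤ (+-mono-≤ (m≤m+n 5 55) (*-monoʳ-≤ (suc (length u)) (m≤m+n 30 30)))
   (! while refl ⇛! fast z<s (cases-step {checkStep}) ⇛! ! seq ⇛! ! dec z<s ⇛! ! seq ⇛!
    abort-vars b (λ _ → true) E (base r) (room-right room))
  abort-formula (in-left {u = u} bc b) E room le = aborts-≤ (+-monoˡ-≤ _ (m≤m+n 5 55))
   (check-binary bc (pos-raw u) (below room le) ⇛! abort-formula b (leftOf (binary bc) E) (room-right room) (s≤s le))
  abort-formula (in-right {c = c} {u} bc φ b) {Z} {s} {p} {K} E room le = aborts-≤ enough
   (subst (λ R → Aborts (checking ∷ K , front Z (plain c ∷ R) s ⟨ 0 , 0 , 0 , suc p ⟩) (5 + (size φ * 60 + suc (length u) * 60))) (symm eq)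
    (check-binary bc (pos-ahead φ (blanks φ)) (below room le) ⇛!
     check-formula φ (leftOf (binary bc) E) (pos-raw u) (room-right room′) (s≤s le) ⇛!
     abort-formula b (rightOf (binary bc) φ (blanks φ) E) (room-pushed φ (blanks φ) z<s (room-right room′))
      (≤-trans (≤-trans le (n≤1+n _)) (pushed-longer φ (blanks φ) z<s)))) where
   eq : raw (encode σ φ ++ u) ≡ ahead φ (blanks φ) (raw u)
   eq = raw-formula φ u
   room′ : Room Z (plain c ∷ ahead φ (blanks φ) (raw u))
   room′ = subst (λ R → Room Z (plain c ∷ R)) eq room
   enough : 5 + (size φ * 60 + suc (length u) * 60) ≤ suc (suc (length (encode σ φ ++ u))) * 60
   enough = ≤-trans (both-parts (size φ) (suc (length u)) (m≤m+n 5 55)) (*-monoˡ-≤ 60 (s≤s (≡⇒≤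
    (trans (+-suc (size φ) (length u)) (cong suc (trans (cong (_+ length u) (size-encode φ)) (symm (length-++ (encode σ φ)))))))))
  abort-formula (beneath {Q = forAll} {u} b) E room le = aborts-≤ (+-monoˡ-≤ _ (m≤m+n 3 57))
   (check-quant forAll (pos-raw u) ⇛! abort-formula b (under forAll blank E) (room-right room) (≤-trans le (n≤1+n _)))
  abort-formula (beneath {Q = exists} {u} b) E room le = aborts-≤ (+-monoˡ-≤ _ (m≤m+n 3 57))
   (check-quant exists (pos-raw u) ⇛! abort-formula b (under exists blank E) (room-right room) (≤-trans le (n≤1+n _)))

  start-cells : List Cell
  start-cells = (⊢ , blank) ∷ []

  end-cells : List Cell
  end-cells = (⊣ , blank) ∷ []

  data Checked (w : Word (#letters σ)) : Set₁ where
   sentence : ∀ (θ : Sentence σ) → w ≡ encode σ θ →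
    (∀ {K} → (check ∷ K , initStore w) ⇒[ suc (length w) * 60 ] (K , on (pushed θ (blanks θ) start-cells) end-cells (bit true) 0s)) → Checked w
   malformed : (∀ (θ : Sentence σ) → encode σ θ ≢ w) → (∀ {K} → Aborts (check ∷ K , initStore w) (suc (suc (length w)) * 60)) → Checked w

  run-check : ∀ w → 2 + length w ≤ M → Checked w
  run-check w wide = checked (parse (length w) 0 w ≤-refl) where
   room : Room start-cells (raw w)
   room = within-room (≤-trans (s≤s (≡⇒≤ (length-raw w))) wide)
   initial : initStore w ≡ on start-cells (raw w) blank 0s
   initial = cong (λ R → store [] (⊢ , blank) R blank 0s []) (raw-initial w)
   enter : ∀ {K} → (check ∷ K , initStore w) ⇒[ 5 ] (checking ∷ ifThen (at? isEnd) goL (halt verdict) ∷ K , front start-cells (raw w) blank ⟨ 0 , 0 , 0 , 1 ⟩)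
   enter {K} = launching (cong (check ∷ K ,_) initial)
    (! seq ⇛ ! inc (≤-trans z<s wide) ⇛ ! seq ⇛ fast z<s (go-right {start-cells} z<s (pos-raw w)) ⇛ ! seq)
   whole : ∀ (θ : Sentence σ) {u} → w ≡ encode σ θ ++ u → ∀ {K} → (checking ∷ K , front start-cells (raw w) blank ⟨ 0 , 0 , 0 , 1 ⟩) ⇒[ size θ * 60 ]
    (checking ∷ K , front (pushed θ (blanks θ) start-cells) (raw u) (bit true) 0s)
   whole θ {u} refl {K} = launching (cong (λ R → checking ∷ K , front start-cells R blank ⟨ 0 , 0 , 0 , 1 ⟩) (raw-formula θ u))
    (check-formula θ root (pos-raw u) (subst (Room start-cells) (raw-formula θ u) room) ≤-refl)
   checked : Split (encode σ {0}) w ⊎ Bad 0 w → Checked w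
   checked (inj₂ b) = malformed (λ θ e → no-formula b θ [] (trans (symm e) (symm (++-identityʳ _))))
    (aborts-≤ (+-monoˡ-≤ _ (m≤m+n 5 55)) (enter ⇛! abort-formula b root room ≤-refl))
   checked (inj₁ (split {θ} {[]} e)) = sentence θ (trans e (++-identityʳ _))
    (⇒-≤ (≤-trans (≡⇒≤ (cong (5 +_) (+-comm (size θ * 60) 3))) (+-mono-≤ (m≤m+n 8 52) (*-monoˡ-≤ 60 (≡⇒≤ (trans (size-encode θ) (cong length (symm (trans e (++-identityʳ _)))))))))
     (enter ⇛ whole θ e ⇛ ! while refl ⇛ ! ifThen refl ⇛ fast z<s (go-left (pos-pushed θ (blanks θ) z<s))))
   checked (inj₁ (split {θ} {a ∷ u} e)) = malformed (λ θ′ e′ → different θ′ (trans e′ e))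
    (aborts-≤ (≤-trans (≡⇒≤ (cong (5 +_) (+-comm (size θ * 60) 2))) (+-mono-≤ (m≤m+n 7 53) (≤-trans (*-monoˡ-≤ 60 θ≤w) (m≤n+m _ 60))))
     (enter ⇛! whole θ e ⇛! ! while refl ⇛! ! ifThen refl ⇛! abort-now)) where
    θ≤w : size {0} θ ≤ length w
    θ≤w = ≤-trans (≤-trans (≡⇒≤ (size-encode θ)) (m≤m+n _ _)) (≡⇒≤ (trans (symm (length-++ (encode σ θ))) (cong length (symm e))))
    different : ∀ (θ′ : Sentence σ) → encode σ θ′ ≢ encode σ θ ++ a ∷ u
    different θ′ e with encode-prefix σ θ′ θ (trans (++-identityʳ _) e)
    ... | _ , ()

  passable-home : Passable home
  passable-home = passable λ _ _ → refl

  run-clear : ∀ d {L h R u p o K} → d ≤ M → (clear ∷ K , store L h R u ⟨ 0 , 0 , d , p ⟩ o) ⇒[ 1 ] (K , store L h R u ⟨ 0 , 0 , 0 , p ⟩ o)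
  run-clear d le = within-unit le (go d) where
   go : ∀ d {L h R u p o K} → Leads (clear ∷ K , store L h R u ⟨ 0 , 0 , d , p ⟩ o) (suc (d * 4)) (K , store L h R u ⟨ 0 , 0 , 0 , p ⟩ o)
   go zero = one-step (while refl)
   go (suc d) = leads-≤ (m≤n+m _ 2) (one-step (while refl) » one-step (dec z<s) » go d)

  run-restart : ∀ {n} (φ : Formula σ n) α {R u K} → length (pushed φ α start-cells) ≤ M →
   (restart ∷ K , on (pushed φ α start-cells) R u 0s) ⇒[ 8 ] (K , front start-cells (ahead φ α R) u 0s)
  run-restart φ α {R} room =
   ! seq ⇛ linear {n = distance S} dist≤ (path S z≤n room) ⇛ ! while refl ⇛ ! seq ⇛ ! dec z<s ⇛ ! seq ⇛
   run-clear (distance S + 0) (≤-trans (≡⇒≤ (+-identityʳ _)) dist≤) ⇛ fast z<s (go-right {start-cells} z<s (pos-ahead φ α))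
   where
   S : Scanned home (pushed φ α start-cells) R 0 0 start-cells (ahead φ α R) 1 0
   S = pass passable-home φ α z<s
   dist≤ : distance S ≤ M
   dist≤ = ≤-trans (≤-trans (m≤m+n _ 1) (≡⇒≥ (moved-length (moved S)))) room

  run-evaluation : ∀ (θ : Sentence σ) α {u K} → 2 + size θ ≤ M →
   (evaluation ∷ K , on (pushed θ α start-cells) end-cells u 0s) ⇒[ 25 + size θ * 60 ]
   (K , on (pushed θ α start-cells) end-cells (bit (evalA θ α [])) 0s)
  run-evaluation θ α wide = ⇒-≤ (≡⇒≤ (cong (13 +_) (+-comm (size θ * 60) 12)))
   (! seq ⇛ run-restart θ α (fits-left room′) ⇛ ! seq ⇛ ! seq ⇛ ! seq ⇛ ! seq ⇛ eval-formula θ α root z<s room ⇛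
    Back.path back ⇛ ! while refl ⇛ run-rewind (fits-left room′) z<s (Back.moved back)) where
   room : Room start-cells (ahead θ α end-cells)
   room = within-room (≤-trans (≡⇒≤ (cong suc (trans (length-ahead θ α) (+-comm (size θ) 1)))) wide)
   room′ : Room (pushed θ α start-cells) end-cells
   room′ = room-pushed θ α z<s room
   back : Back start-cells (ahead θ α end-cells) (pushed θ α start-cells) end-cells (bit (evalA θ α [])) 0
   back = run-find θ α z<s (fits-left room′) refl

  walk-one : ∀ {f l Z R u K} → isEnd (sym l) ≡ false → f (sym l) ≡ skip → Positive R →
   (walking f ∷ K , front Z (plain l ∷ R) u 0s) ⇒[ 5 ] (walking f ∷ K , front (plain l ∷ Z) R u 0s)
  walk-one {f} {l} {Z} {R} {u} {K} e e′ pos = ! while refl ⇛ ! seq ⇛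
   landing (cong (λ q → q ∷ goR ∷ walking f ∷ K , front Z (plain l ∷ R) u 0s) e′) (fast z<s (cases-step {f})) ⇛ ! setReg ⇛ fast z<s (go-right {plain l ∷ Z} z<s pos)

  walk-ticks : ∀ {f} → f (sym tick-letter) ≡ skip → ∀ n {Z R u K} → Positive R →
   (walking f ∷ K , front Z (ticks n R) u 0s) ⇒[ n * 5 ] (walking f ∷ K , front (ticks n Z) R u 0s)
  walk-ticks e zero pos = ⇒-refl
  walk-ticks {f} e (suc n) {Z} {R} {u} {K} pos = walk-one {f} {Z = Z} refl e (pos-ticks n pos) ⇛
   landing (cong (λ Z → walking f ∷ K , front Z R u 0s) (ticks-snoc n Z)) (walk-ticks {f} e n pos)

  walk-vars : ∀ {f} → f (sym tick-letter) ≡ skip → f (sym stop-letter) ≡ skip → ∀ {n m} (xs : Vec (Fin n) m) {Z R u K} → Positive R →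
   (walking f ∷ K , front Z (aheadVars xs R) u 0s) ⇒[ vsize xs * 5 ] (walking f ∷ K , front (pushedVars xs Z) R u 0s)
  walk-vars e e′ [] pos = ⇒-refl
  walk-vars {f} e e′ (x ∷ xs) {Z} pos = ⇒-≤ (≡⇒≥ (*-distribʳ-+ 5 (toℕ x) (suc (vsize xs))))
   (walk-ticks {f} e (toℕ x) z<s ⇛ walk-one {f} {Z = ticks (toℕ x) Z} refl e′ (pos-aheadVars xs pos) ⇛ walk-vars {f} e e′ xs pos)

  record Decides (c : Config) (t : ℕ) (A : Set) : Set₁ where
   constructor decides
   field
    {Leaves} : Set
    tree : ATree M AccLeaf (t * unit) c Leaves
    means : Leaves ⇔ A

  open Decides public

  infixr 5 _⇛?_
  _⇛?_ : ∀ {c t c′ s A} → c ⇒[ t ] c′ → Decides c′ s A → Decides c (t + s) A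
  _⇛?_ {t = t} {s = s} f d = decides (weakenA (≡⇒≥ (*-distribʳ-+ unit t s)) (before (steps f) (tree d))) (means d)

  decides-≤ : ∀ {c s t A} → s ≤ t → Decides c s A → Decides c t A
  decides-≤ le d = decides (weakenA (*-monoˡ-≤ unit le) (tree d)) (means d)

  decides-⇔ : ∀ {c t A A′} → A ⇔ A′ → Decides c t A → Decides c t A′
  decides-⇔ e d = decides (tree d) (mk⇔ (to e ∘ to (means d)) (from (means d) ∘ from e))
   where open Equivalence

  halting : ∀ v {K s} → Decides (halt v ∷ K , s) 0 (T v)
  halting v = decides (leaf halted (mk⇔ id id)) (mk⇔ id id)

  aborting : ∀ {c t} → Aborts c t → Decides c t (T verdict)
  aborting a = decides (run-off a) (mk⇔ id id)

  holds-bit : ∀ v → holds (bit v) ≡ v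
  holds-bit true = refl
  holds-bit false = refl

  run-answer : ∀ v {Z R vs K} → Decides (answer ∷ K , on Z R (bit v) vs) 1 (T v)
  run-answer v {Z} {R} {vs} = go Z v where
   go : ∀ Z v {K} → Decides (answer ∷ K , on Z R (bit v) vs) 1 (T v)
   go [] true = ! ifThen refl ⇛? halting true
   go [] false = ! ifThen refl ⇛? halting false
   go (_ ∷ _) true = ! ifThen refl ⇛? halting true
   go (_ ∷ _) false = ! ifThen refl ⇛? halting false

  checked-decides : ∀ w → 2 + length w ≤ M → ∀ {q} {t : (θ : Sentence σ) → w ≡ encode σ θ → ℕ} {A} →
   (∀ (θ : Sentence σ) e → Decides (q ∷ [] , on (pushed θ (blanks θ) start-cells) end-cells (bit true) 0s) (t θ e) A) →
   ((∀ (θ : Sentence σ) → encode σ θ ≢ w) → T verdict ⇔ A) →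
   ∃[ s ] Decides ((check ⨾ q) ∷ [] , initStore w) s A × (∀ b → (∀ (θ : Sentence σ) e → t θ e ≤ b) → s ≤ suc (suc (suc (length w)) * 60 + b))
  checked-decides w wide good bad with run-check w wide
  ... | malformed b a = _ , (! seq ⇛? decides-⇔ (bad b) (aborting a)) , λ b _ → s≤s (m≤m+n (suc (suc (length w)) * 60) b)
  ... | sentence θ e run = _ , (! seq ⇛? run ⇛? good θ e) , λ b h → s≤s (+-mono-≤ (m≤n+m (suc (length w) * 60) 60) (h θ e))

module _ {σ : Signature} (B : Structure σ) where

 open Semantics B using (Splits∧)

 logspace-member : Splits∧ → Semantics.Splits∧ (complement B) → Logspace (MC B)
 logspace-member splits splitsᶜ = machine , 60 , deterministic refl ,
   (λ w → let n , c , _ , r , h , _ = program-halts w (proj₁ (proj₂ (proj₂ (decided w)))) in n , c , r , h) ,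
   (λ w n c r → ≤-trans (program-space w (proj₁ (proj₂ (proj₂ (decided w)))) r) (small (length w))) ,
   (λ {w} m → from (accepts⇔ w) m) , (λ {w} a → to (accepts⇔ w) a) where
  open Dual.Table B splits splitsᶜ using (AtomTable; TableSat; table)

  code : Quantifier → Fin 3
  code forAll = suc zero
  code exists = suc (suc zero)

  decode : Fin 3 → Quantifier
  decode (suc zero) = forAll
  decode _ = exists

  decode-code : ∀ Q → decode (code Q) ≡ Q
  decode-code forAll = refl
  decode-code exists = refl

  atomTable? : ∀ r qs → Dec (AtomTable r qs)
  atomTable? r qs = all? λ a → any? λ e → Structure.rel? B r (Vec.map (pick a e) qs)

  relate : ∀ r → Vec (Fin 3) (arity σ r) → Bool
  relate r qs = isYes (atomTable? r (Vec.map decode qs))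

  open Machines {σ} 0 false false (λ Q _ → code Q) false relate
   using (ATree; AccLeaf; Prog; _⨾_; answer; bit; blanks; check; evalA; evaluation; initStore; on; pushed; seq; size)

  evalA-table : ∀ {n} (φ : Formula σ n) α ρ → T (evalA φ α (Vec.map code ρ)) ⇔ TableSat ρ φ
  evalA-table (atom r xs) α ρ = ⇔P.trans (mk⇔ toWitness fromWitness) (mk⇔ (subst (AtomTable r) eq) (subst (AtomTable r) (symm eq)))
   where
   eq : Vec.map decode (Vec.map (lookup (Vec.map code ρ)) xs) ≡ Vec.map (lookup ρ) xs
   eq = trans (symm (map-∘ decode _ xs)) (map-cong (λ i → trans (cong decode (lookup-map i code ρ)) (decode-code _)) xs)
  evalA-table (φ ∧ ψ) (α , β) ρ = ⇔P.trans T-∧ (evalA-table φ α ρ ×-⇔ evalA-table ψ β ρ)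
  evalA-table (φ ∨ ψ) (α , β) ρ = ⇔P.trans T-∨ (evalA-table φ α ρ ⊎-⇔ evalA-table ψ β ρ)
  evalA-table (quant Q φ) (a , α) ρ = evalA-table φ α (Q ∷ ρ)

  p₀ : Prog
  p₀ = check ⨾ evaluation ⨾ answer

  open Programs.Results (#letters σ) 0 0 4 false false p₀ using (machine; deterministic; spaceUsed; program-halts; program-space; program-accepts)

  module Run (M : ℕ) where

   open Machines.Correctness {σ} 0 false false (λ Q _ → code Q) false relate M
    using (!_; 0s; Decides; _⇛?_; checked-decides; decides-⇔; end-cells; means; run-answer; run-evaluation; size-encode; start-cells; tree)
   decision : ∀ w → 2 + length w ≤ M → ∃[ t ] ∃[ L ] ATree M AccLeaf t (p₀ ∷ [] , initStore w) L × L ⇔ MC B w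
   decision w wide = let t , d , _ = checked-decides w wide {t = λ θ _ → 1 + (25 + size θ * 60 + 1)} good (λ bad → mk⇔ (λ ()) (λ (θ , e , _) → ⊥-elim (bad θ e))) in _ , _ , tree d , means d
    where
    good : ∀ θ → w ≡ encode σ θ → Decides ((evaluation ⨾ answer) ∷ [] , on (pushed θ (blanks θ) start-cells) end-cells (bit true) 0s) (1 + (25 + size θ * 60 + 1)) (MC B w)
    good θ refl = decides-⇔ (⇔P.trans (evalA-table θ (blanks θ) []) (⇔P.trans (⇔P.sym (table [] θ)) (⇔P.sym (mc-encode B θ))))
     (! seq ⇛? run-evaluation θ (blanks θ) (≤-trans (≡⇒≤ (cong (2 +_) (size-encode θ))) wide) ⇛? run-answer (evalA θ (blanks θ) []))

  decided : ∀ w → ∃[ t ] ∃[ L ] ATree (2 + length w) AccLeaf t (p₀ ∷ [] , initStore w) L × L ⇔ MC B w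
  decided w = Run.decision (2 + length w) w ≤-refl

  accepts⇔ : ∀ w → Machine.Accepts machine w ⇔ MC B w
  accepts⇔ w = ⇔P.trans (program-accepts w (proj₁ (proj₂ (proj₂ (decided w))))) (proj₂ (proj₂ (proj₂ (decided w))))

  small : ∀ n → spaceUsed n (2 + n) ≤ 60 * suc ⌊log₂ n ⌋
  small n = ≤-trans (+-monoʳ-≤ 2 (*-monoʳ-≤ 4 (+-monoʳ-≤ 3 (log-bound n))))
   (≤-trans (≡⇒≤ (solve 1 (λ l → con 2 :+ con 4 :* (con 3 :+ (con 2 :+ l)) := con 22 :+ con 4 :* l) refl ⌊log₂ n ⌋))
    (≤-trans (+-mono-≤ (m≤m+n 22 38) (*-monoˡ-≤ ⌊log₂ n ⌋ (m≤m+n 4 56))) (≡⇒≥ (*-suc 60 ⌊log₂ n ⌋))))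
   where
   open +-*-Solver
   log-bound : ∀ n → ⌊log₂ suc (2 + n) ⌋ ≤ 2 + ⌊log₂ n ⌋
   log-bound zero = s≤s z≤n
   log-bound (suc n) = ≤-trans (⌊log₂⌋-mono-≤ four) (≡⇒≤ (trans (⌊log₂[2*b]⌋≡1+⌊log₂b⌋ (2 * suc n)) (cong suc (⌊log₂[2*b]⌋≡1+⌊log₂b⌋ (suc n)))))
    where
    four : 3 + suc n ≤ 2 * (2 * suc n)
    four = ≤-trans (+-monoʳ-≤ 4 (m≤m+n n (3 * n))) (≡⇒≤ (solve 1 (λ n → con 4 :+ (n :+ con 3 :* n) := con 2 :* (con 2 :* (con 1 :+ n))) refl n))

uncurried : {X Y : Set} (A : X × Y → Set) → (∃[ x ] ∃[ y ] A (x , y)) ⇔ ∃ A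
uncurried A = mk⇔ (λ (x , y , a) → (x , y) , a) (λ ((x , y) , a) → x , y , a)

-- The annotation of a quantifier is the value given to its variable.
module Valued {σ : Signature} (B : Structure σ) where

 open Structure B using () renaming (size to #B)

 Code : Set
 Code = Fin (3 + #B)

 code : Dom B → Code
 code d = suc (suc (suc d))

 decode : Code → Dom B
 decode (suc (suc (suc d))) = d
 decode _ = element B

 relate : ∀ r → Vec Code (arity σ r) → Bool
 relate r ss = isYes (Structure.rel? B r (Vec.map decode ss))

 relate⇔ : ∀ {n} r xs (ρ : Vec Code n) → T (relate r (Vec.map (lookup ρ) xs)) ⇔ Sat B (Vec.map decode ρ) (atom r xs)
 relate⇔ r xs ρ = ⇔P.trans (mk⇔ toWitness fromWitness) (mk⇔ (subst (Rel B r) eq) (subst (Rel B r) (symm eq)))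
  where
  eq : Vec.map decode (Vec.map (lookup ρ) xs) ≡ Vec.map (lookup (Vec.map decode ρ)) xs
  eq = trans (symm (map-∘ decode _ xs)) (map-cong (λ i → symm (lookup-map i decode ρ)) xs)

-- To refute a sentence is to choose values for the universal variables.
module Guess {σ : Signature} (B : Structure σ) (good : Bool) where

 open Structure B using () renaming (size to #B)
 open Valued B using (code; relate)

 open Machines {σ} #B true true (λ _ s → s) (not good) relate public
  using (ATree; AccLeaf; Ann; Input; Prog; Sym; Test; _⨾_; ahead; bit; blanks; check; choose; evalA; evaluation; fork; front; goL; goR; halt; holds;
    ifThen; initStore; local; on; pushed; quantCell; restart; seq; setAnn; size; skip; store; test; vsize; walking; weakenA; while)

 private
  D : Set
  D = Dom B

 isGuessed : Quantifier → Bool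
 isGuessed forAll = not good
 isGuessed exists = good

 Option : Bool → Set
 Option b = if b then D else ⊤

 option : D → ∀ b → Option b → D
 option a true d = d
 option a false _ = a

 Choice : ∀ {n} → Formula σ n → Set
 Choice (atom r xs) = ⊤
 Choice (φ ∧ ψ) = Choice φ × Choice ψ
 Choice (φ ∨ ψ) = Choice φ × Choice ψ
 Choice (quant Q φ) = Option (isGuessed Q) × Choice φ

 annotate : D → ∀ {n} (φ : Formula σ n) → Choice φ → Ann φ
 annotate a (atom r xs) c = tt
 annotate a (φ ∧ ψ) (c , d) = annotate a φ c , annotate a ψ d
 annotate a (φ ∨ ψ) (c , d) = annotate a φ c , annotate a ψ d
 annotate a (quant Q φ) (o , c) = code (option a (isGuessed Q) o) , annotate a φ c

 anything : ∀ {n} (φ : Formula σ n) → Choice φ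
 anything (atom r xs) = tt
 anything (φ ∧ ψ) = anything φ , anything ψ
 anything (φ ∨ ψ) = anything φ , anything ψ
 anything (quant Q φ) = default (isGuessed Q) , anything φ where
  default : ∀ b → Option b
  default true = element B
  default false = tt

 pick-one : ∀ n → (Fin n → Sym) → Prog
 pick-one zero f = halt false
 pick-one (suc n) f = choose tt (setAnn tt (λ _ _ _ → f zero)) (pick-one n (f ∘ suc))

 mark : D → Bool → Prog
 mark a true = pick-one #B code
 mark a false = setAnn tt (λ _ _ _ → code a)

 guessStep : D → Input → Prog
 guessStep a (sym forAll-letter) = mark a (isGuessed forAll)
 guessStep a (sym exists-letter) = mark a (isGuessed exists)
 guessStep a _ = skip

 guessing : D → Prog
 guessing a = walking (guessStep a)

 continue? : Test
 continue? = local (λ _ _ u → isYes (holds u ≟ᵇ good))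

 rounds : ∀ n → (Fin n → D) → Prog
 rounds zero f = halt true
 rounds (suc n) f = restart ⨾ guessing (f zero) ⨾ goL ⨾ evaluation ⨾ ifThen continue? (rounds n (f ∘ suc)) (halt false)

 p₀ : Prog
 p₀ = check ⨾ rounds #B id

 Guessed : Sentence σ → D → Set
 Guessed θ a = ∃[ c ] evalA θ (annotate a θ c) [] ≡ good

 module GuessCorrectness (M : ℕ) where

  open Machines.Correctness {σ} #B true true (λ _ s → s) (not good) relate M
   using (!_; 0s; Decides; Positive; _⇛?_; cases-step; checked-decides; decides; decides-⇔; decides-≤; end-cells; fast; fits-left; go-left; go-right;
     halting; holds-bit; landing; length-ahead; means; pos-ahead; pos-aheadVars; pos-pushed; room-pushed; run-evaluation; run-restart;
     size-encode; start-cells; tree; unit; walk-one; walk-vars; within-room)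

  cost : ℕ
  cost = 10 + #B * 2

  run-pick : ∀ {n} f {L a x R u vs o K t} {A : Fin n → Set} → (∀ i → Decides (K , store L (a , f i) R u vs o) t (A i)) →
   Decides (pick-one n f ∷ K , store L (a , x) R u vs o) (n * 2 + t) (∃ A)
  run-pick {zero} f h = decides-≤ z≤n (decides-⇔ (mk⇔ (λ ()) (λ ())) (halting false))
  run-pick {suc n} f {t = t} {A} h = decides
   (weakenA (+-monoˡ-≤ ((1 + (n * 2 + t)) * unit) (s≤s (z≤n {9 + M * 10})))
    (fork (tree (decides-≤ {s = 1 + t} (s≤s (m≤n+m t (n * 2))) (! setAnn ⇛? h zero))) (tree (decides-≤ (n≤1+n _) (run-pick (f ∘ suc) (h ∘ suc))))))
   (mk⇔ (λ { (inj₁ x) → zero , to (means (h zero)) x ; (inj₂ x) → let i , y = to (means (run-pick (f ∘ suc) (h ∘ suc))) x in suc i , y })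
     (λ { (zero , y) → inj₁ (from (means (h zero)) y) ; (suc i , y) → inj₂ (from (means (run-pick (f ∘ suc) (h ∘ suc))) (i , y)) }))

  run-mark : ∀ a b {L h x R u vs o K t} {A : Option b → Set} → (∀ c → Decides (K , store L (h , code (option a b c)) R u vs o) t (A c)) →
   Decides (mark a b ∷ K , store L (h , x) R u vs o) (#B * 2 + (1 + t)) (∃ A)
  run-mark a true h = decides-≤ (+-monoʳ-≤ (#B * 2) (n≤1+n _)) (run-pick code h)
  run-mark a false h = decides-≤ (m≤n+m _ (#B * 2)) (decides-⇔ (mk⇔ (tt ,_) proj₂) (! setAnn ⇛? h tt))

  pair-cost : ∀ m n t → 5 + (m * cost + (n * cost + t)) ≤ suc (m + n) * cost + t
  pair-cost m n t = ≤-trans (≡⇒≤ (solve 3 (λ m n t → con 5 :+ (m :+ (n :+ t)) := con 5 :+ (m :+ n) :+ t) refl (m * cost) (n * cost) t))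
   (+-monoˡ-≤ t (≤-trans (+-monoˡ-≤ (m * cost + n * cost) (m≤m+n 5 (5 + #B * 2))) (≡⇒≤ (cong (cost +_) (symm (*-distribʳ-+ cost m n))))))
   where open +-*-Solver

  run-guess : ∀ a {n} (φ : Formula σ n) {α Z R u K t} {A : Choice φ → Set} → Positive R →
   (∀ c → Decides (guessing a ∷ K , front (pushed φ (annotate a φ c) Z) R u 0s) t (A c)) →
   Decides (guessing a ∷ K , front Z (ahead φ α R) u 0s) (size φ * cost + t) (∃ A)
  run-guess a (atom r xs) {Z = Z} {t = t} pos h = decides-≤ (+-monoˡ-≤ t (+-mono-≤ (m≤m+n 5 _) (*-monoʳ-≤ (vsize xs) (m≤m+n 5 _))))
   (decides-⇔ (mk⇔ (tt ,_) proj₂)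
    (decides-≤ (≡⇒≥ (+-assoc 5 (vsize xs * 5) t)) (walk-one {guessStep a} {Z = Z} refl refl (pos-aheadVars xs pos) ⇛? walk-vars {guessStep a} refl refl xs pos ⇛? h tt)))
  run-guess a (φ ∧ ψ) {α , β} {Z} {t = t} {A} pos h = decides-≤ (pair-cost (size φ) (size ψ) t)
   (decides-⇔ (uncurried A)
    (walk-one {guessStep a} {Z = Z} refl refl (pos-ahead φ α) ⇛? run-guess a φ {A = λ c → ∃ λ d → A (c , d)} (pos-ahead ψ β) (λ c → run-guess a ψ pos (λ d → h (c , d)))))
  run-guess a (φ ∨ ψ) {α , β} {Z} {t = t} {A} pos h = decides-≤ (pair-cost (size φ) (size ψ) t)
   (decides-⇔ (uncurried A)
    (walk-one {guessStep a} {Z = Z} refl refl (pos-ahead φ α) ⇛? run-guess a φ {A = λ c → ∃ λ d → A (c , d)} (pos-ahead ψ β) (λ c → run-guess a ψ pos (λ d → h (c , d)))))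
  run-guess a (quant Q φ) {x , α} {Z} {R} {u} {K} {t} {A} pos h = decides-≤ (quant-cost #B (size φ * cost) t)
   (decides-⇔ (uncurried A)
    (! while refl ⇛? ! seq ⇛? landing (cong (λ q → q ∷ goR ∷ guessing a ∷ K , front Z (quantCell Q x ∷ ahead φ α R) u 0s) (quant-step Q)) (fast z<s (cases-step {guessStep a})) ⇛?
     run-mark a (isGuessed Q) {A = λ o → ∃ λ c → A (o , c)} (λ o → fast z<s (go-right {quantCell Q _ ∷ Z} z<s (pos-ahead φ α)) ⇛? run-guess a φ {A = λ c → A (o , c)} pos (λ c → h (o , c)))))
   where
   quant-step : ∀ Q → guessStep a (sym (quantifier-letter σ Q)) ≡ mark a (isGuessed Q)
   quant-step forAll = refl
   quant-step exists = refl
   quant-cost : ∀ s r t → 3 + (s * 2 + (1 + (1 + (r + t)))) ≤ 10 + s * 2 + r + t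
   quant-cost s r t = ≤-trans (≡⇒≤ (solve 3 (λ s r t → con 3 :+ (s :* con 2 :+ (con 1 :+ (con 1 :+ (r :+ t)))) := con 5 :+ (s :* con 2 :+ r :+ t)) refl s r t))
    (≤-trans (+-monoˡ-≤ _ (m≤m+n 5 5)) (≡⇒≤ (solve 3 (λ s r t → con 10 :+ (s :* con 2 :+ r :+ t) := con 10 :+ s :* con 2 :+ r :+ t) refl s r t)))
    where open +-*-Solver

  module _ (w : Word (#letters σ)) (wide : 2 + length w ≤ M) where

   roundTime : ℕ
   roundTime = 50 + (length w * cost + length w * 60)
   run-rounds : ∀ n f (θ : Sentence σ) → w ≡ encode σ θ → ∀ α {u K} →
    Decides (rounds n f ∷ K , on (pushed θ α start-cells) end-cells u 0s) (n * roundTime) (∀ i → Guessed θ (f i))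
   run-rounds zero f θ e α = decides-⇔ (mk⇔ (λ _ ()) (λ _ → tt)) (halting true)
   run-rounds (suc n) f θ refl α {u} {K} = decides-≤ (round-cost (size θ) (length w) (n * roundTime) (size-encode θ))
    (decides-⇔ (mk⇔ (λ (c , e , h) → λ { zero → c , e ; (suc i) → h i }) (λ h → proj₁ (h zero) , proj₂ (h zero) , h ∘ suc))
     (! seq ⇛? run-restart θ α (shorter α) ⇛? ! seq ⇛?
      run-guess (f zero) θ {A = λ c → evalA θ (annotate (f zero) θ c) [] ≡ good × (∀ i → Guessed θ (f (suc i)))} z<s (λ c →
       ! while refl ⇛? ! seq ⇛? fast z<s (go-left (pos-pushed θ (annotate (f zero) θ c) z<s)) ⇛? ! seq ⇛?
       run-evaluation θ (annotate (f zero) θ c) (≤-trans (≡⇒≤ (cong (2 +_) (size-encode θ))) wide) ⇛?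
       tested (evalA θ (annotate (f zero) θ c) []) (pushed θ (annotate (f zero) θ c) start-cells) (run-rounds n (f ∘ suc) θ refl (annotate (f zero) θ c)))))
    where
    shorter : ∀ α → length (pushed θ α start-cells) ≤ M
    shorter α = fits-left (room-pushed θ α {R = end-cells} z<s (within-room (≤-trans (≡⇒≤ (cong suc (trans (length-ahead θ α) (trans (+-comm (size θ) 1) (cong suc (size-encode θ)))))) wide)))
    tested : ∀ v Z {K t A} → Decides (rounds n (f ∘ suc) ∷ K , on Z end-cells (bit v) 0s) t A →
     Decides (ifThen continue? (rounds n (f ∘ suc)) (halt false) ∷ K , on Z end-cells (bit v) 0s) (1 + t) (v ≡ good × A)
    tested v Z d with v ≟ᵇ good | on-reg Z where
     on-reg : ∀ Z → test (on Z end-cells (bit v) 0s) continue? ≡ isYes (v ≟ᵇ good)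
     on-reg [] = cong (λ b → isYes (b ≟ᵇ good)) (holds-bit v)
     on-reg (_ ∷ _) = cong (λ b → isYes (b ≟ᵇ good)) (holds-bit v)
    ... | yes e | r = decides-⇔ (mk⇔ (e ,_) proj₂) (! ifThen r ⇛? d)
    ... | no ne | r = decides-≤ z<s (decides-⇔ (mk⇔ (λ ()) (λ (e , _) → ne e)) (! ifThen r ⇛? halting false))
    round-cost : ∀ s l t → s ≡ l → 1 + (8 + (1 + (s * cost + (1 + (1 + (1 + (1 + (25 + s * 60 + (1 + t))))))))) ≤ 50 + (l * cost + l * 60) + t
    round-cost s l t refl = ≤-trans
     (≡⇒≤ (solve 3 (λ x y t → con 1 :+ (con 8 :+ (con 1 :+ (x :+ (con 1 :+ (con 1 :+ (con 1 :+ (con 1 :+ (con 25 :+ y :+ (con 1 :+ t))))))))) := con 40 :+ (x :+ y) :+ t) refl (s * cost) (s * 60) t))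
     (+-monoˡ-≤ t (+-monoˡ-≤ _ (m≤m+n 40 10)))
     where open +-*-Solver
   time : ℕ
   time = suc (suc (suc (length w)) * 60 + #B * roundTime)
   decision : ∀ {A} → (∀ θ → w ≡ encode σ θ → (∀ a → Guessed θ a) ⇔ A) → ((∀ (θ : Sentence σ) → encode σ θ ≢ w) → T (not good) ⇔ A) →
    ∃[ L ] ATree M AccLeaf (time * unit) (p₀ ∷ [] , initStore w) L × L ⇔ A
   decision h b with checked-decides w wide {t = λ _ _ → #B * roundTime} (λ θ e → decides-⇔ (h θ e) (run-rounds #B id θ e (blanks θ))) b
   ... | s , d , s≤ = _ , tree (decides-≤ (s≤ _ (λ _ _ → ≤-refl)) d) , means d

 open Programs.Results (#letters σ) 0 #B 4 true true p₀ using (machine; timeUsed; program-time; program-accepts)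

 np : (A : Word (#letters σ) → Set) → (∀ w θ → w ≡ encode σ θ → (∀ a → Guessed θ a) ⇔ A w) →
   (∀ w → (∀ (θ : Sentence σ) → encode σ θ ≢ w) → T (not good) ⇔ A w) → NP A
 np A h b = machine , proj₁ polyTime , (λ w n c r → ≤-trans (program-time w (proj₁ (proj₂ (d w))) r) (proj₂ polyTime (length w))) ,
  (λ {w} a → from (accepts⇔ w) a) , (λ {w} a → to (accepts⇔ w) a) where
  d : ∀ w → ∃[ L ] ATree (2 + length w) AccLeaf _ (p₀ ∷ [] , initStore w) L × L ⇔ A w
  d w = GuessCorrectness.decision (2 + length w) w ≤-refl (h w) (b w)
  accepts⇔ : ∀ w → Machine.Accepts machine w ⇔ A w
  accepts⇔ w = ⇔P.trans (program-accepts w (proj₁ (proj₂ (d w)))) (proj₂ (proj₂ (d w)))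
  c : ℕ
  c = 10 + #B * 2
  polyTime : PolyBound (λ n → timeUsed (suc (suc (suc n) * 60 + #B * (50 + (n * c + n * 60))) * (suc (2 + n) * 10)) (2 + n))
  polyTime = pb-* (pb-+ (pb-const 4) (pb-* (pb-const 2) (pb-suc (pb-log (pb-suc (pb-+ (pb-const 2) pb-id))))))
   (pb-* (pb-suc (pb-+ (pb-* (pb-suc (pb-suc pb-id)) (pb-const 60)) (pb-* (pb-const #B) (pb-+ (pb-const 50) (pb-+ (pb-* pb-id (pb-const c)) (pb-* pb-id (pb-const 60)))))))
    (pb-* (pb-suc (pb-+ (pb-const 2) pb-id)) (pb-const 10)))

dec-mc : ∀ {σ} (B : Structure σ) w → Dec (MC B w)
dec-mc {σ} B w with Parsing.parse σ (length w) 0 w ≤-refl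
... | inj₂ b = no λ (θ , e , _) → Parsing.no-formula σ b θ [] (trans (symm e) (symm (++-identityʳ _)))
... | inj₁ (Parsing.split {θ} {[]} e) = map-⇔
  (⇔P.trans (⇔P.sym (mc-encode B θ)) (mk⇔ (subst (MC B) eq) (subst (MC B) (symm eq)))) (Semantics.sat? B [] θ)
 where
 eq : encode σ θ ≡ w
 eq = symm (trans e (++-identityʳ _))
... | inj₁ (Parsing.split {θ} {a ∷ u} e) = no λ (θ′ , e′ , _) → nonempty (proj₂ (encode-prefix σ θ′ θ (trans (++-identityʳ _) (trans e′ e))))
 where
 nonempty : [] ≢ a ∷ u
 nonempty ()

np-member : ∀ {σ} (B : Structure σ) → Semantics.Splits∧ (complement B) → NP (MC B)
np-member {σ} B splitsᶜ = np (MC B) meaning (λ w bad → mk⇔ (λ ()) (λ (θ , e , _) → bad θ e)) where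
 open Valued B using (code; decode; relate⇔)
 open Semantics B using (SatAt; sat⇒satAt∀)
 open Guess B true using (annotate; anything; evalA; Guessed; np)
 chosen⇔ : ∀ a {n} (φ : Formula σ n) ρ → (∃[ c ] evalA φ (annotate a φ c) ρ ≡ true) ⇔ SatAt forAll a (Vec.map decode ρ) φ
 chosen⇔ a (atom r xs) ρ = ⇔P.trans (mk⇔ (λ (_ , e) → from T-≡ e) (λ t → tt , to T-≡ t)) (relate⇔ r xs ρ)
 chosen⇔ a (φ ∧ ψ) ρ = mk⇔
  (λ ((c , d) , e) → let x , y = to T-∧ (from T-≡ e) in to (chosen⇔ a φ ρ) (c , to T-≡ x) , to (chosen⇔ a ψ ρ) (d , to T-≡ y))
  (λ (s , t) → let c , x = from (chosen⇔ a φ ρ) s ; d , y = from (chosen⇔ a ψ ρ) t in (c , d) , cong₂ _∧ᵇ_ x y)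
 chosen⇔ a (φ ∨ ψ) ρ = mk⇔
  (λ ((c , d) , e) → Sum.map (λ x → to (chosen⇔ a φ ρ) (c , to T-≡ x)) (λ y → to (chosen⇔ a ψ ρ) (d , to T-≡ y)) (to T-∨ (from T-≡ e)))
  (λ { (inj₁ s) → let c , x = from (chosen⇔ a φ ρ) s in (c , anything ψ) , cong (_∨ᵇ evalA ψ (annotate a ψ (anything ψ)) ρ) x
    ; (inj₂ t) → let d , y = from (chosen⇔ a ψ ρ) t in (anything φ , d) , trans (cong (_ ∨ᵇ_) y) (∨-zeroʳ _) })
 chosen⇔ a (quant forAll φ) ρ = mk⇔ (λ ((_ , c) , e) → to (chosen⇔ a φ (code a ∷ ρ)) (c , e))
  (λ s → let c , e = from (chosen⇔ a φ (code a ∷ ρ)) s in (tt , c) , e)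
 chosen⇔ a (quant exists φ) ρ = mk⇔ (λ ((b , c) , e) → b , to (chosen⇔ a φ (code b ∷ ρ)) (c , e))
  (λ (b , s) → let c , e = from (chosen⇔ a φ (code b ∷ ρ)) s in (b , c) , e)
 meaning : ∀ w θ → w ≡ encode σ θ → (∀ a → Guessed θ a) ⇔ MC B w
 meaning w θ refl = ⇔P.trans
  (mk⇔ (λ h → Dual.collapse∀ B splitsᶜ θ (λ a → to (chosen⇔ a θ []) (h a))) (λ s a → from (chosen⇔ a θ []) (sat⇒satAt∀ θ s)))
  (⇔P.sym (mc-encode B θ))

conp-member : ∀ {σ} (B : Structure σ) → Semantics.Splits∧ B → coNP (MC B)
conp-member {σ} B splits = (λ w → ¬ MC B w) , np (λ w → ¬ MC B w) meaning (λ w bad → mk⇔ (λ _ (θ , e , _) → bad θ e) (λ _ → tt)) ,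
 (λ m n → n m) , (λ {w} → decidable-stable (dec-mc B w)) where
 open Valued B using (code; decode; relate⇔)
 open Semantics B using (SatAt; satAt∃⇒sat; collapse∃)
 open Guess B false using (annotate; anything; evalA; Guessed; np)
 satAt? : ∀ a {n} (ρ : Vec (Dom B) n) φ → Dec (SatAt exists a ρ φ)
 satAt? a ρ (atom r xs) = Structure.rel? B r _
 satAt? a ρ (φ ∧ ψ) = satAt? a ρ φ ×-dec satAt? a ρ ψ
 satAt? a ρ (φ ∨ ψ) = satAt? a ρ φ ⊎-dec satAt? a ρ ψ
 satAt? a ρ (quant forAll φ) = all? λ b → satAt? a (b ∷ ρ) φ
 satAt? a ρ (quant exists φ) = satAt? a (a ∷ ρ) φ
 not-T : ∀ {b} → (b ≡ false) ⇔ (¬ T b)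
 not-T {false} = mk⇔ (λ _ ()) (λ _ → refl)
 not-T {true} = mk⇔ (λ ()) (λ n → ⊥-elim (n tt))
 chosen⇔ : ∀ a {n} (φ : Formula σ n) ρ → (∃[ c ] evalA φ (annotate a φ c) ρ ≡ false) ⇔ (¬ SatAt exists a (Vec.map decode ρ) φ)
 chosen⇔ a (atom r xs) ρ = ⇔P.trans (mk⇔ (λ (_ , e) → to not-T e) (λ n → tt , from not-T n))
  (mk⇔ (_∘ from (relate⇔ r xs ρ)) (_∘ to (relate⇔ r xs ρ)))
 chosen⇔ a (φ ∧ ψ) ρ = mk⇔
  (λ ((c , d) , e) (s , t) → [ (λ x → to (chosen⇔ a φ ρ) (c , x) s) , (λ y → to (chosen⇔ a ψ ρ) (d , y) t) ]′ (either (evalA φ (annotate a φ c) ρ) e))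
  only-if where
  either : ∀ x {y} → x ∧ᵇ y ≡ false → x ≡ false ⊎ y ≡ false
  either false e = inj₁ refl
  either true e = inj₂ e
  only-if : ¬ SatAt exists a (Vec.map decode ρ) (φ ∧ ψ) → ∃[ c ] evalA (φ ∧ ψ) (annotate a (φ ∧ ψ) c) ρ ≡ false
  only-if n with satAt? a (Vec.map decode ρ) φ
  ... | no m = let c , x = from (chosen⇔ a φ ρ) m in (c , anything ψ) , cong (_∧ᵇ evalA ψ (annotate a ψ (anything ψ)) ρ) x
  ... | yes s = let d , y = from (chosen⇔ a ψ ρ) (n ∘ (s ,_)) in (anything φ , d) , trans (cong (evalA φ (annotate a φ (anything φ)) ρ ∧ᵇ_) y) (∧-zeroʳ _)
 chosen⇔ a (φ ∨ ψ) ρ = mk⇔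
  (λ ((c , d) , e) → let x , y = neither (evalA φ (annotate a φ c) ρ) e in [ to (chosen⇔ a φ ρ) (c , x) , to (chosen⇔ a ψ ρ) (d , y) ]′)
  (λ n → let c , x = from (chosen⇔ a φ ρ) (n ∘ inj₁) ; d , y = from (chosen⇔ a ψ ρ) (n ∘ inj₂) in (c , d) , cong₂ _∨ᵇ_ x y)
  where
  neither : ∀ x {y} → x ∨ᵇ y ≡ false → x ≡ false × y ≡ false
  neither false e = refl , e
 chosen⇔ a (quant exists φ) ρ = mk⇔ (λ ((_ , c) , e) → to (chosen⇔ a φ (code a ∷ ρ)) (c , e))
  (λ n → let c , e = from (chosen⇔ a φ (code a ∷ ρ)) n in (tt , c) , e)
 chosen⇔ a (quant forAll φ) ρ = mk⇔ (λ ((b , c) , e) f → to (chosen⇔ a φ (code b ∷ ρ)) (c , e) (f b))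
  (λ n → let b , m = ¬∀⟶∃¬ _ _ (λ b → satAt? a (b ∷ Vec.map decode ρ) φ) n ; c , e = from (chosen⇔ a φ (code b ∷ ρ)) m in (b , c) , e)
 meaning : ∀ w θ → w ≡ encode σ θ → (∀ a → Guessed θ a) ⇔ (¬ MC B w)
 meaning w θ refl = ⇔P.trans
  (mk⇔ (λ h s → let e , t = collapse∃ splits θ s in to (chosen⇔ e θ []) (h e) t) (λ n e → from (chosen⇔ e θ []) (n ∘ satAt∃⇒sat θ)))
  (mk⇔ (_∘ to (mc-encode B θ)) (_∘ from (mc-encode B θ)))

module Odometer {σ : Signature} (B : Structure σ) where

 open Structure B using () renaming (size to #B)
 open Valued B using (code; decode; relate; relate⇔)

 open Machines {σ} #B true false (λ _ s → s) false relate
  using (ATree; AccLeaf; Ann; Cell; Cont; Input; Prog; Sym; _⨾_; ahead; aheadVars; answer; at?; bit; blank; blanks; check; evalA; evaluation; front; goL; goR; holds;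
    ifThen; initStore; local; neg; on; plain; pushed; pushedVars; quantCell; restart; seq; setAnn; size; skip; ticks; ticks-snoc; walking; while)

 private
  D : Set
  D = Dom B

 private instance
  size-positive : NonZero #B
  size-positive = >-nonZero (≤-trans z<s (toℕ<n (element B)))

 last : ℕ
 last = pred #B

 suc-last : suc last ≡ #B
 suc-last = suc-pred #B

 nth : ℕ → D
 nth i = i mod #B

 toℕ-nth : ∀ {i} → i ≤ last → toℕ (nth i) ≡ i
 toℕ-nth {i} le = trans (toℕ-fromℕ< (m%n<n i #B)) (m<n⇒m%n≡m (≤-trans (s≤s le) (≡⇒≤ suc-last)))

 toℕ≤last : ∀ (d : D) → toℕ d ≤ last
 toℕ≤last d = ≤-pred (≤-trans (toℕ<n d) (≡⇒≥ suc-last))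

 nth-toℕ : ∀ d → nth (toℕ d) ≡ d
 nth-toℕ d = toℕ-injective (toℕ-nth (toℕ≤last d))

 op : Quantifier → Bool → Bool → Bool
 op forAll = _∧ᵇ_
 op exists = _∨ᵇ_

 opFrom : Quantifier → ℕ → ℕ → (D → Bool) → Bool
 opFrom Q i zero k = k (nth i)
 opFrom Q i (suc j) k = op Q (k (nth i)) (opFrom Q (suc i) j k)

 opAll : Quantifier → (D → Bool) → Bool
 opAll Q = opFrom Q 0 last

 opFrom-cong : ∀ Q i j {k k′} → (∀ d → k d ≡ k′ d) → opFrom Q i j k ≡ opFrom Q i j k′
 opFrom-cong Q i zero e = e _
 opFrom-cong Q i (suc j) e = cong₂ (op Q) (e _) (opFrom-cong Q (suc i) j e)

 -- The players choose the annotations in the order of the text.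
 game : ∀ {n} (φ : Formula σ n) → (Ann φ → Bool) → Bool
 game (atom r xs) k = k tt
 game (φ ∧ ψ) k = game φ λ α → game ψ λ β → k (α , β)
 game (φ ∨ ψ) k = game φ λ α → game ψ λ β → k (α , β)
 game (quant Q φ) k = opAll Q λ d → game φ λ α → k (code d , α)

 game-cong : ∀ {n} (φ : Formula σ n) {k k′} → (∀ α → k α ≡ k′ α) → game φ k ≡ game φ k′
 game-cong (atom r xs) e = e tt
 game-cong (φ ∧ ψ) e = game-cong φ λ α → game-cong ψ λ β → e (α , β)
 game-cong (φ ∨ ψ) e = game-cong φ λ α → game-cong ψ λ β → e (α , β)
 game-cong (quant Q φ) e = opFrom-cong Q 0 last λ d → game-cong φ λ α → e (code d , α)

 truth : ∀ {n} → Formula σ n → Vec Sym n → Bool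
 truth (atom r xs) ρ = evalA (atom r xs) tt ρ
 truth (φ ∧ ψ) ρ = truth φ ρ ∧ᵇ truth ψ ρ
 truth (φ ∨ ψ) ρ = truth φ ρ ∨ᵇ truth ψ ρ
 truth (quant Q φ) ρ = opAll Q λ d → truth φ (code d ∷ ρ)

 Monotone : (Bool → Bool) → Set
 Monotone h = h false ≡ true → h true ≡ true

 op-idem : ∀ Q a → op Q a a ≡ a
 op-idem forAll true = refl
 op-idem forAll false = refl
 op-idem exists true = refl
 op-idem exists false = refl

 op-monotone : ∀ Q h → Monotone h → ∀ a b → op Q (h a) (h b) ≡ h (op Q a b)
 op-monotone Q h m true true = trans (op-idem Q (h true)) (cong h (symm (op-idem Q true)))
 op-monotone Q h m false false = trans (op-idem Q (h false)) (cong h (symm (op-idem Q false)))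
 op-monotone forAll h m true false with h false
 ... | true = trans (∧-identityʳ (h true)) (m refl)
 ... | false = ∧-zeroʳ (h true)
 op-monotone forAll h m false true with h false
 ... | true = m refl
 ... | false = refl
 op-monotone exists h m true false with h false
 ... | true = trans (∨-zeroʳ (h true)) (symm (m refl))
 ... | false = ∨-identityʳ (h true)
 op-monotone exists h m false true with h false
 ... | true = symm (m refl)
 ... | false = refl

 opFrom-monotone : ∀ Q i j h → Monotone h → ∀ k → opFrom Q i j (h ∘ k) ≡ h (opFrom Q i j k)
 opFrom-monotone Q i zero h m k = refl
 opFrom-monotone Q i (suc j) h m k = trans (cong (op Q (h (k (nth i)))) (opFrom-monotone Q (suc i) j h m k)) (op-monotone Q h m (k (nth i)) _)

 -- A quantifier commutes with the monotone context in which its scope is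
 -- evaluated, so that the moves may be made in the order of the text.
 game-truth : ∀ {n} (φ : Formula σ n) ρ h → Monotone h → game φ (λ α → h (evalA φ α ρ)) ≡ h (truth φ ρ)
 game-truth (atom r xs) ρ h m = refl
 game-truth (φ ∧ ψ) ρ h m = trans
  (game-cong φ λ α → game-truth ψ ρ (λ b → h (evalA φ α ρ ∧ᵇ b)) (right-monotone (evalA φ α ρ)))
  (game-truth φ ρ (λ b → h (b ∧ᵇ truth ψ ρ)) left-monotone) where
  right-monotone : ∀ a → Monotone (λ b → h (a ∧ᵇ b))
  right-monotone true = m
  right-monotone false = id
  left-monotone : Monotone (λ b → h (b ∧ᵇ truth ψ ρ))
  left-monotone with truth ψ ρ
  ... | true = m
  ... | false = id
 game-truth (φ ∨ ψ) ρ h m = trans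
  (game-cong φ λ α → game-truth ψ ρ (λ b → h (evalA φ α ρ ∨ᵇ b)) (right-monotone (evalA φ α ρ)))
  (game-truth φ ρ (λ b → h (b ∨ᵇ truth ψ ρ)) left-monotone) where
  right-monotone : ∀ a → Monotone (λ b → h (a ∨ᵇ b))
  right-monotone true = id
  right-monotone false = m
  left-monotone : Monotone (λ b → h (b ∨ᵇ truth ψ ρ))
  left-monotone with truth ψ ρ
  ... | true = id
  ... | false = m
 game-truth (quant Q φ) ρ h m = trans (opFrom-cong Q 0 last λ d → game-truth φ (code d ∷ ρ) h m)
  (opFrom-monotone Q 0 last h m (λ d → truth φ (code d ∷ ρ)))

 opFrom-forAll : ∀ i j k → T (opFrom forAll i j k) ⇔ (∀ x → i ≤ x → x ≤ i + j → T (k (nth x)))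
 opFrom-forAll i zero k = mk⇔ (λ t x l u → subst (T ∘ k ∘ nth) (≤-antisym l (≤-trans u (≡⇒≤ (+-identityʳ i)))) t) (λ f → f i ≤-refl (m≤m+n i 0))
 opFrom-forAll i (suc j) k = ⇔P.trans T-∧ (mk⇔
  (λ (t , ts) x l u → [ (λ lt → to (opFrom-forAll (suc i) j k) ts x lt (≤-trans u (≡⇒≤ (+-suc i j)))) , (λ { refl → t }) ]′ (m≤n⇒m<n∨m≡n l))
  (λ f → f i ≤-refl (m≤m+n i (suc j)) , from (opFrom-forAll (suc i) j k) (λ x l u → f x (<⇒≤ l) (≤-trans u (≡⇒≥ (+-suc i j))))))

 opFrom-exists : ∀ i j k → T (opFrom exists i j k) ⇔ (∃[ x ] i ≤ x × x ≤ i + j × T (k (nth x)))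
 opFrom-exists i zero k = mk⇔ (λ t → i , ≤-refl , m≤m+n i 0 , t)
  (λ (x , l , u , t) → subst (T ∘ k ∘ nth) (≤-antisym (≤-trans u (≡⇒≤ (+-identityʳ i))) l) t)
 opFrom-exists i (suc j) k = ⇔P.trans T-∨ (mk⇔
  (λ { (inj₁ t) → i , ≤-refl , m≤m+n i (suc j) , t
    ; (inj₂ ts) → let x , l , u , t = to (opFrom-exists (suc i) j k) ts in x , <⇒≤ l , ≤-trans u (≡⇒≥ (+-suc i j)) , t })
  (λ (x , l , u , t) → [ (λ lt → inj₂ (from (opFrom-exists (suc i) j k) (x , lt , ≤-trans u (≡⇒≤ (+-suc i j)) , t))) , (λ { refl → inj₁ t }) ]′ (m≤n⇒m<n∨m≡n l)))

 truth-sat : ∀ {n} (φ : Formula σ n) ρ → T (truth φ ρ) ⇔ Sat B (Vec.map decode ρ) φ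
 truth-sat (atom r xs) ρ = relate⇔ r xs ρ
 truth-sat (φ ∧ ψ) ρ = ⇔P.trans T-∧ (truth-sat φ ρ ×-⇔ truth-sat ψ ρ)
 truth-sat (φ ∨ ψ) ρ = ⇔P.trans T-∨ (truth-sat φ ρ ⊎-⇔ truth-sat ψ ρ)
 truth-sat (quant forAll φ) ρ = ⇔P.trans (opFrom-forAll 0 last _) (mk⇔
  (λ f d → to (truth-sat φ (code d ∷ ρ)) (subst (λ e → T (truth φ (code e ∷ ρ))) (nth-toℕ d) (f (toℕ d) z≤n (toℕ≤last d))))
  (λ f x _ _ → from (truth-sat φ (code (nth x) ∷ ρ)) (f (nth x))))
 truth-sat (quant exists φ) ρ = ⇔P.trans (opFrom-exists 0 last _) (mk⇔
  (λ (x , _ , _ , t) → nth x , to (truth-sat φ (code (nth x) ∷ ρ)) t)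
  (λ (d , s) → toℕ d , z≤n , toℕ≤last d , subst (λ e → T (truth φ (code e ∷ ρ))) (symm (nth-toℕ d)) (from (truth-sat φ (code d ∷ ρ)) s)))

 lastMark? : Sym → Bool
 lastMark? s = does (toℕ (decode s) ≟ last)

 nextMark : Sym → Sym
 nextMark s = code (nth (suc (toℕ (decode s))))

 advance? : Input → Sym → Sym → Bool
 advance? (sym forAll-letter) s u = holds u ∧ᵇ not (lastMark? s)
 advance? (sym exists-letter) s u = not (holds u) ∧ᵇ not (lastMark? s)
 advance? _ _ _ = false

 wants : Quantifier → Bool → Bool
 wants forAll v = v
 wants exists v = not v

 advances : ∀ Q s v → advance? (sym (quantifier-letter σ Q)) s (bit v) ≡ wants Q v ∧ᵇ not (lastMark? s)
 advances forAll s true = refl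
 advances forAll s false = refl
 advances exists s true = refl
 advances exists s false = refl

 op-stops : ∀ Q v {r} → wants Q v ≡ false → op Q v r ≡ v
 op-stops forAll false e = refl
 op-stops exists true e = refl

 op-goes-on : ∀ Q v {r} → wants Q v ≡ true → op Q v r ≡ r
 op-goes-on forAll true e = refl
 op-goes-on exists false e = refl

 at-last : ∀ {i} → i ≡ last → lastMark? (code (nth i)) ≡ true
 at-last refl = dec-true (toℕ (nth last) ≟ last) (toℕ-nth ≤-refl)

 before-last : ∀ {i} → i < last → lastMark? (code (nth i)) ≡ false
 before-last {i} lt = dec-false (toℕ (nth i) ≟ last) (λ e → <⇒≢ lt (trans (symm (toℕ-nth (<⇒≤ lt))) e))

 resetStep : Input → Prog
 resetStep (sym forAll-letter) = setAnn tt (λ _ _ _ → code (nth 0))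
 resetStep (sym exists-letter) = setAnn tt (λ _ _ _ → code (nth 0))
 resetStep _ = skip

 explore odometer p₀ : Prog
 explore = walking resetStep ⨾ goL ⨾ evaluation
 odometer = while (neg (at? isStart)) (ifThen (local advance?) (setAnn tt (λ _ s _ → nextMark s) ⨾ goR ⨾ explore) goL)
 p₀ = check ⨾ ((restart ⨾ explore) ⨾ odometer) ⨾ answer

 module OdometerCorrectness (M : ℕ) where

  open Machines.Correctness {σ} #B true false (λ _ s → s) false relate M
   using (!_; 0s; Decides; Leads; Positive; _⇒[_]_; _⇛?_; _⇛_; cases-step; checked-decides; decides-⇔; end-cells; fast; fits-left; go-left; go-right; landing; launching; length-ahead; means; pos-ahead; pos-aheadVars; pos-pushed; pos-ticks; room-pushed; run-answer; run-evaluation; run-restart; size-encode; start-cells; tree; walk-one; walk-vars; within-room; ⇒-refl)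

  private
   K : Cont
   K = answer ∷ []

  -- The run from the point where everything to the right of Z is to be reset
  -- until the head has come back to the last cell of Z with the value v of
  -- the game on the right part; P describes the shape of that part.
  record Visit (Z X Z′ : List Cell) (P : List Cell → Set) (u v : Sym) : Set₁ where
   constructor visited
   field
    {X′} : List Cell
    {t} : ℕ
    kept : P X′
    path : (walking resetStep ∷ (goL ⨾ evaluation) ∷ odometer ∷ K , front Z X u 0s) ⇒[ t ] (odometer ∷ K , on Z′ X′ v 0s)

  record Explores (Z : List Cell) (P : List Cell → Set) (v : Bool) : Set₁ where
   constructor exploring
   field visit : ∀ X u → P X → Visit Z X Z P u (bit v)

  open Explores

  Ahead : ∀ {n} → Formula σ n → (List Cell → Set) → List Cell → Set
  Ahead φ P X = ∃[ α ] ∃[ R ] X ≡ ahead φ α R × P R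

  retreat-plain : ∀ {l Z R u} → advance? (sym l) blank u ≡ false → Positive Z →
   (odometer ∷ K , on (plain l ∷ Z) R u 0s) ⇒[ 3 ] (odometer ∷ K , on Z (plain l ∷ R) u 0s)
  retreat-plain e pos = ! while refl ⇛ ! ifThen e ⇛ fast z<s (go-left pos)

  retreat-ticks : ∀ n {Z R u} → Positive Z → ∃[ t ] (odometer ∷ K , on (ticks n Z) R u 0s) ⇒[ t ] (odometer ∷ K , on Z (ticks n R) u 0s)
  retreat-ticks zero pos = 0 , ⇒-refl
  retreat-ticks (suc n) {Z} {R} {u} pos with retreat-ticks n {Z} {plain tick-letter ∷ R} {u} pos
  ... | t , run = _ , (retreat-plain refl (pos-ticks n pos) ⇛ landing (cong (λ R → odometer ∷ K , on Z R u 0s) (ticks-snoc n R)) run)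

  retreat-vars : ∀ {n m} (xs : Vec (Fin n) m) {Z R u} → Positive Z → ∃[ t ] (odometer ∷ K , on (pushedVars xs Z) R u 0s) ⇒[ t ] (odometer ∷ K , on Z (aheadVars xs R) u 0s)
  retreat-vars [] pos = 0 , ⇒-refl
  retreat-vars (x ∷ xs) {Z} {R} {u} pos with retreat-vars xs {plain stop-letter ∷ ticks (toℕ x) Z} {R} {u} z<s
    | retreat-ticks (toℕ x) {Z} {plain stop-letter ∷ aheadVars xs R} {u} pos
  ... | t , run | s , run′ = _ , (run ⇛ retreat-plain refl (pos-ticks (toℕ x) pos) ⇛ run′)

  pos-Ahead : ∀ {n} (φ : Formula σ n) {P X} → Ahead φ P X → Positive X
  pos-Ahead φ (α , R , refl , _) = pos-ahead φ α

  record Cons (c : Cell) (P : List Cell → Set) (X : List Cell) : Set where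
   constructor cons!
   field
    {X₁} : List Cell
    shape : X ≡ c ∷ X₁
    tail : P X₁

  explore-binary : ∀ {c Z P v n} (φ : Formula σ n) → isEnd (sym c) ≡ false → resetStep (sym c) ≡ skip → (∀ u → advance? (sym c) blank u ≡ false) → Positive Z →
   Explores (plain c ∷ Z) (Ahead φ P) v → Explores Z (Cons (plain c) (Ahead φ P)) v
  explore-binary {c} {Z} {P} {v} φ e e′ e″ pos E = exploring λ { _ u (cons! {X} refl p) → go X u p (visit E X u p) }
   where
   go : ∀ X u → Ahead φ P X → Visit (plain c ∷ Z) X (plain c ∷ Z) (Ahead φ P) u (bit v) → Visit Z (plain c ∷ X) Z (Cons (plain c) (Ahead φ P)) u (bit v)
   go X u p (visited p′ run) = visited (cons! refl p′) (walk-one {resetStep} {Z = Z} e e′ (pos-Ahead φ p) ⇛ run ⇛ retreat-plain (e″ (bit v)) pos)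

  reshape : ∀ {Z P Q v} → (∀ {X} → P X → Q X) → (∀ {X} → Q X → P X) → Explores Z P v → Explores Z Q v
  reshape {Z} {P} {Q} {v} f g E = exploring λ X u q → go (visit E X u (g q)) where
   go : ∀ {X u} → Visit Z X Z P u (bit v) → Visit Z X Z Q u (bit v)
   go (visited p path) = visited (f p) path

  leave : ∀ Q {s Z X u} → Positive Z → advance? (sym (quantifier-letter σ Q)) s u ≡ false →
   (odometer ∷ K , on (quantCell Q s ∷ Z) X u 0s) ⇒[ 3 ] (odometer ∷ K , on Z (quantCell Q s ∷ X) u 0s)
  leave Q pos e = ! while refl ⇛ ! ifThen e ⇛ fast z<s (go-left pos)

  turn : ∀ Q {s Z X u} → Positive X → advance? (sym (quantifier-letter σ Q)) s u ≡ true →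
   (odometer ∷ K , on (quantCell Q s ∷ Z) X u 0s) ⇒[ 7 ]
   (walking resetStep ∷ (goL ⨾ evaluation) ∷ odometer ∷ K , front (quantCell Q (nextMark s) ∷ Z) X u 0s)
  turn Q {s} {Z} pos e = ! while refl ⇛ ! ifThen e ⇛ ! seq ⇛ ! setAnn ⇛ ! seq ⇛ fast z<s (go-right {quantCell Q (nextMark s) ∷ Z} z<s pos) ⇛ ! seq

  explore-formula : ∀ {n} (φ : Formula σ n) {Z P k} → (∀ X → P X → Positive X) → Positive Z →
   (∀ α → Explores (pushed φ α Z) P (k α)) → Explores Z (Ahead φ P) (game φ k)
  explore-formula (atom r xs) {Z} {P} {k} posP pos h = exploring λ { _ u (tt , R , refl , p) → go R u p (visit (h tt) R u p) }
   where
   go : ∀ R u → P R → Visit (pushedVars xs (plain (rel-letter σ r) ∷ Z)) R (pushedVars xs (plain (rel-letter σ r) ∷ Z)) P u (bit (k tt)) →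
     Visit Z (ahead (atom r xs) tt R) Z (Ahead (atom r xs) P) u (bit (k tt))
   go R u p (visited {X′} p′ run) with retreat-vars xs {plain (rel-letter σ r) ∷ Z} {X′} {bit (k tt)} z<s
   ... | s , back = visited (tt , X′ , refl , p′)
    (walk-one {resetStep} {Z = Z} refl refl (pos-aheadVars xs (posP R p)) ⇛ walk-vars {resetStep} refl refl xs (posP R p) ⇛ run ⇛ back ⇛ retreat-plain refl pos)
  explore-formula (φ ∧ ψ) {Z} {P} {k} posP pos h = reshape
   (λ { (cons! refl (α , _ , refl , β , R , refl , p)) → (α , β) , R , refl , p }) (λ { ((α , β) , R , refl , p) → cons! refl (α , _ , refl , β , R , refl , p) })
   (explore-binary {P = Ahead ψ P} φ refl refl (λ _ → refl) pos
    (explore-formula φ (λ X → pos-Ahead ψ) z<s (λ α → explore-formula ψ posP (pos-pushed φ α z<s) (λ β → h (α , β)))))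
  explore-formula (φ ∨ ψ) {Z} {P} {k} posP pos h = reshape
   (λ { (cons! refl (α , _ , refl , β , R , refl , p)) → (α , β) , R , refl , p }) (λ { ((α , β) , R , refl , p) → cons! refl (α , _ , refl , β , R , refl , p) })
   (explore-binary {P = Ahead ψ P} φ refl refl (λ _ → refl) pos
    (explore-formula φ (λ X → pos-Ahead ψ) z<s (λ α → explore-formula ψ posP (pos-pushed φ α z<s) (λ β → h (α , β)))))
  explore-formula (quant Q φ) {Z} {P} {k} posP pos h = exploring λ { _ u ((s , α) , R , refl , p) → enter u s _ (pos-ahead φ α) (spin last 0 refl (ahead φ α R) u (α , R , refl , p)) }
   where
   value-at : D → Bool
   value-at d = game φ λ α → k (code d , α)
   Shape : List Cell → Set
   Shape X = ∃[ s ] Cons (quantCell Q s) (Ahead φ P) X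
   spin : ∀ j i → i + j ≡ last → ∀ X u → Ahead φ P X → Visit (quantCell Q (code (nth i)) ∷ Z) X Z Shape u (bit (opFrom Q i j value-at))
   turned : ∀ j i → i + j ≡ last → ∀ {X u} v → v ≡ value-at (nth i) → Visit (quantCell Q (code (nth i)) ∷ Z) X (quantCell Q (code (nth i)) ∷ Z) (Ahead φ P) u (bit v) →
     Visit (quantCell Q (code (nth i)) ∷ Z) X Z Shape u (bit (opFrom Q i j value-at))
   spin j i e X u p = turned j i e (value-at (nth i)) refl
    (visit (explore-formula φ {k = λ α → k (code (nth i) , α)} posP z<s (λ α → h (code (nth i) , α))) X u p)
   turned zero i e v refl (visited {X′} p run) = visited (_ , cons! refl p)
    (run ⇛ leave Q pos (trans (advances Q (code (nth i)) v) (trans (cong (λ b → wants Q v ∧ᵇ not b) (at-last (trans (symm (+-identityʳ i)) e))) (∧-zeroʳ (wants Q v)))))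
   turned (suc j) i e v refl (visited {X′} p run) with wants Q v in w
   ... | false = visited (_ , cons! refl p) (landing (cong (λ b → odometer ∷ K , on Z (quantCell Q _ ∷ X′) (bit b) 0s) (symm (op-stops Q v w)))
     (run ⇛ leave Q pos (trans (advances Q (code (nth i)) v) (cong (_∧ᵇ not (lastMark? (code (nth i)))) w))))
   ... | true = go (spin j (suc i) (trans (symm (+-suc i j)) e) X′ (bit v) p) where
    i<last : i < last
    i<last = ≤-trans (m≤m+n (suc i) j) (≡⇒≤ (trans (symm (+-suc i j)) e))
    go : Visit (quantCell Q (code (nth (suc i))) ∷ Z) X′ Z Shape (bit v) (bit (opFrom Q (suc i) j value-at)) → _
    go (visited shape run′) = visited shape (landing (cong (λ b → odometer ∷ K , on Z _ (bit b) 0s) (symm (op-goes-on Q v w)))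
     (run ⇛ turn Q (pos-Ahead φ p) (trans (advances Q (code (nth i)) v) (cong₂ (λ a b → a ∧ᵇ not b) w (before-last i<last))) ⇛
      launching (cong (λ d → walking resetStep ∷ (goL ⨾ evaluation) ∷ odometer ∷ K , front (quantCell Q (code d) ∷ Z) X′ (bit v) 0s) (cong (nth ∘ suc) (toℕ-nth (<⇒≤ i<last)))) run′))
   reset-quant : ∀ Q → resetStep (sym (quantifier-letter σ Q)) ≡ setAnn tt (λ _ _ _ → code (nth 0))
   reset-quant forAll = refl
   reset-quant exists = refl
   enter : ∀ u s X → Positive X → Visit (quantCell Q (code (nth 0)) ∷ Z) X Z Shape u (bit (opAll Q value-at)) →
     Visit Z (quantCell Q s ∷ X) Z (Ahead (quant Q φ) P) u (bit (game (quant Q φ) k))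
   enter u s X posX (visited (s′ , cons! refl (α′ , R′ , refl , p′)) run) = visited ((s′ , α′) , R′ , refl , p′)
    (! while refl ⇛ ! seq ⇛
     landing (cong (λ q → q ∷ goR ∷ walking resetStep ∷ (goL ⨾ evaluation) ∷ odometer ∷ K , front Z (quantCell Q s ∷ X) u 0s) (reset-quant Q)) (fast z<s (cases-step {resetStep})) ⇛
     ! setAnn ⇛ fast z<s (go-right {quantCell Q (code (nth 0)) ∷ Z} z<s posX) ⇛ run)

  module _ (θ : Sentence σ) (wide : 2 + size θ ≤ M) where

   result : Bool
   result = game θ λ α → evalA θ α []
   evaluated : ∀ α → Explores (pushed θ α start-cells) (_≡ end-cells) (evalA θ α [])
   evaluated α = exploring λ { _ u refl → visited refl
    (! while refl ⇛ ! seq ⇛ fast z<s (go-left (pos-pushed θ α z<s)) ⇛ run-evaluation θ α wide) }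
   whole : Visit start-cells (ahead θ (blanks θ) end-cells) start-cells (Ahead θ (_≡ end-cells)) (bit true) (bit result)
   whole = visit (explore-formula θ (λ { _ refl → z<s }) z<s evaluated) _ _ (blanks θ , end-cells , refl , refl)
   outcome : ∃[ t ] Decides ((((restart ⨾ explore) ⨾ odometer) ⨾ answer) ∷ [] , on (pushed θ (blanks θ) start-cells) end-cells (bit true) 0s) t (T result)
   outcome = _ , (! seq ⇛? ! seq ⇛? ! seq ⇛? run-restart θ (blanks θ) room ⇛? ! seq ⇛? Visit.path whole ⇛? ! while refl ⇛? run-answer result {start-cells})
    where
    room : length (pushed θ (blanks θ) start-cells) ≤ M
    room = fits-left (room-pushed θ (blanks θ) {R = end-cells} z<s (within-room (≤-trans (≡⇒≤ (cong suc (trans (length-ahead θ (blanks θ)) (+-comm (size θ) 1)))) wide)))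
   result⇔ : T result ⇔ B ⊨ θ
   result⇔ = ⇔P.trans (mk⇔ (subst T eq) (subst T (symm eq))) (truth-sat θ []) where
    eq : result ≡ truth θ []
    eq = game-truth θ [] id (λ _ → refl)

  decision : ∀ w → 2 + length w ≤ M → ∃[ t ] ∃[ L ] ATree M AccLeaf t (p₀ ∷ [] , initStore w) L × L ⇔ MC B w
  decision w wide = let t , d , _ = checked-decides w wide (λ θ e → proj₂ (meaning θ e)) (λ bad → mk⇔ (λ ()) (λ (θ , e , _) → ⊥-elim (bad θ e))) in _ , _ , tree d , means d
   where
   meaning : ∀ θ → w ≡ encode σ θ → ∃[ t ] Decides ((((restart ⨾ explore) ⨾ odometer) ⨾ answer) ∷ [] , on (pushed θ (blanks θ) start-cells) end-cells (bit true) 0s) t (MC B w)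
   meaning θ refl = let t , d = outcome θ fits-θ in t , decides-⇔ (⇔P.trans (result⇔ θ fits-θ) (⇔P.sym (mc-encode B θ))) d
    where
    fits-θ : 2 + size θ ≤ M
    fits-θ = ≤-trans (≡⇒≤ (cong (2 +_) (size-encode θ))) wide

 open Programs.Results (#letters σ) 0 #B 4 true false p₀ using (machine; deterministic; spaceUsed; program-halts; program-space; program-accepts)

 pspace-member : Pspace (MC B)
 pspace-member = machine , proj₁ polySpace , deterministic refl ,
   (λ w → let n , c , _ , r , h , _ = program-halts w (proj₁ (proj₂ (proj₂ (decided w)))) in n , c , r , h) ,
   (λ w n c r → ≤-trans (program-space w (proj₁ (proj₂ (proj₂ (decided w)))) r) (proj₂ polySpace (length w))) ,
   (λ {w} m → from (accepts⇔ w) m) , (λ {w} a → to (accepts⇔ w) a) where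
  decided : ∀ w → ∃[ t ] ∃[ L ] ATree (2 + length w) AccLeaf t (p₀ ∷ [] , initStore w) L × L ⇔ MC B w
  decided w = OdometerCorrectness.decision (2 + length w) w ≤-refl
  accepts⇔ : ∀ w → Machine.Accepts machine w ⇔ MC B w
  accepts⇔ w = ⇔P.trans (program-accepts w (proj₁ (proj₂ (proj₂ (decided w))))) (proj₂ (proj₂ (proj₂ (decided w))))
  polySpace : PolyBound (λ n → spaceUsed n (2 + n))
  polySpace = pb-+ (pb-+ (pb-const 2) pb-id) (pb-+ (pb-const 1) (pb-* (pb-const 4) (pb-+ (pb-const 2) (pb-suc (pb-log (pb-suc (pb-+ (pb-const 2) pb-id)))))))

corollary8 : (σ : Signature) (B : Structure σ) →
  (¬ ∃ (Breaks∧ B) → ¬ ∃ (Breaks∨ B) → Logspace (MC B)) ×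
  (∃ (Breaks∧ B) → ¬ ∃ (Breaks∨ B) → Complete NP (MC B)) ×
  (¬ ∃ (Breaks∧ B) → ∃ (Breaks∨ B) → Complete coNP (MC B)) ×
  (∃ (Breaks∧ B) → ∃ (Breaks∨ B) → Complete Pspace (MC B))
corollary8 σ B =
 (λ ¬∧ ¬∨ → logspace-member B (unbroken⇒splits ¬∧) (unbroken∨⇒splits ¬∨)) ,
 (λ ∃∧ ¬∨ → np-member B (unbroken∨⇒splits ¬∨) , np-hard B ∃∧) ,
 (λ ¬∧ ∃∨ → conp-member B (unbroken⇒splits ¬∧) , conp-hard B ∃∨) ,
 (λ ∃∧ ∃∨ → Odometer.pspace-member B , pspace-hard B ∃∧ ∃∨) where
 open Semantics B using (unbroken⇒splits)
 open Dual B using (unbroken∨⇒splits)
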